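{- Let $c_n$ be the number of nonnesting permutations of the multiset $\{1,1,2,2,\dots,n,n\}$ that avoid the pattern $123$. As $n\to\infty$, \[ c_n\sim\frac{9+6\sqrt3}{8\sqrt{\pi}}\,6^n\,n^{ -3/2}, \] i.e. the ratio of the two sides tends to $1$.
   Context: For $n\ge 0$, a nonnesting permutation of $\{1,1,2,2,\dots,n,n\}$ is a word $w=w_1w_2\cdots w_{2n}$ using each of the labels $1,\dots,n$ exactly twice such that there are no indices $i<j<k<\ell$ and labels $a\ne b$ with $w_i=w_\ell=a$ and $w_j=w_k=b$. The word $w$ avoids $123$ if there are no indices $i<j<k$ with $w_i<w_j<w_k$. -}

module Defs where

open import Data.Empty using (⊥-elim)
open import Data.Fin.Base as Fin using (Fin)
import Data.Fin.Properties as Fin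
open import Data.Integer.Base as ℤ using (ℤ; +_; -[1+_]; +[1+_])
import Data.Integer.Properties as ℤ
open import Data.List.Base as List using (List; [_]; allFin; cartesianProductWith; filter; length)
open import Data.Nat.Base as ℕ using (ℕ; zero; suc)
import Data.Nat.Properties as ℕ
open import Data.Nat.Coprimality using (1-coprimeTo) renaming (sym to coprime-sym)
open import Data.Product.Base using (Σ; ∃; _×_; _,_; proj₁; proj₂; Σ-syntax; ∃-syntax)
open import Data.Rational.Base as ℚ using (ℚ; 0ℚ; 1ℚ; ½; mkℚ; *≤*; *<*)
import Data.Rational.Properties as ℚP
open import Data.Rational.Solver using (module +-*-Solver)
open import Data.Sum.Base using (inj₁; inj₂)
open import Data.Vec.Base using (Vec; []; _∷_; lookup; count)
open import Relation.Binary.PropositionalEquality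
  using (_≡_; _≢_; refl; sym; trans; cong; cong₂; subst; subst₂)
open import Relation.Nullary using (¬_; yes; no)
open import Relation.Nullary.Decidable using (¬?; _×-dec_)
open import Relation.Unary using (Decidable)

------------------------------------------------------------------------
-- Nonnesting permutations

-- The labels 1, …, n are represented by the elements of Fin n.

Word : ℕ → ℕ → Set
Word n m = Vec (Fin n) m

EachLabelTwice : ∀ {n m} → Word n m → Set
EachLabelTwice {n} w = ∀ (a : Fin n) → count (Fin._≟ a) w ≡ 2

HasNesting : ∀ {n m} → Word n m → Set
HasNesting w = ∃[ i ] ∃[ j ] ∃[ k ] ∃[ l ]
  (i Fin.< j × j Fin.< k × k Fin.< l ×
   lookup w i ≡ lookup w l × lookup w j ≡ lookup w k × lookup w i ≢ lookup w j)

Contains123 : ∀ {n m} → Word n m → Set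
Contains123 w = ∃[ i ] ∃[ j ] ∃[ k ]
  (i Fin.< j × j Fin.< k ×
   lookup w i Fin.< lookup w j × lookup w j Fin.< lookup w k)

Nonnesting123Avoiding : ∀ {n m} → Word n m → Set
Nonnesting123Avoiding w = EachLabelTwice w × ¬ HasNesting w × ¬ Contains123 w

nonnesting123Avoiding? : ∀ {n m} → Decidable (Nonnesting123Avoiding {n} {m})
nonnesting123Avoiding? w =
  Fin.all? (λ a → count (Fin._≟ a) w ℕ.≟ 2)
  ×-dec
  ¬? (Fin.any? λ i → Fin.any? λ j → Fin.any? λ k → Fin.any? λ l →
        i Fin.<? j ×-dec j Fin.<? k ×-dec k Fin.<? l
        ×-dec lookup w i Fin.≟ lookup w l
        ×-dec lookup w j Fin.≟ lookup w k
        ×-dec ¬? (lookup w i Fin.≟ lookup w j))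
  ×-dec
  ¬? (Fin.any? λ i → Fin.any? λ j → Fin.any? λ k →
        i Fin.<? j ×-dec j Fin.<? k
        ×-dec lookup w i Fin.<? lookup w j
        ×-dec lookup w j Fin.<? lookup w k)

-- Every word of length m over Fin n occurs exactly once in this list.

words : ∀ n m → List (Word n m)
words n zero    = [ [] ]
words n (suc m) = cartesianProductWith _∷_ (allFin n) (words n m)

c : ℕ → ℕ
c n = length (filter nonnesting123Avoiding? (words n (2 ℕ.* n)))

------------------------------------------------------------------------
-- Rational sequences

Eventually : (ℕ → Set) → Set
Eventually P = ∃[ N ] ∀ n → N ℕ.≤ n → P n

Cauchy : (ℕ → ℚ) → Set
Cauchy s = ∀ ε → 0ℚ ℚ.< ε →
  ∃[ N ] ∀ m n → N ℕ.≤ m → N ℕ.≤ n → ℚ.∣ s m ℚ.- s n ∣ ℚ.< ε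

module RationalSequences where

  open import Data.Rational.Base using (_+_; _*_; -_; _-_; ∣_∣; _≤_; _<_; _⊔_; _⊓_; 1/_; _/_)
  open import Data.Rational.Properties
  open ≤-Reasoning
  open +-*-Solver using (solve; _:+_; _:*_; _:-_; :-_; _:=_; con)

  private variable
    p q r ε δ d x y a b : ℚ
    s t : ℕ → ℚ

  0<* : 0ℚ < p → 0ℚ < q → 0ℚ < p * q
  0<* {p} {q} 0<p 0<q =
    positive⁻¹ (p * q) {{pos*pos⇒pos p {{ℚ.positive 0<p}} q {{ℚ.positive 0<q}}}}

  0≤* : 0ℚ ≤ p → 0ℚ ≤ q → 0ℚ ≤ p * q
  0≤* {p} {q} 0≤p 0≤q = nonNegative⁻¹ (p * q)
    {{nonNeg*nonNeg⇒nonNeg p {{ℚ.nonNegative 0≤p}} q {{ℚ.nonNegative 0≤q}}}}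

  0<½ : 0ℚ < ½
  0<½ = positive⁻¹ ½

  0<1 : 0ℚ < 1ℚ
  0<1 = positive⁻¹ 1ℚ

  ½+½ : ∀ ε → ½ * ε + ½ * ε ≡ ε
  ½+½ ε = trans (sym (*-distribʳ-+ ε ½ ½)) (*-identityˡ ε)

  0<1/ : (0<p : 0ℚ < p) → 0ℚ < (1/ p) {{ℚ.>-nonZero 0<p}}
  0<1/ {p} 0<p = positive⁻¹ _ {{1/pos⇒pos p {{ℚ.positive 0<p}}}}

  *-mono-≤ : 0ℚ ≤ p → p ≤ q → 0ℚ ≤ x → x ≤ y → p * x ≤ q * y
  *-mono-≤ {p} {q} {x} {y} 0≤p p≤q 0≤x x≤y = ≤-trans
    (*-monoʳ-≤-nonNeg x {{ℚ.nonNegative 0≤x}} p≤q)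
    (*-monoˡ-≤-nonNeg q {{ℚ.nonNegative (≤-trans 0≤p p≤q)}} x≤y)

  square-cancel-< : 0ℚ ≤ b → a * a < b * b → a < b
  square-cancel-< {b} {a} 0≤b a²<b² with a <? b
  ... | yes a<b = a<b
  ... | no  a≮b = ⊥-elim (<-irrefl refl (<-≤-trans a²<b² (*-mono-≤ 0≤b (≮⇒≥ a≮b) 0≤b (≮⇒≥ a≮b))))

  p-q≤r : p ≤ r + q → p - q ≤ r
  p-q≤r {p} {r} {q} h = ≤-trans (+-monoˡ-≤ (- q) h)
    (≤-reflexive (solve 2 (λ r q → (r :+ q) :- q := r) refl r q))

  p≤∣p∣ : ∀ p → p ≤ ∣ p ∣
  p≤∣p∣ p with ≤-total 0ℚ p
  ... | inj₁ 0≤p = ≤-reflexive (sym (0≤p⇒∣p∣≡p 0≤p))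
  ... | inj₂ p≤0 = ≤-trans p≤0 (0≤∣p∣ p)

  -p≤∣p∣ : ∀ p → - p ≤ ∣ p ∣
  -p≤∣p∣ p = subst (- p ≤_) (∣-p∣≡∣p∣ p) (p≤∣p∣ (- p))

  ∣p∣≤ : p ≤ d → - p ≤ d → ∣ p ∣ ≤ d
  ∣p∣≤ {p} {d} p≤d -p≤d with ∣p∣≡p∨∣p∣≡-p p
  ... | inj₁ e = subst (_≤ d) (sym e) p≤d
  ... | inj₂ e = subst (_≤ d) (sym e) -p≤d

  ∣-∣-comm : ∀ p q → ∣ p - q ∣ ≡ ∣ q - p ∣
  ∣-∣-comm p q = trans
    (cong ∣_∣ (solve 2 (λ p q → p :- q := :- (q :- p)) refl p q)) (∣-p∣≡∣p∣ (q - p))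

  ∣p-q∣< : ∀ p q → p - q < d → q - p < d → ∣ p - q ∣ < d
  ∣p-q∣< {d} p q h₁ h₂ with ∣p∣≡p∨∣p∣≡-p (p - q)
  ... | inj₁ e = subst (_< d) (sym e) h₁
  ... | inj₂ e = subst (_< d) (trans (solve 2 (λ p q → q :- p := :- (p :- q)) refl p q) (sym e)) h₂

  ∣p∣-∣q∣≤∣p-q∣ : ∀ p q → ∣ p ∣ - ∣ q ∣ ≤ ∣ p - q ∣
  ∣p∣-∣q∣≤∣p-q∣ p q = p-q≤r {∣ p ∣} {∣ p - q ∣} {∣ q ∣} (begin
    ∣ p ∣             ≡⟨ cong ∣_∣ (solve 2 (λ p q → p := (p :- q) :+ q) refl p q) ⟩
    ∣ (p - q) + q ∣   ≤⟨ ∣p+q∣≤∣p∣+∣q∣ (p - q) q ⟩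
    ∣ p - q ∣ + ∣ q ∣ ∎)

  fromℕ : ℕ → ℚ
  fromℕ n = + n / 1

  fromℕ-mkℚ : ∀ n → fromℕ n ≡ mkℚ (+ n) 0 (coprime-sym (1-coprimeTo n))
  fromℕ-mkℚ n = normalize-coprime (coprime-sym (1-coprimeTo n))

  fromℕ-suc : ∀ n → fromℕ (suc n) ≡ fromℕ n + 1ℚ
  fromℕ-suc n = trans
    (cong (_/ 1) (trans (ℤ.+-comm (+ 1) (+ n)) (sym (cong₂ ℤ._+_ (ℤ.*-identityʳ (+ n)) refl))))
    (cong (_+ 1ℚ) (sym (fromℕ-mkℚ n)))

  0≤fromℕ : ∀ n → 0ℚ ≤ fromℕ n
  0≤fromℕ n = nonNegative⁻¹ _ {{normalize-nonNeg n 1}}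

  fromℕ-mono : ∀ {m n} → m ℕ.≤ n → fromℕ m ≤ fromℕ n
  fromℕ-mono {m} m≤n with ℕ.m≤n⇒∃[o]m+o≡n m≤n
  ... | o , refl = go m o
    where
    go : ∀ m o → fromℕ m ≤ fromℕ (m ℕ.+ o)
    go m zero    = ≤-reflexive (cong fromℕ (sym (ℕ.+-identityʳ m)))
    go m (suc o) = begin
      fromℕ m                ≤⟨ go m o ⟩
      fromℕ (m ℕ.+ o)        ≡⟨ +-identityʳ _ ⟨
      fromℕ (m ℕ.+ o) + 0ℚ   ≤⟨ +-monoʳ-≤ (fromℕ (m ℕ.+ o)) (<⇒≤ 0<1) ⟩
      fromℕ (m ℕ.+ o) + 1ℚ   ≡⟨ fromℕ-suc (m ℕ.+ o) ⟨
      fromℕ (suc (m ℕ.+ o))  ≡⟨ cong fromℕ (ℕ.+-suc m o) ⟨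
      fromℕ (m ℕ.+ suc o)    ∎

  archimedean : ∀ q → ∃[ N ] q ≤ fromℕ N
  archimedean q@(mkℚ (+ k) d-1 _) = k , subst (q ≤_) (sym (fromℕ-mkℚ k))
    (*≤* (ℤ.*-monoˡ-≤-nonNeg (+ k) (ℤ.+≤+ (ℕ.s≤s ℕ.z≤n))))
  archimedean (mkℚ -[1+ k ] d-1 _) = 0 , *≤* ℤ.-≤+

  -- Closure properties of Cauchy sequences

  const-cauchy : ∀ q → Cauchy (λ _ → q)
  const-cauchy q ε 0<ε = 0 , λ _ _ _ _ →
    subst (_< ε) (cong ∣_∣ (sym (+-inverseʳ q))) 0<ε

  neg-cauchy : Cauchy s → Cauchy (λ n → - s n)
  neg-cauchy {s} cs ε 0<ε with cs ε 0<ε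
  ... | N , h = N , λ m n N≤m N≤n → subst (_< ε)
    (trans (∣-∣-comm (s m) (s n))
           (cong ∣_∣ (solve 2 (λ a b → b :- a := (:- a) :- (:- b)) refl (s m) (s n))))
    (h m n N≤m N≤n)

  abs-cauchy : Cauchy s → Cauchy (λ n → ∣ s n ∣)
  abs-cauchy {s} cs ε 0<ε with cs ε 0<ε
  ... | N , h = N , λ m n N≤m N≤n → ∣p-q∣< (∣ s m ∣) (∣ s n ∣)
    (≤-<-trans (∣p∣-∣q∣≤∣p-q∣ (s m) (s n)) (h m n N≤m N≤n))
    (≤-<-trans (∣p∣-∣q∣≤∣p-q∣ (s n) (s m)) (h n m N≤n N≤m))

  +-cauchy : Cauchy s → Cauchy t → Cauchy (λ n → s n + t n)
  +-cauchy {s} {t} cs ct ε 0<ε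
    with cs (½ * ε) (0<* 0<½ 0<ε) | ct (½ * ε) (0<* 0<½ 0<ε)
  ... | N₁ , h₁ | N₂ , h₂ = N₁ ℕ.⊔ N₂ , λ m n N≤m N≤n → begin-strict
    ∣ (s m + t m) - (s n + t n) ∣   ≡⟨ cong ∣_∣ (solve 4 (λ a b c d →
      (a :+ b) :- (c :+ d) := (a :- c) :+ (b :- d)) refl (s m) (t m) (s n) (t n)) ⟩
    ∣ (s m - s n) + (t m - t n) ∣   ≤⟨ ∣p+q∣≤∣p∣+∣q∣ (s m - s n) (t m - t n) ⟩
    ∣ s m - s n ∣ + ∣ t m - t n ∣   <⟨ +-mono-<
      (h₁ m n (ℕ.m⊔n≤o⇒m≤o N₁ N₂ N≤m) (ℕ.m⊔n≤o⇒m≤o N₁ N₂ N≤n))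
      (h₂ m n (ℕ.m⊔n≤o⇒n≤o N₁ N₂ N≤m) (ℕ.m⊔n≤o⇒n≤o N₁ N₂ N≤n)) ⟩
    ½ * ε + ½ * ε                   ≡⟨ ½+½ ε ⟩
    ε                               ∎

  bounded : Cauchy s → ∃[ B ] 0ℚ < B × Eventually (λ n → ∣ s n ∣ ≤ B)
  bounded {s} cs with cs 1ℚ 0<1
  ... | N , h = 1ℚ + ∣ s N ∣
              , <-≤-trans 0<1 (≤-trans (≤-reflexive (sym (+-identityʳ 1ℚ))) (+-monoʳ-≤ 1ℚ (0≤∣p∣ (s N))))
              , N , λ n N≤n → begin
    ∣ s n ∣                      ≡⟨ cong ∣_∣ (solve 2 (λ a b → a := (a :- b) :+ b) refl (s n) (s N)) ⟩
    ∣ (s n - s N) + s N ∣        ≤⟨ ∣p+q∣≤∣p∣+∣q∣ (s n - s N) (s N) ⟩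
    ∣ s n - s N ∣ + ∣ s N ∣      ≤⟨ +-monoˡ-≤ ∣ s N ∣ (<⇒≤ (h n N N≤n ℕ.≤-refl)) ⟩
    1ℚ + ∣ s N ∣                 ∎

  divide : 0ℚ < p → 0ℚ < ε → ∃[ δ ] 0ℚ < δ × p * δ ≡ ε
  divide {p} {ε} 0<p 0<ε = (1/ p) {{p≢0}} * ε , 0<* (0<1/ 0<p) 0<ε ,
    trans (sym (*-assoc p _ ε)) (trans (cong (_* ε) (*-inverseʳ p {{p≢0}})) (*-identityˡ ε))
    where
    p≢0 : ℚ.NonZero p
    p≢0 = ℚ.>-nonZero 0<p

  *-close : ∀ {B C δ₁ δ₂} → 0ℚ < B → 0ℚ < C → B * δ₁ ≡ ½ * ε → C * δ₂ ≡ ½ * ε →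
            ∣ a ∣ ≤ B → ∣ d ∣ ≤ C → ∣ b - d ∣ < δ₁ → ∣ a - q ∣ < δ₂ →
            ∣ a * b - q * d ∣ < ε
  *-close {ε} {a} {d} {b} {q} {B} {C} {δ₁} {δ₂} 0<B 0<C Bδ₁ Cδ₂ a≤B d≤C b-d< a-q< = begin-strict
    ∣ a * b - q * d ∣                          ≡⟨ cong ∣_∣ (solve 4 (λ a b q d →
      a :* b :- q :* d := a :* (b :- d) :+ d :* (a :- q)) refl a b q d) ⟩
    ∣ a * (b - d) + d * (a - q) ∣              ≤⟨ ∣p+q∣≤∣p∣+∣q∣ (a * (b - d)) (d * (a - q)) ⟩
    ∣ a * (b - d) ∣ + ∣ d * (a - q) ∣          ≡⟨ cong₂ _+_ (∣p*q∣≡∣p∣*∣q∣ a (b - d)) (∣p*q∣≡∣p∣*∣q∣ d (a - q)) ⟩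
    ∣ a ∣ * ∣ b - d ∣ + ∣ d ∣ * ∣ a - q ∣      ≤⟨ +-mono-≤
      (*-monoʳ-≤-nonNeg (∣ b - d ∣) {{∣-∣-nonNeg (b - d)}} a≤B)
      (*-monoʳ-≤-nonNeg (∣ a - q ∣) {{∣-∣-nonNeg (a - q)}} d≤C) ⟩
    B * ∣ b - d ∣ + C * ∣ a - q ∣              <⟨ +-mono-<
      (*-monoʳ-<-pos B {{ℚ.positive 0<B}} b-d<) (*-monoʳ-<-pos C {{ℚ.positive 0<C}} a-q<) ⟩
    B * δ₁ + C * δ₂                            ≡⟨ cong₂ _+_ Bδ₁ Cδ₂ ⟩
    ½ * ε + ½ * ε                              ≡⟨ ½+½ ε ⟩
    ε                                          ∎

  *-cauchy : Cauchy s → Cauchy t → Cauchy (λ n → s n * t n)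
  *-cauchy {s} {t} cs ct ε 0<ε =
    let B , 0<B , M₁ , s≤B = bounded {s} cs
        C , 0<C , M₂ , t≤C = bounded {t} ct
        δ₁ , 0<δ₁ , Bδ₁ = divide 0<B (0<* 0<½ 0<ε)
        δ₂ , 0<δ₂ , Cδ₂ = divide 0<C (0<* 0<½ 0<ε)
        N₁ , t-close = ct δ₁ 0<δ₁
        N₂ , s-close = cs δ₂ 0<δ₂
    in (M₁ ℕ.⊔ M₂) ℕ.⊔ (N₁ ℕ.⊔ N₂) , λ m n N≤m N≤n →
      let M≤m  = ℕ.m⊔n≤o⇒m≤o (M₁ ℕ.⊔ M₂) (N₁ ℕ.⊔ N₂) N≤m
          M≤n  = ℕ.m⊔n≤o⇒m≤o (M₁ ℕ.⊔ M₂) (N₁ ℕ.⊔ N₂) N≤n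
          N≤m′ = ℕ.m⊔n≤o⇒n≤o (M₁ ℕ.⊔ M₂) (N₁ ℕ.⊔ N₂) N≤m
          N≤n′ = ℕ.m⊔n≤o⇒n≤o (M₁ ℕ.⊔ M₂) (N₁ ℕ.⊔ N₂) N≤n
      in *-close {ε} {s m} {t n} {t m} {s n} {B} {C} {δ₁} {δ₂} 0<B 0<C Bδ₁ Cδ₂
           (s≤B m (ℕ.m⊔n≤o⇒m≤o M₁ M₂ M≤m)) (t≤C n (ℕ.m⊔n≤o⇒n≤o M₁ M₂ M≤n))
           (t-close m n (ℕ.m⊔n≤o⇒m≤o N₁ N₂ N≤m′) (ℕ.m⊔n≤o⇒m≤o N₁ N₂ N≤n′))
           (s-close m n (ℕ.m⊔n≤o⇒n≤o N₁ N₂ N≤m′) (ℕ.m⊔n≤o⇒n≤o N₁ N₂ N≤n′))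

  -- Inverting a sequence termwise: the junk value inverse 0 = 0 can only
  -- occur at finitely many terms of a sequence bounded away from 0.

  inverse : ℚ → ℚ
  inverse p with p ≟ 0ℚ
  ... | yes _   = 0ℚ
  ... | no  p≢0 = (1/ p) {{ℚ.≢-nonZero p≢0}}

  inverseʳ : p ≢ 0ℚ → p * inverse p ≡ 1ℚ
  inverseʳ {p} p≢0 with p ≟ 0ℚ
  ... | yes p≡0 = ⊥-elim (p≢0 p≡0)
  ... | no  p≢0 = *-inverseʳ p {{ℚ.≢-nonZero p≢0}}

  inverse-cauchy : Cauchy s → 0ℚ < δ → Eventually (λ n → δ ≤ ∣ s n ∣) →
                   Cauchy (λ n → inverse (s n))
  inverse-cauchy {s} {δ} cs 0<δ (M , δ≤) ε 0<ε with cs (ε * (δ * δ)) (0<* 0<ε (0<* 0<δ 0<δ))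
  ... | N , h = M ℕ.⊔ N , λ m n N≤m N≤n → *-cancelʳ-<-nonNeg (δ * δ)
    {{ℚ.nonNegative (<⇒≤ (0<* 0<δ 0<δ))}} (begin-strict
    ∣ i m - i n ∣ * (δ * δ)                        ≡⟨ cong (λ z → ∣ z ∣ * (δ * δ)) (difference m n
      (ℕ.m⊔n≤o⇒m≤o M N N≤m) (ℕ.m⊔n≤o⇒m≤o M N N≤n)) ⟩
    ∣ (i m * i n) * (s n - s m) ∣ * (δ * δ)        ≡⟨ cong (_* (δ * δ)) (trans
      (∣p*q∣≡∣p∣*∣q∣ (i m * i n) _) (cong (_* ∣ s n - s m ∣) (∣p*q∣≡∣p∣*∣q∣ (i m) (i n)))) ⟩
    (∣ i m ∣ * ∣ i n ∣) * ∣ s n - s m ∣ * (δ * δ)  ≡⟨ solve 4 (λ a b c d →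
      (a :* b) :* c :* (d :* d) := ((a :* d) :* (b :* d)) :* c) refl (∣ i m ∣) (∣ i n ∣) (∣ s n - s m ∣) δ ⟩
    ((∣ i m ∣ * δ) * (∣ i n ∣ * δ)) * ∣ s n - s m ∣ ≤⟨ *-monoʳ-≤-nonNeg (∣ s n - s m ∣) {{∣-∣-nonNeg (s n - s m)}}
      (*-mono-≤ (0≤iδ m) (iδ≤1 m (ℕ.m⊔n≤o⇒m≤o M N N≤m)) (0≤iδ n) (iδ≤1 n (ℕ.m⊔n≤o⇒m≤o M N N≤n))) ⟩
    (1ℚ * 1ℚ) * ∣ s n - s m ∣                      ≡⟨ *-identityˡ _ ⟩
    ∣ s n - s m ∣                                  <⟨ h n m (ℕ.m⊔n≤o⇒n≤o M N N≤n) (ℕ.m⊔n≤o⇒n≤o M N N≤m) ⟩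
    ε * (δ * δ)                                    ∎)
    where
    i : ℕ → ℚ
    i n = inverse (s n)
    s≢0 : ∀ n → M ℕ.≤ n → s n ≢ 0ℚ
    s≢0 n M≤n e = <-irrefl refl (<-≤-trans 0<δ (subst (λ z → δ ≤ ∣ z ∣) e (δ≤ n M≤n)))
    difference : ∀ m n → M ℕ.≤ m → M ℕ.≤ n → i m - i n ≡ (i m * i n) * (s n - s m)
    difference m n M≤m M≤n = sym (trans
      (solve 4 (λ a b c d → (a :* b) :* (d :- c) := a :* (d :* b) :- b :* (c :* a)) refl (i m) (i n) (s m) (s n))
      (cong₂ _-_
        (trans (cong (i m *_) (inverseʳ (s≢0 n M≤n))) (*-identityʳ (i m)))
        (trans (cong (i n *_) (inverseʳ (s≢0 m M≤m))) (*-identityʳ (i n)))))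
    0≤iδ : ∀ n → 0ℚ ≤ ∣ i n ∣ * δ
    0≤iδ n = 0≤* (0≤∣p∣ (i n)) (<⇒≤ 0<δ)
    iδ≤1 : ∀ n → M ℕ.≤ n → ∣ i n ∣ * δ ≤ 1ℚ
    iδ≤1 n M≤n = begin
      ∣ i n ∣ * δ          ≤⟨ *-monoˡ-≤-nonNeg (∣ i n ∣) {{∣-∣-nonNeg (i n)}} (δ≤ n M≤n) ⟩
      ∣ i n ∣ * ∣ s n ∣    ≡⟨ trans (sym (∣p*q∣≡∣p∣*∣q∣ (i n) (s n))) (cong ∣_∣ (*-comm (i n) (s n))) ⟩
      ∣ s n * i n ∣        ≡⟨ cong ∣_∣ (inverseʳ (s≢0 n M≤n)) ⟩
      1ℚ                   ∎

  -- Square roots by bisection: the invariant is 0 ≤ lo, lo² ≤ q < hi².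

  bisect : ℕ → (q lo hi : ℚ) → ℚ × ℚ
  bisect zero    q lo hi = lo , hi
  bisect (suc k) q lo hi with (½ * (lo + hi)) * (½ * (lo + hi)) ≤? q
  ... | yes _ = bisect k q (½ * (lo + hi)) hi
  ... | no  _ = bisect k q lo (½ * (lo + hi))

  sqrtInterval : ℕ → ℚ → ℚ × ℚ
  sqrtInterval k q = bisect k (0ℚ ⊔ q) 0ℚ (1ℚ + (0ℚ ⊔ q))

  sqrt : ℕ → ℚ → ℚ
  sqrt k q = proj₁ (sqrtInterval k q)

  ½^ : ℕ → ℚ
  ½^ zero    = 1ℚ
  ½^ (suc k) = ½^ k * ½

  record Bracket (q w : ℚ) (I : ℚ × ℚ) : Set where
    field
      lo≥0  : 0ℚ ≤ proj₁ I
      lo²≤q : proj₁ I * proj₁ I ≤ q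
      q<hi² : q < proj₂ I * proj₂ I
      width : proj₂ I ≡ proj₁ I + w

  bisect-bracket : ∀ k {q lo hi w} → 0ℚ < w → Bracket q w (lo , hi) →
                   Bracket q (½^ k * w) (bisect k q lo hi)
  bisect-bracket zero    {w = w} _ B = subst (λ z → Bracket _ z _) (sym (*-identityˡ w)) B
  bisect-bracket (suc k) {q} {lo} {hi} {w} 0<w B
    with (½ * (lo + hi)) * (½ * (lo + hi)) ≤? q
  ... | yes mid²≤q = subst (λ z → Bracket q z _) (sym (*-assoc (½^ k) ½ w))
    (bisect-bracket k (0<* 0<½ 0<w) record
      { lo≥0 = 0≤mid ; lo²≤q = mid²≤q ; q<hi² = q<hi²
      ; width = trans width (trans
          (solve 2 (λ l w → l :+ w := con ½ :* (l :+ (l :+ w)) :+ con ½ :* w) refl lo w)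
          (cong (λ z → ½ * (lo + z) + ½ * w) (sym width))) })
    where
    open Bracket B
    0≤mid : 0ℚ ≤ ½ * (lo + hi)
    0≤mid = 0≤* (<⇒≤ 0<½) (+-mono-≤ lo≥0
      (subst (0ℚ ≤_) (sym width) (+-mono-≤ lo≥0 (<⇒≤ 0<w))))
  ... | no mid²≰q = subst (λ z → Bracket q z _) (sym (*-assoc (½^ k) ½ w))
    (bisect-bracket k (0<* 0<½ 0<w) record
      { lo≥0 = lo≥0 ; lo²≤q = lo²≤q ; q<hi² = ≰⇒> mid²≰q
      ; width = trans (cong (λ z → ½ * (lo + z)) width)
          (solve 2 (λ l w → con ½ :* (l :+ (l :+ w)) := l :+ con ½ :* w) refl lo w) })
    where open Bracket B

  sqrt-bracket : ∀ k q → Bracket (0ℚ ⊔ q) (½^ k * (1ℚ + (0ℚ ⊔ q))) (sqrtInterval k q)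
  sqrt-bracket k q = bisect-bracket k 0<w record
    { lo≥0 = ≤-refl ; lo²≤q = 0≤q⁺
    ; q<hi² = begin-strict
        q⁺                      ≡⟨ +-identityˡ q⁺ ⟨
        0ℚ + q⁺                 <⟨ +-monoˡ-< q⁺ 0<1 ⟩
        1ℚ + q⁺                 ≡⟨ *-identityʳ _ ⟨
        (1ℚ + q⁺) * 1ℚ          ≤⟨ *-monoˡ-≤-nonNeg (1ℚ + q⁺) {{ℚ.nonNegative (<⇒≤ 0<w)}} 1≤w ⟩
        (1ℚ + q⁺) * (1ℚ + q⁺)   ∎
    ; width = sym (+-identityˡ _) }
    where
    q⁺ = 0ℚ ⊔ q
    0≤q⁺ : 0ℚ ≤ q⁺
    0≤q⁺ = p≤p⊔q 0ℚ q
    1≤w : 1ℚ ≤ 1ℚ + q⁺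
    1≤w = ≤-trans (≤-reflexive (sym (+-identityʳ 1ℚ))) (+-monoʳ-≤ 1ℚ 0≤q⁺)
    0<w : 0ℚ < 1ℚ + q⁺
    0<w = <-≤-trans 0<1 1≤w

  0≤½^ : ∀ k → 0ℚ ≤ ½^ k
  0≤½^ zero    = <⇒≤ 0<1
  0≤½^ (suc k) = 0≤* (0≤½^ k) (<⇒≤ 0<½)

  ½^-bound : ∀ k → ½^ k * fromℕ (suc k) ≤ 1ℚ
  ½^-bound zero    = ≤-refl
  ½^-bound (suc k) = begin
    ½^ k * ½ * fromℕ (2 ℕ.+ k)                              ≤⟨ *-monoˡ-≤-nonNeg (½^ k * ½)
      {{ℚ.nonNegative (0≤½^ (suc k))}} fromℕ[2+k]≤ ⟩
    ½^ k * ½ * (fromℕ (suc k) + fromℕ (suc k))              ≡⟨ solve 2 (λ h n →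
      h :* con ½ :* (n :+ n) := h :* n) refl (½^ k) (fromℕ (suc k)) ⟩
    ½^ k * fromℕ (suc k)                                    ≤⟨ ½^-bound k ⟩
    1ℚ                                                      ∎
    where
    fromℕ[2+k]≤ : fromℕ (2 ℕ.+ k) ≤ fromℕ (suc k) + fromℕ (suc k)
    fromℕ[2+k]≤ = begin
      fromℕ (2 ℕ.+ k)                ≡⟨ fromℕ-suc (suc k) ⟩
      fromℕ (suc k) + fromℕ 1        ≤⟨ +-monoʳ-≤ (fromℕ (suc k)) (fromℕ-mono {1} {suc k} (ℕ.s≤s ℕ.z≤n)) ⟩
      fromℕ (suc k) + fromℕ (suc k)  ∎

  -- The width of the bracket around √(s n) tends to 0.

  sqrt-width : ℕ → ℚ → ℚ
  sqrt-width k q = ½^ k * (1ℚ + (0ℚ ⊔ q))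

  0≤sqrt-width : ∀ k q → 0ℚ ≤ sqrt-width k q
  0≤sqrt-width k q = 0≤* (0≤½^ k) (+-mono-≤ (<⇒≤ 0<1) (p≤p⊔q 0ℚ q))

  sqrt-width-bound : ∀ {B η} k K → 0ℚ < B → 0ℚ < η → ∣ q ∣ ≤ B → 1ℚ + B ≤ η * fromℕ K →
                     K ℕ.≤ suc k → sqrt-width k q ≤ η
  sqrt-width-bound {q} {B} {η} k K 0<B 0<η q≤B B≤ηK K≤k = begin
    ½^ k * (1ℚ + (0ℚ ⊔ q))        ≤⟨ *-monoˡ-≤-nonNeg (½^ k) {{ℚ.nonNegative (0≤½^ k)}} (begin
      1ℚ + (0ℚ ⊔ q)                 ≤⟨ +-monoʳ-≤ 1ℚ (⊔-lub (<⇒≤ 0<B) (≤-trans (p≤∣p∣ q) q≤B)) ⟩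
      1ℚ + B                        ≤⟨ B≤ηK ⟩
      η * fromℕ K                   ≤⟨ *-monoˡ-≤-nonNeg η {{ℚ.nonNegative (<⇒≤ 0<η)}} (fromℕ-mono K≤k) ⟩
      η * fromℕ (suc k)             ∎) ⟩
    ½^ k * (η * fromℕ (suc k))    ≡⟨ solve 3 (λ h e n → h :* (e :* n) := e :* (h :* n)) refl
                                       (½^ k) η (fromℕ (suc k)) ⟩
    η * (½^ k * fromℕ (suc k))    ≤⟨ *-monoˡ-≤-nonNeg η {{ℚ.nonNegative (<⇒≤ 0<η)}} (½^-bound k) ⟩
    η * 1ℚ                        ≡⟨ *-identityʳ η ⟩
    η                             ∎

  archimedean′ : ∀ B η → 0ℚ < η → ∃[ K ] B ≤ η * fromℕ K
  archimedean′ B η 0<η =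
    let K , h = archimedean ((1/ η) {{η≢0}} * B) in K , (begin
    B                           ≡⟨ *-identityˡ B ⟨
    1ℚ * B                      ≡⟨ cong (_* B) (*-inverseʳ η {{η≢0}}) ⟨
    η * (1/ η) {{η≢0}} * B      ≡⟨ *-assoc η _ B ⟩
    η * ((1/ η) {{η≢0}} * B)    ≤⟨ *-monoˡ-≤-nonNeg η {{ℚ.nonNegative (<⇒≤ 0<η)}} h ⟩
    η * fromℕ K                 ∎)
    where
    η≢0 : ℚ.NonZero η
    η≢0 = ℚ.>-nonZero 0<η

  sqrt-width-small : Cauchy s → ∀ η → 0ℚ < η → Eventually (λ n → sqrt-width n (s n) ≤ η)
  sqrt-width-small {s} cs η 0<η =
    let B , 0<B , M , s≤B = bounded {s} cs
        K , B≤ηK = archimedean′ (1ℚ + B) η 0<η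
    in M ℕ.⊔ K , λ n N≤n → sqrt-width-bound {s n} {B} {η} n K 0<B 0<η
         (s≤B n (ℕ.m⊔n≤o⇒m≤o M K N≤n)) B≤ηK
         (ℕ.≤-trans (ℕ.m⊔n≤o⇒n≤o M K N≤n) (ℕ.n≤1+n n))

  sqrt-below : ∀ {η} m n → 0ℚ < η → p - q ≤ η * η → sqrt-width n q ≤ η →
               sqrt m p - sqrt n q < η + η
  sqrt-below {p} {q} {η} m n 0<η p-q≤ w≤η = begin-strict
    l - l′                    <⟨ +-monoˡ-< (- l′) (square-cancel-< {hi + η} {l} 0≤hi+η l²<) ⟩
    (hi + η) - l′             ≡⟨ cong (λ z → (z + η) - l′) B′.width ⟩
    ((l′ + w) + η) - l′       ≡⟨ solve 3 (λ l w e → ((l :+ w) :+ e) :- l := w :+ e) refl l′ w η ⟩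
    w + η                     ≤⟨ +-monoˡ-≤ η w≤η ⟩
    η + η                     ∎
    where
    module B  = Bracket (sqrt-bracket m p)
    module B′ = Bracket (sqrt-bracket n q)
    l  = sqrt m p
    l′ = sqrt n q
    hi = proj₂ (sqrtInterval n q)
    w  = sqrt-width n q
    0≤hi : 0ℚ ≤ hi
    0≤hi = subst (0ℚ ≤_) (sym B′.width) (+-mono-≤ B′.lo≥0 (0≤sqrt-width n q))
    0≤hi+η : 0ℚ ≤ hi + η
    0≤hi+η = +-mono-≤ 0≤hi (<⇒≤ 0<η)
    p⁺≤q⁺+η² : 0ℚ ⊔ p ≤ (0ℚ ⊔ q) + η * η
    p⁺≤q⁺+η² = ⊔-lub
      (+-mono-≤ (p≤p⊔q 0ℚ q) (<⇒≤ (0<* 0<η 0<η)))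
      (begin
        p                  ≡⟨ solve 2 (λ a b → a := b :+ (a :- b)) refl p q ⟩
        q + (p - q)        ≤⟨ +-mono-≤ (p≤q⊔p 0ℚ q) p-q≤ ⟩
        (0ℚ ⊔ q) + η * η   ∎)
    l²< : l * l < (hi + η) * (hi + η)
    l²< = begin-strict
      l * l                              ≤⟨ B.lo²≤q ⟩
      0ℚ ⊔ p                             ≤⟨ p⁺≤q⁺+η² ⟩
      (0ℚ ⊔ q) + η * η                   <⟨ +-monoˡ-< (η * η) B′.q<hi² ⟩
      hi * hi + η * η                    ≡⟨ +-identityʳ _ ⟨
      (hi * hi + η * η) + 0ℚ             ≤⟨ +-monoʳ-≤ (hi * hi + η * η)
                                             (+-mono-≤ (0≤* 0≤hi (<⇒≤ 0<η)) (0≤* 0≤hi (<⇒≤ 0<η))) ⟩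
      (hi * hi + η * η) + (hi * η + hi * η)  ≡⟨ solve 2 (λ h e →
        (h :* h :+ e :* e) :+ (h :* e :+ h :* e) := (h :+ e) :* (h :+ e)) refl hi η ⟩
      (hi + η) * (hi + η)                ∎

  sqrt-cauchy : Cauchy s → Cauchy (λ n → sqrt n (s n))
  sqrt-cauchy {s} cs ε 0<ε =
    let η = ½ * ε
        0<η = 0<* 0<½ 0<ε
        N , close = cs (η * η) (0<* 0<η 0<η)
        M , small = sqrt-width-small {s} cs η 0<η
        below : ∀ m n → N ℕ.⊔ M ℕ.≤ m → N ℕ.⊔ M ℕ.≤ n → sqrt m (s m) - sqrt n (s n) < ε
        below m n N≤m N≤n = subst (sqrt m (s m) - sqrt n (s n) <_) (½+½ ε)
          (sqrt-below {s m} {s n} {η} m n 0<η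
            (≤-trans (p≤∣p∣ (s m - s n))
              (<⇒≤ (close m n (ℕ.m⊔n≤o⇒m≤o N M N≤m) (ℕ.m⊔n≤o⇒m≤o N M N≤n))))
            (small n (ℕ.m⊔n≤o⇒n≤o N M N≤n)))
    in N ℕ.⊔ M , λ m n N≤m N≤n →
         ∣p-q∣< (sqrt m (s m)) (sqrt n (s n)) (below m n N≤m N≤n) (below n m N≤n N≤m)

  0<⊓ : 0ℚ < p → 0ℚ < q → 0ℚ < p ⊓ q
  0<⊓ {p} {q} 0<p 0<q with ≤-total p q
  ... | inj₁ p≤q = subst (0ℚ <_) (sym (p≤q⇒p⊓q≡p p≤q)) 0<p
  ... | inj₂ q≤p = subst (0ℚ <_) (sym (p≥q⇒p⊓q≡q q≤p)) 0<q

  sqrt-lower : ∀ {μ} n → 0ℚ < μ → μ ≤ 1ℚ → μ ≤ q → sqrt-width n q ≤ ½ * μ → ½ * μ ≤ sqrt n q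
  sqrt-lower {q} {μ} n 0<μ μ≤1 μ≤q w≤η = begin
    η                ≡⟨ solve 1 (λ e → e := (e :+ e) :- e) refl η ⟩
    (η + η) - η      ≡⟨ cong (_- η) (½+½ μ) ⟩
    μ - η            ≤⟨ p-q≤r {μ} {l} {η} (<⇒≤ (square-cancel-< {l + η} {μ} 0≤l+η μ²<)) ⟩
    l                ∎
    where
    open Bracket (sqrt-bracket n q)
    η  = ½ * μ
    l  = sqrt n q
    hi = proj₂ (sqrtInterval n q)
    0≤l+η : 0ℚ ≤ l + η
    0≤l+η = +-mono-≤ lo≥0 (<⇒≤ (0<* 0<½ 0<μ))
    0≤hi : 0ℚ ≤ hi
    0≤hi = subst (0ℚ ≤_) (sym width) (+-mono-≤ lo≥0 (0≤sqrt-width n q))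
    hi≤l+η : hi ≤ l + η
    hi≤l+η = subst (_≤ l + η) (sym width) (+-monoʳ-≤ l w≤η)
    μ²< : μ * μ < (l + η) * (l + η)
    μ²< = begin-strict
      μ * μ                ≤⟨ *-monoˡ-≤-nonNeg μ {{ℚ.nonNegative (<⇒≤ 0<μ)}} μ≤1 ⟩
      μ * 1ℚ               ≡⟨ *-identityʳ μ ⟩
      μ                    ≤⟨ μ≤q ⟩
      q                    ≤⟨ p≤q⊔p 0ℚ q ⟩
      0ℚ ⊔ q               <⟨ q<hi² ⟩
      hi * hi              ≤⟨ *-mono-≤ 0≤hi hi≤l+η 0≤hi hi≤l+η ⟩
      (l + η) * (l + η)    ∎

  sqrt-positive : Cauchy s → 0ℚ < δ → Eventually (λ n → δ ≤ s n) →
                  ∃[ η ] 0ℚ < η × Eventually (λ n → η ≤ sqrt n (s n))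
  sqrt-positive {s} {δ} cs 0<δ (M , δ≤) =
    let μ = δ ⊓ 1ℚ
        0<μ = 0<⊓ 0<δ 0<1
        K , small = sqrt-width-small {s} cs (½ * μ) (0<* 0<½ 0<μ)
    in ½ * μ , 0<* 0<½ 0<μ , M ℕ.⊔ K , λ n N≤n →
         sqrt-lower {s n} {μ} n 0<μ (p⊓q≤q δ 1ℚ)
           (≤-trans (p⊓q≤p δ 1ℚ) (δ≤ n (ℕ.m⊔n≤o⇒m≤o M K N≤n)))
           (small n (ℕ.m⊔n≤o⇒n≤o M K N≤n))

  -- Partial sums of the Leibniz series 1 − 1/3 + 1/5 − ⋯

  -1^_ : ℕ → ℚ
  -1^ zero    = 1ℚ
  -1^ (suc k) = - (-1^ k)

  odd⁻¹ : ℕ → ℚ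
  odd⁻¹ k = + 1 / suc (2 ℕ.* k)

  leibniz : ℕ → ℚ
  leibniz zero    = 0ℚ
  leibniz (suc k) = leibniz k + -1^ k * odd⁻¹ k

  odd⁻¹-mkℚ : ∀ k → odd⁻¹ k ≡ mkℚ (+ 1) (2 ℕ.* k) (1-coprimeTo (suc (2 ℕ.* k)))
  odd⁻¹-mkℚ k = normalize-coprime (1-coprimeTo (suc (2 ℕ.* k)))

  0≤odd⁻¹ : ∀ k → 0ℚ ≤ odd⁻¹ k
  0≤odd⁻¹ k = nonNegative⁻¹ _ {{normalize-nonNeg 1 (suc (2 ℕ.* k))}}

  odd⁻¹-anti : ∀ k → odd⁻¹ (suc k) ≤ odd⁻¹ k
  odd⁻¹-anti k = subst₂ _≤_ (sym (odd⁻¹-mkℚ (suc k))) (sym (odd⁻¹-mkℚ k))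
    (*≤* (ℤ.*-monoˡ-≤-nonNeg (+ 1) (ℤ.+≤+ (ℕ.s≤s (ℕ.*-monoʳ-≤ 2 (ℕ.n≤1+n k))))))

  odd⁻¹-small : ∀ ε → 0ℚ < ε → Eventually (λ k → odd⁻¹ k < ε)
  odd⁻¹-small (mkℚ (+ zero) d _)   (*<* (ℤ.+<+ ()))
  odd⁻¹-small (mkℚ -[1+ p ] d _)   (*<* ())
  odd⁻¹-small ε@(mkℚ +[1+ p ] d _) _ = suc d , λ k d<k →
    subst (_< ε) (sym (odd⁻¹-mkℚ k)) (*<* (ℤ.+<+ (lemma k d<k)))
    where
    lemma : ∀ k → suc d ℕ.≤ k → 1 ℕ.* suc d ℕ.< suc p ℕ.* suc (2 ℕ.* k)
    lemma k d<k = ℕ.<-≤-trans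
      (ℕ.s≤s (ℕ.≤-trans (ℕ.≤-reflexive (ℕ.*-identityˡ (suc d))) (ℕ.≤-trans d<k (ℕ.m≤m+n k _))))
      (ℕ.m≤m+n (suc (2 ℕ.* k)) _)

  -- The sum of any block starting at k is (-1)ᵏ r with 0 ≤ r ≤ 1/(2k+1).

  leibniz-block : ∀ j k → ∃[ r ] 0ℚ ≤ r × r ≤ odd⁻¹ k ×
                  leibniz (j ℕ.+ k) ≡ leibniz k + -1^ k * r
  leibniz-block zero    k = 0ℚ , ≤-refl , 0≤odd⁻¹ k ,
    solve 2 (λ l s → l := l :+ s :* con 0ℚ) refl (leibniz k) (-1^ k)
  leibniz-block (suc j) k with leibniz-block j (suc k)
  ... | r , 0≤r , r≤ , e = odd⁻¹ k - r
      , subst (_≤ odd⁻¹ k - r) (+-inverseʳ r) (+-monoˡ-≤ (- r) (≤-trans r≤ (odd⁻¹-anti k)))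
      , p-q≤r {odd⁻¹ k} {odd⁻¹ k} {r} (subst (_≤ odd⁻¹ k + r) (+-identityʳ (odd⁻¹ k)) (+-monoʳ-≤ (odd⁻¹ k) 0≤r))
      , trans (cong leibniz (sym (ℕ.+-suc j k))) (trans e
          (solve 4 (λ l s a r → (l :+ s :* a) :+ (:- s) :* r := l :+ s :* (a :- r)) refl
            (leibniz k) (-1^ k) (odd⁻¹ k) r))

  ∣-1^∣ : ∀ k → ∣ -1^ k ∣ ≡ 1ℚ
  ∣-1^∣ zero    = refl
  ∣-1^∣ (suc k) = trans (∣-p∣≡∣p∣ (-1^ k)) (∣-1^∣ k)

  leibniz-cauchy : Cauchy leibniz
  leibniz-cauchy ε 0<ε with odd⁻¹-small (½ * ε) (0<* 0<½ 0<ε)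
  ... | N , small = N , λ m n N≤m N≤n → begin-strict
    ∣ leibniz m - leibniz n ∣                           ≡⟨ cong ∣_∣ (solve 3 (λ a b c →
      a :- b := (a :- c) :- (b :- c)) refl (leibniz m) (leibniz n) (leibniz N)) ⟩
    ∣ (leibniz m - leibniz N) - (leibniz n - leibniz N) ∣ ≤⟨ ∣p-q∣≤∣p∣+∣q∣ (leibniz m - leibniz N) _ ⟩
    ∣ leibniz m - leibniz N ∣ + ∣ leibniz n - leibniz N ∣ <⟨ +-mono-< (tail m N≤m) (tail n N≤n) ⟩
    ½ * ε + ½ * ε                                       ≡⟨ ½+½ ε ⟩
    ε                                                   ∎
    where
    tail : ∀ m → N ℕ.≤ m → ∣ leibniz m - leibniz N ∣ < ½ * ε
    tail m N≤m with leibniz-block (m ℕ.∸ N) N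
    ... | r , 0≤r , r≤ , e = begin-strict
      ∣ leibniz m - leibniz N ∣      ≡⟨ cong (λ z → ∣ leibniz z - leibniz N ∣) (ℕ.m∸n+n≡m N≤m) ⟨
      ∣ leibniz (m ℕ.∸ N ℕ.+ N) - leibniz N ∣  ≡⟨ cong (λ z → ∣ z - leibniz N ∣) e ⟩
      ∣ (leibniz N + -1^ N * r) - leibniz N ∣  ≡⟨ cong ∣_∣ (solve 2 (λ l x →
        (l :+ x) :- l := x) refl (leibniz N) (-1^ N * r)) ⟩
      ∣ -1^ N * r ∣                  ≡⟨ ∣p*q∣≡∣p∣*∣q∣ (-1^ N) r ⟩
      ∣ -1^ N ∣ * ∣ r ∣              ≡⟨ cong₂ _*_ (∣-1^∣ N) (0≤p⇒∣p∣≡p 0≤r) ⟩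
      1ℚ * r                         ≡⟨ *-identityˡ r ⟩
      r                              ≤⟨ r≤ ⟩
      odd⁻¹ N                        <⟨ small N ℕ.≤-refl ⟩
      ½ * ε                          ∎

  ½≤leibniz : ∀ n → 1 ℕ.≤ n → ½ ≤ leibniz n
  ½≤leibniz (suc n) _ with leibniz-block n 1
  ... | r , _ , r≤ , e = begin
    ½                    ≤⟨ ≤ᵇ⇒≤ _ ⟩
    1ℚ - odd⁻¹ 1         ≤⟨ +-monoʳ-≤ 1ℚ (neg-antimono-≤ r≤) ⟩
    1ℚ - r               ≡⟨ solve 1 (λ r → con 1ℚ :- r := con 1ℚ :+ con (- 1ℚ) :* r) refl r ⟩
    1ℚ + - 1ℚ * r        ≡⟨ trans (cong leibniz (sym (ℕ.+-comm n 1))) e ⟨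
    leibniz (suc n)      ∎

open RationalSequences using
  ( 0<*; p≤∣p∣; const-cauchy; neg-cauchy; abs-cauchy; +-cauchy; *-cauchy; inverse; inverse-cauchy
  ; sqrt; sqrt-cauchy; sqrt-positive; leibniz; leibniz-cauchy; ½≤leibniz )

------------------------------------------------------------------------
-- Real numbers

-- A real number is a Cauchy sequence of rationals; two of them denote the
-- same number when their difference tends to 0, and every notion below
-- depends on this only.

record ℝ : Set where
  constructor mkℝ
  field
    seq    : ℕ → ℚ
    cauchy : Cauchy seq

open ℝ public

infix  4 _<_ _≉0 _∼_
infixl 6 _+_ _-_
infixl 7 _*_ _÷_⟨_⟩
infix  8 -_

fromℚ : ℚ → ℝ
fromℚ q = mkℝ (λ _ → q) (const-cauchy q)

fromℕ : ℕ → ℝ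
fromℕ n = fromℚ (+ n ℚ./ 1)

_+_ : ℝ → ℝ → ℝ
x + y = mkℝ (λ n → seq x n ℚ.+ seq y n) (+-cauchy {seq x} {seq y} (cauchy x) (cauchy y))

-_ : ℝ → ℝ
- x = mkℝ (λ n → ℚ.- seq x n) (neg-cauchy {seq x} (cauchy x))

_-_ : ℝ → ℝ → ℝ
x - y = x + - y

_*_ : ℝ → ℝ → ℝ
x * y = mkℝ (λ n → seq x n ℚ.* seq y n) (*-cauchy {seq x} {seq y} (cauchy x) (cauchy y))

∣_∣ : ℝ → ℝ
∣ x ∣ = mkℝ (λ n → ℚ.∣ seq x n ∣) (abs-cauchy {seq x} (cauchy x))

_<_ : ℝ → ℝ → Set
x < y = ∃[ δ ] 0ℚ ℚ.< δ × Eventually (λ n → seq x n ℚ.+ δ ℚ.≤ seq y n)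

0ℝ 1ℝ : ℝ
0ℝ = fromℚ 0ℚ
1ℝ = fromℚ 1ℚ

_≉0 : ℝ → Set
x ≉0 = 0ℝ < ∣ x ∣

drop-0+ : ∀ {p q : ℚ} → 0ℚ ℚ.+ p ℚ.≤ q → p ℚ.≤ q
drop-0+ {p} = subst (ℚ._≤ _) (ℚP.+-identityˡ p)

add-0+ : ∀ {p q : ℚ} → p ℚ.≤ q → 0ℚ ℚ.+ p ℚ.≤ q
add-0+ {p} = subst (ℚ._≤ _) (sym (ℚP.+-identityˡ p))

_⁻¹⟨_⟩ : (x : ℝ) → x ≉0 → ℝ
x ⁻¹⟨ δ , 0<δ , N , δ≤∣x∣ ⟩ = mkℝ (λ n → inverse (seq x n))
  (inverse-cauchy {seq x} (cauchy x) 0<δ (N , λ n N≤n → drop-0+ {δ} {ℚ.∣ seq x n ∣} (δ≤∣x∣ n N≤n)))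

_÷_⟨_⟩ : (x y : ℝ) → y ≉0 → ℝ
x ÷ y ⟨ y≉0 ⟩ = x * (y ⁻¹⟨ y≉0 ⟩)

-- The n-th approximation to √x is obtained from the n-th approximation to x
-- by n bisection steps; negative approximations are replaced by 0.

√ : ℝ → ℝ
√ x = mkℝ (λ n → sqrt n (seq x n)) (sqrt-cauchy {seq x} (cauchy x))

leibniz-ℝ : ℝ
leibniz-ℝ = mkℝ leibniz leibniz-cauchy

-- π = 4 (1 − 1/3 + 1/5 − ⋯)

π : ℝ
π = fromℕ 4 * leibniz-ℝ

0<⇒≉0 : ∀ x → 0ℝ < x → x ≉0
0<⇒≉0 x (δ , 0<δ , N , δ≤x) =
  δ , 0<δ , N , λ n N≤n → ℚP.≤-trans (δ≤x n N≤n) (p≤∣p∣ (seq x n))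

0<*-ℝ : ∀ x y → 0ℝ < x → 0ℝ < y → 0ℝ < x * y
0<*-ℝ x y (δ , 0<δ , M , δ≤x) (η , 0<η , N , η≤y) = δ ℚ.* η , 0<* 0<δ 0<η , M ℕ.⊔ N , λ n N≤n →
  add-0+ {δ ℚ.* η} {seq x n ℚ.* seq y n} (RationalSequences.*-mono-≤ {δ} {seq x n} {η} {seq y n} (ℚP.<⇒≤ 0<δ) (drop-0+ {δ} {seq x n} (δ≤x n (ℕ.m⊔n≤o⇒m≤o M N N≤n)))
                                     (ℚP.<⇒≤ 0<η) (drop-0+ {η} {seq y n} (η≤y n (ℕ.m⊔n≤o⇒n≤o M N N≤n))))

0<√ : ∀ x → 0ℝ < x → 0ℝ < √ x
0<√ x (δ , 0<δ , N , δ≤x) =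
  let η , 0<η , M , η≤ = sqrt-positive {seq x} (cauchy x) 0<δ (N , λ n N≤n → drop-0+ {δ} {seq x n} (δ≤x n N≤n))
  in η , 0<η , M , λ n M≤n → add-0+ {η} {sqrt n (seq x n)} (η≤ n M≤n)

0<fromℕ-suc : ∀ n → 0ℝ < fromℕ (suc n)
0<fromℕ-suc n = + suc n ℚ./ 1 , ℚP.positive⁻¹ _ {{ℚP.normalize-pos (suc n) 1}} , 0 ,
  λ _ _ → add-0+ {+ suc n ℚ./ 1} {+ suc n ℚ./ 1} ℚP.≤-refl

0<π : 0ℝ < π
0<π = 0<*-ℝ (fromℕ 4) leibniz-ℝ (0<fromℕ-suc 3)
  (½ , RationalSequences.0<½ , 1 , λ n 1≤n → add-0+ {½} {leibniz n} (½≤leibniz n 1≤n))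

8√π≉0 : fromℕ 8 * √ π ≉0
8√π≉0 = 0<⇒≉0 (fromℕ 8 * √ π) (0<*-ℝ (fromℕ 8) (√ π) (0<fromℕ-suc 7) (0<√ π 0<π))

-- n^(-3/2) as the square root of n⁻³.

_^[-3/2] : (n : ℕ) .{{_ : ℕ.NonZero n}} → ℝ
n ^[-3/2] = √ (fromℚ ((+ 1 ℚ./ (n ℕ.^ 3)) {{ℕ.m^n≢0 n 3}}))

-- f ∼ g says that f n / g n → 1 as n → ∞; that the quotient is defined for
-- large n is part of the claim.

_∼_ : (f g : (n : ℕ) .{{_ : ℕ.NonZero n}} → ℝ) → Set
f ∼ g = ∀ (ε : ℝ) → 0ℝ < ε → ∃[ N ] ∀ n .{{_ : ℕ.NonZero n}} → N ℕ.≤ n →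
  Σ[ g≉0 ∈ g n ≉0 ] ∣ f n ÷ g n ⟨ g≉0 ⟩ - 1ℝ ∣ < ε

{-# OPTIONS --safe #-}

-- When a word is read from left to right, the labels below the current minimum
-- are all unseen, the remaining labels above it must come in weakly decreasing
-- order, and the labels seen once form a queue.  So only a few numbers matter,
-- and they satisfy a recurrence whose solution is algebraic: if
-- C = 1 + x C² and μ = 2x (1 + μ + μ²), then
--   Σ cₙ xⁿ = 1 + (C − 1)(1 + μ) / (1 − (C² − 1) μ).
-- In the variable z = 6x the singularity 1 stems from μ alone: θ = z d/dz gives
-- θ μ = μ (1 + z/3)^(−1/2) (1 − z)^(−1/2).  Hence θ of the whole series is
-- h (1 − z)^(−1/2) + w, where h and w have absolutely summable coefficients of
-- size o(1/n), and n cₙ / 6ⁿ ∼ h(1) C(2n,n) / 4ⁿ.  At z = 1 one has C = 3 − √3 and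
-- μ = 1, which gives h(1) = (9 + 6√3) / 8.  Finally n (C(2n,n) / 4ⁿ)² → 1/π by
-- Wallis: Σ (−1)ᵏ C(2N+1,N−k) / ((2k+1) C(2N+1,N)) has a closed form and tends,
-- term by term, to the Leibniz series.

module Submission where

open import Data.Nat.Base as ℕ using (ℕ; zero; suc)
import Data.Nat.Properties as ℕ
open import Data.Product.Base using (∃-syntax; _×_; _,_; proj₁; proj₂)
open import Data.Rational.Base as ℚ using (ℚ; 0ℚ; 1ℚ; ½)
import Data.Rational.Properties as ℚ
open import Relation.Binary.PropositionalEquality using (_≡_; refl; sym; trans; cong; cong₂; subst; subst₂; module ≡-Reasoning)
open import Relation.Nullary using (¬_; yes; no)
open import Data.Empty using (⊥; ⊥-elim)
open import Defs using (module RationalSequences)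

-- The constants that come out of the series are sequences of partial sums at z = 1, taken modulo
-- null sequences and known only through polynomial relations such as s² = 1/3. Therefore the
-- comparison with the required constant is made between squares, and positivity alone recovers the
-- roots. The identities between series, like those between limits, are ideal memberships: multiples
-- of known equations are added until the ring solver closes the goal. The operator θ trades the
-- square-root singularity (1 - z)^(1/2) for (1 - z)^(-1/2), whose coefficients are positive,
-- decreasing and satisfy a first-order recurrence. An elementary estimate of a convolution then
-- replaces complex analysis. A real number being a Cauchy sequence, there are two limits, over the
-- index n and over the precision m. The second cannot be uniform in the first: the error in the
-- approximation to n^(-3) is multiplied by n³, so m is chosen after n.

-- Counting words without deciding the predicate

module Counting where

  open import Data.Fin.Base as Fin using (Fin; toℕ)
  open import Data.List.Base
    using (List; []; _∷_; [_]; _++_; map; length; filter; allFin; tabulate; cartesianProductWith)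
  open import Data.List.Properties using (map-tabulate)
  open import Data.Nat.Base
  open import Data.Nat.Properties
  open import Data.Sum.Base using (_⊎_; inj₁; inj₂)
  open import Data.Vec.Base using (Vec; []; _∷_)
  open import Defs using (Word; words)
  open import Function.Base using (_∘_)
  open import Relation.Binary.PropositionalEquality
  open import Relation.Unary using (Decidable)

  occ : ℕ → List ℕ → ℕ
  occ a []       = 0
  occ a (x ∷ xs) with x ≟ a
  ... | yes _ = suc (occ a xs)
  ... | no  _ = occ a xs

  occ-here : ∀ a xs → occ a (a ∷ xs) ≡ suc (occ a xs)
  occ-here a xs with a ≟ a
  ... | yes _   = refl
  ... | no  a≢a = ⊥-elim (a≢a refl)

  occ-there : ∀ {a x} xs → x ≢ a → occ a (x ∷ xs) ≡ occ a xs
  occ-there {a} {x} xs x≢a with x ≟ a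
  ... | yes x≡a = ⊥-elim (x≢a x≡a)
  ... | no  _   = refl

  occ-++ : ∀ a xs ys → occ a (xs ++ ys) ≡ occ a xs + occ a ys
  occ-++ a []       ys = refl
  occ-++ a (x ∷ xs) ys with x ≟ a
  ... | yes _ = cong suc (occ-++ a xs ys)
  ... | no  _ = occ-++ a xs ys

  module _ {A : Set} where

    -- A relation rather than the length of a filter: the predicates counted below, such as
    -- `Completes`, come without a decision procedure, and each `hit` or `miss` settles them one
    -- word at a time.
    data Count (P : A → Set) : List A → ℕ → Set where
      []   : Count P [] 0
      hit  : ∀ {x xs k} → P x   → Count P xs k → Count P (x ∷ xs) (suc k)
      miss : ∀ {x xs k} → ¬ P x → Count P xs k → Count P (x ∷ xs) k

    private variable
      P Q : A → Set
      xs ys : List A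
      j k : ℕ

    count-filter : (P? : Decidable P) → Count P xs k → length (filter P? xs) ≡ k
    count-filter P? [] = refl
    count-filter P? (hit {x} p c) with P? x
    ... | yes _  = cong suc (count-filter P? c)
    ... | no  ¬p = ⊥-elim (¬p p)
    count-filter P? (miss {x} ¬p c) with P? x
    ... | yes p = ⊥-elim (¬p p)
    ... | no  _ = count-filter P? c

    count-⇔ : (∀ x → P x → Q x) → (∀ x → Q x → P x) → Count P xs k → Count Q xs k
    count-⇔ f g []        = []
    count-⇔ f g (hit p c) = hit (f _ p) (count-⇔ f g c)
    count-⇔ f g (miss ¬p c) = miss (¬p ∘ g _) (count-⇔ f g c)

    count-none : ∀ xs → (∀ x → ¬ P x) → Count P xs 0
    count-none []       ¬p = []
    count-none (x ∷ xs) ¬p = miss (¬p x) (count-none xs ¬p)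

    count-⊎ : (∀ x → P x → Q x → ⊥) → Count P xs j → Count Q xs k →
              Count (λ x → P x ⊎ Q x) xs (j + k)
    count-⊎ d []        []        = []
    count-⊎ d (hit p c) (hit q e) = ⊥-elim (d _ p q)
    count-⊎ d (hit p c) (miss ¬q e) = hit (inj₁ p) (count-⊎ d c e)
    count-⊎ d (miss ¬p c) (hit q e) =
      subst (Count _ _) (sym (+-suc _ _)) (hit (inj₂ q) (count-⊎ d c e))
    count-⊎ d (miss ¬p c) (miss ¬q e) =
      miss (λ { (inj₁ p) → ¬p p ; (inj₂ q) → ¬q q }) (count-⊎ d c e)

    count-++ : Count P xs j → Count P ys k → Count P (xs ++ ys) (j + k)
    count-++ []        d = d
    count-++ (hit p c) d = hit p (count-++ c d)
    count-++ (miss ¬p c) d = miss ¬p (count-++ c d)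

  count-map : ∀ {A B : Set} {P : B → Set} {f : A → B} {xs k} →
              Count (P ∘ f) xs k → Count P (map f xs) k
  count-map []        = []
  count-map (hit p c) = hit p (count-map c)
  count-map (miss ¬p c) = miss ¬p (count-map c)

  toList : ∀ {n m} → Word n m → List ℕ
  toList []      = []
  toList (x ∷ w) = toℕ x ∷ toList w

  CountWords : ∀ n m → (List ℕ → Set) → ℕ → Set
  CountWords n m P k = Count (P ∘ toList) (words n m) k

  First : ℕ → (List ℕ → Set) → List ℕ → Set
  First y P w = ∃[ v ] w ≡ y ∷ v × P v

  occ-tabulate-< : ∀ {n} k y (f : Fin n → ℕ) → (∀ i → f i ≡ k + toℕ i) → y < k → occ y (tabulate f) ≡ 0
  occ-tabulate-< {zero}  k y f e y<k = refl
  occ-tabulate-< {suc n} k y f e y<k = trans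
    (occ-there _ λ f0≡y → <-irrefl refl (<-≤-trans y<k (subst (k ≤_) (trans (sym (e Fin.zero)) f0≡y) (m≤m+n k 0))))
    (occ-tabulate-< (suc k) y (f ∘ Fin.suc) (λ i → trans (e (Fin.suc i)) (+-suc k (toℕ i))) (m<n⇒m<1+n y<k))

  occ-tabulate : ∀ {n} k j (f : Fin n → ℕ) → (∀ i → f i ≡ k + toℕ i) → j < n → occ (k + j) (tabulate f) ≡ 1
  occ-tabulate {suc n} k zero f e _ rewrite e Fin.zero = trans (occ-here (k + 0) _)
    (cong suc (occ-tabulate-< (suc k) (k + 0) (f ∘ Fin.suc)
      (λ i → trans (e (Fin.suc i)) (+-suc k (toℕ i))) (s≤s (≤-reflexive (+-identityʳ k)))))
  occ-tabulate {suc n} k (suc j) f e (s≤s j<n) = trans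
    (occ-there _ λ f0≡ → <-irrefl (trans (sym (e Fin.zero)) f0≡) (+-monoʳ-< k (s≤s z≤n)))
    (trans (cong (λ z → occ z (tabulate (f ∘ Fin.suc))) (+-suc k j))
      (occ-tabulate (suc k) j (f ∘ Fin.suc) (λ i → trans (e (Fin.suc i)) (+-suc k (toℕ i))) j<n))

  occ-allFin : ∀ {n y} → y < n → occ y (map toℕ (allFin n)) ≡ 1
  occ-allFin {n} {y} y<n = trans (cong (occ y) (map-tabulate {n = n} (λ i → i) toℕ))
    (occ-tabulate 0 y toℕ (λ _ → refl) y<n)

  -- The list of words is grouped by first letter. The block of `y` contributes k and every other
  -- block nothing, so the total is k times the multiplicity of `y` among the letters, which is 1.
  count-first : ∀ {n m P k y} → y < n → CountWords n m P k → CountWords n (suc m) (First y P) k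
  count-first {n} {m} {P} {k} {y} y<n c = subst (Count _ _)
    (trans (cong (_* k) (occ-allFin y<n)) (+-identityʳ k)) (go (allFin n))
    where
    go : ∀ xs → Count (First y P ∘ toList) (cartesianProductWith _∷_ xs (words n m)) (occ y (map toℕ xs) * k)
    go []       = []
    go (x ∷ xs) with toℕ x ≟ y
    ... | yes refl = count-++ (count-map (count-⇔ (λ v p → toList v , refl , p) (λ { v (_ , refl , p) → p }) c)) (go xs)
    ... | no x≢y   = count-++ (count-map (count-none (words n m) (λ { v (_ , refl , _) → x≢y refl }))) (go xs)

-- Which letters may follow a prefix

module Completions where

  open Counting
  open import Data.List.Base using (List; []; _∷_; [_]; _++_; downFrom)
  open import Data.List.Properties using (++-assoc)
  open import Data.List.Membership.Propositional using (_∈_)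
  open import Data.List.Membership.Propositional.Properties using (∈-++⁺ʳ)
  open import Data.List.Relation.Binary.Sublist.Propositional as ⊆
    using (_⊆_; []; _∷_; _∷ʳ_; minimum; ⊆-refl; ⊆-trans; from∈; to∈)
  open import Data.List.Relation.Binary.Sublist.Propositional.Properties using (++⁺; ++⁺ˡ)
  open import Data.List.Relation.Unary.All as All using (All; []; _∷_)
  open import Data.List.Relation.Unary.AllPairs using (AllPairs; []; _∷_)
  open import Data.List.Relation.Unary.Any using (here; there)
  open import Data.Nat.Base
  open import Data.Nat.Properties
  open import Data.Nat.Solver using (module +-*-Solver)
  open import Data.Sum.Base using (_⊎_; inj₁; inj₂; [_,_]′)
  open import Relation.Binary.PropositionalEquality hiding ([_])

  private variable
    a b n ℓ x y z : ℕ
    v w xs ys Q U U′ Hs : List ℕ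

  occ-⊆ : ∀ a → xs ⊆ ys → occ a xs ≤ occ a ys
  occ-⊆ a []           = z≤n
  occ-⊆ a (y ∷ʳ p) with y ≟ a
  ... | yes _ = m≤n⇒m≤1+n (occ-⊆ a p)
  ... | no  _ = occ-⊆ a p
  occ-⊆ a (_∷_ {x} refl p) with x ≟ a
  ... | yes _ = s≤s (occ-⊆ a p)
  ... | no  _ = occ-⊆ a p

  occ-∈ : a ∈ xs → 1 ≤ occ a xs
  occ-∈ {a} {xs} a∈xs = subst (_≤ occ a xs) (occ-here a []) (occ-⊆ a (from∈ a∈xs))

  ∈-occ : ∀ xs → 1 ≤ occ a xs → a ∈ xs
  ∈-occ {a} (x ∷ xs) h with x ≟ a
  ... | yes x≡a = here (sym x≡a)
  ... | no  _   = there (∈-occ xs h)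

  occ-above : All (_< y) xs → occ y xs ≡ 0
  occ-above []           = refl
  occ-above (x<y ∷ rest) = trans (occ-there _ (<⇒≢ x<y)) (occ-above rest)

  occ-desc : AllPairs _>_ xs → ∀ b → occ b xs ≤ 1
  occ-desc [] b = z≤n
  occ-desc (_∷_ {x} x> d) b with x ≟ b
  ... | yes refl = s≤s (≤-reflexive (occ-above x>))
  ... | no  _    = occ-desc d b

  All-downFrom : ∀ ℓ → All (_< ℓ) (downFrom ℓ)
  All-downFrom zero    = []
  All-downFrom (suc ℓ) = ≤-refl ∷ All.map m≤n⇒m≤1+n (All-downFrom ℓ)

  NonNesting : List ℕ → Set
  NonNesting w = ∀ {a b} → a ≢ b → ¬ (a ∷ b ∷ b ∷ a ∷ [] ⊆ w)

  Avoids123 : List ℕ → Set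
  Avoids123 w = ∀ {a b c} → a < b → b < c → ¬ (a ∷ b ∷ c ∷ [] ⊆ w)

  -- v completes a prefix whose minimum is ℓ, whose labels seen once form the
  -- queue Q, and whose unseen labels are those of U.

  record Completes (ℓ : ℕ) (Q U v : List ℕ) : Set where
    constructor completes
    field
      occs       : ∀ a → occ a v ≡ occ a Q + (occ a U + occ a U)
      nonNesting : NonNesting (Q ++ v)
      avoids     : Avoids123 (ℓ ∷ v)

  open Completes

  remove : ∀ Q → occ y xs ≡ 0 → xs ⊆ Q ++ y ∷ v → xs ⊆ Q ++ v
  remove []      e (y ∷ʳ p)     = p
  remove {y} []  e (refl ∷ p)   with () ← trans (sym (occ-here y _)) e
  remove (z ∷ Q) e (.z ∷ʳ p)    = z ∷ʳ remove Q e p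
  remove {y} (z ∷ Q) e (refl ∷ p) with z ≟ y
  remove {y} (z ∷ Q) () (refl ∷ p) | yes _
  ... | no _ = refl ∷ remove Q e p

  -- The final y of the pattern is matched no later than the displayed `y`, since none occurs in
  -- `v`; what precedes it is then matched inside `Q`.
  before-last : ∀ Q xs → occ y v ≡ 0 → xs ++ [ y ] ⊆ Q ++ y ∷ v → xs ⊆ Q
  before-last []      []       e p = []
  before-last {y} {v} [] (x ∷ xs) e p = ⊥-elim (<-irrefl (sym e) (occ-∈ {xs = v} (y∈v p)))
    where
    y∈v : x ∷ xs ++ [ y ] ⊆ y ∷ v → y ∈ v
    y∈v (_ ∷ʳ p) = ⊆.lookup p (there (∈-++⁺ʳ xs (here refl)))
    y∈v (_ ∷ p)  = ⊆.lookup p (∈-++⁺ʳ xs (here refl))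
  before-last (z ∷ Q) []       e p          = minimum (z ∷ Q)
  before-last (z ∷ Q) (x ∷ xs) e (.z ∷ʳ p)  = z ∷ʳ before-last Q (x ∷ xs) e p
  before-last (z ∷ Q) (x ∷ xs) e (refl ∷ p) = refl ∷ before-last Q xs e p

  -- A nesting that uses the first `y` as its outer label would need both inner letters inside `Q`,
  -- where no label is repeated. One that avoids this first `y` cannot involve y, of which a single
  -- copy is left, so it survives the removal of that copy.
  nonNesting-flush : occ y Q ≡ 0 → occ y v ≡ 0 → (∀ b → occ b Q ≤ 1) →
                     NonNesting (Q ++ v) → NonNesting (y ∷ Q ++ y ∷ v)
  nonNesting-flush {y} {Q} {v} y∉Q y∉v Q≤1 nn {a} {b} a≢b (refl ∷ p) =
    <-irrefl refl (<-≤-trans (s≤s (≤-reflexive (sym (trans (occ-here b _) (cong suc (occ-here b []))))))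
      (≤-trans (s≤s (occ-⊆ b (before-last Q (b ∷ b ∷ []) y∉v p))) (s≤s (Q≤1 b))))
  nonNesting-flush {y} {Q} {v} y∉Q y∉v Q≤1 nn {a} {b} a≢b (_ ∷ʳ p)
    with a ≟ y | b ≟ y
  ... | no a≢y | no b≢y = nn a≢b (remove Q
    (trans (occ-there _ a≢y) (trans (occ-there _ b≢y) (trans (occ-there _ b≢y) (occ-there [] a≢y)))) p)
  ... | yes refl | _ = <-irrefl refl (≤-trans
      (≤-trans (s≤s (occ-∈ {a} {b ∷ b ∷ a ∷ []} (there (there (here refl))))) (≤-reflexive (sym (occ-here a (b ∷ b ∷ a ∷ [])))))
      (≤-trans (occ-⊆ a p) once))
    where
    once : occ y (Q ++ y ∷ v) ≤ 1
    once = ≤-reflexive (trans (occ-++ y Q _) (cong₂ _+_ y∉Q (trans (occ-here y v) (cong suc y∉v))))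
  ... | no a≢y | yes refl = <-irrefl refl (≤-trans
      (≤-reflexive (sym (trans (occ-there _ a≢b) (trans (occ-here b _) (cong suc (trans (occ-here b _) (cong suc (occ-there [] a≢b))))))))
      (≤-trans (occ-⊆ b p) once))
    where
    once : occ y (Q ++ y ∷ v) ≤ 1
    once = ≤-reflexive (trans (occ-++ y Q _) (cong₂ _+_ y∉Q (trans (occ-here y v) (cong suc y∉v))))

  avoids-low : x ≤ ℓ → Avoids123 (x ∷ v) → Avoids123 (ℓ ∷ x ∷ v)
  avoids-low x≤ℓ av a<b b<c (refl ∷ refl ∷ p)   = <-irrefl refl (<-≤-trans a<b x≤ℓ)
  avoids-low x≤ℓ av a<b b<c (refl ∷ (_ ∷ʳ p))   = av (≤-<-trans x≤ℓ a<b) b<c (refl ∷ p)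
  avoids-low x≤ℓ av a<b b<c (_ ∷ʳ p)            = av a<b b<c p

  avoids-high : (∀ {c} → c ∈ v → c ≤ x) → Avoids123 (ℓ ∷ v) → Avoids123 (ℓ ∷ x ∷ v)
  avoids-high v≤x av a<b b<c (refl ∷ refl ∷ p)  = <-irrefl refl (<-≤-trans b<c (v≤x (to∈ p)))
  avoids-high v≤x av a<b b<c (refl ∷ (_ ∷ʳ p))  = av a<b b<c (refl ∷ p)
  avoids-high v≤x av a<b b<c (_ ∷ʳ (refl ∷ p))  = <-irrefl refl (<-≤-trans a<b (v≤x (⊆.lookup p (here refl))))
  avoids-high v≤x av a<b b<c (_ ∷ʳ (_ ∷ʳ p))    = av a<b b<c (_ ∷ʳ p)

  avoids-⊆ : v ⊆ w → Avoids123 w → Avoids123 v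
  avoids-⊆ v⊆w av a<b b<c p = av a<b b<c (⊆-trans p v⊆w)

  pending : Completes ℓ Q U v → x ∈ v → x ∈ Q ⊎ x ∈ U
  pending {Q = Q} {U} {v} {x} s x∈v with occ x Q in eQ | occ x U in eU
  ... | suc _ | _     = inj₁ (∈-occ Q (subst (1 ≤_) (sym eQ) (s≤s z≤n)))
  ... | zero  | suc _ = inj₂ (∈-occ U (subst (1 ≤_) (sym eU) (s≤s z≤n)))
  ... | zero  | zero  = ⊥-elim (<-irrefl (sym (trans (occs s x) (cong₂ (λ i j → i + (j + j)) eQ eU))) (occ-∈ x∈v))

  -- The letters that can be read without lowering the minimum: a repeat of it, or a letter at least
  -- as large as all pending ones. After the former nothing changes, after the latter nothing larger
  -- is left to complete an ascent. This is why the minimum is all that a prefix must remember as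
  -- far as 123 is concerned.
  Top : ℕ → ℕ → List ℕ → List ℕ → Set
  Top ℓ x Q U = x ≡ ℓ ⊎ All (_≤ x) Q × All (_≤ x) U

  avoids-top : Top ℓ x Q U → Completes ℓ Q U v → Avoids123 (ℓ ∷ x ∷ v)
  avoids-top (inj₁ refl) s = avoids-low ≤-refl (avoids s)
  avoids-top (inj₂ (Q≤ , U≤)) s =
    avoids-high (λ c∈v → [ All.lookup Q≤ , All.lookup U≤ ]′ (pending s c∈v)) (avoids s)

  occ-∷ : ∀ x a xs → occ a (x ∷ xs) ≡ occ a [ x ] + occ a xs
  occ-∷ x a xs = occ-++ a [ x ] xs

  flush→ : Completes ℓ (y ∷ Q) U (y ∷ v) → Completes ℓ Q U v
  flush→ {ℓ} {y} {Q} {U} {v} s = completes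
    (λ a → +-cancelˡ-≡ (occ a [ y ]) _ _ (trans (sym (occ-∷ y a v)) (trans (occs s a)
      (trans (cong (_+ (occ a U + occ a U)) (occ-∷ y a Q)) (+-assoc (occ a [ y ]) _ _)))))
    (λ a≢b p → nonNesting s a≢b (⊆-trans p (y ∷ʳ ++⁺ (⊆-refl {x = Q}) (y ∷ʳ ⊆-refl))))
    (avoids-⊆ (refl ∷ (y ∷ʳ ⊆-refl)) (avoids s))

  flush← : occ y Q ≡ 0 → occ y U ≡ 0 → (∀ b → occ b Q ≤ 1) → Top ℓ y Q U →
           Completes ℓ Q U v → Completes ℓ (y ∷ Q) U (y ∷ v)
  flush← {y} {Q} {U} {ℓ} {v} y∉Q y∉U Q≤1 top s = completes
    (λ a → trans (occ-∷ y a v) (trans (cong (occ a [ y ] +_) (occs s a))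
      (trans (sym (+-assoc (occ a [ y ]) _ _)) (cong (_+ (occ a U + occ a U)) (sym (occ-∷ y a Q))))))
    (nonNesting-flush {Q = Q} y∉Q (trans (occs s y) (cong₂ (λ i j → i + (j + j)) y∉Q y∉U)) Q≤1 (nonNesting s))
    (avoids-top top s)

  Removes : ℕ → List ℕ → List ℕ → Set
  Removes x U U′ = ∀ a → occ a U ≡ occ a [ x ] + occ a U′

  private
    -- Reading an unseen label spends one of its two copies and moves the other to the queue.
    rearrange : ∀ x q u → q + ((x + u) + (x + u)) ≡ x + ((q + x) + (u + u))
    rearrange = solve 3 (λ x q u → q :+ ((x :+ u) :+ (x :+ u)) := x :+ ((q :+ x) :+ (u :+ u))) refl
      where open +-*-Solver

  open-occs→ : Removes x U U′ → (∀ a → occ a (x ∷ v) ≡ occ a Q + (occ a U + occ a U)) →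
               ∀ a → occ a v ≡ occ a (Q ++ [ x ]) + (occ a U′ + occ a U′)
  open-occs→ {x} {U} {U′} {v} {Q} r o a = +-cancelˡ-≡ (occ a [ x ]) _ _ (begin
    occ a [ x ] + occ a v                                     ≡⟨ occ-∷ x a v ⟨
    occ a (x ∷ v)                                             ≡⟨ o a ⟩
    occ a Q + (occ a U + occ a U)                             ≡⟨ cong (λ u → occ a Q + (u + u)) (r a) ⟩
    occ a Q + ((occ a [ x ] + occ a U′) + (occ a [ x ] + occ a U′)) ≡⟨ rearrange (occ a [ x ]) (occ a Q) (occ a U′) ⟩
    occ a [ x ] + ((occ a Q + occ a [ x ]) + (occ a U′ + occ a U′)) ≡⟨ cong (λ q → occ a [ x ] + (q + _)) (occ-++ a Q [ x ]) ⟨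
    occ a [ x ] + (occ a (Q ++ [ x ]) + (occ a U′ + occ a U′)) ∎)
    where open ≡-Reasoning

  open-occs← : Removes x U U′ → (∀ a → occ a v ≡ occ a (Q ++ [ x ]) + (occ a U′ + occ a U′)) →
               ∀ a → occ a (x ∷ v) ≡ occ a Q + (occ a U + occ a U)
  open-occs← {x} {U} {U′} {v} {Q} r o a = begin
    occ a (x ∷ v)                                             ≡⟨ occ-∷ x a v ⟩
    occ a [ x ] + occ a v                                     ≡⟨ cong (occ a [ x ] +_) (o a) ⟩
    occ a [ x ] + (occ a (Q ++ [ x ]) + (occ a U′ + occ a U′)) ≡⟨ cong (λ q → occ a [ x ] + (q + _)) (occ-++ a Q [ x ]) ⟩
    occ a [ x ] + ((occ a Q + occ a [ x ]) + (occ a U′ + occ a U′)) ≡⟨ rearrange (occ a [ x ]) (occ a Q) (occ a U′) ⟨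
    occ a Q + ((occ a [ x ] + occ a U′) + (occ a [ x ] + occ a U′)) ≡⟨ cong (λ u → occ a Q + (u + u)) (r a) ⟨
    occ a Q + (occ a U + occ a U)                             ∎
    where open ≡-Reasoning

  push→ : Removes x U U′ → Completes ℓ Q U (x ∷ v) → Completes ℓ (Q ++ [ x ]) U′ v
  push→ {x} {U} {U′} {Q = Q} {v} r s = completes (open-occs→ {U = U} {U′} {Q = Q} r (occs s))
    (subst NonNesting (sym (++-assoc Q [ x ] v)) (nonNesting s))
    (avoids-⊆ (refl ∷ (x ∷ʳ ⊆-refl)) (avoids s))

  push← : Removes x U U′ → Top ℓ x (Q ++ [ x ]) U′ → Completes ℓ (Q ++ [ x ]) U′ v → Completes ℓ Q U (x ∷ v)
  push← {x} {U} {U′} {Q = Q} {v} r top s = completes (open-occs← {U = U} {U′} {Q = Q} r (occs s))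
    (subst NonNesting (++-assoc Q [ x ] v) (nonNesting s))
    (avoids-top top s)

  -- The bound ℓ need not be the current minimum: lowering it by one peels off a single candidate
  -- for the next minimum. The old minimum drops out of the avoidance condition because a 123
  -- starting there could as well start at the smaller `head`.
  record NewMin (ℓ : ℕ) (Q U w : List ℕ) : Set where
    constructor newMin
    field
      {head}     : ℕ
      {rest}     : List ℕ
      w≡         : w ≡ head ∷ rest
      head<ℓ     : head < ℓ
      occs       : ∀ a → occ a (head ∷ rest) ≡ occ a Q + (occ a U + occ a U)
      nonNesting : NonNesting (Q ++ head ∷ rest)
      avoids     : Avoids123 (head ∷ rest)

  newMin→ : x < ℓ → Completes ℓ Q U (x ∷ v) → NewMin ℓ Q U (x ∷ v)
  newMin→ x<ℓ (completes o nn av) = newMin refl x<ℓ o nn (avoids-⊆ (_ ∷ʳ ⊆-refl) av)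

  newMin← : NewMin ℓ Q U w → Completes ℓ Q U w
  newMin← (newMin refl x<ℓ o nn av) = completes o nn (avoids-low (<⇒≤ x<ℓ) av)

  module _ {ℓ U U′} (r : Removes ℓ U U′) where

    newMin-split : ∀ w → NewMin (suc ℓ) Q U w → First ℓ (Completes ℓ (Q ++ [ ℓ ]) U′) w ⊎ NewMin ℓ Q U w
    newMin-split {Q} w (newMin {x} {v} e x<sℓ o nn av) with m≤n⇒m<n∨m≡n (≤-pred x<sℓ)
    ... | inj₁ x<ℓ  = inj₂ (newMin e x<ℓ o nn av)
    ... | inj₂ refl = inj₁ (v , e , completes (open-occs→ {U = U} {U′} {Q = Q} r o)
      (subst NonNesting (sym (++-assoc Q [ ℓ ] v)) nn) av)

    newMin-join : ∀ w → First ℓ (Completes ℓ (Q ++ [ ℓ ]) U′) w ⊎ NewMin ℓ Q U w → NewMin (suc ℓ) Q U w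
    newMin-join {Q} w (inj₁ (v , e , completes o nn av)) =
      newMin e ≤-refl (open-occs← {U = U} {U′} {Q = Q} r o) (subst NonNesting (++-assoc Q [ ℓ ] v) nn) av
    newMin-join w (inj₂ (newMin e x<ℓ o nn av)) = newMin e (m≤n⇒m≤1+n x<ℓ) o nn av

    newMin-disjoint : ∀ w → First ℓ (Completes ℓ (Q ++ [ ℓ ]) U′) w → NewMin ℓ Q U w → ⊥
    newMin-disjoint w (v , refl , _) (newMin refl x<ℓ _ _ _) = <-irrefl refl x<ℓ

  -- Letters that cannot come next

  later : ∀ Q U → Completes ℓ Q U (x ∷ v) → x ≢ z → z ∈ Q ⊎ z ∈ U → z ∈ v
  later {v = v} {z} Q U s x≢z z∈ = ∈-occ v (≤-trans ([ left , right ]′ z∈)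
    (≤-reflexive (trans (sym (occs s z)) (occ-there v x≢z))))
    where
    left : z ∈ Q → 1 ≤ occ z Q + (occ z U + occ z U)
    left h = ≤-trans (occ-∈ h) (m≤m+n _ _)
    right : z ∈ U → 1 ≤ occ z Q + (occ z U + occ z U)
    right h = ≤-trans (occ-∈ h) (≤-trans (m≤m+n _ _) (m≤n+m _ (occ z Q)))

  -- The front `y` is still pending after `x`, so the queued y and x followed by x and y would nest.
  dead-queue : Completes ℓ (y ∷ Q) U (x ∷ v) → x ∈ Q → x ≢ y → ⊥
  dead-queue {y = y} {Q = Q} {U} {x} s x∈Q x≢y = nonNesting s {y} {x} (λ e → x≢y (sym e))
    (refl ∷ ++⁺ (from∈ x∈Q) (refl ∷ from∈ (later (y ∷ Q) U s x≢y (inj₁ (here refl)))))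

  -- After the ascent from the minimum to `x`, the larger pending `z` completes a 123.
  dead-high : Completes ℓ Q U (x ∷ v) → ℓ < x → x < z → z ∈ Q ⊎ z ∈ U → ⊥
  dead-high {Q = Q} {U} s ℓ<x x<z z∈ = avoids s ℓ<x x<z (refl ∷ refl ∷ from∈ (later Q U s (<⇒≢ x<z) z∈))

  order₂ : y ≢ z → 1 ≤ occ y v → 1 ≤ occ z v → y ∷ z ∷ [] ⊆ v ⊎ z ∷ y ∷ [] ⊆ v
  order₂ {y} {z} {x ∷ v} y≢z hy hz with x ≟ y | x ≟ z
  ... | yes refl | yes refl = ⊥-elim (y≢z refl)
  ... | yes refl | no _     = inj₁ (refl ∷ from∈ (∈-occ v hz))
  ... | no _     | yes refl = inj₂ (refl ∷ from∈ (∈-occ v hy))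
  ... | no _     | no _     = [ (λ p → inj₁ (x ∷ʳ p)) , (λ p → inj₂ (x ∷ʳ p)) ]′ (order₂ y≢z hy hz)

  order₃ : y ≢ z → 1 ≤ occ y v → 2 ≤ occ z v → y ∷ z ∷ [] ⊆ v ⊎ z ∷ z ∷ y ∷ [] ⊆ v
  order₃ {y} {z} {x ∷ v} y≢z hy hz with x ≟ y | x ≟ z
  ... | yes refl | yes refl = ⊥-elim (y≢z refl)
  ... | yes refl | no _     = inj₁ (refl ∷ from∈ (∈-occ v (≤-trans (s≤s z≤n) hz)))
  ... | no _     | no _     = [ (λ p → inj₁ (x ∷ʳ p)) , (λ p → inj₂ (x ∷ʳ p)) ]′ (order₃ y≢z hy hz)
  ... | no _     | yes refl with order₂ y≢z hy (≤-pred hz)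
  ...   | inj₁ p = inj₁ (x ∷ʳ p)
  ...   | inj₂ p = inj₂ (refl ∷ p)

  -- The pending copy of ℓ and both copies of `z` come after x in some order. If ℓ precedes some z,
  -- then x, ℓ, z is a 123; otherwise both z precede ℓ and are nested inside it.
  dead-min-unseen : ∀ Q → Completes ℓ (Q ++ [ ℓ ]) U (x ∷ v) → x < ℓ → ℓ < z → z ∈ U → ⊥
  dead-min-unseen {ℓ} {U} {x} {v} {z} Q s x<ℓ ℓ<z z∈U with order₃ {y = ℓ} {z} {v} (<⇒≢ ℓ<z)
      (occ-∈ (later (Q ++ [ ℓ ]) U s (<⇒≢ x<ℓ) (inj₁ (∈-++⁺ʳ Q (here refl)))))
      (≤-trans (≤-trans (+-mono-≤ (occ-∈ z∈U) (occ-∈ z∈U)) (m≤n+m _ (occ z (Q ++ [ ℓ ]))))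
        (≤-reflexive (trans (sym (occs s z)) (occ-there v (<⇒≢ (<-trans x<ℓ ℓ<z))))))
  ... | inj₁ p = avoids s x<ℓ ℓ<z (_ ∷ʳ (refl ∷ p))
  ... | inj₂ p = nonNesting s (<⇒≢ ℓ<z) (++⁺ (++⁺ˡ Q ⊆-refl) (x ∷ʳ p))

  -- As for an unseen z, except that the queue already holds the first z: if ℓ does not precede the
  -- pending z, the letters ℓ, z, z, ℓ nest.
  dead-min-queued : Completes ℓ (ℓ ∷ z ∷ []) U (x ∷ v) → x < ℓ → ℓ < z → ⊥
  dead-min-queued {ℓ} {z} {U} {x} {v} s x<ℓ ℓ<z with order₂ {y = ℓ} {z} {v} (<⇒≢ ℓ<z)
      (occ-∈ (later (ℓ ∷ z ∷ []) U s (<⇒≢ x<ℓ) (inj₁ (here refl))))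
      (occ-∈ (later (ℓ ∷ z ∷ []) U s (<⇒≢ (<-trans x<ℓ ℓ<z)) (inj₁ (there (here refl)))))
  ... | inj₁ p = avoids s x<ℓ ℓ<z (_ ∷ʳ (refl ∷ p))
  ... | inj₂ p = nonNesting s (<⇒≢ ℓ<z) (refl ∷ refl ∷ (x ∷ʳ p))

-- The recurrences

module Recurrences where

  open import Data.Nat.Base

  -- Completions of a prefix with ℓ unseen labels below its minimum.  A h ℓ: no
  -- label seen once, and h unseen labels above the minimum.  C h ℓ: the same
  -- with one label, larger than those h, seen once.  E h ℓ: suc h unseen labels
  -- above the minimum, which is itself seen once.  G k ℓ: only labels below the
  -- minimum unseen, the minimum and k larger labels seen once.  T h ℓ and N k ℓ
  -- collect the continuations by a new minimum.

  A C E T G N : ℕ → ℕ → ℕ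

  A zero    zero    = 1
  A zero    (suc ℓ) = N 0 (suc ℓ)
  A (suc h) ℓ       = C h ℓ + T h ℓ

  C zero    ℓ = A 0 ℓ + N 1 ℓ
  C (suc h) ℓ = A (suc h) ℓ + T h ℓ

  E h ℓ = A (suc h) ℓ + C h ℓ

  T h zero    = 0
  T h (suc ℓ) = E h ℓ + T (suc h) ℓ

  G zero    ℓ = A 0 ℓ + N 1 ℓ
  G (suc k) ℓ = G k ℓ + N (2 + k) ℓ

  N k zero    = 0
  N k (suc ℓ) = G k ℓ + T 0 ℓ

-- The completions satisfy the recurrences

module Enumeration where

  open Counting
  open Completions
  open Recurrences
  open import Data.List.Base using (List; []; _∷_; [_]; _++_; length; downFrom)
  open import Data.List.Properties using (++-assoc; length-++)
  open import Data.List.Membership.Propositional using (_∈_)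
  open import Data.List.Membership.Propositional.Properties using (∈-++⁻)
  open import Data.List.Relation.Unary.All as All using (All; []; _∷_)
  import Data.List.Relation.Unary.All.Properties as All
  open import Data.List.Relation.Unary.AllPairs using (AllPairs; []; _∷_)
  open import Data.List.Relation.Unary.Any using (here; there)
  open import Data.Nat.Base
  open import Data.Nat.Properties
  open import Data.Nat.Solver using (module +-*-Solver)
  open import Data.Sum.Base using (_⊎_; inj₁; inj₂; [_,_]′)
  open import Function.Base using (_∘_)
  open import Relation.Binary.PropositionalEquality hiding ([_])

  private variable
    n r ℓ x y u : ℕ
    v w Q V Hs xs ys : List ℕ

  ⇔-count : ∀ {n r P Q k} → (∀ w → P w → Q w) → (∀ w → Q w → P w) → CountWords n r P k → CountWords n r Q k
  ⇔-count f g = count-⇔ (f ∘ toList) (g ∘ toList)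

  ⊎-count : ∀ {n r P Q j k} → (∀ w → P w → Q w → ⊥) → CountWords n r P j → CountWords n r Q k →
            CountWords n r (λ w → P w ⊎ Q w) (j + k)
  ⊎-count d = count-⊎ (d ∘ toList)

  none-count : ∀ n r {P} → (∀ w → ¬ P w) → CountWords n r P 0
  none-count n r ¬p = count-none (words n r) (¬p ∘ toList)
    where open import Defs using (words)

  Desc : ℕ → ℕ → List ℕ → Set
  Desc n ℓ xs = AllPairs _>_ xs × All (λ y → ℓ < y × y < n) xs

  desc-++ˡ : ∀ xs → Desc n ℓ (xs ++ ys) → Desc n ℓ xs
  desc-++ˡ []       d               = [] , []
  desc-++ˡ (x ∷ xs) (a ∷ d , b ∷ i) =
    let d′ , i′ = desc-++ˡ xs (d , i) in All.++⁻ˡ xs a ∷ d′ , b ∷ i′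

  desc-snoc : ∀ xs → ℓ < n → Desc n ℓ xs → AllPairs _>_ (xs ++ [ ℓ ])
  desc-snoc []       ℓ<n d = [] ∷ []
  desc-snoc (x ∷ xs) ℓ<n (a ∷ d , b ∷ i) = All.++⁺ a (proj₁ b ∷ []) ∷ desc-snoc xs ℓ<n (d , i)

  downFrom-removes : ∀ Hs ℓ → Removes ℓ (Hs ++ downFrom (suc ℓ)) (Hs ++ downFrom ℓ)
  downFrom-removes Hs ℓ a = begin
    occ a (Hs ++ downFrom (suc ℓ))                ≡⟨ occ-++ a Hs _ ⟩
    occ a Hs + occ a (ℓ ∷ downFrom ℓ)             ≡⟨ cong (occ a Hs +_) (occ-∷ ℓ a (downFrom ℓ)) ⟩
    occ a Hs + (occ a [ ℓ ] + occ a (downFrom ℓ)) ≡⟨ +-assoc (occ a Hs) _ _ ⟨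
    occ a Hs + occ a [ ℓ ] + occ a (downFrom ℓ)   ≡⟨ cong (_+ occ a (downFrom ℓ)) (+-comm (occ a Hs) _) ⟩
    occ a [ ℓ ] + occ a Hs + occ a (downFrom ℓ)   ≡⟨ +-assoc (occ a [ ℓ ]) _ _ ⟩
    occ a [ ℓ ] + (occ a Hs + occ a (downFrom ℓ)) ≡⟨ cong (occ a [ ℓ ] +_) (occ-++ a Hs _) ⟨
    occ a [ ℓ ] + occ a (Hs ++ downFrom ℓ)        ∎
    where open ≡-Reasoning

  head-removes : ∀ u U → Removes u (u ∷ U) U
  head-removes u U a = occ-∷ u a U

  below : All (_< y) Hs → ℓ ≤ y → All (_< y) (Hs ++ downFrom ℓ)
  below h ℓ≤y = All.++⁺ h (All.map (λ p → <-≤-trans p ℓ≤y) (All-downFrom _))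

  occ-below : ∀ {Hs} → All (λ y → ℓ < y × y < n) Hs → occ ℓ Hs ≡ 0
  occ-below []            = refl
  occ-below ((p , _) ∷ i) = trans (occ-there _ (>⇒≢ p)) (occ-below i)

  ≤-weaken : All (_< y) xs → All (_≤ y) xs
  ≤-weaken = All.map <⇒≤

  above-ℓ : ∀ Hs → All (λ y → ℓ < y × y < n) Hs → x ∈ Hs ++ downFrom ℓ → x ∈ Hs ⊎ x < ℓ
  above-ℓ Hs i x∈ with ∈-++⁻ Hs x∈
  ... | inj₁ h = inj₁ h
  ... | inj₂ h = inj₂ (All.lookup (All-downFrom _) h)

  head-pending : Completes ℓ Q V (x ∷ v) → x ∈ Q ⊎ x ∈ V
  head-pending s = pending s (here refl)

  no-completion-[] : y ∈ Q ⊎ y ∈ V → ¬ Completes ℓ Q V []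
  no-completion-[] {y} {Q} {V} m s = <-irrefl (Completes.occs s y) ([ (λ h → ≤-trans (occ-∈ h) (m≤m+n _ _))
    , (λ h → ≤-trans (occ-∈ h) (≤-trans (m≤m+n _ _) (m≤n+m _ (occ y Q)))) ]′ m)

  private
    open +-*-Solver
    size-open : ∀ q h ℓ {r} → q + 2 * (h + suc ℓ) ≡ suc r → (q + 1) + 2 * (h + ℓ) ≡ r
    size-open q h ℓ e = suc-injective (trans
      (solve 3 (λ q h ℓ → con 1 :+ ((q :+ con 1) :+ con 2 :* (h :+ ℓ)) := q :+ con 2 :* (h :+ (con 1 :+ ℓ))) refl q h ℓ) e)
    size-push : ∀ q h ℓ {r} → q + 2 * (suc h + ℓ) ≡ suc r → (q + 1) + 2 * (h + ℓ) ≡ r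
    size-push q h ℓ e = suc-injective (trans
      (solve 3 (λ q h ℓ → con 1 :+ ((q :+ con 1) :+ con 2 :* (h :+ ℓ)) := q :+ con 2 :* ((con 1 :+ h) :+ ℓ)) refl q h ℓ) e)
    size-skip : ∀ q h ℓ → q + 2 * (h + suc ℓ) ≡ q + 2 * ((h + 1) + ℓ)
    size-skip = solve 3 (λ q h ℓ → q :+ con 2 :* (h :+ (con 1 :+ ℓ)) := q :+ con 2 :* ((h :+ con 1) :+ ℓ)) refl

  Size : List ℕ → List ℕ → ℕ → ℕ → Set
  Size Q Hs ℓ r = length Q + 2 * (length Hs + ℓ) ≡ r

  size-open′ : ∀ Q Hs ℓ → Size Q Hs (suc ℓ) (suc r) → Size (Q ++ [ ℓ ]) Hs ℓ r
  size-open′ Q Hs ℓ e = trans (cong (_+ 2 * (length Hs + ℓ)) (length-++ Q)) (size-open (length Q) (length Hs) ℓ e)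

  size-skip′ : ∀ Q Hs ℓ → Size Q Hs (suc ℓ) r → Size Q (Hs ++ [ ℓ ]) ℓ r
  size-skip′ Q Hs ℓ e = trans (cong (λ z → length Q + 2 * (z + ℓ)) (length-++ Hs))
    (trans (sym (size-skip (length Q) (length Hs) ℓ)) e)

  module _ (n : ℕ) where

    -- All seven statements are proved together by induction on the word length r, which `Size` ties
    -- to the queue and the unseen labels; at equal length `new-T` and `new-N` recurse on the bound
    -- ℓ.
    state-A : ∀ r Hs ℓ → Size [] Hs ℓ r → Desc n ℓ Hs → ℓ ≤ n →
              CountWords n r (Completes ℓ [] (Hs ++ downFrom ℓ)) (A (length Hs) ℓ)
    state-C : ∀ r u Hs ℓ → Size [ u ] Hs ℓ r → Desc n ℓ (u ∷ Hs) → ℓ ≤ n →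
              CountWords n r (Completes ℓ [ u ] (Hs ++ downFrom ℓ)) (C (length Hs) ℓ)
    -- With ℓ queued ahead of the larger `u` the repeat of ℓ is forced, so this state inherits the
    -- count of its only successor and needs no recurrence of its own.
    state-D : ∀ r u Hs ℓ → Size (ℓ ∷ u ∷ []) Hs ℓ r → Desc n ℓ (u ∷ Hs) → ℓ < n →
              CountWords n r (Completes ℓ (ℓ ∷ u ∷ []) (Hs ++ downFrom ℓ)) (C (length Hs) ℓ)
    -- As long as an unseen `u` lies above the queued minimum ℓ, no smaller letter may come, and the
    -- labels of `Q` have to be repeated first. The count is thus independent of `Q`, which is why
    -- `E` and `T` carry no queue length.
    state-E : ∀ r Q u Hs ℓ → Size (Q ++ [ ℓ ]) (u ∷ Hs) ℓ r → Desc n ℓ (Q ++ u ∷ Hs) → ℓ < n →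
              CountWords n r (Completes ℓ (Q ++ [ ℓ ]) (u ∷ Hs ++ downFrom ℓ)) (E (length Hs) ℓ)
    -- Nothing unseen lies above ℓ, so the next minimum may come at any moment while the queue is
    -- being emptied; here the length of the queue does matter.
    state-G : ∀ r Q ℓ → Size (Q ++ [ ℓ ]) [] ℓ r → Desc n ℓ Q → ℓ < n →
              CountWords n r (Completes ℓ (Q ++ [ ℓ ]) (downFrom ℓ)) (G (length Q) ℓ)
    -- A label passed over in the choice of the new minimum becomes an unseen label above it, hence
    -- h grows whenever ℓ is skipped.
    new-T   : ∀ r Q u Hs ℓ → Size Q (u ∷ Hs) ℓ (suc r) → AllPairs _>_ (Q ++ u ∷ Hs) →
              All (λ y → ℓ ≤ y × y < n) (Q ++ u ∷ Hs) → ℓ ≤ n →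
              CountWords n (suc r) (NewMin ℓ Q (u ∷ Hs ++ downFrom ℓ)) (T (length Hs) ℓ)
    new-N   : ∀ r Q ℓ → Size Q [] ℓ (suc r) → AllPairs _>_ Q → All (λ y → ℓ ≤ y × y < n) Q → ℓ ≤ n →
              CountWords n (suc r) (NewMin ℓ Q (downFrom ℓ)) (N (length Q) ℓ)

    new-T r Q u Hs zero    e d i ℓ≤n =
      none-count n (suc r) {NewMin zero Q _} (λ { w (newMin _ () _ _ _) })
    new-T r Q u Hs (suc ℓ) e d i ℓ<n =
      ⇔-count (newMin-join (downFrom-removes (u ∷ Hs) ℓ)) (newMin-split (downFrom-removes (u ∷ Hs) ℓ))
        (⊎-count (newMin-disjoint (downFrom-removes (u ∷ Hs) ℓ))
          (count-first ℓ<n (state-E r Q u Hs ℓ (size-open′ Q (u ∷ Hs) ℓ e) (d , i) ℓ<n))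
          (subst₂ (λ U k → CountWords n (suc r) (NewMin ℓ Q U) (T k ℓ))
            (cong (u ∷_) (++-assoc Hs [ ℓ ] (downFrom ℓ)))
            (trans (length-++ Hs) (+-comm (length Hs) 1))
            (new-T r Q u (Hs ++ [ ℓ ]) ℓ (size-skip′ Q (u ∷ Hs) ℓ e)
              (subst (AllPairs _>_) (++-assoc Q (u ∷ Hs) [ ℓ ]) (desc-snoc (Q ++ u ∷ Hs) ℓ<n (d , i)))
              (subst (All _) (++-assoc Q (u ∷ Hs) [ ℓ ])
                (All.++⁺ (All.map (λ { (p , q) → <⇒≤ p , q }) i) ((≤-refl , ℓ<n) ∷ [])))
              (<⇒≤ ℓ<n))))

    new-N r Q zero    e d i ℓ≤n =
      none-count n (suc r) {NewMin zero Q _} (λ { w (newMin _ () _ _ _) })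
    new-N r Q (suc ℓ) e d i ℓ<n =
      ⇔-count (newMin-join (downFrom-removes [] ℓ)) (newMin-split (downFrom-removes [] ℓ))
        (⊎-count (newMin-disjoint (downFrom-removes [] ℓ))
          (count-first ℓ<n (state-G r Q ℓ (size-open′ Q [] ℓ e) (d , i) ℓ<n))
          (new-T r Q ℓ [] ℓ (size-skip′ Q [] ℓ e) (desc-snoc Q ℓ<n (d , i))
            (All.++⁺ (All.map (λ { (p , q) → <⇒≤ p , q }) i) ((≤-refl , ℓ<n) ∷ [])) (<⇒≤ ℓ<n)))

    private
      relax : ∀ {ℓ xs} → All (λ y → ℓ < y × y < n) xs → All (λ y → ℓ ≤ y × y < n) xs
      relax = All.map (λ { (p , q) → <⇒≤ p , q })

    state-A r [] zero e d ℓ≤n with refl ← e = hit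
      (completes (λ _ → refl) (λ { _ () }) (λ { _ _ (_ ∷ʳ ()) ; _ _ (_ ∷ ()) })) []
      where open import Data.List.Relation.Binary.Sublist.Propositional
    state-A zero    [] (suc ℓ) () d ℓ≤n
    state-A (suc r) [] (suc ℓ) e d ℓ≤n = ⇔-count (λ _ → newMin←) to
      (new-N r [] (suc ℓ) e [] [] ℓ≤n)
      where
      to : ∀ w → Completes (suc ℓ) [] (downFrom (suc ℓ)) w → NewMin (suc ℓ) [] (downFrom (suc ℓ)) w
      to []      s = ⊥-elim (no-completion-[] (inj₂ (here refl)) s)
      to (x ∷ v) s with head-pending s
      ... | inj₂ h = newMin→ (All.lookup (All-downFrom (suc ℓ)) h) s
    state-A (suc r) (u ∷ Hs) ℓ e (a ∷ d , (ℓ<u , u<n) ∷ i) ℓ≤n = ⇔-count from to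
      (⊎-count disjoint
        (count-first u<n (state-C r u Hs ℓ (size-push 0 (length Hs) ℓ e) (a ∷ d , (ℓ<u , u<n) ∷ i) ℓ≤n))
        (new-T r [] u Hs ℓ e (a ∷ d) (relax ((ℓ<u , u<n) ∷ i)) ℓ≤n))
      where
      U = Hs ++ downFrom ℓ
      from : ∀ w → First u (Completes ℓ [ u ] U) w ⊎ NewMin ℓ [] (u ∷ U) w → Completes ℓ [] (u ∷ U) w
      from w (inj₁ (v , refl , s)) = push← (head-removes u U)
        (inj₂ (≤-refl ∷ [] , ≤-weaken (below a (<⇒≤ ℓ<u)))) s
      from w (inj₂ m) = newMin← m
      to : ∀ w → Completes ℓ [] (u ∷ U) w → First u (Completes ℓ [ u ] U) w ⊎ NewMin ℓ [] (u ∷ U) w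
      to []      s = ⊥-elim (no-completion-[] (inj₂ (here refl)) s)
      to (x ∷ v) s with head-pending s
      ... | inj₂ (here refl) = inj₁ (v , refl , push→ (head-removes u U) s)
      ... | inj₂ (there h) with above-ℓ Hs i h
      ...   | inj₁ x∈Hs = ⊥-elim (dead-high s (proj₁ (All.lookup i x∈Hs)) (All.lookup a x∈Hs) (inj₂ (here refl)))
      ...   | inj₂ x<ℓ = inj₂ (newMin→ x<ℓ s)
      disjoint : ∀ w → First u (Completes ℓ [ u ] U) w → NewMin ℓ [] (u ∷ U) w → ⊥
      disjoint w (v , refl , _) (newMin refl x<ℓ _ _ _) = <-asym ℓ<u x<ℓ

    state-C (suc r) u Hs ℓ e (a ∷ d , (ℓ<u , u<n) ∷ i) ℓ≤n = subst (CountWords n (suc r) (Completes ℓ [ u ] (Hs ++ downFrom ℓ))) (total Hs)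
      (⇔-count from to (⊎-count disjoint
        (count-first u<n (state-A r Hs ℓ (suc-injective e) (d , i) ℓ≤n))
        (minima Hs e a d i)))
      where
      U = Hs ++ downFrom ℓ
      -- Once no unseen label is above the minimum, the length of the queue, here 1, enters the
      -- count; this is the case distinction in `C`.
      other : List ℕ → ℕ
      other []       = N 1 ℓ
      other (_ ∷ Hs) = T (length Hs) ℓ
      total : ∀ Hs → A (length Hs) ℓ + other Hs ≡ C (length Hs) ℓ
      total []      = refl
      total (_ ∷ _) = refl
      minima : ∀ Hs → Size [ u ] Hs ℓ (suc r) → All (_< u) Hs → AllPairs _>_ Hs →
               All (λ y → ℓ < y × y < n) Hs →
               CountWords n (suc r) (NewMin ℓ [ u ] (Hs ++ downFrom ℓ)) (other Hs)
      minima []       e a d i = new-N r [ u ] ℓ e ([] ∷ []) (relax ((ℓ<u , u<n) ∷ [])) ℓ≤n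
      minima (h ∷ Hs) e a d i = new-T r [ u ] h Hs ℓ e (a ∷ d) (relax ((ℓ<u , u<n) ∷ i)) ℓ≤n
      from : ∀ w → First u (Completes ℓ [] U) w ⊎ NewMin ℓ [ u ] U w → Completes ℓ [ u ] U w
      from w (inj₁ (v , refl , s)) = flush← refl (occ-above (below a (<⇒≤ ℓ<u))) (λ _ → z≤n)
        (inj₂ ([] , ≤-weaken (below a (<⇒≤ ℓ<u)))) s
      from w (inj₂ m) = newMin← m
      to : ∀ w → Completes ℓ [ u ] U w → First u (Completes ℓ [] U) w ⊎ NewMin ℓ [ u ] U w
      to []      s = ⊥-elim (no-completion-[] (inj₁ (here refl)) s)
      to (x ∷ v) s with head-pending s
      ... | inj₁ (here refl) = inj₁ (v , refl , flush→ s)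
      ... | inj₂ h with above-ℓ Hs i h
      ...   | inj₁ x∈Hs = ⊥-elim (dead-high s (proj₁ (All.lookup i x∈Hs)) (All.lookup a x∈Hs) (inj₁ (here refl)))
      ...   | inj₂ x<ℓ  = inj₂ (newMin→ x<ℓ s)
      disjoint : ∀ w → First u (Completes ℓ [] U) w → NewMin ℓ [ u ] U w → ⊥
      disjoint w (v , refl , _) (newMin refl x<ℓ _ _ _) = <-asym ℓ<u x<ℓ

    state-D (suc r) u Hs ℓ e (a ∷ d , (ℓ<u , u<n) ∷ i) ℓ<n = ⇔-count from to
      (count-first ℓ<n (state-C r u Hs ℓ (suc-injective e) (a ∷ d , (ℓ<u , u<n) ∷ i) (<⇒≤ ℓ<n)))
      where
      U = Hs ++ downFrom ℓ
      ℓ∉U : occ ℓ U ≡ 0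
      ℓ∉U = trans (occ-++ ℓ Hs _) (cong₂ _+_ (occ-below i) (occ-above (All-downFrom ℓ)))
      from : ∀ w → First ℓ (Completes ℓ [ u ] U) w → Completes ℓ (ℓ ∷ u ∷ []) U w
      from w (v , refl , s) = flush← (occ-there [] (>⇒≢ ℓ<u)) ℓ∉U (occ-desc {u ∷ []} ([] ∷ [])) (inj₁ refl) s
      to : ∀ w → Completes ℓ (ℓ ∷ u ∷ []) U w → First ℓ (Completes ℓ [ u ] U) w
      to []      s = ⊥-elim (no-completion-[] (inj₁ (here refl)) s)
      to (x ∷ v) s with head-pending s
      ... | inj₁ (here refl)         = v , refl , flush→ s
      ... | inj₁ (there (here refl)) = ⊥-elim (dead-queue s (here refl) (>⇒≢ ℓ<u))
      ... | inj₂ h with above-ℓ Hs i h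
      ...   | inj₁ x∈Hs = ⊥-elim (dead-high s (proj₁ (All.lookup i x∈Hs)) (All.lookup a x∈Hs) (inj₁ (there (here refl))))
      ...   | inj₂ x<ℓ  = ⊥-elim (dead-min-queued s x<ℓ ℓ<u)

    state-E (suc r) [] u Hs ℓ e (a ∷ d , (ℓ<u , u<n) ∷ i) ℓ<n = subst (CountWords n (suc r) (Completes ℓ [ ℓ ] (u ∷ Hs ++ downFrom ℓ)))
      (+-comm (C (length Hs) ℓ) (A (suc (length Hs)) ℓ)) (⇔-count from to
      (⊎-count disjoint
        (count-first u<n (state-D r u Hs ℓ (size-push 1 (length Hs) ℓ e) (a ∷ d , (ℓ<u , u<n) ∷ i) ℓ<n))
        (count-first ℓ<n (state-A r (u ∷ Hs) ℓ (suc-injective e) (a ∷ d , (ℓ<u , u<n) ∷ i) (<⇒≤ ℓ<n)))))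
      where
      U = Hs ++ downFrom ℓ
      ℓ∉U : occ ℓ (u ∷ U) ≡ 0
      ℓ∉U = trans (occ-there U (>⇒≢ ℓ<u))
        (trans (occ-++ ℓ Hs _) (cong₂ _+_ (occ-below i) (occ-above (All-downFrom ℓ))))
      Next : List ℕ → Set
      Next w = First u (Completes ℓ (ℓ ∷ u ∷ []) U) w ⊎ First ℓ (Completes ℓ [] (u ∷ U)) w
      from : ∀ w → Next w → Completes ℓ [ ℓ ] (u ∷ U) w
      from w (inj₁ (v , refl , s)) = push← (head-removes u U)
        (inj₂ (<⇒≤ ℓ<u ∷ ≤-refl ∷ [] , ≤-weaken (below a (<⇒≤ ℓ<u)))) s
      from w (inj₂ (v , refl , s)) = flush← refl ℓ∉U (λ _ → z≤n) (inj₁ refl) s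
      to : ∀ w → Completes ℓ [ ℓ ] (u ∷ U) w → Next w
      to []      s = ⊥-elim (no-completion-[] (inj₁ (here refl)) s)
      to (x ∷ v) s with head-pending s
      ... | inj₁ (here refl) = inj₂ (v , refl , flush→ s)
      ... | inj₂ (here refl) = inj₁ (v , refl , push→ (head-removes u U) s)
      ... | inj₂ (there h) with above-ℓ Hs i h
      ...   | inj₁ x∈Hs = ⊥-elim (dead-high s (proj₁ (All.lookup i x∈Hs)) (All.lookup a x∈Hs) (inj₂ (here refl)))
      ...   | inj₂ x<ℓ  = ⊥-elim (dead-min-unseen [] s x<ℓ ℓ<u (here refl))
      disjoint : ∀ w → First u (Completes ℓ (ℓ ∷ u ∷ []) U) w → First ℓ (Completes ℓ [] (u ∷ U)) w → ⊥
      disjoint w (v , refl , _) (v , refl , _) = <-irrefl refl ℓ<u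
    state-E (suc r) (y ∷ Q) u Hs ℓ e (a ∷ d , (ℓ<y , y<n) ∷ i) ℓ<n = ⇔-count from to
      (count-first y<n (state-E r Q u Hs ℓ (suc-injective e) (d , i) ℓ<n))
      where
      U = u ∷ Hs ++ downFrom ℓ
      a-Q = All.++⁺ (All.++⁻ˡ Q a) (ℓ<y ∷ [])
      a-U = below (All.++⁻ʳ Q a) (<⇒≤ ℓ<y)
      u-in = All.++⁻ʳ Q i
      from : ∀ w → First y (Completes ℓ (Q ++ [ ℓ ]) U) w → Completes ℓ (y ∷ Q ++ [ ℓ ]) U w
      from w (v , refl , s) = flush← (occ-above a-Q) (occ-above a-U)
        (occ-desc (desc-snoc Q ℓ<n (desc-++ˡ Q (d , i)))) (inj₂ (≤-weaken a-Q , ≤-weaken a-U)) s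
      to : ∀ w → Completes ℓ (y ∷ Q ++ [ ℓ ]) U w → First y (Completes ℓ (Q ++ [ ℓ ]) U) w
      to []      s = ⊥-elim (no-completion-[] (inj₁ (here refl)) s)
      to (x ∷ v) s with head-pending s
      ... | inj₁ (here refl) = v , refl , flush→ s
      ... | inj₁ (there h)   = ⊥-elim (dead-queue s h (<⇒≢ (All.lookup a-Q h)))
      ... | inj₂ h with above-ℓ (u ∷ Hs) u-in h
      ...   | inj₁ x∈Hs = ⊥-elim (dead-high s (proj₁ (All.lookup u-in x∈Hs))
                (All.lookup (All.++⁻ʳ Q a) x∈Hs) (inj₁ (here refl)))
      ...   | inj₂ x<ℓ  = ⊥-elim (dead-min-unseen (y ∷ Q) s x<ℓ (proj₁ (All.head u-in)) (here refl))
    state-E zero    Q u Hs ℓ e d ℓ<n = ⊥-elim (1+n≢0 (trans (sym (trans (cong (_+ 2 * suc (length Hs + ℓ)) (trans (length-++ Q) (+-comm (length Q) 1))) refl)) e))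

    state-G zero    Q ℓ e d ℓ<n = ⊥-elim (1+n≢0 (trans (sym (trans (cong (_+ 2 * ℓ) (trans (length-++ Q) (+-comm (length Q) 1))) refl)) e))
    state-G (suc r) [] ℓ e d ℓ<n = ⇔-count from to
      (⊎-count disjoint
        (count-first ℓ<n (state-A r [] ℓ (suc-injective e) ([] , []) (<⇒≤ ℓ<n)))
        (new-N r [ ℓ ] ℓ e ([] ∷ []) ((≤-refl , ℓ<n) ∷ []) (<⇒≤ ℓ<n)))
      where
      U = downFrom ℓ
      Next : List ℕ → Set
      Next w = First ℓ (Completes ℓ [] U) w ⊎ NewMin ℓ [ ℓ ] U w
      from : ∀ w → Next w → Completes ℓ [ ℓ ] U w
      from w (inj₁ (v , refl , s)) = flush← refl (occ-above (All-downFrom ℓ)) (λ _ → z≤n) (inj₁ refl) s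
      from w (inj₂ m) = newMin← m
      to : ∀ w → Completes ℓ [ ℓ ] U w → Next w
      to []      s = ⊥-elim (no-completion-[] (inj₁ (here refl)) s)
      to (x ∷ v) s with head-pending s
      ... | inj₁ (here refl) = inj₁ (v , refl , flush→ s)
      ... | inj₂ h           = inj₂ (newMin→ (All.lookup (All-downFrom ℓ) h) s)
      disjoint : ∀ w → First ℓ (Completes ℓ [] U) w → NewMin ℓ [ ℓ ] U w → ⊥
      disjoint w (v , refl , _) (newMin refl x<ℓ _ _ _) = <-irrefl refl x<ℓ
    state-G (suc r) (y ∷ Q) ℓ e (a ∷ d , (ℓ<y , y<n) ∷ i) ℓ<n = ⇔-count from to
      (⊎-count disjoint
        (count-first y<n (state-G r Q ℓ (suc-injective e) (d , i) ℓ<n))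
        (subst (λ k → CountWords n (suc r) (NewMin ℓ (y ∷ Q ++ [ ℓ ]) U) (N k ℓ))
          (cong suc (trans (length-++ Q) (+-comm (length Q) 1)))
          (new-N r (y ∷ Q ++ [ ℓ ]) ℓ e (a-Q ∷ desc-snoc Q ℓ<n (d , i))
            ((<⇒≤ ℓ<y , y<n) ∷ All.++⁺ (relax i) ((≤-refl , ℓ<n) ∷ [])) (<⇒≤ ℓ<n))))
      where
      U = downFrom ℓ
      a-Q = All.++⁺ a (ℓ<y ∷ [])
      a-U : All (_< y) U
      a-U = below [] (<⇒≤ ℓ<y)
      Next : List ℕ → Set
      Next w = First y (Completes ℓ (Q ++ [ ℓ ]) U) w ⊎ NewMin ℓ (y ∷ Q ++ [ ℓ ]) U w
      from : ∀ w → Next w → Completes ℓ (y ∷ Q ++ [ ℓ ]) U w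
      from w (inj₁ (v , refl , s)) = flush← (occ-above a-Q) (occ-above a-U)
        (occ-desc (desc-snoc Q ℓ<n (d , i))) (inj₂ (≤-weaken a-Q , ≤-weaken a-U)) s
      from w (inj₂ m) = newMin← m
      to : ∀ w → Completes ℓ (y ∷ Q ++ [ ℓ ]) U w → Next w
      to []      s = ⊥-elim (no-completion-[] (inj₁ (here refl)) s)
      to (x ∷ v) s with head-pending s
      ... | inj₁ (here refl) = inj₁ (v , refl , flush→ s)
      ... | inj₁ (there h)   = ⊥-elim (dead-queue s h (<⇒≢ (All.lookup a-Q h)))
      ... | inj₂ h           = inj₂ (newMin→ (All.lookup (All-downFrom ℓ) h) s)
      disjoint : ∀ w → First y (Completes ℓ (Q ++ [ ℓ ]) U) w → NewMin ℓ (y ∷ Q ++ [ ℓ ]) U w → ⊥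
      disjoint w (v , refl , _) (newMin refl x<ℓ _ _ _) = <-asym ℓ<y x<ℓ

-- Words over `Fin n` as lists of numbers

module NonnestingWords where

  open Counting
  open Completions
  open Recurrences
  open Enumeration
  open import Defs using (Word; EachLabelTwice; HasNesting; Contains123; Nonnesting123Avoiding; nonnesting123Avoiding?; c)
  open import Data.Fin.Base as Fin using (Fin; toℕ; fromℕ<)
  import Data.Fin.Properties as Fin
  open import Data.List.Base using (List; []; _∷_; downFrom)
  open import Data.List.Relation.Binary.Sublist.Propositional using (_⊆_; []; _∷_; _∷ʳ_; minimum)
  open import Data.List.Relation.Unary.All using ([])
  open import Data.List.Relation.Unary.AllPairs using ([])
  open import Data.Nat.Base
  open import Data.Nat.Properties
  open import Data.Vec.Base using (Vec; []; _∷_; lookup; count)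
  open import Relation.Binary.PropositionalEquality hiding ([_])

  private variable
    n m : ℕ
    a b d : ℕ
    xs : List ℕ

  count≡occ : ∀ (a : Fin n) (w : Word n m) → count (Fin._≟ a) w ≡ occ (toℕ a) (toList w)
  count≡occ a []      = refl
  count≡occ a (x ∷ w) with x Fin.≟ a | toℕ x ≟ toℕ a
  ... | yes _   | yes _ = cong suc (count≡occ a w)
  ... | no _    | no _  = count≡occ a w
  ... | yes x≡a | no ¬e = ⊥-elim (¬e (cong toℕ x≡a))
  ... | no x≢a  | yes e = ⊥-elim (x≢a (Fin.toℕ-injective e))

  occ-large : ∀ (w : Word n m) → n ≤ a → occ a (toList w) ≡ 0
  occ-large []      n≤a = refl
  occ-large (x ∷ w) n≤a = trans (occ-there _ (<⇒≢ (<-≤-trans (Fin.toℕ<n x) n≤a))) (occ-large w n≤a)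

  occ-downFrom-≥ : ∀ n → n ≤ a → occ a (downFrom n) ≡ 0
  occ-downFrom-≥ zero    n≤a = refl
  occ-downFrom-≥ (suc n) n<a = trans (occ-there _ (<⇒≢ n<a)) (occ-downFrom-≥ n (<⇒≤ n<a))

  occ-downFrom-< : ∀ n → a < n → occ a (downFrom n) ≡ 1
  occ-downFrom-< {a} (suc n) a<n with n ≟ a
  ... | yes refl = cong suc (occ-downFrom-≥ n ≤-refl)
  ... | no n≢a   = occ-downFrom-< n (≤∧≢⇒< (≤-pred a<n) (λ e → n≢a (sym e)))

  sub₁ : ∀ (w : Word n m) i → toℕ (lookup w i) ∷ [] ⊆ toList w
  sub₁ (x ∷ w) Fin.zero    = refl ∷ minimum _
  sub₁ (x ∷ w) (Fin.suc i) = _ ∷ʳ sub₁ w i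

  sub₂ : ∀ (w : Word n m) {i j} → i Fin.< j → toℕ (lookup w i) ∷ toℕ (lookup w j) ∷ [] ⊆ toList w
  sub₂ (x ∷ w) {Fin.zero}  {Fin.suc j} _         = refl ∷ sub₁ w j
  sub₂ (x ∷ w) {Fin.suc i} {Fin.suc j} (s≤s i<j) = _ ∷ʳ sub₂ w i<j

  sub₃ : ∀ (w : Word n m) {i j k} → i Fin.< j → j Fin.< k →
         toℕ (lookup w i) ∷ toℕ (lookup w j) ∷ toℕ (lookup w k) ∷ [] ⊆ toList w
  sub₃ (x ∷ w) {Fin.zero}  {Fin.suc j} {Fin.suc k} _ (s≤s j<k)         = refl ∷ sub₂ w j<k
  sub₃ (x ∷ w) {Fin.suc i} {Fin.suc j} {Fin.suc k} (s≤s i<j) (s≤s j<k) = _ ∷ʳ sub₃ w i<j j<k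

  sub₄ : ∀ (w : Word n m) {i j k l} → i Fin.< j → j Fin.< k → k Fin.< l →
         toℕ (lookup w i) ∷ toℕ (lookup w j) ∷ toℕ (lookup w k) ∷ toℕ (lookup w l) ∷ [] ⊆ toList w
  sub₄ (x ∷ w) {Fin.zero}  {Fin.suc j} {Fin.suc k} {Fin.suc l} _ (s≤s p) (s≤s q)       = refl ∷ sub₃ w p q
  sub₄ (x ∷ w) {Fin.suc i} {Fin.suc j} {Fin.suc k} {Fin.suc l} (s≤s o) (s≤s p) (s≤s q) = _ ∷ʳ sub₄ w o p q

  indices₁ : ∀ (w : Word n m) → a ∷ [] ⊆ toList w → ∃[ i ] toℕ (lookup w i) ≡ a
  indices₁ (x ∷ w) (_ ∷ʳ p)   = let i , e = indices₁ w p in Fin.suc i , e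
  indices₁ (x ∷ w) (refl ∷ p) = Fin.zero , refl

  indices₂ : ∀ (w : Word n m) → a ∷ b ∷ [] ⊆ toList w →
             ∃[ i ] ∃[ j ] i Fin.< j × toℕ (lookup w i) ≡ a × toℕ (lookup w j) ≡ b
  indices₂ (x ∷ w) (_ ∷ʳ p)   = let i , j , o , e = indices₂ w p in Fin.suc i , Fin.suc j , s≤s o , e
  indices₂ (x ∷ w) (refl ∷ p) = let j , e = indices₁ w p in Fin.zero , Fin.suc j , s≤s z≤n , refl , e

  indices₃ : ∀ (w : Word n m) → a ∷ b ∷ d ∷ [] ⊆ toList w →
             ∃[ i ] ∃[ j ] ∃[ k ] i Fin.< j × j Fin.< k ×
             toℕ (lookup w i) ≡ a × toℕ (lookup w j) ≡ b × toℕ (lookup w k) ≡ d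
  indices₃ (x ∷ w) (_ ∷ʳ p)   =
    let i , j , k , o , p , e = indices₃ w p in Fin.suc i , Fin.suc j , Fin.suc k , s≤s o , s≤s p , e
  indices₃ (x ∷ w) (refl ∷ p) =
    let j , k , o , e = indices₂ w p in Fin.zero , Fin.suc j , Fin.suc k , s≤s z≤n , s≤s o , refl , e

  indices₄ : ∀ (w : Word n m) {e} → a ∷ b ∷ d ∷ e ∷ [] ⊆ toList w →
             ∃[ i ] ∃[ j ] ∃[ k ] ∃[ l ] i Fin.< j × j Fin.< k × k Fin.< l ×
             toℕ (lookup w i) ≡ a × toℕ (lookup w j) ≡ b × toℕ (lookup w k) ≡ d × toℕ (lookup w l) ≡ e
  indices₄ (x ∷ w) (_ ∷ʳ p)   =
    let i , j , k , l , o , p , q , e = indices₄ w p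
    in Fin.suc i , Fin.suc j , Fin.suc k , Fin.suc l , s≤s o , s≤s p , s≤s q , e
  indices₄ (x ∷ w) (refl ∷ p) =
    let j , k , l , o , p , e = indices₃ w p
    in Fin.zero , Fin.suc j , Fin.suc k , Fin.suc l , s≤s z≤n , s≤s o , s≤s p , refl , e

  -- The empty prefix is assigned the minimum n, which exceeds every label: it can start no 123, and
  -- all labels count as unseen labels below it.
  completes→ : (w : Word n m) → Completes n [] (downFrom n) (toList w) → Nonnesting123Avoiding w
  completes→ {n} w (completes o nn av) = twice , noNest , no123
    where
    twice : EachLabelTwice w
    twice a = trans (count≡occ a w) (trans (o (toℕ a))
      (cong₂ _+_ (occ-downFrom-< n (Fin.toℕ<n a)) (occ-downFrom-< n (Fin.toℕ<n a))))
    noNest : HasNesting w → _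
    noNest (i , j , k , l , i<j , j<k , k<l , wi≡wl , wj≡wk , wi≢wj) =
      nn {toℕ (lookup w i)} {toℕ (lookup w j)} (λ e → wi≢wj (Fin.toℕ-injective e))
        (subst₂ (λ x y → toℕ (lookup w i) ∷ toℕ (lookup w j) ∷ toℕ x ∷ toℕ y ∷ [] ⊆ toList w)
          (sym wj≡wk) (sym wi≡wl) (sub₄ w i<j j<k k<l))
    no123 : Contains123 w → _
    no123 (i , j , k , i<j , j<k , p , q) = av p q (_ ∷ʳ sub₃ w i<j j<k)

  completes← : (w : Word n m) → Nonnesting123Avoiding w → Completes n [] (downFrom n) (toList w)
  completes← {n} w (twice , noNest , no123) = completes o nn av
    where
    o : ∀ a → occ a (toList w) ≡ occ a (downFrom n) + occ a (downFrom n)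
    o a with a <? n
    ... | no a≮n  = trans (occ-large w (≮⇒≥ a≮n))
      (sym (cong₂ _+_ (occ-downFrom-≥ n (≮⇒≥ a≮n)) (occ-downFrom-≥ n (≮⇒≥ a≮n))))
    ... | yes a<n = trans
      (trans (cong (λ z → occ z (toList w)) (sym (Fin.toℕ-fromℕ< a<n)))
        (trans (sym (count≡occ (fromℕ< a<n) w)) (twice (fromℕ< a<n))))
      (sym (cong₂ _+_ (occ-downFrom-< n a<n) (occ-downFrom-< n a<n)))
    nn : NonNesting (toList w)
    nn a≢b p with indices₄ w p
    ... | i , j , k , l , i<j , j<k , k<l , refl , refl , wk , wl =
      noNest (i , j , k , l , i<j , j<k , k<l , sym (Fin.toℕ-injective wl) , sym (Fin.toℕ-injective wk)
        , λ e → a≢b (cong toℕ e))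
    av : Avoids123 (n ∷ toList w)
    av a<b b<c (refl ∷ p) with indices₂ w p
    ... | i , _ , _ , refl , _ = <-asym a<b (Fin.toℕ<n (lookup w i))
    av a<b b<c (_ ∷ʳ p) with indices₃ w p
    ... | i , j , k , i<j , j<k , refl , refl , refl = no123 (i , j , k , i<j , j<k , a<b , b<c)

  c≡A : ∀ n → c n ≡ A 0 n
  c≡A n = count-filter nonnesting123Avoiding? (count-⇔ completes→ completes←
    (state-A n (2 * n) [] n refl ([] , []) ≤-refl))

-- The ring of formal power series over the rationals

module Series where

  open import Algebra.Bundles using (CommutativeRing)
  import Algebra.Solver.Ring as Ring-Solver
  open import Algebra.Solver.Ring.AlmostCommutativeRing
    using (AlmostCommutativeRing; fromCommutativeRing; _-Raw-AlmostCommutative⟶_)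
  open import Data.Maybe.Base using (Maybe; just; nothing)
  open import Data.Rational.Solver using (module +-*-Solver)
  open import Function.Base using (_∘_)
  open import Level using (0ℓ)
  open import Relation.Binary.PropositionalEquality
  open RationalSequences using (fromℕ; fromℕ-suc)

  infix  4 _≈_
  infixl 6 _+_ _-_
  infixl 7 _*_
  infix  8 -_

  Series : Set
  Series = ℕ → ℚ

  -- A record, so that both series can be recovered from the type of an equation between them.
  record _≈_ (a b : Series) : Set where
    constructor pointwise
    field at : ∀ n → a n ≡ b n

  open _≈_ public

  private variable
    a a′ b b′ d : Series

  ≈-refl : a ≈ a
  ≈-refl .at n = refl

  ≈-sym : a ≈ b → b ≈ a
  ≈-sym e .at n = sym (at e n)

  ≈-trans : a ≈ b → b ≈ d → a ≈ d
  ≈-trans e f .at n = trans (at e n) (at f n)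

  tail : Series → Series
  tail a n = a (suc n)

  const : ℚ → Series
  const q zero    = q
  const q (suc _) = 0ℚ

  shift : Series → Series
  shift a zero    = 0ℚ
  shift a (suc n) = a n

  z : Series
  z = shift (const 1ℚ)

  _+_ _*_ : Series → Series → Series
  (a + b) n = a n ℚ.+ b n
  (a * b) zero    = a 0 ℚ.* b 0
  (a * b) (suc n) = a 0 ℚ.* b (suc n) ℚ.+ (tail a * b) n

  -_ : Series → Series
  -_ a n = ℚ.- a n

  _-_ : Series → Series → Series
  a - b = a + - b

  scale : ℚ → Series → Series
  scale q a n = q ℚ.* a n

  private
    module Q = +-*-Solver
    open Q using (_:=_; _:+_; _:*_; con)

  *-cong : a ≈ a′ → b ≈ b′ → a * b ≈ a′ * b′
  *-cong e f .at n = go e f n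
    where
    go : ∀ {a a′ b b′} → a ≈ a′ → b ≈ b′ → ∀ n → (a * b) n ≡ (a′ * b′) n
    go e f zero    = cong₂ ℚ._*_ (at e 0) (at f 0)
    go e f (suc n) = cong₂ ℚ._+_ (cong₂ ℚ._*_ (at e 0) (at f (suc n)))
      (go (pointwise λ k → at e (suc k)) f n)

  +-cong : a ≈ a′ → b ≈ b′ → a + b ≈ a′ + b′
  +-cong e f .at n = cong₂ ℚ._+_ (at e n) (at f n)

  +-congˡ : ∀ a → b ≈ b′ → a + b ≈ a + b′
  +-congˡ a = +-cong {a} ≈-refl

  -‿cong : a ≈ b → - a ≈ - b
  -‿cong e .at n = cong ℚ.-_ (at e n)

  *-zeroˡ : ∀ b n → (∀ k → a k ≡ 0ℚ) → (a * b) n ≡ 0ℚ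
  *-zeroˡ b zero    a≡0 = trans (cong (ℚ._* b 0) (a≡0 0)) (ℚ.*-zeroˡ (b 0))
  *-zeroˡ b (suc n) a≡0 = trans
    (cong₂ ℚ._+_ (trans (cong (ℚ._* b (suc n)) (a≡0 0)) (ℚ.*-zeroˡ (b (suc n)))) (*-zeroˡ b n (a≡0 ∘ suc)))
    (ℚ.+-identityˡ 0ℚ)

  const-* : ∀ q b n → (const q * b) n ≡ q ℚ.* b n
  const-* q b zero    = refl
  const-* q b (suc n) = trans (cong (q ℚ.* b (suc n) ℚ.+_) (*-zeroˡ b n (λ _ → refl))) (ℚ.+-identityʳ _)

  scale-* : ∀ q a b n → (scale q a * b) n ≡ q ℚ.* (a * b) n
  scale-* q a b zero    = ℚ.*-assoc q (a 0) (b 0)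
  scale-* q a b (suc n) = trans (cong₂ ℚ._+_ (ℚ.*-assoc q (a 0) (b (suc n))) (scale-* q (tail a) b n))
    (sym (ℚ.*-distribˡ-+ q (a 0 ℚ.* b (suc n)) ((tail a * b) n)))

  *-distribʳ : ∀ a b d n → ((a + b) * d) n ≡ (a * d) n ℚ.+ (b * d) n
  *-distribʳ a b d zero    = ℚ.*-distribʳ-+ (d 0) (a 0) (b 0)
  *-distribʳ a b d (suc n) = trans (cong ((a 0 ℚ.+ b 0) ℚ.* d (suc n) ℚ.+_) (*-distribʳ (tail a) (tail b) d n))
    (Q.solve 5 (λ a b d p q → (a :+ b) :* d :+ (p :+ q) := (a :* d :+ p) :+ (b :* d :+ q)) refl
      (a 0) (b 0) (d (suc n)) ((tail a * d) n) ((tail b * d) n))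

  *-suc : ∀ a b n → (a * b) (suc n) ≡ (a * tail b) n ℚ.+ a (suc n) ℚ.* b 0
  *-suc a b zero    = refl
  *-suc a b (suc n) = trans (cong (a 0 ℚ.* b (suc (suc n)) ℚ.+_) (*-suc (tail a) b n))
    (sym (ℚ.+-assoc (a 0 ℚ.* b (suc (suc n))) ((tail a * tail b) n) (a (suc (suc n)) ℚ.* b 0)))

  *-comm′ : ∀ a b n → (a * b) n ≡ (b * a) n
  *-comm′ a b zero    = ℚ.*-comm (a 0) (b 0)
  *-comm′ a b (suc n) = begin
    a 0 ℚ.* b (suc n) ℚ.+ (tail a * b) n  ≡⟨ cong₂ ℚ._+_ (ℚ.*-comm (a 0) (b (suc n))) (*-comm′ (tail a) b n) ⟩
    b (suc n) ℚ.* a 0 ℚ.+ (b * tail a) n  ≡⟨ ℚ.+-comm (b (suc n) ℚ.* a 0) ((b * tail a) n) ⟩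
    (b * tail a) n ℚ.+ b (suc n) ℚ.* a 0  ≡⟨ *-suc b a n ⟨
    (b * a) (suc n)                       ∎
    where open ≡-Reasoning

  *-assoc′ : ∀ a b d n → ((a * b) * d) n ≡ (a * (b * d)) n
  *-assoc′ a b d zero    = ℚ.*-assoc (a 0) (b 0) (d 0)
  *-assoc′ a b d (suc n) = begin
    a 0 ℚ.* b 0 ℚ.* d (suc n) ℚ.+ ((scale (a 0) (tail b) + tail a * b) * d) n
      ≡⟨ cong (a 0 ℚ.* b 0 ℚ.* d (suc n) ℚ.+_) (*-distribʳ (scale (a 0) (tail b)) (tail a * b) d n) ⟩
    a 0 ℚ.* b 0 ℚ.* d (suc n) ℚ.+ ((scale (a 0) (tail b) * d) n ℚ.+ ((tail a * b) * d) n)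
      ≡⟨ cong₂ (λ p q → a 0 ℚ.* b 0 ℚ.* d (suc n) ℚ.+ (p ℚ.+ q)) (scale-* (a 0) (tail b) d n) (*-assoc′ (tail a) b d n) ⟩
    a 0 ℚ.* b 0 ℚ.* d (suc n) ℚ.+ (a 0 ℚ.* (tail b * d) n ℚ.+ (tail a * (b * d)) n)
      ≡⟨ Q.solve 5 (λ a b d p q → a :* b :* d :+ (a :* p :+ q) := a :* (b :* d :+ p) :+ q) refl
           (a 0) (b 0) (d (suc n)) ((tail b * d) n) ((tail a * (b * d)) n) ⟩
    a 0 ℚ.* (b 0 ℚ.* d (suc n) ℚ.+ (tail b * d) n) ℚ.+ (tail a * (b * d)) n ∎
    where open ≡-Reasoning

  seriesRing : CommutativeRing 0ℓ 0ℓ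
  seriesRing = record
    { Carrier = Series ; _≈_ = _≈_ ; _+_ = _+_ ; _*_ = _*_ ; -_ = -_ ; 0# = const 0ℚ ; 1# = const 1ℚ
    ; isCommutativeRing = record
      { isRing = record
        { +-isAbelianGroup = record
          { isGroup = record
            { isMonoid = record
              { isSemigroup = record
                { isMagma = record
                  { isEquivalence = record { refl = ≈-refl ; sym = ≈-sym ; trans = ≈-trans }
                  ; ∙-cong = +-cong }
                ; assoc = λ a b d → pointwise λ n → ℚ.+-assoc (a n) (b n) (d n) }
              ; identity = (λ a → pointwise λ n → trans (cong (ℚ._+ a n) (const0 n)) (ℚ.+-identityˡ (a n)))
                         , (λ a → pointwise λ n → trans (cong (a n ℚ.+_) (const0 n)) (ℚ.+-identityʳ (a n))) }
            ; inverse = (λ a → pointwise λ n → trans (ℚ.+-inverseˡ (a n)) (sym (const0 n)))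
                      , (λ a → pointwise λ n → trans (ℚ.+-inverseʳ (a n)) (sym (const0 n)))
            ; ⁻¹-cong = -‿cong }
          ; comm = λ a b → pointwise λ n → ℚ.+-comm (a n) (b n) }
        ; *-cong = *-cong
        ; *-assoc = λ a b d → pointwise (*-assoc′ a b d)
        ; *-identity = (λ a → pointwise λ n → trans (const-* 1ℚ a n) (ℚ.*-identityˡ (a n)))
                     , (λ a → pointwise λ n → trans (*-comm′ a (const 1ℚ) n) (trans (const-* 1ℚ a n) (ℚ.*-identityˡ (a n))))
        ; distrib = (λ a b d → pointwise λ n → trans (*-comm′ a (b + d) n) (trans (*-distribʳ b d a n)
                      (cong₂ ℚ._+_ (*-comm′ b a n) (*-comm′ d a n))))
                  , (λ a b d → pointwise (*-distribʳ b d a)) }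
      ; *-comm = λ a b → pointwise (*-comm′ a b) } }
    where
    const0 : ∀ n → const 0ℚ n ≡ 0ℚ
    const0 zero    = refl
    const0 (suc n) = refl

  open CommutativeRing seriesRing public
    using (*-assoc; *-comm; *-identityˡ; *-identityʳ; setoid)

  module SeriesSolver where

    private
      almost : AlmostCommutativeRing 0ℓ 0ℓ
      almost = fromCommutativeRing seriesRing

      const-morphism : AlmostCommutativeRing.rawRing (fromCommutativeRing ℚ.+-*-commutativeRing)
                       -Raw-AlmostCommutative⟶ almost
      const-morphism = record
        { ⟦_⟧    = const
        ; +-homo = λ p q → pointwise λ { zero → refl ; (suc n) → refl }
        ; *-homo = λ p q → pointwise λ { zero → refl ; (suc n) → sym (trans (const-* p (const q) (suc n)) (ℚ.*-zeroʳ p)) }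
        ; -‿homo = λ p → pointwise λ { zero → refl ; (suc n) → refl }
        ; 0-homo = ≈-refl
        ; 1-homo = ≈-refl }

      weakly : ∀ p q → Maybe (const p ≈ const q)
      weakly p q with p ℚ.≟ q
      ... | yes refl = just ≈-refl
      ... | no _     = nothing

    open Ring-Solver _ almost const-morphism weakly public

  shift-tail : ∀ a n → shift a n ≡ (z * a) n
  shift-tail a zero    = sym (ℚ.*-zeroˡ (a 0))
  shift-tail a (suc n) = sym (trans (cong₂ ℚ._+_ (ℚ.*-zeroˡ (a (suc n)))
    (trans (const-* 1ℚ a n) (ℚ.*-identityˡ (a n)))) (ℚ.+-identityˡ (a n)))

  z*-suc : ∀ a n → (z * a) (suc n) ≡ a n
  z*-suc a n = sym (shift-tail a (suc n))

  z*-zero : ∀ a → (z * a) 0 ≡ 0ℚ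
  z*-zero a = ℚ.*-zeroˡ (a 0)

  -- z is not a zero divisor. Series that are quotients by z, such as `Cat` and `μ`, are handled by
  -- clearing that denominator and cancelling it at the end.
  z-cancel : z * a ≈ z * b → a ≈ b
  z-cancel {a} {b} e .at n = trans (sym (z*-suc a n)) (trans (at e (suc n)) (z*-suc b n))

  z*tail : a 0 ≡ 0ℚ → z * tail a ≈ a
  z*tail {a} a0 .at zero    = trans (z*-zero (tail a)) (sym a0)
  z*tail {a} a0 .at (suc n) = z*-suc (tail a) n

  -- θ = z d/dz

  θ : Series → Series
  θ a n = fromℕ n ℚ.* a n

  θ-cong : a ≈ b → θ a ≈ θ b
  θ-cong e .at n = cong (fromℕ n ℚ.*_) (at e n)

  θ-+ : ∀ a b → θ (a + b) ≈ θ a + θ b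
  θ-+ a b .at n = ℚ.*-distribˡ-+ (fromℕ n) (a n) (b n)

  θ-neg : ∀ a → θ (- a) ≈ - θ a
  θ-neg a .at n = sym (ℚ.neg-distribʳ-* (fromℕ n) (a n))

  θ-const : ∀ q → θ (const q) ≈ const 0ℚ
  θ-const q .at zero    = ℚ.*-zeroˡ q
  θ-const q .at (suc n) = ℚ.*-zeroʳ (fromℕ (suc n))

  θ-z : θ z ≈ z
  θ-z .at zero          = refl
  θ-z .at (suc zero)    = refl
  θ-z .at (suc (suc n)) = ℚ.*-zeroʳ (fromℕ (suc (suc n)))

  θ-tail : ∀ a n → θ a (suc n) ≡ θ (tail a) n ℚ.+ a (suc n)
  θ-tail a n = trans (cong (ℚ._* a (suc n)) (fromℕ-suc n))
    (Q.solve 2 (λ n a → (n :+ con 1ℚ) :* a := n :* a :+ a) refl (fromℕ n) (a (suc n)))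

  θ-* : ∀ a b → θ (a * b) ≈ θ a * b + a * θ b
  θ-* a b .at = go a b
    where
    go : ∀ a b n → θ (a * b) n ≡ (θ a * b) n ℚ.+ (a * θ b) n
    go a b zero    = Q.solve 2 (λ a b → con 0ℚ :* (a :* b) := con 0ℚ :* a :* b :+ a :* (con 0ℚ :* b)) refl (a 0) (b 0)
    go a b (suc n) = begin
      fromℕ (suc n) ℚ.* (a 0 ℚ.* b (suc n) ℚ.+ t)
        ≡⟨ cong (ℚ._* (a 0 ℚ.* b (suc n) ℚ.+ t)) (fromℕ-suc n) ⟩
      (fromℕ n ℚ.+ 1ℚ) ℚ.* (a 0 ℚ.* b (suc n) ℚ.+ t)
        ≡⟨ Q.solve 4 (λ n a b t → (n :+ con 1ℚ) :* (a :* b :+ t) := a :* ((n :+ con 1ℚ) :* b) :+ (n :* t :+ t)) refl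
             (fromℕ n) (a 0) (b (suc n)) t ⟩
      a 0 ℚ.* ((fromℕ n ℚ.+ 1ℚ) ℚ.* b (suc n)) ℚ.+ (fromℕ n ℚ.* t ℚ.+ t)
        ≡⟨ cong₂ (λ x y → a 0 ℚ.* (x ℚ.* b (suc n)) ℚ.+ (y ℚ.+ t)) (sym (fromℕ-suc n)) (go (tail a) b n) ⟩
      a 0 ℚ.* θ b (suc n) ℚ.+ ((u ℚ.+ v) ℚ.+ t)
        ≡⟨ Q.solve 5 (λ a b u v t → a :* b :+ ((u :+ v) :+ t) := con 0ℚ :* a :+ (u :+ t) :+ (a :* b :+ v)) refl
             (a 0) (θ b (suc n)) u v t ⟩
      0ℚ ℚ.* a 0 ℚ.+ (u ℚ.+ t) ℚ.+ (a 0 ℚ.* θ b (suc n) ℚ.+ v)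
        ≡⟨ cong (ℚ._+ (a 0 ℚ.* θ b (suc n) ℚ.+ v)) (cong₂ ℚ._+_
             (trans (ℚ.*-zeroˡ (a 0)) (sym (trans (cong (ℚ._* b (suc n)) (ℚ.*-zeroˡ (a 0))) (ℚ.*-zeroˡ (b (suc n))))))
             (trans (sym (*-distribʳ (θ (tail a)) (tail a) b n))
               (at (*-cong (pointwise (λ k → sym (θ-tail a k))) ≈-refl) n))) ⟩
      (θ a * b) (suc n) ℚ.+ (a * θ b) (suc n) ∎
      where
      open ≡-Reasoning
      t = (tail a * b) n
      u = (θ (tail a) * b) n
      v = (tail a * θ b) n

  -- This turns differentiation into a method of proof for algebraic identities: only constant terms
  -- remain to be compared.
  θ≈0⇒const : θ a ≈ const 0ℚ → a ≈ const (a 0)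
  θ≈0⇒const e .at zero = refl
  θ≈0⇒const {a} e .at (suc n) = trans (sym (ℚ.*-identityˡ (a (suc n)))) (trans
    (cong (ℚ._* a (suc n)) (sym (ℚ.*-inverseˡ (fromℕ (suc n)))))
    (trans (ℚ.*-assoc (ℚ.1/ fromℕ (suc n)) (fromℕ (suc n)) (a (suc n)))
      (trans (cong (ℚ.1/ fromℕ (suc n) ℚ.*_) (at e (suc n))) (ℚ.*-zeroʳ (ℚ.1/ fromℕ (suc n))))))
    where instance _ = ℚ.pos⇒nonZero (fromℕ (suc n)) {{ℚ.normalize-pos (suc n) 1}}

-- Square roots, the Catalan series and `μ`

module ClosedForms where

  open Series
  open import Data.Integer.Base using (+_; -[1+_])
  open import Data.Rational.Base using (_/_)
  open import Data.Rational.Solver using (module +-*-Solver)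
  open RationalSequences using (fromℕ; fromℕ-suc)
  import Relation.Binary.Reasoning.Setoid as Setoid-Reasoning

  private
    module Q = +-*-Solver
    open SeriesSolver using (solve; con; _:=_; _:+_; _:*_; _:-_; :-_)
    module ≈-Reasoning = Setoid-Reasoning setoid
    module E = ≡-Reasoning

  -- Adding a multiple of a hypothesis l ≈ r; the identities below become
  -- polynomial ones after such corrections.

  correct : ∀ {l r} x u → l ≈ r → x ≈ x + u * (l - r)
  correct {l} {r} x u e = ≈-trans
    (solve 3 (λ x u r → x := x :+ u :* (r :- r)) ≈-refl x u r)
    (+-congˡ x (*-cong {u} ≈-refl (+-cong {b = - r} (≈-sym e) ≈-refl)))

  correct₂ : ∀ {l r l′ r′} x u → l ≈ r → ∀ u′ → l′ ≈ r′ → x ≈ x + u * (l - r) + u′ * (l′ - r′)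
  correct₂ x u e u′ e′ = ≈-trans (correct x u e) (correct _ u′ e′)

  inv : ℕ → ℚ
  inv n = + 1 / suc n

  fromℕ*inv : ∀ n → fromℕ (suc n) ℚ.* inv n ≡ 1ℚ
  fromℕ*inv n = trans (cong₂ ℚ._*_ (fromℕ-mkℚ (suc n)) (ℚ.normalize-coprime {1} {n} (1-coprimeTo (suc n))))
    (ℚ.*-inverseʳ (ℚ.mkℚ (+ suc n) 0 (coprime-sym (1-coprimeTo (suc n)))))
    where
    open RationalSequences using (fromℕ-mkℚ)
    open import Data.Nat.Coprimality using (1-coprimeTo) renaming (sym to coprime-sym)

  -- b n = C(2n,n) / 4ⁿ

  b : ℕ → ℚ
  b zero    = 1ℚ
  b (suc n) = b n ℚ.- ½ ℚ.* inv n ℚ.* b n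

  b-rec : ∀ n → fromℕ (suc n) ℚ.* b (suc n) ≡ fromℕ n ℚ.* b n ℚ.+ ½ ℚ.* b n
  b-rec n = E.begin
    fromℕ (suc n) ℚ.* (b n ℚ.- ½ ℚ.* inv n ℚ.* b n)
      E.≡⟨ Q.solve 3 (λ n i b → n Q.:* (b Q.:- Q.con ½ Q.:* i Q.:* b) Q.:= n Q.:* b Q.:- Q.con ½ Q.:* (n Q.:* i) Q.:* b)
           refl (fromℕ (suc n)) (inv n) (b n) ⟩
    fromℕ (suc n) ℚ.* b n ℚ.- ½ ℚ.* (fromℕ (suc n) ℚ.* inv n) ℚ.* b n
      E.≡⟨ cong₂ (λ x y → x ℚ.* b n ℚ.- ½ ℚ.* y ℚ.* b n) (fromℕ-suc n) (fromℕ*inv n) ⟩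
    (fromℕ n ℚ.+ 1ℚ) ℚ.* b n ℚ.- ½ ℚ.* 1ℚ ℚ.* b n
      E.≡⟨ Q.solve 2 (λ n b → (n Q.:+ Q.con 1ℚ) Q.:* b Q.:- Q.con ½ Q.:* Q.con 1ℚ Q.:* b Q.:= n Q.:* b Q.:+ Q.con ½ Q.:* b)
           refl (fromℕ n) (b n) ⟩
    fromℕ n ℚ.* b n ℚ.+ ½ ℚ.* b n E.∎

  pow : ℚ → ℕ → ℚ
  pow t zero    = 1ℚ
  pow t (suc n) = t ℚ.* pow t n

  -- β t = (1 − t z)^(−1/2) and σ t = (1 − t z)^(1/2)

  β σ : ℚ → Series
  β t n = b n ℚ.* pow t n
  σ t = (const 1ℚ - const t * z) * β t

  -- The first-order recurrence of `b` as a differential equation, (1 - t z) θβ = (t/2) z β.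
  θβ : ∀ t → θ (β t) ≈ const t * (z * (θ (β t) + const ½ * β t))
  θβ t .at zero = E.begin
    0ℚ ℚ.* (1ℚ ℚ.* 1ℚ)     E.≡⟨ ℚ.*-zeroʳ t ⟨
    t ℚ.* 0ℚ               E.≡⟨ cong (t ℚ.*_) (z*-zero y) ⟨
    t ℚ.* (z * y) 0        E.∎
    where y = θ (β t) + const ½ * β t
  θβ t .at (suc n) = E.begin
    fromℕ (suc n) ℚ.* (b (suc n) ℚ.* (t ℚ.* pow t n))
      E.≡⟨ Q.solve 4 (λ n b t p → n Q.:* (b Q.:* (t Q.:* p)) Q.:= t Q.:* ((n Q.:* b) Q.:* p)) refl
           (fromℕ (suc n)) (b (suc n)) t (pow t n) ⟩
    t ℚ.* ((fromℕ (suc n) ℚ.* b (suc n)) ℚ.* pow t n)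
      E.≡⟨ cong (λ x → t ℚ.* (x ℚ.* pow t n)) (b-rec n) ⟩
    t ℚ.* ((fromℕ n ℚ.* b n ℚ.+ ½ ℚ.* b n) ℚ.* pow t n)
      E.≡⟨ cong (t ℚ.*_) (Q.solve 3 (λ n b p → (n Q.:* b Q.:+ Q.con ½ Q.:* b) Q.:* p Q.:= n Q.:* (b Q.:* p) Q.:+ Q.con ½ Q.:* (b Q.:* p))
           refl (fromℕ n) (b n) (pow t n)) ⟩
    t ℚ.* (θ (β t) n ℚ.+ ½ ℚ.* β t n)
      E.≡⟨ cong (λ x → t ℚ.* (θ (β t) n ℚ.+ x)) (const-* ½ (β t) n) ⟨
    t ℚ.* y n
      E.≡⟨ cong (t ℚ.*_) (z*-suc y n) ⟨
    t ℚ.* (z * y) (suc n)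
      E.≡⟨ const-* t (z * y) (suc n) ⟨
    (const t * (z * y)) (suc n) E.∎
    where y = θ (β t) + const ½ * β t

  θ-linear : ∀ t → θ (const 1ℚ - const t * z) ≈ - (const t * z)
  θ-linear t = begin
    θ (const 1ℚ - const t * z)                           ≈⟨ θ-+ (const 1ℚ) (- (const t * z)) ⟩
    θ (const 1ℚ) + θ (- (const t * z))                   ≈⟨ +-cong (θ-const 1ℚ) (θ-neg (const t * z)) ⟩
    const 0ℚ - θ (const t * z)                           ≈⟨ +-congˡ (const 0ℚ) (-‿cong (θ-* (const t) z)) ⟩
    const 0ℚ - (θ (const t) * z + const t * θ z)         ≈⟨ +-congˡ (const 0ℚ) (-‿cong (+-cong (*-cong (θ-const t) (≈-refl {z})) (*-cong (≈-refl {const t}) θ-z))) ⟩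
    const 0ℚ - (const 0ℚ * z + const t * z)              ≈⟨ solve 2 (λ t z → con 0ℚ :- (con 0ℚ :* z :+ t :* z) := :- (t :* z)) ≈-refl (const t) z ⟩
    - (const t * z)                                      ∎
    where open ≈-Reasoning

  -- By `θβ` the operator θ annihilates the left side, which is therefore constant.
  β² : ∀ t → β t * β t * (const 1ℚ - const t * z) ≈ const 1ℚ
  β² t = ≈-trans (θ≈0⇒const θ≈0) (pointwise λ { zero → e₀ ; (suc n) → refl })
    where
    open ≈-Reasoning
    B = β t
    T = const t
    L = const 1ℚ - T * z
    e₀ : (B * B * L) 0 ≡ 1ℚ
    e₀ = Q.solve 1 (λ t → Q.con 1ℚ Q.:* (Q.con 1ℚ Q.:- t Q.:* Q.con 0ℚ) Q.:= Q.con 1ℚ) refl t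
    θ≈0 : θ (B * B * L) ≈ const 0ℚ
    θ≈0 = begin
      θ (B * B * L)                                 ≈⟨ θ-* (B * B) L ⟩
      θ (B * B) * L + B * B * θ L                   ≈⟨ +-cong (*-cong (θ-* B B) ≈-refl) (*-cong ≈-refl (θ-linear t)) ⟩
      (θ B * B + B * θ B) * L + B * B * - (T * z)   ≈⟨ correct _ (- (const (1ℚ ℚ.+ 1ℚ) * B)) (θβ t) ⟩
      (θ B * B + B * θ B) * L + B * B * - (T * z) + - (const (1ℚ ℚ.+ 1ℚ) * B) * (θ B - T * (z * (θ B + const ½ * B)))
        ≈⟨ solve 4 (λ B D T z →
             (D :* B :+ B :* D) :* (con 1ℚ :- T :* z) :+ B :* B :* :- (T :* z)
               :+ :- (con (1ℚ ℚ.+ 1ℚ) :* B) :* (D :- T :* (z :* (D :+ con ½ :* B)))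
             := con 0ℚ) ≈-refl B (θ B) T z ⟩
      const 0ℚ ∎

  σ*β : ∀ t → σ t * β t ≈ const 1ℚ
  σ*β t = ≈-trans (solve 2 (λ L B → L :* B :* B := B :* B :* L) ≈-refl (const 1ℚ - const t * z) (β t)) (β² t)

  σ² : ∀ t → σ t * σ t ≈ const 1ℚ - const t * z
  σ² t = ≈-trans (solve 2 (λ L B → L :* B :* (L :* B) := L :* (B :* B :* L)) ≈-refl L (β t))
    (≈-trans (*-cong ≈-refl (β² t)) (*-identityʳ L))
    where L = const 1ℚ - const t * z

  θσ : ∀ t → θ (σ t) ≈ - (const (½ ℚ.* t) * (z * β t))
  θσ t = begin
    θ (L * B)                         ≈⟨ θ-* L B ⟩
    θ L * B + L * θ B                 ≈⟨ +-cong (*-cong (θ-linear t) ≈-refl) ≈-refl ⟩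
    - (T * z) * B + L * θ B           ≈⟨ correct _ (- const 1ℚ) (θβ t) ⟩
    - (T * z) * B + L * θ B + - const 1ℚ * (θ B - T * (z * (θ B + const ½ * B)))
      ≈⟨ solve 4 (λ B D T z → :- (T :* z) :* B :+ (con 1ℚ :- T :* z) :* D
           :+ :- con 1ℚ :* (D :- T :* (z :* (D :+ con ½ :* B))) := :- (con ½ :* T :* (z :* B))) ≈-refl B (θ B) T z ⟩
    - (const ½ * T * (z * B))         ≈⟨ -‿cong (*-cong (≈-trans (pointwise (const-* ½ T)) const-½) ≈-refl) ⟩
    - (const (½ ℚ.* t) * (z * B))     ∎
    where
    open ≈-Reasoning
    B = β t
    T = const t
    L = const 1ℚ - T * z
    const-½ : scale ½ T ≈ const (½ ℚ.* t)
    const-½ .at zero    = refl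
    const-½ .at (suc n) = refl

  ⅓ ⅔ -⅓ 3ℚ 3/2 ⅙ : ℚ
  ⅓   = + 1 / 3
  ⅔   = + 2 / 3
  -⅓  = -[1+ 0 ] / 3
  3ℚ  = + 3 / 1
  3/2 = + 3 / 2
  ⅙   = + 1 / 6

  σ-zero : ∀ t → σ t 0 ≡ 1ℚ
  σ-zero t = Q.solve 1 (λ t → (Q.con 1ℚ Q.:- t Q.:* Q.con 0ℚ) Q.:* Q.con 1ℚ Q.:= Q.con 1ℚ) refl t

  -- `x` is the variable of the generating function of the cₙ. The other two are those roots of
  -- their quadratic equations that are power series, (1 - √(1 - 4x)) / (2x) for `Cat` and (1 - 2x -
  -- √((1 - 6x)(1 + 2x))) / (4x) for `μ`; `tail` performs the division by z.
  x Cat μ : Series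
  x   = const ⅙ * z
  Cat = const 3ℚ * tail (const 1ℚ - σ ⅔)
  μ   = const 3/2 * tail (const 1ℚ - const ⅓ * z - σ 1ℚ * σ -⅓)

  z*Cat : z * Cat ≈ const 3ℚ * (const 1ℚ - σ ⅔)
  z*Cat = ≈-trans (solve 2 (λ z t → z :* (con 3ℚ :* t) := con 3ℚ :* (z :* t)) ≈-refl z (tail (const 1ℚ - σ ⅔)))
    (*-cong ≈-refl (z*tail {const 1ℚ - σ ⅔} (cong (λ y → 1ℚ ℚ.- y) (σ-zero ⅔))))

  -- Multiplied by z² the claim is polynomial in z, z·`Cat` and the square root; `z*Cat` eliminates
  -- the second of these and `σ²` the third.
  Cat-eq : Cat ≈ const 1ℚ + x * (Cat * Cat)
  Cat-eq = z-cancel (z-cancel (begin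
    z * (z * Cat)
      ≈⟨ correct₂ (z * (z * Cat))
           (const ⅙ * z * (z * Cat + const 3ℚ * (const 1ℚ - s)) - z) z*Cat (const 3/2 * z) (σ² ⅔) ⟩
    z * (z * Cat) + (const ⅙ * z * (z * Cat + const 3ℚ * (const 1ℚ - s)) - z) * (z * Cat - const 3ℚ * (const 1ℚ - s))
      + const 3/2 * z * (s * s - (const 1ℚ - const ⅔ * z))
      ≈⟨ solve 3 (λ z C s →
           z :* (z :* C)
             :+ (con ⅙ :* z :* (z :* C :+ con 3ℚ :* (con 1ℚ :- s)) :- z) :* (z :* C :- con 3ℚ :* (con 1ℚ :- s))
             :+ con 3/2 :* z :* (s :* s :- (con 1ℚ :- con ⅔ :* z))
           := z :* (z :* (con 1ℚ :+ con ⅙ :* z :* (C :* C)))) ≈-refl z Cat s ⟩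
    z * (z * (const 1ℚ + x * (Cat * Cat))) ∎))
    where
    open ≈-Reasoning
    s = σ ⅔

  θCat : θ Cat ≈ β ⅔ - Cat
  θCat = z-cancel (begin
    z * θ Cat
      ≈⟨ solve 3 (λ z D C → z :* D := z :* C :+ z :* D :- z :* C) ≈-refl z (θ Cat) Cat ⟩
    z * Cat + z * θ Cat - z * Cat
      ≈⟨ +-cong (+-cong (*-cong (≈-sym θ-z) ≈-refl) ≈-refl) ≈-refl ⟩
    θ z * Cat + z * θ Cat - z * Cat              ≈⟨ +-cong (≈-sym (θ-* z Cat)) ≈-refl ⟩
    θ (z * Cat) - z * Cat                        ≈⟨ +-cong (θ-cong z*Cat) ≈-refl ⟩
    θ (const 3ℚ * (const 1ℚ - σ ⅔)) - z * Cat    ≈⟨ +-cong (θ-* (const 3ℚ) (const 1ℚ - σ ⅔)) ≈-refl ⟩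
    θ (const 3ℚ) * (const 1ℚ - σ ⅔) + const 3ℚ * θ (const 1ℚ - σ ⅔) - z * Cat
      ≈⟨ +-cong (+-cong (*-cong (θ-const 3ℚ) ≈-refl) (*-cong ≈-refl (≈-trans (θ-+ (const 1ℚ) (- σ ⅔))
           (+-cong (θ-const 1ℚ) (≈-trans (θ-neg (σ ⅔)) (-‿cong (θσ ⅔))))))) ≈-refl ⟩
    const 0ℚ * (const 1ℚ - σ ⅔) + const 3ℚ * (const 0ℚ - - (const ⅓ * (z * β ⅔))) - z * Cat
      ≈⟨ solve 4 (λ s z B C → con 0ℚ :* (con 1ℚ :- s) :+ con 3ℚ :* (con 0ℚ :- :- (con ⅓ :* (z :* B))) :- z :* C
           := z :* (B :- C)) ≈-refl (σ ⅔) z (β ⅔) Cat ⟩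
    z * (β ⅔ - Cat) ∎)
    where open ≈-Reasoning

  z*μ : z * μ ≈ const 3/2 * (const 1ℚ - const ⅓ * z - σ 1ℚ * σ -⅓)
  z*μ = ≈-trans (solve 2 (λ z t → z :* (con 3/2 :* t) := con 3/2 :* (z :* t)) ≈-refl z
      (tail (const 1ℚ - const ⅓ * z - σ 1ℚ * σ -⅓)))
    (*-cong ≈-refl (z*tail {const 1ℚ - const ⅓ * z - σ 1ℚ * σ -⅓} refl))

  σσ : σ 1ℚ * σ -⅓ ≈ const 1ℚ - const ⅓ * z - const ⅔ * (z * μ)
  σσ = begin
    s * t
      ≈⟨ correct (s * t) (- const ⅔) z*μ ⟩
    s * t + - const ⅔ * (z * μ - const 3/2 * (const 1ℚ - const ⅓ * z - s * t))
      ≈⟨ solve 4 (λ s t z m → s :* t :+ :- con ⅔ :* (z :* m :- con 3/2 :* (con 1ℚ :- con ⅓ :* z :- s :* t))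
           := con 1ℚ :- con ⅓ :* z :- con ⅔ :* (z :* m)) ≈-refl s t z μ ⟩
    const 1ℚ - const ⅓ * z - const ⅔ * (z * μ) ∎
    where
    open ≈-Reasoning
    s = σ 1ℚ
    t = σ -⅓

  -- The square of `σσ` is (1 - z)(1 + z/3); expanded and divided by a multiple of z, this is the
  -- quadratic equation.
  μ-eq : μ ≈ const ⅓ * (z * (const 1ℚ + μ + μ * μ))
  μ-eq = z-cancel (begin
    z * μ
      ≈⟨ correct₂ (z * μ) (- const (+ 3 / 4) * (s * t + y)) σσ (const (+ 3 / 4) * (t * t)) (σ² 1ℚ) ⟩
    z * μ + - const (+ 3 / 4) * (s * t + y) * (s * t - y) + const (+ 3 / 4) * (t * t) * (s * s - (const 1ℚ - const 1ℚ * z))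
      ≈⟨ correct _ (const (+ 3 / 4) * (const 1ℚ - const 1ℚ * z)) (σ² -⅓) ⟩
    z * μ + - const (+ 3 / 4) * (s * t + y) * (s * t - y) + const (+ 3 / 4) * (t * t) * (s * s - (const 1ℚ - const 1ℚ * z))
      + const (+ 3 / 4) * (const 1ℚ - const 1ℚ * z) * (t * t - (const 1ℚ - const -⅓ * z))
      ≈⟨ solve 4 (λ s t z m →
           let y = con 1ℚ :- con ⅓ :* z :- con ⅔ :* (z :* m) in
           z :* m :+ :- con (+ 3 / 4) :* (s :* t :+ y) :* (s :* t :- y)
             :+ con (+ 3 / 4) :* (t :* t) :* (s :* s :- (con 1ℚ :- con 1ℚ :* z))
             :+ con (+ 3 / 4) :* (con 1ℚ :- con 1ℚ :* z) :* (t :* t :- (con 1ℚ :- con -⅓ :* z))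
           := z :* (con ⅓ :* (z :* (con 1ℚ :+ m :+ m :* m)))) ≈-refl s t z μ ⟩
    z * (const ⅓ * (z * (const 1ℚ + μ + μ * μ))) ∎)
    where
    open ≈-Reasoning
    s = σ 1ℚ
    t = σ -⅓
    y = const 1ℚ - const ⅓ * z - const ⅔ * (z * μ)

-- The generating function and its derivative

module GeneratingFunction where

  open Series
  open ClosedForms
  open import Data.Integer.Base using (+_)
  open import Data.Nat.Base using (z≤n; s≤s)
  import Relation.Binary.Reasoning.Setoid as Setoid-Reasoning

  private
    open SeriesSolver using (solve; con; _:=_; _:+_; _:*_; _:-_; :-_)
    module ≈-Reasoning = Setoid-Reasoning setoid

  -- The coefficient of zⁿ in 1 / (1 − p), for p without constant term, is that
  -- in the iterate approx p (suc n) of y ↦ 1 + p y.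

  approx : Series → ℕ → Series
  approx p zero    = const 0ℚ
  approx p (suc k) = const 1ℚ + p * approx p k

  geometric : Series → Series
  geometric p n = approx p (suc n) n

  *-agree : ∀ d {a b : Series} n → (∀ {k} → k ℕ.≤ n → a k ≡ b k) → (d * a) n ≡ (d * b) n
  *-agree d zero    e = cong (d 0 ℚ.*_) (e z≤n)
  *-agree d (suc n) e = cong₂ ℚ._+_ (cong (d 0 ℚ.*_) (e ℕ.≤-refl))
    (*-agree (tail d) n (λ k≤n → e (ℕ.m≤n⇒m≤1+n k≤n)))

  module _ {p : Series} (p₀ : p 0 ≡ 0ℚ) where

    -- A product with `p`, which has no constant term, consults strictly earlier coefficients only,
    -- so each further iterate of y ↦ 1 + p y fixes one more coefficient.
    p*-agree : ∀ {a b : Series} n → (∀ {k} → k ℕ.< n → a k ≡ b k) → (p * a) n ≡ (p * b) n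
    p*-agree {a} {b} zero e = trans (cong (ℚ._* a 0) p₀) (trans (ℚ.*-zeroˡ (a 0))
      (sym (trans (cong (ℚ._* b 0) p₀) (ℚ.*-zeroˡ (b 0)))))
    p*-agree {a} {b} (suc n) e = cong₂ ℚ._+_
      (trans (cong (ℚ._* a (suc n)) p₀) (trans (ℚ.*-zeroˡ (a (suc n)))
        (sym (trans (cong (ℚ._* b (suc n)) p₀) (ℚ.*-zeroˡ (b (suc n)))))))
      (*-agree (tail p) n (λ k≤n → e (s≤s k≤n)))

    approx-stable : ∀ k {n} → n ℕ.< k → approx p k n ≡ approx p (suc k) n
    approx-stable (suc k) {n} n<k = cong (const 1ℚ n ℚ.+_) (p*-agree n (λ {m} m<n →
      approx-stable k (ℕ.<-≤-trans m<n (ℕ.≤-pred n<k))))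

    approx-geometric : ∀ j n → approx p (j ℕ.+ suc n) n ≡ geometric p n
    approx-geometric zero    n = refl
    approx-geometric (suc j) n = trans (sym (approx-stable (j ℕ.+ suc n) (ℕ.m≤n+m (suc n) j))) (approx-geometric j n)

    geometric-eq : geometric p ≈ const 1ℚ + p * geometric p
    geometric-eq .at n = cong (const 1ℚ n ℚ.+_) (p*-agree n λ {k} k<n →
      trans (cong (λ j → approx p j k) (sym (ℕ.m∸n+n≡m k<n))) (approx-geometric (n ℕ.∸ suc k) k))

    geometric-unique : ∀ {f g} → f ≈ g + p * f → f ≈ g * geometric p
    geometric-unique {f} {g} e = begin
      f
        ≈⟨ correct₂ f (- q) e f geometric-eq ⟩
      f + - q * (f - (g + p * f)) + f * (q - (const 1ℚ + p * q))
        ≈⟨ solve 4 (λ f g p q → f :+ :- q :* (f :- (g :+ p :* f)) :+ f :* (q :- (con 1ℚ :+ p :* q)) := g :* q)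
             ≈-refl f g p q ⟩
      g * q ∎
      where
      open ≈-Reasoning
      q = geometric p

    θ-geometric : θ (geometric p) ≈ geometric p * geometric p * θ p
    θ-geometric = begin
      θ q
        ≈⟨ correct (θ q) (- q) (≈-trans (θ-cong geometric-eq) (≈-trans (θ-+ (const 1ℚ) (p * q))
             (+-cong (θ-const 1ℚ) (θ-* p q)))) ⟩
      θ q + - q * (θ q - (const 0ℚ + (θ p * q + p * θ q)))
        ≈⟨ correct _ (θ q) geometric-eq ⟩
      θ q + - q * (θ q - (const 0ℚ + (θ p * q + p * θ q))) + θ q * (q - (const 1ℚ + p * q))
        ≈⟨ solve 4 (λ D P p q → D :+ :- q :* (D :- (con 0ℚ :+ (P :* q :+ p :* D))) :+ D :* (q :- (con 1ℚ :+ p :* q))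
             := q :* q :* P) ≈-refl (θ q) (θ p) p q ⟩
      q * q * θ p ∎
      where
      open ≈-Reasoning
      q = geometric p

  -- `q` is 1 / (1 - p). In terms of the recurrences, `K` is the series of `C` at h = 0, each
  -- further h multiplies it by `lam`, `τ` is x times the series of `T` at h = 0, and `f` is the
  -- series of the cₙ without its constant term.
  p q K lam τ f : Series
  p   = (Cat * Cat - const 1ℚ) * μ
  q   = geometric p
  K   = Cat * Cat * q
  lam = const 1ℚ + (μ + μ)
  τ   = x * (K * μ)
  f   = (Cat - const 1ℚ) * (const 1ℚ + μ) * q

  p-zero : p 0 ≡ 0ℚ
  p-zero = refl

  q-eq : q ≈ const 1ℚ + p * q
  q-eq = geometric-eq p-zero

  -- θ f is a tame multiple of β 1 = (1 − z)^(−1/2), up to a tame term.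

  h w : Series
  h = (Cat - const 1ℚ) * (Cat * Cat) * (q * q) * μ * β -⅓
  w = θ Cat * ((const 1ℚ + μ) * q * (const 1ℚ + (Cat - const 1ℚ) * q * (const (1ℚ ℚ.+ 1ℚ) * Cat * μ)))

  θ-1+ : ∀ q a → θ (const q + a) ≈ θ a
  θ-1+ q a = ≈-trans (θ-+ (const q) a) (≈-trans (+-cong (θ-const q) (≈-refl {θ a}))
    (solve 1 (λ a → con 0ℚ :+ a := a) ≈-refl (θ a)))

  θ-minus-1 : ∀ a → θ (a - const 1ℚ) ≈ θ a
  θ-minus-1 a = ≈-trans (θ-+ a (- const 1ℚ)) (≈-trans (+-congˡ (θ a) (≈-trans (θ-neg (const 1ℚ)) (-‿cong (θ-const 1ℚ))))
    (solve 1 (λ a → a :- con 0ℚ := a) ≈-refl (θ a)))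

  θμ-eq : θ μ ≈ const 0ℚ * (z * (const 1ℚ + μ + μ * μ))
              + const ⅓ * (z * (const 1ℚ + μ + μ * μ) + z * (θ μ + (θ μ * μ + μ * θ μ)))
  θμ-eq = begin
    θ μ                                        ≈⟨ θ-cong μ-eq ⟩
    θ (const ⅓ * (z * S))                      ≈⟨ θ-* (const ⅓) (z * S) ⟩
    θ (const ⅓) * (z * S) + const ⅓ * θ (z * S)
      ≈⟨ +-cong (*-cong (θ-const ⅓) (≈-refl {z * S})) (*-cong (≈-refl {const ⅓}) (≈-trans (θ-* z S)
           (+-cong (*-cong θ-z (≈-refl {S})) (*-cong (≈-refl {z}) (≈-trans (θ-+ (const 1ℚ + μ) (μ * μ))
             (+-cong (θ-1+ 1ℚ μ) (θ-* μ μ))))))) ⟩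
    const 0ℚ * (z * S) + const ⅓ * (z * S + z * (θ μ + (θ μ * μ + μ * θ μ))) ∎
    where
    open ≈-Reasoning
    S = const 1ℚ + μ + μ * μ

  -- Differentiating the quadratic equation gives θ μ (1 - z/3 - (2/3) z μ) = μ, and the bracket is
  -- the square root of the discriminant by `σσ`.
  θμ*σσ : θ μ * (σ 1ℚ * σ -⅓) ≈ μ
  θμ*σσ = begin
    D * y
      ≈⟨ correct₂ (D * y) (- D) σσ (- const 1ℚ) θμ-eq ⟩
    D * y + - D * (y - (const 1ℚ - const ⅓ * z - const ⅔ * (z * μ)))
      + - const 1ℚ * (D - (const 0ℚ * (z * S) + const ⅓ * (z * S + z * (D + (D * μ + μ * D)))))
      ≈⟨ correct _ (const 1ℚ) μ-eq ⟩
    D * y + - D * (y - (const 1ℚ - const ⅓ * z - const ⅔ * (z * μ)))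
      + - const 1ℚ * (D - (const 0ℚ * (z * S) + const ⅓ * (z * S + z * (D + (D * μ + μ * D)))))
      + const 1ℚ * (μ - const ⅓ * (z * S))
      ≈⟨ solve 4 (λ D y z m → let S = con 1ℚ :+ m :+ m :* m in
           D :* y :+ :- D :* (y :- (con 1ℚ :- con ⅓ :* z :- con ⅔ :* (z :* m)))
             :+ :- con 1ℚ :* (D :- (con 0ℚ :* (z :* S) :+ con ⅓ :* (z :* S :+ z :* (D :+ (D :* m :+ m :* D)))))
             :+ con 1ℚ :* (m :- con ⅓ :* (z :* S)) := m) ≈-refl D y z μ ⟩
    μ ∎
    where
    open ≈-Reasoning
    S = const 1ℚ + μ + μ * μ
    D = θ μ
    y = σ 1ℚ * σ -⅓

  θμ : θ μ ≈ μ * β -⅓ * β 1ℚ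
  θμ = begin
    D
      ≈⟨ solve 1 (λ D → D := D :* con 1ℚ :* con 1ℚ) ≈-refl D ⟩
    D * const 1ℚ * const 1ℚ
      ≈⟨ *-cong (*-cong (≈-refl {D}) (≈-sym (σ*β 1ℚ))) (≈-sym (σ*β -⅓)) ⟩
    D * (σ 1ℚ * β 1ℚ) * (σ -⅓ * β -⅓)
      ≈⟨ solve 5 (λ D s t B B′ → D :* (s :* B) :* (t :* B′) := D :* (s :* t) :* B′ :* B) ≈-refl D (σ 1ℚ) (σ -⅓) (β 1ℚ) (β -⅓) ⟩
    D * (σ 1ℚ * σ -⅓) * β -⅓ * β 1ℚ
      ≈⟨ *-cong (*-cong θμ*σσ (≈-refl {β -⅓})) (≈-refl {β 1ℚ}) ⟩
    μ * β -⅓ * β 1ℚ ∎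
    where
    open ≈-Reasoning
    D = θ μ

  θp : θ p ≈ (θ Cat * Cat + Cat * θ Cat) * μ + (Cat * Cat - const 1ℚ) * θ μ
  θp = ≈-trans (θ-* (Cat * Cat - const 1ℚ) μ) (+-cong (*-cong (≈-trans (θ-minus-1 (Cat * Cat)) (θ-* Cat Cat)) (≈-refl {μ}))
    (≈-refl {(Cat * Cat - const 1ℚ) * θ μ}))

  θf : θ f ≈ h * β 1ℚ + w
  θf = begin
    θ ((Cat - const 1ℚ) * (const 1ℚ + μ) * q)
      ≈⟨ ≈-trans (θ-* ((Cat - const 1ℚ) * (const 1ℚ + μ)) q) (+-cong (*-cong (≈-trans (θ-* (Cat - const 1ℚ) (const 1ℚ + μ))
           (+-cong (*-cong (θ-minus-1 Cat) (≈-refl {const 1ℚ + μ})) (*-cong (≈-refl {Cat - const 1ℚ}) (θ-1+ 1ℚ μ)))) (≈-refl {q}))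
           (*-cong (≈-refl {(Cat - const 1ℚ) * (const 1ℚ + μ)}) (≈-trans (θ-geometric p-zero) (*-cong (≈-refl {q * q}) θp)))) ⟩
    (C′ * (const 1ℚ + μ) + (Cat - const 1ℚ) * D) * q
      + (Cat - const 1ℚ) * (const 1ℚ + μ) * (q * q * ((C′ * Cat + Cat * C′) * μ + (Cat * Cat - const 1ℚ) * D))
      -- With 1/q = 1 - (C² - 1) μ, the coefficient (C - 1) q + (C - 1)(1 + μ)(C² - 1) q² of θ μ
      -- collapses to (C - 1) C² q².
      ≈⟨ correct _ ((Cat - const 1ℚ) * D * q) q-eq ⟩
    (C′ * (const 1ℚ + μ) + (Cat - const 1ℚ) * D) * q
      + (Cat - const 1ℚ) * (const 1ℚ + μ) * (q * q * ((C′ * Cat + Cat * C′) * μ + (Cat * Cat - const 1ℚ) * D))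
      + (Cat - const 1ℚ) * D * q * (q - (const 1ℚ + (Cat * Cat - const 1ℚ) * μ * q))
      ≈⟨ solve 5 (λ C C′ m D q →
           (C′ :* (con 1ℚ :+ m) :+ (C :- con 1ℚ) :* D) :* q
             :+ (C :- con 1ℚ) :* (con 1ℚ :+ m) :* (q :* q :* ((C′ :* C :+ C :* C′) :* m :+ (C :* C :- con 1ℚ) :* D))
             :+ (C :- con 1ℚ) :* D :* q :* (q :- (con 1ℚ :+ (C :* C :- con 1ℚ) :* m :* q))
           := (C :- con 1ℚ) :* (C :* C) :* (q :* q) :* D
             :+ C′ :* ((con 1ℚ :+ m) :* q :* (con 1ℚ :+ (C :- con 1ℚ) :* q :* (con (1ℚ ℚ.+ 1ℚ) :* C :* m)))) ≈-refl
           Cat C′ μ D q ⟩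
    (Cat - const 1ℚ) * (Cat * Cat) * (q * q) * D + w
      ≈⟨ +-cong (≈-trans (*-cong (≈-refl {(Cat - const 1ℚ) * (Cat * Cat) * (q * q)}) θμ)
           (solve 4 (λ a m B′ B → a :* (m :* B′ :* B) := a :* m :* B′ :* B) ≈-refl
             ((Cat - const 1ℚ) * (Cat * Cat) * (q * q)) μ (β -⅓) (β 1ℚ))) (≈-refl {w}) ⟩
    h * β 1ℚ + w ∎
    where
    open ≈-Reasoning
    C′ = θ Cat
    D = θ μ

-- The recurrences solved by power series

module Coefficients where

  open Series
  open ClosedForms
  open GeneratingFunction
  open Recurrences
  open import Data.Rational.Solver using (module +-*-Solver)
  import Relation.Binary.Reasoning.Setoid as Setoid-Reasoning
  open RationalSequences using (fromℕ; fromℕ-suc)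

  private
    open SeriesSolver using (solve; con; _:=_; _:+_; _:*_; _:-_; :-_)
    module ≈-Reasoning = Setoid-Reasoning setoid
    module Q = +-*-Solver
    2ℚ = 1ℚ ℚ.+ 1ℚ

  fromℕ-+ : ∀ m n → fromℕ (m ℕ.+ n) ≡ fromℕ m ℚ.+ fromℕ n
  fromℕ-+ zero    n = sym (ℚ.+-identityˡ (fromℕ n))
  fromℕ-+ (suc m) n = trans (fromℕ-suc (m ℕ.+ n)) (trans (cong (ℚ._+ 1ℚ) (fromℕ-+ m n))
    (trans (Q.solve 2 (λ m n → (m Q.:+ n) Q.:+ Q.con 1ℚ Q.:= (m Q.:+ Q.con 1ℚ) Q.:+ n) refl (fromℕ m) (fromℕ n))
      (cong (ℚ._+ fromℕ n) (sym (fromℕ-suc m)))))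

  -- `Cat^ k` solves the homogeneous recurrence H(k+1) = H(k) + x H(k+2), `S k` is (`Cat^ k` - 1) /
  -- x written without a division, and `H` adds the response to the constant term τ. `Lam` is
  -- geometric because C(h+1) = C(h) + 2 T(h) with T(h) = μ C(h).
  Cat^ S H Lam N̂ : ℕ → Series
  Cat^ zero    = const 1ℚ
  Cat^ (suc k) = Cat * Cat^ k
  S zero       = const 0ℚ
  S (suc k)    = S k + Cat^ (2 ℕ.+ k)
  H k          = Cat^ k + τ * S k
  Lam zero     = K
  Lam (suc h)  = Lam h * lam
  N̂ k          = x * H (2 ℕ.+ k) + τ

  -- A geometric sum: x `Cat`² = `Cat` - 1 makes consecutive terms telescope.
  x*S : ∀ k → x * S k + const 1ℚ ≈ Cat^ k
  x*S zero    = solve 1 (λ x → x :* con 0ℚ :+ con 1ℚ := con 1ℚ) ≈-refl x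
  x*S (suc k) = begin
    x * (S k + Cat * (Cat * Cat^ k)) + const 1ℚ
      ≈⟨ correct₂ _ (- const 1ℚ) (x*S k) (Cat^ k) Cat-eq ⟩
    x * (S k + Cat * (Cat * Cat^ k)) + const 1ℚ + - const 1ℚ * (x * S k + const 1ℚ - Cat^ k)
      + Cat^ k * (Cat - (const 1ℚ + x * (Cat * Cat)))
      ≈⟨ solve 4 (λ x s C c → x :* (s :+ C :* (C :* c)) :+ con 1ℚ :+ :- con 1ℚ :* (x :* s :+ con 1ℚ :- c)
           :+ c :* (C :- (con 1ℚ :+ x :* (C :* C))) := C :* c) ≈-refl x (S k) Cat (Cat^ k) ⟩
    Cat * Cat^ k ∎
    where open ≈-Reasoning

  H-rec : ∀ k → H (suc k) ≈ H k + (x * H (2 ℕ.+ k) + τ)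
  H-rec k = begin
    Cat * c + τ * (s + Cat * (Cat * c))
      ≈⟨ correct₂ _ (- c) Cat-eq τ (x*S (2 ℕ.+ k)) ⟩
    Cat * c + τ * (s + Cat * (Cat * c)) + - c * (Cat - (const 1ℚ + x * (Cat * Cat)))
      + τ * (x * (s + Cat * (Cat * c) + Cat * (Cat * (Cat * c))) + const 1ℚ - Cat * (Cat * c))
      ≈⟨ solve 5 (λ x s C c t →
           C :* c :+ t :* (s :+ C :* (C :* c)) :+ :- c :* (C :- (con 1ℚ :+ x :* (C :* C)))
             :+ t :* (x :* (s :+ C :* (C :* c) :+ C :* (C :* (C :* c))) :+ con 1ℚ :- C :* (C :* c))
           := (c :+ t :* s) :+ (x :* (C :* (C :* c) :+ t :* (s :+ C :* (C :* c) :+ C :* (C :* (C :* c)))) :+ t))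
           ≈-refl x s Cat c τ ⟩
    H k + (x * H (2 ℕ.+ k) + τ) ∎
    where
    open ≈-Reasoning
    c = Cat^ k
    s = S k

  H₀ : H 0 ≈ const 1ℚ
  H₀ = solve 1 (λ t → con 1ℚ :+ t :* con 0ℚ := con 1ℚ) ≈-refl τ

  H₁ : H 1 ≈ const 1ℚ + N̂ 0
  H₁ = ≈-trans (H-rec 0) (+-cong H₀ (≈-refl {N̂ 0}))

  H₁≈1+f : H 1 ≈ const 1ℚ + f
  H₁≈1+f = begin
    Cat * const 1ℚ + x * (Cat * Cat * q * μ) * (const 0ℚ + Cat * (Cat * const 1ℚ))
      ≈⟨ correct₂ _ (Cat * Cat * q * μ) Cat-eq (Cat - const 1ℚ) q-eq ⟩
    Cat * const 1ℚ + x * (Cat * Cat * q * μ) * (const 0ℚ + Cat * (Cat * const 1ℚ))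
      + Cat * Cat * q * μ * (Cat - (const 1ℚ + x * (Cat * Cat)))
      + (Cat - const 1ℚ) * (q - (const 1ℚ + p * q))
      ≈⟨ solve 4 (λ x C q m →
           C :* con 1ℚ :+ x :* (C :* C :* q :* m) :* (con 0ℚ :+ C :* (C :* con 1ℚ))
             :+ C :* C :* q :* m :* (C :- (con 1ℚ :+ x :* (C :* C)))
             :+ (C :- con 1ℚ) :* (q :- (con 1ℚ :+ (C :* C :- con 1ℚ) :* m :* q))
           := con 1ℚ :+ (C :- con 1ℚ) :* (con 1ℚ :+ m) :* q) ≈-refl x Cat q μ ⟩
    const 1ℚ + f ∎
    where open ≈-Reasoning

  -- This is what determines `K`: the recurrence expresses it through τ, which contains `K` itself.
  -- Solving K = C² + τ (C² + C³) with x C² = C - 1 produces the denominator 1 - (C² - 1) μ.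
  K≈H₂ : K ≈ H 2
  K≈H₂ = begin
    Cat * Cat * q
      ≈⟨ correct₂ _ (- (Cat * Cat)) q-eq (- (Cat * Cat * q * μ * (Cat + const 1ℚ))) Cat-eq ⟩
    Cat * Cat * q + - (Cat * Cat) * (q - (const 1ℚ + p * q))
      + - (Cat * Cat * q * μ * (Cat + const 1ℚ)) * (Cat - (const 1ℚ + x * (Cat * Cat)))
      ≈⟨ solve 4 (λ x C q m →
           C :* C :* q :+ :- (C :* C) :* (q :- (con 1ℚ :+ (C :* C :- con 1ℚ) :* m :* q))
             :+ :- (C :* C :* q :* m :* (C :+ con 1ℚ)) :* (C :- (con 1ℚ :+ x :* (C :* C)))
           := C :* (C :* con 1ℚ) :+ x :* (C :* C :* q :* m) :* (con 0ℚ :+ C :* (C :* con 1ℚ) :+ C :* (C :* (C :* con 1ℚ))))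
           ≈-refl x Cat q μ ⟩
    H 2 ∎
    where open ≈-Reasoning

  -- The origin of the equation for μ: inserting T = μ Lam, E = (2 + μ) Lam and the ratio 1 + 2μ
  -- into T(h) = x (E(h) + T(h+1)) leaves μ = 2x (1 + μ + μ²).
  T̂ : ∀ h → Lam h * μ ≈ x * (Lam h * (const 2ℚ + μ) + Lam (suc h) * μ)
  T̂ h = begin
    l * μ
      ≈⟨ correct _ (- l) μ-eq ⟩
    l * μ + - l * (μ - const ⅓ * (z * (const 1ℚ + μ + μ * μ)))
      ≈⟨ solve 3 (λ z l m → l :* m :+ :- l :* (m :- con ⅓ :* (z :* (con 1ℚ :+ m :+ m :* m)))
           := con ⅙ :* z :* (l :* (con 2ℚ :+ m) :+ l :* (con 1ℚ :+ (m :+ m)) :* m)) ≈-refl z l μ ⟩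
    x * (Lam h * (const 2ℚ + μ) + Lam (suc h) * μ) ∎
    where
    open ≈-Reasoning
    l = Lam h

  Ĉ : ∀ h → Lam (suc h) ≈ Lam h * (const 1ℚ + μ) + Lam h * μ
  Ĉ h = solve 2 (λ l m → l :* (con 1ℚ :+ (m :+ m)) := l :* (con 1ℚ :+ m) :+ l :* m) ≈-refl (Lam h) μ

  Â : ∀ h → Lam h * (const 1ℚ + μ) ≈ Lam h + Lam h * μ
  Â h = solve 2 (λ l m → l :* (con 1ℚ :+ m) := l :+ l :* m) ≈-refl (Lam h) μ

  Ê : ∀ h → Lam h * (const 2ℚ + μ) ≈ Lam h * (const 1ℚ + μ) + Lam h
  Ê h = solve 2 (λ l m → l :* (con 2ℚ :+ m) := l :* (con 1ℚ :+ m) :+ l) ≈-refl (Lam h) μ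

  x*-zero : ∀ a → (x * a) 0 ≡ 0ℚ
  x*-zero a = ℚ.*-zeroˡ (a 0)

  x*-suc : ∀ a n → (x * a) (suc n) ≡ ⅙ ℚ.* a n
  x*-suc a n = trans (at (*-assoc (const ⅙) z a) (suc n))
    (trans (const-* ⅙ (z * a) (suc n)) (cong (⅙ ℚ.*_) (z*-suc a n)))

  -- The normalisation under which the series have radius of convergence 1.

  norm : ℕ → ℕ → ℚ
  norm v ℓ = fromℕ v ℚ.* pow ⅙ ℓ

  norm-+ : ∀ u v ℓ → norm (u ℕ.+ v) ℓ ≡ norm u ℓ ℚ.+ norm v ℓ
  norm-+ u v ℓ = trans (cong (ℚ._* pow ⅙ ℓ) (fromℕ-+ u v)) (ℚ.*-distribʳ-+ (pow ⅙ ℓ) (fromℕ u) (fromℕ v))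

  norm-suc : ∀ v ℓ → norm v (suc ℓ) ≡ ⅙ ℚ.* norm v ℓ
  norm-suc v ℓ = Q.solve 3 (λ v s p → v Q.:* (s Q.:* p) Q.:= s Q.:* (v Q.:* p)) refl (fromℕ v) ⅙ (pow ⅙ ℓ)

  sum-norm : ∀ u v ℓ {a b} → norm u ℓ ≡ a → norm v ℓ ≡ b → norm (u ℕ.+ v) ℓ ≡ a ℚ.+ b
  sum-norm u v ℓ eu ev = trans (norm-+ u v ℓ) (cong₂ ℚ._+_ eu ev)

  -- A mutual induction in which only `T` and `N` lower ℓ, each time with a factor x = z/6; the
  -- other equations relate series at the same ℓ.
  norm-A₀ : ∀ ℓ → norm (A 0 ℓ) ℓ ≡ H 1 ℓ
  norm-A : ∀ h ℓ → norm (A (suc h) ℓ) ℓ ≡ (Lam h * (const 1ℚ + μ)) ℓ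
  norm-C : ∀ h ℓ → norm (C h ℓ) ℓ ≡ Lam h ℓ
  norm-E : ∀ h ℓ → norm (E h ℓ) ℓ ≡ (Lam h * (const 2ℚ + μ)) ℓ
  norm-T : ∀ h ℓ → norm (T h ℓ) ℓ ≡ (Lam h * μ) ℓ
  norm-G : ∀ k ℓ → norm (G k ℓ) ℓ ≡ H (2 ℕ.+ k) ℓ
  norm-N : ∀ k ℓ → norm (N k ℓ) ℓ ≡ N̂ k ℓ

  norm-A₀ zero    = sym (trans (at H₁ 0) (cong (1ℚ ℚ.+_) (cong₂ ℚ._+_ (x*-zero (H 2)) (x*-zero (K * μ)))))
  norm-A₀ (suc ℓ) = trans (norm-N 0 (suc ℓ)) (sym (trans (at H₁ (suc ℓ)) (ℚ.+-identityˡ (N̂ 0 (suc ℓ)))))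

  norm-A h ℓ = trans (sum-norm (C h ℓ) (T h ℓ) ℓ (norm-C h ℓ) (norm-T h ℓ)) (sym (at (Â h) ℓ))

  norm-C zero    ℓ = trans (sum-norm (A 0 ℓ) (N 1 ℓ) ℓ (norm-A₀ ℓ) (norm-N 1 ℓ))
    (trans (sym (at (H-rec 1) ℓ)) (sym (at K≈H₂ ℓ)))
  norm-C (suc h) ℓ = trans (sum-norm (A (suc h) ℓ) (T h ℓ) ℓ (norm-A h ℓ) (norm-T h ℓ)) (sym (at (Ĉ h) ℓ))

  norm-E h ℓ = trans (sum-norm (A (suc h) ℓ) (C h ℓ) ℓ (norm-A h ℓ) (norm-C h ℓ)) (sym (at (Ê h) ℓ))

  norm-T h zero    = sym (trans (at (T̂ h) 0) (x*-zero (Lam h * (const 2ℚ + μ) + Lam (suc h) * μ)))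
  norm-T h (suc ℓ) = trans (norm-suc (T h (suc ℓ)) ℓ) (trans
    (cong (⅙ ℚ.*_) (sum-norm (E h ℓ) (T (suc h) ℓ) ℓ (norm-E h ℓ) (norm-T (suc h) ℓ)))
    (sym (trans (at (T̂ h) (suc ℓ)) (x*-suc (Lam h * (const 2ℚ + μ) + Lam (suc h) * μ) ℓ))))

  norm-G zero    ℓ = trans (sum-norm (A 0 ℓ) (N 1 ℓ) ℓ (norm-A₀ ℓ) (norm-N 1 ℓ)) (sym (at (H-rec 1) ℓ))
  norm-G (suc k) ℓ = trans (sum-norm (G k ℓ) (N (2 ℕ.+ k) ℓ) ℓ (norm-G k ℓ) (norm-N (2 ℕ.+ k) ℓ))
    (sym (at (H-rec (2 ℕ.+ k)) ℓ))

  norm-N k zero    = sym (cong₂ ℚ._+_ (x*-zero (H (2 ℕ.+ k))) (x*-zero (K * μ)))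
  norm-N k (suc ℓ) = trans (norm-suc (N k (suc ℓ)) ℓ) (trans
    (cong (⅙ ℚ.*_) (sum-norm (G k ℓ) (T 0 ℓ) ℓ (norm-G k ℓ) (norm-T 0 ℓ)))
    (trans (ℚ.*-distribˡ-+ ⅙ (H (2 ℕ.+ k) ℓ) ((K * μ) ℓ))
      (sym (cong₂ ℚ._+_ (x*-suc (H (2 ℕ.+ k)) ℓ) (x*-suc (K * μ) ℓ)))))

  norm-f : ∀ n → norm (A 0 (suc n)) (suc n) ≡ f (suc n)
  norm-f n = trans (norm-A₀ (suc n)) (trans (at H₁≈1+f (suc n)) (ℚ.+-identityˡ (f (suc n))))

-- Null and bounded functions along a filter

module Limits where

  open import Data.Rational.Base
  open import Data.Rational.Properties
  open import Data.Rational.Solver using (module +-*-Solver)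
  open import Defs using (Eventually)
  open RationalSequences using (0<*; 0<½; 0<1; ½+½; *-mono-≤; divide)
  open +-*-Solver

  private variable
    p q r s ε : ℚ

  ≤+ : ∀ p {r} → 0ℚ ≤ r → p ≤ p + r
  ≤+ p 0≤r = subst (_≤ p + _) (+-identityʳ p) (+-monoʳ-≤ p 0≤r)

  *-≤ˡ : 0ℚ ≤ r → p ≤ q → r * p ≤ r * q
  *-≤ˡ {r} 0≤r = *-monoˡ-≤-nonNeg r {{nonNegative 0≤r}}

  *-≤ʳ : 0ℚ ≤ r → p ≤ q → p * r ≤ q * r
  *-≤ʳ {r} 0≤r = *-monoʳ-≤-nonNeg r {{nonNegative 0≤r}}

  ∣∣-*-≤ : ∀ p q → ∣ p ∣ ≤ r → ∣ q ∣ ≤ s → ∣ p * q ∣ ≤ r * s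
  ∣∣-*-≤ p q p≤ q≤ = ≤-trans (≤-reflexive (∣p*q∣≡∣p∣*∣q∣ p q)) (*-mono-≤ (0≤∣p∣ p) p≤ (0≤∣p∣ q) q≤)

  ∣∣-+-≤ : ∀ p q → ∣ p ∣ ≤ r → ∣ q ∣ ≤ s → ∣ p + q ∣ ≤ r + s
  ∣∣-+-≤ p q p≤ q≤ = ≤-trans (∣p+q∣≤∣p∣+∣q∣ p q) (+-mono-≤ p≤ q≤)

  -- The calculus of null functions needs only these closure properties of "eventually", so it
  -- serves both for sequences and for the iterated limit.
  record Filter (I : Set) : Set₁ where
    field
      Ev     : (I → Set) → Set
      always : ∀ {P} → (∀ i → P i) → Ev P
      map    : ∀ {P Q : I → Set} → (∀ i → P i → Q i) → Ev P → Ev Q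
      both   : ∀ {P Q} → Ev P → Ev Q → Ev (λ i → P i × Q i)

  module Null {I : Set} (F : Filter I) where

    open Filter F

    infix 4 _~_

    Null Bounded : (I → ℚ) → Set
    Null a    = ∀ ε → 0ℚ < ε → Ev (λ i → ∣ a i ∣ ≤ ε)
    Bounded a = ∃[ B ] 0ℚ < B × Ev (λ i → ∣ a i ∣ ≤ B)

    record _~_ (a b : I → ℚ) : Set where
      constructor near
      field null : Null (λ i → a i - b i)

    open _~_ public

    private variable
      a a′ b b′ c : I → ℚ

    abstract

      both-map : ∀ {P Q R : I → Set} → (∀ i → P i → Q i → R i) → Ev P → Ev Q → Ev R
      both-map f e e′ = map (λ i (p , q) → f i p q) (both e e′)

      null-≤ : ∀ {K} → 0ℚ < K → Ev (λ i → ∣ a i ∣ ≤ K * ∣ b i ∣) → Null b → Null a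
      null-≤ {a} {b} {K} 0<K a≤ nb ε 0<ε with divide 0<K 0<ε
      ... | δ , 0<δ , Kδ≡ε = both-map (λ i h k → ≤-trans h (≤-trans (*-≤ˡ (<⇒≤ 0<K) k) (≤-reflexive Kδ≡ε))) a≤ (nb δ 0<δ)

      null-≡ : (∀ i → a i ≡ b i) → Null b → Null a
      null-≡ e n ε 0<ε = map (λ i → subst (λ x → ∣ x ∣ ≤ ε) (sym (e i))) (n ε 0<ε)

      null-0 : Null (λ _ → 0ℚ)
      null-0 ε 0<ε = always λ _ → <⇒≤ 0<ε

      null-neg : Null a → Null (λ i → - a i)
      null-neg {a} n ε 0<ε = map (λ i → subst (_≤ ε) (sym (∣-p∣≡∣p∣ (a i)))) (n ε 0<ε)

      null-+ : Null a → Null b → Null (λ i → a i + b i)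
      null-+ {a} {b} na nb ε 0<ε = both-map
        (λ i h k → subst (∣ a i + b i ∣ ≤_) (½+½ ε) (∣∣-+-≤ (a i) (b i) h k))
        (na (½ * ε) (0<* 0<½ 0<ε)) (nb (½ * ε) (0<* 0<½ 0<ε))

      null-* : Bounded a → Null b → Null (λ i → a i * b i)
      null-* {a} {b} (B , 0<B , a≤B) nb = null-≤ 0<B (map
        (λ i h → ∣∣-*-≤ (a i) (b i) h ≤-refl) a≤B) nb

      bounded-const : ∀ q → Bounded (λ _ → q)
      bounded-const q = 1ℚ + ∣ q ∣ , <-≤-trans 0<1 (≤+ 1ℚ (0≤∣p∣ q)) , always λ _ →
        ≤-trans (≤+ ∣ q ∣ (<⇒≤ 0<1)) (≤-reflexive (+-comm ∣ q ∣ 1ℚ))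

      bounded-+ : Bounded a → Bounded b → Bounded (λ i → a i + b i)
      bounded-+ {a} {b} (A , 0<A , a≤) (B , 0<B , b≤) =
        A + B , +-mono-< 0<A 0<B , both-map (λ i → ∣∣-+-≤ (a i) (b i)) a≤ b≤

      bounded-* : Bounded a → Bounded b → Bounded (λ i → a i * b i)
      bounded-* {a} {b} (A , 0<A , a≤) (B , 0<B , b≤) =
        A * B , 0<* 0<A 0<B , both-map (λ i → ∣∣-*-≤ (a i) (b i)) a≤ b≤

      bounded-neg : Bounded a → Bounded (λ i → - a i)
      bounded-neg {a} (A , 0<A , a≤) = A , 0<A , map (λ i → subst (_≤ A) (sym (∣-p∣≡∣p∣ (a i)))) a≤

      bounded-~ : a ~ b → Bounded b → Bounded a
      bounded-~ {a} {b} (near n) (B , 0<B , b≤) = 1ℚ + B , +-mono-< 0<1 0<B ,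
        both-map (λ i h k → subst (λ x → ∣ x ∣ ≤ 1ℚ + B) (solve 2 (λ a b → (a :- b) :+ b := a) refl (a i) (b i))
          (∣∣-+-≤ (a i - b i) (b i) h k)) (n 1ℚ 0<1) b≤

      ~-refl : a ~ a
      ~-refl {a} = near (null-≡ (λ i → +-inverseʳ (a i)) null-0)

      ~-≡ : (∀ i → a i ≡ b i) → a ~ b
      ~-≡ {a} {b} e = near (null-≡ (λ i → trans (cong (_- b i) (e i)) (+-inverseʳ (b i))) null-0)

      ~-sym : a ~ b → b ~ a
      ~-sym {a} {b} (near n) = near (null-≡ (λ i → solve 2 (λ a b → b :- a := :- (a :- b)) refl (a i) (b i)) (null-neg n))

      ~-trans : a ~ b → b ~ c → a ~ c
      ~-trans {a} {b} {c} (near m) (near n) = near (null-≡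
        (λ i → solve 3 (λ a b c → a :- c := (a :- b) :+ (b :- c)) refl (a i) (b i) (c i)) (null-+ m n))

      ~-+ : a ~ a′ → b ~ b′ → (λ i → a i + b i) ~ (λ i → a′ i + b′ i)
      ~-+ {a} {a′} {b} {b′} (near m) (near n) = near (null-≡
        (λ i → solve 4 (λ a a′ b b′ → (a :+ b) :- (a′ :+ b′) := (a :- a′) :+ (b :- b′)) refl (a i) (a′ i) (b i) (b′ i))
        (null-+ m n))

      ~-* : Bounded a → Bounded b′ → a ~ a′ → b ~ b′ → (λ i → a i * b i) ~ (λ i → a′ i * b′ i)
      ~-* {a} {b′} {a′} {b} ba bb′ (near m) (near n) = near (null-≡
        (λ i → solve 4 (λ a a′ b b′ → a :* b :- a′ :* b′ := a :* (b :- b′) :+ b′ :* (a :- a′)) refl (a i) (a′ i) (b i) (b′ i))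
        (null-+ (null-* ba n) (null-* bb′ m)))

  sequences : Filter ℕ
  sequences = record
    { Ev     = Eventually
    ; always = λ h → 0 , λ n _ → h n
    ; map    = λ f (N , h) → N , λ n N≤n → f n (h n N≤n)
    ; both   = λ (M , h) (N , k) → M ℕ.⊔ N , λ n le →
                 h n (ℕ.m⊔n≤o⇒m≤o M N le) , k n (ℕ.m⊔n≤o⇒n≤o M N le) }

  -- First n, then m depending on n, is taken large.

  iterated : Filter (ℕ × ℕ)
  iterated = record
    { Ev     = λ P → Eventually (λ n → Eventually (λ m → P (n , m)))
    ; always = λ h → 0 , λ n _ → 0 , λ m _ → h (n , m)
    ; map    = λ f (N , h) → N , λ n N≤n → let M , k = h n N≤n in M , λ m M≤m → f (n , m) (k m M≤m)
    ; both   = λ (M , h) (N , k) → M ℕ.⊔ N , λ n le →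
                 let M′ , h′ = h n (ℕ.m⊔n≤o⇒m≤o M N le)
                     N′ , k′ = k n (ℕ.m⊔n≤o⇒n≤o M N le)
                 in M′ ℕ.⊔ N′ , λ m le′ → h′ m (ℕ.m⊔n≤o⇒m≤o M′ N′ le′) , k′ m (ℕ.m⊔n≤o⇒n≤o M′ N′ le′) }

-- Tame series and their values at 1

module TameSeries where

  open Limits
  private module S = Series
  open Series using (Series; tail; const; shift; z; θ; θ-*; θ-+; θ-neg; θ-tail; _≈_; at; pointwise; *-comm′)
  open import Data.Rational.Base
  open import Data.Rational.Properties
  open import Data.Rational.Solver using (module +-*-Solver)
  open RationalSequences using (0<*; 0≤*; 0<½; 0<1; ½+½; *-mono-≤; divide; fromℕ)
  open +-*-Solver
  open Null sequences public

  private variable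
    a a′ b b′ : Series
    ε : ℚ

  abs : Series → Series
  abs a n = ∣ a n ∣

  drop : ℕ → Series → Series
  drop zero    a = a
  drop (suc N) a = drop N (tail a)

  drop-at : ∀ N a n → drop N a n ≡ a (N ℕ.+ n)
  drop-at zero    a n = refl
  drop-at (suc N) a n = drop-at N (tail a) n

  -- sum a n = a 0 + ⋯ + a (n − 1)

  sum : Series → ℕ → ℚ
  sum a zero    = 0ℚ
  sum a (suc n) = a 0 + sum (tail a) n

  sum-cong : (∀ n → a n ≡ b n) → ∀ n → sum a n ≡ sum b n
  sum-cong e zero    = refl
  sum-cong e (suc n) = cong₂ _+_ (e 0) (sum-cong (λ k → e (suc k)) n)

  sum-mono : (∀ n → a n ≤ b n) → ∀ n → sum a n ≤ sum b n
  sum-mono h zero    = ≤-refl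
  sum-mono h (suc n) = +-mono-≤ (h 0) (sum-mono (λ k → h (suc k)) n)

  sum-mono-< : ∀ n → (∀ k → k ℕ.< n → a k ≤ b k) → sum a n ≤ sum b n
  sum-mono-< zero    h = ≤-refl
  sum-mono-< (suc n) h = +-mono-≤ (h 0 (ℕ.s≤s ℕ.z≤n)) (sum-mono-< n (λ k k<n → h (suc k) (ℕ.s≤s k<n)))

  sum-≥0 : (∀ n → 0ℚ ≤ a n) → ∀ n → 0ℚ ≤ sum a n
  sum-≥0 h zero    = ≤-refl
  sum-≥0 h (suc n) = +-mono-≤ (h 0) (sum-≥0 (λ k → h (suc k)) n)

  sum-split : ∀ a m n → sum a (m ℕ.+ n) ≡ sum a m + sum (drop m a) n
  sum-split a zero    n = sym (+-identityˡ (sum a n))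
  sum-split a (suc m) n = trans (cong (a 0 +_) (sum-split (tail a) m n)) (sym (+-assoc (a 0) (sum (tail a) m) _))

  sum-snoc : ∀ a n → sum a (suc n) ≡ sum a n + a n
  sum-snoc a zero    = trans (+-identityʳ (a 0)) (sym (+-identityˡ (a 0)))
  sum-snoc a (suc n) = trans (cong (a 0 +_) (sum-snoc (tail a) n)) (sym (+-assoc (a 0) (sum (tail a) n) (a (suc n))))

  sum-+ : ∀ a b n → sum (a S.+ b) n ≡ sum a n + sum b n
  sum-+ a b zero    = refl
  sum-+ a b (suc n) = trans (cong (a 0 + b 0 +_) (sum-+ (tail a) (tail b) n))
    (solve 4 (λ a b s t → (a :+ b) :+ (s :+ t) := (a :+ s) :+ (b :+ t)) refl (a 0) (b 0) (sum (tail a) n) (sum (tail b) n))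

  sum-scale : ∀ q a n → sum (λ k → q * a k) n ≡ q * sum a n
  sum-scale q a zero    = sym (*-zeroʳ q)
  sum-scale q a (suc n) = trans (cong (q * a 0 +_) (sum-scale q (tail a) n)) (sym (*-distribˡ-+ q (a 0) (sum (tail a) n)))

  sum-tail-const : ∀ q n → sum (tail (const q)) n ≡ 0ℚ
  sum-tail-const q zero    = refl
  sum-tail-const q (suc n) = trans (+-identityˡ _) (sum-tail-const q n)

  sum-increasing : (∀ n → 0ℚ ≤ a n) → ∀ {m n} → m ℕ.≤ n → sum a m ≤ sum a n
  sum-increasing {a} h {m} {n} m≤n with ℕ.m≤n⇒∃[o]m+o≡n m≤n
  ... | o , refl = ≤-trans (≤+ (sum a m) (sum-≥0 (λ k → subst (0ℚ ≤_) (sym (drop-at m a k)) (h (m ℕ.+ k))) o))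
    (≤-reflexive (sym (sum-split a m o)))

  ∣sum∣ : ∀ a n → ∣ sum a n ∣ ≤ sum (abs a) n
  ∣sum∣ a zero    = ≤-refl
  ∣sum∣ a (suc n) = ∣∣-+-≤ (a 0) (sum (tail a) n) ≤-refl (∣sum∣ (tail a) n)

  -- Absolute convergence without naming the sum: one bound for the tail, uniform in the number of
  -- terms.
  Summable : Series → Set
  Summable a = ∀ ε → 0ℚ < ε → ∃[ N ] ∀ m → sum (abs (drop N a)) m ≤ ε

  module _ (s : Summable a) where

    summable-bound : ∃[ B ] 0ℚ < B × (∀ m → sum (abs a) m ≤ B)
    summable-bound with s 1ℚ 0<1
    ... | N , h = 1ℚ + sum (abs a) N , <-≤-trans 0<1 (≤+ 1ℚ (sum-≥0 (λ n → 0≤∣p∣ (a n)) N)) , λ m → ≤-trans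
      (sum-increasing {abs a} (λ n → 0≤∣p∣ (a n)) (ℕ.m≤n+m m N))
      (≤-trans (≤-reflexive (trans (sum-split (abs a) N m) (+-comm (sum (abs a) N) _)))
        (+-monoˡ-≤ (sum (abs a) N) (≤-trans (≤-reflexive (sum-cong (drop-abs N a) m)) (h m))))
      where
      drop-abs : ∀ N a n → drop N (abs a) n ≡ abs (drop N a) n
      drop-abs N a n = trans (drop-at N (abs a) n) (cong ∣_∣ (sym (drop-at N a n)))

  tail-sums : ∀ N {M} a m → N ℕ.≤ M → (∀ m → sum (abs (drop N a)) m ≤ ε) → sum (abs (drop M a)) m ≤ ε
  tail-sums N a m N≤M h with ℕ.m≤n⇒∃[o]m+o≡n N≤M
  ... | o , refl = ≤-trans (≤-reflexive (sum-cong (λ k → cong ∣_∣ (trans (drop-at (N ℕ.+ o) a k)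
          (trans (cong a (ℕ.+-assoc N o k)) (trans (sym (drop-at N a (o ℕ.+ k))) (sym (drop-at o (drop N a) k)))))) m))
    (≤-trans (≤-trans (≤+ _ (sum-≥0 (λ k → 0≤∣p∣ (drop N a k)) o))
      (≤-reflexive (trans (+-comm _ (sum (abs (drop N a)) o))
        (trans (cong (sum (abs (drop N a)) o +_) (sum-cong (λ k → sym (trans (drop-at o (abs (drop N a)) k) (cong ∣_∣ (sym (drop-at o (drop N a) k))))) m))
          (sym (sum-split (abs (drop N a)) o m)))))) (h (o ℕ.+ m)))

  summable⇒null : Summable a → Null a
  summable⇒null {a} s ε 0<ε with s ε 0<ε
  ... | N , h = N , λ n N≤n → ≤-trans (≤-reflexive (cong (λ k → ∣ a k ∣) (sym (ℕ.+-identityʳ n))))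
    (≤-trans (≤-reflexive (trans (cong ∣_∣ (sym (drop-at n a 0))) (sym (+-identityʳ _)))) (tail-sums N a 1 N≤n h))

  everywhere : (N : ℕ) (a : Series) {B : ℚ} → 0ℚ < B → (∀ n → N ℕ.≤ n → ∣ a n ∣ ≤ B) →
               ∃[ C ] 0ℚ < C × (∀ n → ∣ a n ∣ ≤ C)
  everywhere zero    a 0<B h = _ , 0<B , λ n → h n ℕ.z≤n
  everywhere (suc N) a 0<B h with everywhere N (tail a) 0<B (λ n N≤n → h (suc n) (ℕ.s≤s N≤n))
  ... | C , 0<C , k = C + ∣ a 0 ∣ , <-≤-trans 0<C (≤+ C (0≤∣p∣ (a 0))) , λ where
    zero    → ≤-trans (≤+ (∣ a 0 ∣) (<⇒≤ 0<C)) (≤-reflexive (+-comm (∣ a 0 ∣) C))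
    (suc n) → ≤-trans (k n) (≤+ C (0≤∣p∣ (a 0)))

  null-everywhere : Null a → ∃[ C ] 0ℚ < C × (∀ n → ∣ a n ∣ ≤ C)
  null-everywhere {a} n = everywhere (proj₁ (n 1ℚ 0<1)) a 0<1 (proj₂ (n 1ℚ 0<1))

  conv-≤ : ∀ a b {B} n → (∀ k → k ℕ.≤ n → ∣ b k ∣ ≤ B) → ∣ (a S.* b) n ∣ ≤ sum (abs a) (suc n) * B
  conv-≤ a b {B} zero    h = ≤-trans (∣∣-*-≤ (a 0) (b 0) ≤-refl (h 0 ℕ.z≤n))
    (≤-reflexive (cong (_* B) (sym (+-identityʳ (∣ a 0 ∣)))))
  conv-≤ a b {B} (suc n) h = ≤-trans
    (∣∣-+-≤ (a 0 * b (suc n)) _ (∣∣-*-≤ (a 0) (b (suc n)) ≤-refl (h (suc n) ℕ.≤-refl))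
      (conv-≤ (tail a) b n (λ k k≤n → h k (ℕ.m≤n⇒m≤1+n k≤n))))
    (≤-reflexive (sym (*-distribʳ-+ B (∣ a 0 ∣) (sum (abs (tail a)) (suc n)))))

  -- The first N coefficients of `a` meet coefficients of `b` of index above n only; the rest of `a`
  -- forms a convolution of its own.
  conv-split : ∀ N a b n {ε} → (∀ k → n ℕ.< k → k ℕ.≤ N ℕ.+ n → ∣ b k ∣ ≤ ε) →
               ∣ (a S.* b) (N ℕ.+ n) ∣ ≤ sum (abs a) N * ε + ∣ (drop N a S.* b) n ∣
  conv-split zero    a b n {ε} h = ≤-reflexive (sym (trans (cong (_+ ∣ (a S.* b) n ∣) (*-zeroˡ ε)) (+-identityˡ _)))
  conv-split (suc N) a b n {ε} h = ≤-trans
    (∣∣-+-≤ (a 0 * b (suc N ℕ.+ n)) _ (∣∣-*-≤ (a 0) (b (suc N ℕ.+ n)) ≤-refl (h (suc N ℕ.+ n) (ℕ.s≤s (ℕ.m≤n+m n N)) ℕ.≤-refl))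
      (conv-split N (tail a) b n (λ k n<k k≤ → h k n<k (ℕ.m≤n⇒m≤1+n k≤))))
    (≤-reflexive (solve 4 (λ x e s c → x :* e :+ (s :* e :+ c) := (x :+ s) :* e :+ c) refl
      (∣ a 0 ∣) ε (sum (abs (tail a)) N) (∣ (drop N (tail a) S.* b) n ∣)))

  -- Early coefficients of `a` meet small terms of `b`; late ones have small total mass and meet
  -- bounded terms.
  summable*null : Summable a → Null b → Null (a S.* b)
  summable*null {a} {b} s nb ε 0<ε =
    let A , 0<A , sum≤A = summable-bound {a} s
        B , 0<B , b≤B   = null-everywhere {b} nb
        δ , 0<δ , Aδ≡   = divide 0<A (0<* 0<½ 0<ε)
        η , 0<η , Bη≡   = divide 0<B (0<* 0<½ 0<ε)
        N , tail≤       = s η 0<η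
        M , b≤δ         = nb δ 0<δ
    in N ℕ.+ M , λ n N+M≤n →
      let n′ = n ℕ.∸ N
          N+n′≡n = ℕ.m+[n∸m]≡n (ℕ.≤-trans (ℕ.m≤m+n N M) N+M≤n)
          M≤n′ = ℕ.≤-trans (ℕ.≤-reflexive (sym (ℕ.m+n∸m≡n N M))) (ℕ.∸-monoˡ-≤ N N+M≤n)
      in subst (λ k → ∣ (a S.* b) k ∣ ≤ ε) N+n′≡n (≤-trans
        (conv-split N a b n′ (λ k n′<k _ → b≤δ k (ℕ.≤-trans M≤n′ (ℕ.<⇒≤ n′<k))))
        (≤-trans (+-mono-≤ (*-≤ʳ (<⇒≤ 0<δ) (sum≤A N)) (≤-trans (conv-≤ (drop N a) b n′ (λ k _ → b≤B k)) (*-≤ʳ (<⇒≤ 0<B) (tail≤ (suc n′)))))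
          (≤-reflexive (trans (cong₂ _+_ Aδ≡ (trans (*-comm η B) Bη≡)) (½+½ ε)))))

  abs-conv : ∀ a b n → ∣ (a S.* b) n ∣ ≤ (abs a S.* abs b) n
  abs-conv a b zero    = ∣∣-*-≤ (a 0) (b 0) ≤-refl ≤-refl
  abs-conv a b (suc n) = ∣∣-+-≤ (a 0 * b (suc n)) _ (∣∣-*-≤ (a 0) (b (suc n)) ≤-refl ≤-refl) (abs-conv (tail a) b n)

  sum-conv-suc : ∀ a b m → sum (a S.* b) (suc m) ≡ a 0 * sum b (suc m) + sum (tail a S.* b) m
  sum-conv-suc a b m = trans (cong (a 0 * b 0 +_) (trans (sum-+ (λ k → a 0 * b (suc k)) (tail a S.* b) m)
      (cong (_+ sum (tail a S.* b) m) (sum-scale (a 0) (tail b) m))))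
    (solve 4 (λ a b s t → a :* b :+ (a :* s :+ t) := a :* (b :+ s) :+ t) refl (a 0) (b 0) (sum (tail b) m) (sum (tail a S.* b) m))

  -- Every product counted on the left has both indices below m, so it also occurs in the full
  -- square on the right.
  sum-conv-≤ : ∀ a b m → (∀ n → 0ℚ ≤ a n) → (∀ n → 0ℚ ≤ b n) → sum (a S.* b) m ≤ sum a m * sum b m
  sum-conv-≤ a b zero    a≥0 b≥0 = ≤-refl
  sum-conv-≤ a b (suc m) a≥0 b≥0 = ≤-trans (≤-reflexive (sum-conv-suc a b m)) (≤-trans
    (+-monoʳ-≤ (a 0 * sum b (suc m)) (≤-trans (sum-conv-≤ (tail a) b m (λ n → a≥0 (suc n)) b≥0)
      (*-≤ˡ (sum-≥0 (λ n → a≥0 (suc n)) m) (sum-increasing {b} b≥0 (ℕ.n≤1+n m)))))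
    (≤-reflexive (sym (*-distribʳ-+ (sum b (suc m)) (a 0) (sum (tail a) m)))))

  conv-≥0 : ∀ a b n → (∀ k → 0ℚ ≤ a k) → (∀ k → 0ℚ ≤ b k) → 0ℚ ≤ (a S.* b) n
  conv-≥0 a b zero    a≥0 b≥0 = 0≤* (a≥0 0) (b≥0 0)
  conv-≥0 a b (suc n) a≥0 b≥0 = +-mono-≤ (0≤* (a≥0 0) (b≥0 (suc n))) (conv-≥0 (tail a) b n (λ k → a≥0 (suc k)) b≥0)

  sum-abs-conv : ∀ a b m → sum (abs (a S.* b)) m ≤ sum (abs a) m * sum (abs b) m
  sum-abs-conv a b m = ≤-trans (sum-mono (abs-conv a b) m)
    (sum-conv-≤ (abs a) (abs b) m (λ n → 0≤∣p∣ (a n)) (λ n → 0≤∣p∣ (b n)))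

  sum-abs-+ : ∀ a b m → sum (abs (a S.+ b)) m ≤ sum (abs a) m + sum (abs b) m
  sum-abs-+ a b m = ≤-trans (sum-mono (λ n → ∣p+q∣≤∣p∣+∣q∣ (a n) (b n)) m) (≤-reflexive (sum-+ (abs a) (abs b) m))

  -- T bounds the contribution of drop N a.

  tail-conv : ∀ N M a b m {ε T} → (∀ j → M ℕ.≤ j → ∀ m → sum (abs (drop j b)) m ≤ ε) →
              sum (abs (drop M (drop N a S.* b))) m ≤ T →
              sum (abs (drop (N ℕ.+ M) (a S.* b))) m ≤ sum (abs a) N * ε + T
  tail-conv zero    M a b m {ε} {T} bt at = ≤-trans at (≤-reflexive (sym (trans (cong (_+ T) (*-zeroˡ ε)) (+-identityˡ T))))
  tail-conv (suc N) M a b m {ε} {T} bt at = ≤-trans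
    (≤-trans (≤-reflexive (sum-cong (λ k → cong ∣_∣ (trans (drop-at (N ℕ.+ M) (tail (a S.* b)) k)
        (cong₂ (λ u v → a 0 * u + v) (sym (drop-at (suc N ℕ.+ M) b k)) (sym (drop-at (N ℕ.+ M) (tail a S.* b) k))))) m))
      (sum-abs-+ (λ k → a 0 * drop (suc N ℕ.+ M) b k) (drop (N ℕ.+ M) (tail a S.* b)) m))
    (≤-trans (+-mono-≤
        (≤-trans (≤-reflexive (trans (sum-cong (λ k → ∣p*q∣≡∣p∣*∣q∣ (a 0) (drop (suc N ℕ.+ M) b k)) m)
            (sum-scale (∣ a 0 ∣) (abs (drop (suc N ℕ.+ M) b)) m)))
          (*-≤ˡ (0≤∣p∣ (a 0)) (bt (suc N ℕ.+ M) (ℕ.m≤n+m M (suc N)) m)))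
        (tail-conv N M (tail a) b m bt at))
      (≤-reflexive (solve 4 (λ x e s t → x :* e :+ (s :* e :+ t) := (x :+ s) :* e :+ t) refl
        (∣ a 0 ∣) ε (sum (abs (tail a)) N) T)))

  drop-sum-≤ : ∀ M a m → sum (abs (drop M a)) m ≤ sum (abs a) (M ℕ.+ m)
  drop-sum-≤ zero    a m = ≤-refl
  drop-sum-≤ (suc M) a m = ≤-trans (drop-sum-≤ M (tail a) m)
    (≤-trans (≤+ _ (0≤∣p∣ (a 0))) (≤-reflexive (+-comm _ (∣ a 0 ∣))))

  summable-* : Summable a → Summable b → Summable (a S.* b)
  summable-* {a} {b} sa sb ε 0<ε =
    let A , 0<A , a≤A = summable-bound {a} sa
        B , 0<B , b≤B = summable-bound {b} sb
        δ , 0<δ , Aδ≡ = divide 0<A (0<* 0<½ 0<ε)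
        η , 0<η , Bη≡ = divide 0<B (0<* 0<½ 0<ε)
        N , at        = sa η 0<η
        M , bt        = sb δ 0<δ
    in N ℕ.+ M , λ m → ≤-trans
      (tail-conv N M a b m (λ j M≤j m → tail-sums M b m M≤j bt)
        (≤-trans (drop-sum-≤ M (drop N a S.* b) m) (≤-trans (sum-abs-conv (drop N a) b (M ℕ.+ m))
          (*-mono-≤ (sum-≥0 (λ n → 0≤∣p∣ (drop N a n)) (M ℕ.+ m)) (at (M ℕ.+ m))
            (sum-≥0 (λ n → 0≤∣p∣ (b n)) (M ℕ.+ m)) (b≤B (M ℕ.+ m))))))
      (≤-trans (+-monoˡ-≤ (η * B) (*-≤ʳ (<⇒≤ 0<δ) (a≤A N)))
        (≤-reflexive (trans (cong₂ _+_ Aδ≡ (trans (*-comm η B) Bη≡)) (½+½ ε))))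

  drop-+ : ∀ N a b n → drop N (a S.+ b) n ≡ drop N a n + drop N b n
  drop-+ N a b n = trans (drop-at N (a S.+ b) n) (sym (cong₂ _+_ (drop-at N a n) (drop-at N b n)))

  summable-+ : Summable a → Summable b → Summable (a S.+ b)
  summable-+ {a} {b} sa sb ε 0<ε with sa (½ * ε) (0<* 0<½ 0<ε) | sb (½ * ε) (0<* 0<½ 0<ε)
  ... | N , at | M , bt = N ℕ.⊔ M , λ m → ≤-trans
    (≤-trans (≤-reflexive (sum-cong (λ k → cong ∣_∣ (drop-+ (N ℕ.⊔ M) a b k)) m)) (sum-abs-+ (drop (N ℕ.⊔ M) a) (drop (N ℕ.⊔ M) b) m))
    (≤-trans (+-mono-≤ (tail-sums N a m (ℕ.m≤m⊔n N M) at) (tail-sums M b m (ℕ.m≤n⊔m N M) bt)) (≤-reflexive (½+½ ε)))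

  summable-≤ : (∀ n → ∣ a n ∣ ≤ ∣ b n ∣) → Summable b → Summable a
  summable-≤ {a} {b} h s ε 0<ε with s ε 0<ε
  ... | N , bt = N , λ m → ≤-trans (sum-mono (λ k →
    subst₂ _≤_ (cong ∣_∣ (sym (drop-at N a k))) (cong ∣_∣ (sym (drop-at N b k))) (h (N ℕ.+ k))) m) (bt m)

  summable-tail : Summable a → Summable (tail a)
  summable-tail {a} s ε 0<ε with s ε 0<ε
  ... | N , h = N , λ m → tail-sums N {suc N} a m (ℕ.n≤1+n N) h

  summable-const : ∀ q → Summable (const q)
  summable-const q ε 0<ε = 1 , λ m → ≤-trans (≤-reflexive (zeros m)) (<⇒≤ 0<ε)
    where
    zeros : ∀ m → sum (abs (tail (const q))) m ≡ 0ℚ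
    zeros zero    = refl
    zeros (suc m) = trans (+-identityˡ _) (zeros m)

  summable-shift : Summable a → Summable (shift a)
  summable-shift s ε 0<ε with s ε 0<ε
  ... | N , h = suc N , h

  -- The two conditions go together: they are jointly closed under products, because θ is a
  -- derivation and summable times null is null, and jointly they are what a convolution with `b`
  -- requires.
  record Tame (a : Series) : Set where
    constructor tame
    field
      summable : Summable a
      null-θ   : Null (θ a)

  open Tame public

  abstract

    tame-≈ : a ≈ b → Tame b → Tame a
    tame-≈ e (tame s n) = tame (summable-≤ (λ k → ≤-reflexive (cong ∣_∣ (at e k))) s)
      (null-≡ (λ k → cong (fromℕ k *_) (at e k)) n)

    tame-+ : Tame a → Tame b → Tame (a S.+ b)
    tame-+ {a} {b} (tame s m) (tame t n) = tame (summable-+ {a} {b} s t) (null-≡ (at (θ-+ a b)) (null-+ {θ a} {θ b} m n))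

    tame-neg : Tame a → Tame (S.- a)
    tame-neg {a} (tame s n) = tame (summable-≤ (λ k → ≤-reflexive (∣-p∣≡∣p∣ (a k))) s) (null-≡ (at (θ-neg a)) (null-neg {θ a} n))

    tame-const : ∀ q → Tame (const q)
    tame-const q = tame (summable-const q) (null-≡ {b = λ _ → 0ℚ} (λ { zero → *-zeroˡ q ; (suc n) → *-zeroʳ (fromℕ (suc n)) }) null-0)

    tame-* : Tame a → Tame b → Tame (a S.* b)
    tame-* {a} {b} (tame s m) (tame t n) = tame (summable-* {a} {b} s t) (null-≡ (at (θ-* a b)) (null-+ {θ a S.* b} {a S.* θ b}
      (null-≡ {θ a S.* b} {b S.* θ a} (*-comm′ (θ a) b) (summable*null {b} t m)) (summable*null {a} s n)))

    tame-z : Tame z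
    tame-z = tame (summable-shift {const 1ℚ} (summable-const 1ℚ)) λ ε 0<ε → 2 , λ { (suc (suc n)) _ →
      subst (_≤ ε) (sym (cong ∣_∣ (*-zeroʳ (fromℕ (suc (suc n)))))) (<⇒≤ 0<ε) ; (suc zero) (ℕ.s≤s ()) }

    null-tail : Null a → Null (tail a)
    null-tail n ε 0<ε with n ε 0<ε
    ... | N , h = N , λ k N≤k → h (suc k) (ℕ.m≤n⇒m≤1+n N≤k)

    tame-tail : Tame a → Tame (tail a)
    tame-tail {a} (tame s n) = tame (summable-tail {a} s) (null-≡ {b = λ k → θ a (suc k) + - a (suc k)}
      (λ k → sym (trans (cong (_- a (suc k)) (θ-tail a k)) (solve 2 (λ x y → (x :+ y) :- y := x) refl (θ (tail a) k) (a (suc k)))))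
      (null-+ {λ k → θ a (suc k)} (null-tail {θ a} n) (null-neg {λ k → a (suc k)} (null-tail {a} (summable⇒null {a} s)))))

    tame-≤ : (∀ n → ∣ a n ∣ ≤ ∣ b n ∣) → Tame b → Tame a
    tame-≤ {a} {b} h (tame s n) = tame (summable-≤ h s) (null-≤ {b = θ b} 0<1 (0 , λ k _ →
      ≤-trans (≤-reflexive (∣p*q∣≡∣p∣*∣q∣ (fromℕ k) (a k))) (≤-trans (*-≤ˡ (0≤∣p∣ (fromℕ k)) (h k))
        (≤-reflexive (trans (sym (∣p*q∣≡∣p∣*∣q∣ (fromℕ k) (b k))) (sym (*-identityˡ _)))))) n)

  -- The n-th approximation to the value of a at z = 1.

  value : Series → Series
  value a n = sum a (suc n)

  1⃗ : Series
  1⃗ _ = 1ℚ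

  -- Partial sums as a product with 1 / (1 - z), which makes associativity of the product available
  -- for them.
  conv-1⃗ : ∀ a n → (a S.* 1⃗) n ≡ value a n
  conv-1⃗ a zero    = trans (*-identityʳ (a 0)) (sym (+-identityʳ (a 0)))
  conv-1⃗ a (suc n) = cong₂ _+_ (*-identityʳ (a 0)) (conv-1⃗ (tail a) n)

  conv-constant : ∀ a q n → (a S.* (λ _ → q)) n ≡ q * value a n
  conv-constant a q n = trans (at (S.*-cong (S.≈-refl {a}) (pointwise {b = S.scale q 1⃗} (λ _ → sym (*-identityʳ q)))) n)
    (trans (*-comm′ a (S.scale q 1⃗) n) (trans (S.scale-* q 1⃗ a n) (cong (q *_) (trans (*-comm′ 1⃗ a n) (conv-1⃗ a n)))))

  conv-minus : ∀ a b q n → (a S.* (λ k → b k - q)) n ≡ (a S.* b) n - value a n * q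
  conv-minus a b q n = trans (*-comm′ a (λ k → b k - q) n) (trans (S.*-distribʳ b (λ _ → - q) a n)
    (cong₂ _+_ (*-comm′ b a n) (trans (*-comm′ (λ _ → - q) a n) (trans (conv-constant a (- q) n)
      (solve 2 (λ q v → (:- q) :* v := :- (v :* q)) refl q (value a n))))))

  -- Mertens' argument: the partial sums of the product are `a` convolved with the partial sums of
  -- `b`. Replacing each of those by the last one costs a convolution of `a` with `D`, where `D` is
  -- small against the first N coefficients of `a` and bounded against the rest.
  value-* : Summable a → Summable b → value (a S.* b) ~ (λ n → value a n * value b n)
  value-* {a} {b} sa sb = near λ ε 0<ε →
    let A , 0<A , a≤A = summable-bound {a} sa
        B , 0<B , b≤B = summable-bound {b} sb
        δ , 0<δ , Aδ≡ = divide 0<A (0<* 0<½ 0<ε)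
        η , 0<η , Bη≡ = divide (+-mono-< 0<B 0<B) (0<* 0<½ 0<ε)
        N , at        = sa η 0<η
        M , bt        = sb (½ * δ) (0<* 0<½ 0<δ)
    in N ℕ.+ M , λ n N+M≤n →
      let n′ = n ℕ.∸ N
          N+n′≡n = ℕ.m+[n∸m]≡n (ℕ.≤-trans (ℕ.m≤m+n N M) N+M≤n)
          M≤n′ = ℕ.≤-trans (ℕ.≤-reflexive (sym (ℕ.m+n∸m≡n N M))) (ℕ.∸-monoˡ-≤ N N+M≤n)
          M≤n = ℕ.≤-trans (ℕ.m≤n+m M N) N+M≤n
          D : Series
          D k = value b k - value b n
      in subst (λ x → ∣ x ∣ ≤ ε) (trans (conv-minus a (value b) (value b n) n)
           (cong (_- value a n * value b n) (product n)))
         (subst (λ k → ∣ (a S.* D) k ∣ ≤ ε) N+n′≡n (≤-trans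
          (conv-split N a D n′ {δ} (λ k n′<k _ → near-value M δ bt (ℕ.≤-trans M≤n′ (ℕ.<⇒≤ n′<k)) M≤n))
          (≤-trans (+-mono-≤ (*-≤ʳ (<⇒≤ 0<δ) (a≤A N))
            (≤-trans (conv-≤ (drop N a) D {B + B} n′ (λ k _ → ∣∣-+-≤ (value b k) (- value b n)
                (≤-trans (∣sum∣ b (suc k)) (b≤B (suc k)))
                (≤-trans (≤-reflexive (∣-p∣≡∣p∣ (value b n))) (≤-trans (∣sum∣ b (suc n)) (b≤B (suc n))))))
              (*-≤ʳ (<⇒≤ (+-mono-< 0<B 0<B)) (at (suc n′)))))
            (≤-reflexive (trans (cong₂ _+_ Aδ≡ (trans (*-comm η (B + B)) Bη≡)) (½+½ ε))))))
    where
    product : ∀ n → (a S.* value b) n ≡ value (a S.* b) n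
    product n = trans (at (S.*-cong (S.≈-refl {a}) (pointwise {b = b S.* 1⃗} (λ k → sym (conv-1⃗ b k)))) n)
      (trans (sym (S.*-assoc′ a b 1⃗ n)) (conv-1⃗ (a S.* b) n))
    near-sum : ∀ M δ → (∀ m → sum (abs (drop M b)) m ≤ ½ * δ) → ∀ {k} → M ℕ.≤ k → ∣ value b k - sum b M ∣ ≤ ½ * δ
    near-sum M δ bt {k} M≤k with ℕ.m≤n⇒∃[o]m+o≡n M≤k
    ... | o , refl = subst (λ x → ∣ x ∣ ≤ ½ * δ)
      (sym (trans (cong (_- sum b M) (trans (cong (sum b) (sym (ℕ.+-suc M o))) (sum-split b M (suc o))))
        (solve 2 (λ x y → (x :+ y) :- x := y) refl (sum b M) (sum (drop M b) (suc o)))))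
      (≤-trans (∣sum∣ (drop M b) (suc o)) (bt (suc o)))
    near-value : ∀ M δ → (∀ m → sum (abs (drop M b)) m ≤ ½ * δ) → ∀ {k l} → M ℕ.≤ k → M ℕ.≤ l →
                 ∣ value b k - value b l ∣ ≤ δ
    near-value M δ bt {k} {l} M≤k M≤l = subst₂ (λ x y → ∣ x ∣ ≤ y)
      (solve 3 (λ x y c → (x :- c) :- (y :- c) := x :- y) refl (value b k) (value b l) (sum b M)) (½+½ δ)
      (∣∣-+-≤ (value b k - sum b M) (- (value b l - sum b M)) (near-sum M δ bt M≤k)
        (≤-trans (≤-reflexive (∣-p∣≡∣p∣ (value b l - sum b M))) (near-sum M δ bt M≤l)))

-- Central binomial coefficients and convolution with them

module CentralBinomial where

  open Limits
  private module S = Series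
  open Series using (Series)
  open ClosedForms using (b; inv; fromℕ*inv; b-rec)
  open TameSeries
  open import Data.Rational.Base
  open import Data.Rational.Properties
  open import Data.Rational.Solver using (module +-*-Solver)
  open RationalSequences using (0<*; 0≤*; 0<½; 0<1; *-mono-≤; divide; fromℕ; 0≤fromℕ; fromℕ-suc; fromℕ-mono; archimedean′)
  open +-*-Solver

  2ℚ 4ℚ : ℚ
  2ℚ = 1ℚ + 1ℚ
  4ℚ = 2ℚ + 2ℚ

  ≤-via : ∀ {p q} r → 0ℚ ≤ r → q ≡ p + r → p ≤ q
  ≤-via {p} r 0≤r e = subst (p ≤_) (sym e) (≤+ p 0≤r)

  0<fromℕ-suc : ∀ n → 0ℚ < fromℕ (suc n)
  0<fromℕ-suc n = <-≤-trans 0<1 (fromℕ-mono {1} {suc n} (ℕ.s≤s ℕ.z≤n))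

  *-cancel-≤ : ∀ {p q r} → 0ℚ < r → r * p ≤ r * q → p ≤ q
  *-cancel-≤ {r = r} 0<r = *-cancelˡ-≤-pos r {{positive 0<r}}

  *-cancel-≡ : ∀ {p q r} → 0ℚ < r → r * p ≡ r * q → p ≡ q
  *-cancel-≡ 0<r e = ≤-antisym (*-cancel-≤ 0<r (≤-reflexive e)) (*-cancel-≤ 0<r (≤-reflexive (sym e)))

  square-cancel-≤ : ∀ {p q} → 0ℚ ≤ q → p * p ≤ q * q → p ≤ q
  square-cancel-≤ {p} {q} 0≤q h with p ≤? q
  ... | yes p≤q = p≤q
  ... | no  p≰q = ⊥-elim (<-irrefl refl (<-≤-trans (square-< (≰⇒> p≰q)) h))
    where
    square-< : q < p → q * q < p * p
    square-< q<p = ≤-<-trans (*-≤ˡ 0≤q (<⇒≤ q<p)) (*-monoˡ-<-pos p {{positive (≤-<-trans 0≤q q<p)}} q<p)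

  0<inv : ∀ n → 0ℚ < inv n
  0<inv n = positive⁻¹ (inv n) {{normalize-pos 1 (suc n)}}

  inv-anti : ∀ {m n} → m ℕ.≤ n → inv n ≤ inv m
  inv-anti {m} {n} m≤n = *-cancel-≤ (0<fromℕ-suc m) (subst (fromℕ (suc m) * inv n ≤_) (sym (fromℕ*inv m))
    (≤-trans (*-≤ʳ (<⇒≤ (0<inv n)) (fromℕ-mono (ℕ.s≤s m≤n))) (≤-reflexive (fromℕ*inv n))))

  inv-null : ∀ ε → 0ℚ < ε → ∃[ N ] ∀ n → N ℕ.≤ n → inv n ≤ ε
  inv-null ε 0<ε = let K , 1≤εK = archimedean′ 1ℚ ε 0<ε in K , λ n K≤n → *-cancel-≤ (0<fromℕ-suc n) (≤-trans (≤-reflexive (fromℕ*inv n))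
    (≤-trans 1≤εK (≤-trans (*-≤ˡ (<⇒≤ 0<ε) (fromℕ-mono (ℕ.m≤n⇒m≤1+n K≤n))) (≤-reflexive (*-comm ε (fromℕ (suc n)))))))

  b-rec′ : ∀ n → (fromℕ n + 1ℚ) * b (suc n) ≡ (fromℕ n + ½) * b n
  b-rec′ n = trans (cong (_* b (suc n)) (sym (fromℕ-suc n))) (trans (b-rec n) (sym (*-distribʳ-+ (b n) (fromℕ n) ½)))

  private
    F = fromℕ
    sF = fromℕ-suc

    0<F+1 : ∀ n → 0ℚ < F n + 1ℚ
    0<F+1 n = subst (0ℚ <_) (sF n) (0<fromℕ-suc n)

  0<b : ∀ n → 0ℚ < b n
  0<b zero    = 0<1
  0<b (suc n) = *-cancelˡ-<-nonNeg (F n + 1ℚ) {{nonNegative (<⇒≤ (0<F+1 n))}}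
    (subst₂ _<_ (sym (*-zeroʳ (F n + 1ℚ))) (sym (b-rec′ n)) (0<* (+-mono-≤-< (0≤fromℕ n) 0<½) (0<b n)))

  0≤b : ∀ n → 0ℚ ≤ b n
  0≤b n = <⇒≤ (0<b n)

  b-step : ∀ n → b (suc n) ≤ b n
  b-step n = ≤-via (½ * inv n * b n) (0≤* (0≤* (<⇒≤ 0<½) (<⇒≤ (0<inv n))) (0≤b n))
    (solve 2 (λ b d → b := (b :- d) :+ d) refl (b n) (½ * inv n * b n))

  b-anti : ∀ {m n} → m ℕ.≤ n → b n ≤ b m
  b-anti {m} {n} m≤n = let o , e = ℕ.m≤n⇒∃[o]m+o≡n m≤n in subst (λ n → b n ≤ b m) e (go o)
    where
    go : ∀ o → b (m ℕ.+ o) ≤ b m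
    go zero    = ≤-reflexive (cong b (ℕ.+-identityʳ m))
    go (suc o) = ≤-trans (≤-reflexive (cong b (ℕ.+-suc m o))) (≤-trans (b-step (m ℕ.+ o)) (go o))

  b≤1 : ∀ n → b n ≤ 1ℚ
  b≤1 n = b-anti (ℕ.z≤n {n})

  odd : ℕ → ℚ
  odd n = F n + F n + 1ℚ

  0≤odd : ∀ n → 0ℚ ≤ odd n
  0≤odd n = +-mono-≤ (+-mono-≤ (0≤fromℕ n) (0≤fromℕ n)) (<⇒≤ 0<1)

  odd-suc : ∀ n → odd (suc n) ≡ odd n + 2ℚ
  odd-suc n = trans (cong (λ x → x + x + 1ℚ) (sF n))
    (solve 1 (λ n → (n :+ con 1ℚ) :+ (n :+ con 1ℚ) :+ con 1ℚ := (n :+ n :+ con 1ℚ) :+ con 2ℚ) refl (F n))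

  odd*b-step : ∀ n → odd (suc n) * b (suc n) ≡ odd n * b n + b (suc n)
  odd*b-step n = trans (cong (_* b (suc n)) (odd-suc n)) (trans
    (solve 2 (λ n b → (n :+ n :+ con 1ℚ :+ con 2ℚ) :* b := con 2ℚ :* ((n :+ con 1ℚ) :* b) :+ b) refl (F n) (b (suc n)))
    (cong (_+ b (suc n)) (trans (cong (2ℚ *_) (b-rec′ n))
      (solve 2 (λ n b → con 2ℚ :* ((n :+ con ½) :* b) := (n :+ n :+ con 1ℚ) :* b) refl (F n) (b n)))))

  1≤odd*b : ∀ n → 1ℚ ≤ odd n * b n
  1≤odd*b zero    = ≤-refl
  1≤odd*b (suc n) = ≤-trans (1≤odd*b n) (≤-via (b (suc n)) (0≤b (suc n)) (odd*b-step n))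

  -- Summation of the step (2n+3) b(n+1) = (2n+1) b(n) + b(n+1).
  sum-b : ∀ n → sum b (suc n) ≡ odd n * b n
  sum-b zero    = refl
  sum-b (suc n) = trans (sum-snoc b (suc n)) (trans (cong (_+ b (suc n)) (sum-b n)) (sym (odd*b-step n)))

  -- Together with `n*b²-step` this pins b(n)² to the order 1/n: one multiple decreases, the other
  -- increases.
  odd*b²-step : ∀ n → odd (suc n) * (b (suc n) * b (suc n)) ≤ odd n * (b n * b n)
  odd*b²-step n = *-cancel-≤ (0<* (0<F+1 n) (0<F+1 n)) (≤-via (½ * ½ * (odd n * (b n * b n)))
      (0≤* (0≤* (<⇒≤ 0<½) (<⇒≤ 0<½)) (0≤* (0≤odd n) (0≤* (0≤b n) (0≤b n))))
    (sym (trans (cong (_+ ½ * ½ * (odd n * (b n * b n))) (trans (cong (λ o → m * m * (o * (b (suc n) * b (suc n)))) (odd-suc n))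
      (trans (solve 3 (λ m o c → m :* m :* (o :* (c :* c)) := o :* ((m :* c) :* (m :* c))) refl m (odd n + 2ℚ) (b (suc n)))
        (cong (λ y → (odd n + 2ℚ) * (y * y)) (b-rec′ n)))))
      (solve 2 (λ n b → (n :+ n :+ con 1ℚ :+ con 2ℚ) :* (((n :+ con ½) :* b) :* ((n :+ con ½) :* b)) :+ con ½ :* con ½ :* ((n :+ n :+ con 1ℚ) :* (b :* b))
        := (n :+ con 1ℚ) :* (n :+ con 1ℚ) :* ((n :+ n :+ con 1ℚ) :* (b :* b))) refl (F n) (b n)))))
    where m = F n + 1ℚ

  odd*b²≤1 : ∀ n → odd n * (b n * b n) ≤ 1ℚ
  odd*b²≤1 zero    = ≤-refl
  odd*b²≤1 (suc n) = ≤-trans (odd*b²-step n) (odd*b²≤1 n)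

  n*b²-step : ∀ n → F n * (b n * b n) ≤ F (suc n) * (b (suc n) * b (suc n))
  n*b²-step n = *-cancel-≤ (0<F+1 n) (≤-via (½ * ½ * (b n * b n)) (0≤* (0≤* (<⇒≤ 0<½) (<⇒≤ 0<½)) (0≤* (0≤b n) (0≤b n)))
    (trans (cong (λ o → m * (o * (b (suc n) * b (suc n)))) (sF n))
      (trans (solve 2 (λ m c → m :* (m :* (c :* c)) := (m :* c) :* (m :* c)) refl m (b (suc n)))
        (trans (cong (λ y → y * y) (b-rec′ n))
          (solve 2 (λ n b → ((n :+ con ½) :* b) :* ((n :+ con ½) :* b) := (n :+ con 1ℚ) :* (n :* (b :* b)) :+ con ½ :* con ½ :* (b :* b))
            refl (F n) (b n))))))
    where m = F n + 1ℚ

  n*b²-mono : ∀ {m n} → m ℕ.≤ n → F m * (b m * b m) ≤ F n * (b n * b n)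
  n*b²-mono {m} {n} m≤n =
    let o , e = ℕ.m≤n⇒∃[o]m+o≡n m≤n in subst (λ n → F m * (b m * b m) ≤ F n * (b n * b n)) e (go o)
    where
    go : ∀ o → F m * (b m * b m) ≤ F (m ℕ.+ o) * (b (m ℕ.+ o) * b (m ℕ.+ o))
    go zero    = ≤-reflexive (cong (λ k → F k * (b k * b k)) (sym (ℕ.+-identityʳ m)))
    go (suc o) = ≤-trans (go o) (≤-trans (n*b²-step (m ℕ.+ o)) (≤-reflexive (cong (λ k → F k * (b k * b k)) (sym (ℕ.+-suc m o)))))

  -- Since n b(n)² increases, the ratio of the squares is at most the ratio of the indices, hence at
  -- most 4.
  b-ratio : ∀ {i j} → suc i ℕ.≤ j → F j ≤ 4ℚ * F (suc i) → b (suc i) ≤ 2ℚ * b j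
  b-ratio {i} {j} i<j j≤4i = square-cancel-≤ (0≤* (<⇒≤ (+-mono-< 0<1 0<1)) (0≤b j)) (*-cancel-≤ (0<fromℕ-suc i)
    (≤-trans (n*b²-mono i<j) (≤-trans (*-≤ʳ (0≤* (0≤b j) (0≤b j)) j≤4i)
      (≤-reflexive (solve 2 (λ i b → con 4ℚ :* i :* (b :* b) := i :* ((con 2ℚ :* b) :* (con 2ℚ :* b))) refl (F (suc i)) (b j))))))

  -- Each of the N steps removes at most b(n) / (2(n+1)).
  b-diff : ∀ N n → b n - b (N ℕ.+ n) ≤ F N * (½ * inv n * b n)
  b-diff zero    n = ≤-reflexive (trans (+-inverseʳ (b n)) (sym (*-zeroˡ (½ * inv n * b n))))
  b-diff (suc N) n = ≤-trans (≤-reflexive (solve 3 (λ x y d → x :- (y :- d) := (x :- y) :+ d) refl (b n) (b (N ℕ.+ n)) (½ * inv (N ℕ.+ n) * b (N ℕ.+ n))))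
    (≤-trans (+-mono-≤ (b-diff N n) (*-mono-≤ (0≤* (<⇒≤ 0<½) (<⇒≤ (0<inv (N ℕ.+ n)))) (*-≤ˡ (<⇒≤ 0<½) (inv-anti (ℕ.m≤n+m n N)))
        (0≤b (N ℕ.+ n)) (b-anti (ℕ.m≤n+m n N))))
      (≤-reflexive (trans (solve 2 (λ n d → n :* d :+ d := (n :+ con 1ℚ) :* d) refl (F N) (½ * inv n * b n))
        (cong (_* (½ * inv n * b n)) (sym (sF N))))))

  b-small : ∀ ε → 0ℚ < ε → ∃[ N ] ∀ n → N ℕ.≤ n → b n ≤ ε
  b-small ε 0<ε = let K , 1≤ = archimedean′ 1ℚ (ε * ε) (0<* 0<ε 0<ε) in K , λ n K≤n → square-cancel-≤ (<⇒≤ 0<ε) (*-cancel-≤ (0<odd n) (≤-trans (odd*b²≤1 n) (≤-trans 1≤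
    (≤-trans (*-≤ˡ (<⇒≤ (0<* 0<ε 0<ε)) (≤-trans (fromℕ-mono K≤n) (≤-via (F n + 1ℚ) (<⇒≤ (0<F+1 n)) (+-assoc (F n) (F n) 1ℚ))))
      (≤-reflexive (*-comm (ε * ε) (odd n)))))))
    where
    0<odd : ∀ n → 0ℚ < odd n
    0<odd n = +-mono-≤-< (+-mono-≤ (0≤fromℕ n) (0≤fromℕ n)) 0<1

  b-null : Null b
  b-null ε 0<ε = let N , h = b-small ε 0<ε in N , λ n N≤n → ≤-trans (≤-reflexive (0≤p⇒∣p∣≡p (0≤b n))) (h n N≤n)

  Small : Series → Set
  Small e = ∀ ε → 0ℚ < ε → ∃[ N ] ∀ n → N ℕ.≤ n → ∣ e n ∣ ≤ ε * b n

  -- b(n) is at least 1/(2n+1), hence o(1/n) is o(b(n)); the quarter of ε absorbs 2n+1 ≤ 4n.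
  small-θ : ∀ {e} → Null (λ n → F n * e n) → Small e
  small-θ {e} n ε 0<ε = let N , h = n (ε * (½ * ½)) (0<* 0<ε (0<* 0<½ 0<½)) in suc N , λ { (suc k) (ℕ.s≤s N≤k) → *-cancel-≤ (0<fromℕ-suc k) (≤-trans
      (≤-reflexive (trans (cong (_* ∣ e (suc k) ∣) (sym (0≤p⇒∣p∣≡p (0≤fromℕ (suc k))))) (sym (∣p*q∣≡∣p∣*∣q∣ (F (suc k)) (e (suc k))))))
      (≤-trans (h (suc k) (ℕ.m≤n⇒m≤1+n N≤k)) (bound k))) }
    where
    bound : ∀ k → ε * (½ * ½) ≤ F (suc k) * (ε * b (suc k))
    bound k = ≤-trans (≤-trans (≤-reflexive (sym (*-identityʳ (ε * (½ * ½)))))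
        (*-≤ˡ (<⇒≤ (0<* 0<ε (0<* 0<½ 0<½))) (≤-trans (1≤odd*b (suc k)) (*-≤ʳ {p = odd (suc k)} {q = 4ℚ * F (suc k)} (0≤b (suc k))
          (≤-via (2ℚ * F k + 1ℚ) (+-mono-≤ (0≤* (<⇒≤ (+-mono-< 0<1 0<1)) (0≤fromℕ k)) (<⇒≤ 0<1))
            (trans (cong (4ℚ *_) (sF k)) (trans (solve 1 (λ k → con 4ℚ :* (k :+ con 1ℚ) :=
              ((k :+ con 1ℚ) :+ (k :+ con 1ℚ) :+ con 1ℚ) :+ (con 2ℚ :* k :+ con 1ℚ)) refl (F k))
              (cong (λ x → (x + x + 1ℚ) + (2ℚ * F k + 1ℚ)) (sym (sF k))))))))))
      (≤-reflexive (solve 3 (λ e f b → e :* (con ½ :* con ½) :* (con 4ℚ :* f :* b) := f :* (e :* b)) refl ε (F (suc k)) (b (suc k))))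

  halve : ∀ n → ∃[ M ] ∃[ r ] M ℕ.+ r ≡ n × r ℕ.≤ M × M ℕ.≤ suc r
  halve zero    = 0 , 0 , refl , ℕ.z≤n , ℕ.z≤n
  halve (suc n) = let M , r , e , r≤M , M≤1+r = halve n in suc r , M , cong suc (trans (ℕ.+-comm r M) e) , M≤1+r , ℕ.s≤s r≤M

  private
    6ℚ = 4ℚ + 2ℚ

    0<6 : 0ℚ < 6ℚ
    0<6 = +-mono-< (+-mono-< (+-mono-< 0<1 0<1) (+-mono-< 0<1 0<1)) (+-mono-< 0<1 0<1)

  module _ {h : Series} where

    -- Replacing every b(k) by b(n) leaves a convolution of `h` with the differences b(k) - b(n),
    -- cut in three. The first N coefficients meet k close to n, where the difference is at most η
    -- b(n). The next M have mass κ and meet k above r, where it is at most b(n) since b(r) ≤ 2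
    -- b(n). The others are at most δ/M each, against a sum of b(k) equal to (2r+1) b(r). The factor
    -- 6 is 3 from 2r+1 ≤ 3M times 2 from b(r) ≤ 2 b(n).
    conv-b-bound : ∀ N m r {A η κ δ} → 1 ℕ.≤ r → r ℕ.≤ suc m → N ℕ.+ (suc m ℕ.+ r) ℕ.≤ 4 ℕ.* r →
      0ℚ ≤ η → 0ℚ ≤ δ →
      sum (abs h) N ≤ A → (∀ j → sum (abs (drop N h)) j ≤ κ) → F N * inv (suc m ℕ.+ r) ≤ η →
      (∀ k → suc m ℕ.≤ k → ∣ F k * h k ∣ ≤ δ) →
      let n = N ℕ.+ (suc m ℕ.+ r) in
      ∣ (h S.* b) n - value h n * b n ∣ ≤ (A * η + (κ + 6ℚ * δ)) * b n
    conv-b-bound N m (suc r′) {A} {η} {κ} {δ} _ r≤M n≤4r 0≤η 0≤δ sum≤A tail≤κ inv≤η θ≤δ = begin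
      ∣ (h S.* b) n - value h n * b n ∣        ≡⟨ cong ∣_∣ (conv-minus h b (b n) n) ⟨
      ∣ (h S.* D) n ∣                          ≤⟨ conv-split N h D n′ step₁ ⟩
      sum (abs h) N * (η * b n) + ∣ (drop N h S.* D) n′ ∣
        ≤⟨ +-mono-≤ (*-≤ʳ (0≤* 0≤η (0≤b n)) sum≤A) (conv-split M (drop N h) D r step₂) ⟩
      A * (η * b n) + (sum (abs (drop N h)) M * b n + ∣ (drop M (drop N h) S.* D) r ∣)
        ≤⟨ +-monoʳ-≤ (A * (η * b n)) (+-mono-≤ (*-≤ʳ (0≤b n) (tail≤κ M)) step₃) ⟩
      A * (η * b n) + (κ * b n + 6ℚ * δ * b n)
        ≡⟨ solve 5 (λ a e b k d → a :* (e :* b) :+ (k :* b :+ con 6ℚ :* d :* b) := (a :* e :+ (k :+ con 6ℚ :* d)) :* b) refl A η (b n) κ δ ⟩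
      (A * η + (κ + 6ℚ * δ)) * b n             ∎
      where
      open ≤-Reasoning
      r  = suc r′
      M  = suc m
      n′ = M ℕ.+ r
      n  = N ℕ.+ n′
      D : Series
      D k = b k - b n
      Fn≤4r : F n ≤ 4ℚ * F r
      Fn≤4r = ≤-trans (fromℕ-mono n≤4r) (≤-reflexive (4* r))
        where
        open Coefficients using (fromℕ-+)
        4* : ∀ r → F (4 ℕ.* r) ≡ 4ℚ * F r
        4* r = trans (fromℕ-+ r (3 ℕ.* r)) (trans (cong (F r +_) (trans (fromℕ-+ r (2 ℕ.* r)) (cong (F r +_)
          (trans (fromℕ-+ r (1 ℕ.* r)) (cong (F r +_) (trans (fromℕ-+ r 0) (+-identityʳ (F r))))))))
          (solve 1 (λ r → r :+ (r :+ (r :+ r)) := con 4ℚ :* r) refl (F r)))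
      r≤n′ : r ℕ.≤ n′
      r≤n′ = ℕ.m≤n+m r M
      n′≤n : n′ ℕ.≤ n
      n′≤n = ℕ.m≤n+m n′ N
      br≤ : b r ≤ 2ℚ * b n
      br≤ = b-ratio (ℕ.≤-trans r≤n′ n′≤n) Fn≤4r
      ∣D∣ : ∀ {k} → k ℕ.≤ n → ∣ D k ∣ ≡ D k
      ∣D∣ {k} k≤n = 0≤p⇒∣p∣≡p (subst (_≤ D k) (+-inverseʳ (b n)) (+-monoˡ-≤ (- b n) (b-anti k≤n)))
      step₁ : ∀ k → n′ ℕ.< k → k ℕ.≤ n → ∣ D k ∣ ≤ η * b n
      step₁ k n′<k k≤n = begin
        ∣ D k ∣                         ≡⟨ ∣D∣ k≤n ⟩
        b k - b n                       ≤⟨ +-monoˡ-≤ (- b n) (b-anti (ℕ.<⇒≤ n′<k)) ⟩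
        b n′ - b n                      ≤⟨ b-diff N n′ ⟩
        F N * (½ * inv n′ * b n′)       ≡⟨ solve 3 (λ N i b → N :* (con ½ :* i :* b) := N :* i :* (con ½ :* b)) refl (F N) (inv n′) (b n′) ⟩
        F N * inv n′ * (½ * b n′)       ≤⟨ *-mono-≤ (0≤* (0≤fromℕ N) (<⇒≤ (0<inv n′))) inv≤η (0≤* (<⇒≤ 0<½) (0≤b n′))
                                             (*-≤ˡ (<⇒≤ 0<½) (≤-trans (b-anti r≤n′) br≤)) ⟩
        η * (½ * (2ℚ * b n))            ≡⟨ solve 2 (λ e b → e :* (con ½ :* (con 2ℚ :* b)) := e :* b) refl η (b n) ⟩
        η * b n                         ∎
      step₂ : ∀ k → r ℕ.< k → k ℕ.≤ n′ → ∣ D k ∣ ≤ b n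
      step₂ k r<k k≤n′ = begin
        ∣ D k ∣                         ≡⟨ ∣D∣ (ℕ.≤-trans k≤n′ n′≤n) ⟩
        b k - b n                       ≤⟨ +-monoˡ-≤ (- b n) (≤-trans (b-anti (ℕ.<⇒≤ r<k)) br≤) ⟩
        2ℚ * b n - b n                  ≡⟨ solve 1 (λ b → con 2ℚ :* b :- b := b) refl (b n) ⟩
        b n                             ∎
      h′ : Series
      h′ = drop M (drop N h)
      h′≤ : ∀ k → k ℕ.≤ r → ∣ h′ k ∣ ≤ inv m * δ
      h′≤ k _ = *-cancel-≤ (0<fromℕ-suc m) (begin
        F M * ∣ h′ k ∣                  ≤⟨ *-≤ʳ (0≤∣p∣ (h′ k)) (fromℕ-mono (ℕ.≤-trans (ℕ.m≤m+n M k) (ℕ.m≤n+m (M ℕ.+ k) N))) ⟩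
        F j * ∣ h′ k ∣                  ≡⟨ cong (λ y → F j * ∣ y ∣) (trans (drop-at M (drop N h) k) (drop-at N h (M ℕ.+ k))) ⟩
        F j * ∣ h j ∣                   ≡⟨ cong (_* ∣ h j ∣) (0≤p⇒∣p∣≡p (0≤fromℕ j)) ⟨
        ∣ F j ∣ * ∣ h j ∣               ≡⟨ ∣p*q∣≡∣p∣*∣q∣ (F j) (h j) ⟨
        ∣ F j * h j ∣                   ≤⟨ θ≤δ j (ℕ.≤-trans (ℕ.m≤m+n M k) (ℕ.m≤n+m (M ℕ.+ k) N)) ⟩
        δ                               ≡⟨ *-identityˡ δ ⟨
        1ℚ * δ                          ≡⟨ cong (_* δ) (fromℕ*inv m) ⟨
        F M * inv m * δ                 ≡⟨ *-assoc (F M) (inv m) δ ⟩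
        F M * (inv m * δ)               ∎)
        where j = N ℕ.+ (M ℕ.+ k)
      odd≤ : odd r ≤ (2ℚ + 1ℚ) * F M
      odd≤ = begin
        F r + F r + 1ℚ                  ≤⟨ +-mono-≤ (+-mono-≤ (fromℕ-mono r≤M) (fromℕ-mono r≤M)) (fromℕ-mono {1} {M} (ℕ.s≤s ℕ.z≤n)) ⟩
        F M + F M + F M                 ≡⟨ solve 1 (λ x → x :+ x :+ x := (con 2ℚ :+ con 1ℚ) :* x) refl (F M) ⟩
        (2ℚ + 1ℚ) * F M                 ∎
      step₃ : ∣ (h′ S.* D) r ∣ ≤ 6ℚ * δ * b n
      step₃ = begin
        ∣ (h′ S.* D) r ∣                ≡⟨ cong ∣_∣ (S.*-comm′ h′ D r) ⟩
        ∣ (D S.* h′) r ∣                ≤⟨ conv-≤ D h′ r h′≤ ⟩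
        sum (abs D) (suc r) * (inv m * δ)
          ≤⟨ *-≤ʳ (0≤* (<⇒≤ (0<inv m)) 0≤δ) (≤-trans (sum-mono-< (suc r) (λ k k<1+r →
               ≤-trans (≤-reflexive (∣D∣ (ℕ.≤-trans (ℕ.≤-pred k<1+r) (ℕ.≤-trans r≤n′ n′≤n))))
                 (≤-via (b n) (0≤b n) (solve 2 (λ x y → x := (x :- y) :+ y) refl (b k) (b n))))) (≤-reflexive (sum-b r))) ⟩
        odd r * b r * (inv m * δ)       ≤⟨ *-≤ʳ (0≤* (<⇒≤ (0<inv m)) 0≤δ) (*-mono-≤ (0≤odd r) odd≤ (0≤b r) br≤) ⟩
        (2ℚ + 1ℚ) * F M * (2ℚ * b n) * (inv m * δ)
          ≡⟨ solve 4 (λ f b i d → (con 2ℚ :+ con 1ℚ) :* f :* (con 2ℚ :* b) :* (i :* d) := (f :* i) :* (con 6ℚ :* d :* b)) refl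
               (F M) (b n) (inv m) δ ⟩
        F M * inv m * (6ℚ * δ * b n)    ≡⟨ trans (cong (_* (6ℚ * δ * b n)) (fromℕ*inv m)) (*-identityˡ _) ⟩
        6ℚ * δ * b n                    ∎

    conv-b : Tame h → Small (λ n → (h S.* b) n - value h n * b n)
    conv-b (tame s nθ) ε 0<ε =
      -- A quarter of ε for each of the three ranges, with one quarter to spare.
      let κ = ½ * (½ * ε)
          0<κ = 0<* 0<½ (0<* 0<½ 0<ε)
          A , 0<A , sum≤A = summable-bound {h} s
          η , 0<η , Aη≡κ  = divide 0<A 0<κ
          δ , 0<δ , 6δ≡κ  = divide 0<6 0<κ
          N , tail≤κ      = s κ 0<κ
          ι , 0<ι , Nι≡η  = divide (0<fromℕ-suc N) 0<η
          J , inv≤ι       = inv-null ι 0<ι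
          L , θ≤δ         = nθ δ 0<δ
          -- Both halves of n - N reach at least this `t`, hence exceed N, J and L at once; that N
          -- is below r also yields n ≤ 4r.
          t = suc (N ℕ.+ (J ℕ.+ L))
      in N ℕ.+ (suc t ℕ.+ t) , λ n le →
        let n′ = n ℕ.∸ N
            N+n′≡n = ℕ.m+[n∸m]≡n (ℕ.≤-trans (ℕ.m≤m+n N (suc t ℕ.+ t)) le)
            2t≤n′ = ℕ.≤-trans (ℕ.≤-reflexive (sym (ℕ.m+n∸m≡n N (suc t ℕ.+ t)))) (ℕ.∸-monoˡ-≤ N le)
            M , r , M+r≡n′ , r≤M , M≤1+r = halve n′
        in conclude ε N {J} {L} M r n (trans (cong (N ℕ.+_) M+r≡n′) N+n′≡n)
             r≤M M≤1+r (ℕ.≤-trans 2t≤n′ (ℕ.≤-reflexive (sym M+r≡n′))) (<⇒≤ 0<ε) (<⇒≤ 0<η) (<⇒≤ 0<δ) (<⇒≤ 0<ι)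
             (sum≤A N) tail≤κ inv≤ι θ≤δ Aη≡κ 6δ≡κ Nι≡η
      where
      conclude : ∀ ε N {J L} M r n {A η δ ι} → N ℕ.+ (M ℕ.+ r) ≡ n → r ℕ.≤ M → M ℕ.≤ suc r →
        (let t = suc (N ℕ.+ (J ℕ.+ L)) in suc t ℕ.+ t ℕ.≤ M ℕ.+ r) →
        0ℚ ≤ ε → 0ℚ ≤ η → 0ℚ ≤ δ → 0ℚ ≤ ι →
        sum (abs h) N ≤ A → (∀ j → sum (abs (drop N h)) j ≤ ½ * (½ * ε)) → (∀ n → J ℕ.≤ n → inv n ≤ ι) →
        (∀ k → L ℕ.≤ k → ∣ F k * h k ∣ ≤ δ) →
        A * η ≡ ½ * (½ * ε) → 6ℚ * δ ≡ ½ * (½ * ε) → F (suc N) * ι ≡ η →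
        ∣ (h S.* b) n - value h n * b n ∣ ≤ ε * b n
      conclude ε N {J} {L} zero zero n e ℕ.z≤n _ () 0≤ε 0≤η 0≤δ 0≤ι sum≤A tail≤κ inv≤ι θ≤δ Aη≡κ 6δ≡κ Nι≡η
      conclude ε N {J} {L} (suc m) r n {A} {η} {δ} {ι} refl r≤M M≤1+r big 0≤ε 0≤η 0≤δ 0≤ι sum≤A tail≤κ inv≤ι θ≤δ Aη≡κ 6δ≡κ Nι≡η =
        ≤-trans (conv-b-bound N m r {A} {η} {½ * (½ * ε)} {δ} (ℕ.≤-trans (ℕ.s≤s ℕ.z≤n) t≤r) r≤M n≤4r 0≤η 0≤δ sum≤A tail≤κ
            (≤-trans (*-≤ˡ (0≤fromℕ N) (inv≤ι (suc m ℕ.+ r) (ℕ.≤-trans J≤t (ℕ.≤-trans t≤r (ℕ.m≤n+m r (suc m))))))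
              (≤-trans (*-≤ʳ 0≤ι (fromℕ-mono (ℕ.n≤1+n N))) (≤-reflexive Nι≡η)))
            (λ k M≤k → θ≤δ k (ℕ.≤-trans L≤t (ℕ.≤-trans t≤r (ℕ.≤-trans r≤M M≤k)))))
          (*-≤ʳ {p = A * η + (½ * (½ * ε) + 6ℚ * δ)} {q = ε} (0≤b (N ℕ.+ (suc m ℕ.+ r))) (≤-via (½ * (½ * ε)) (0≤* (<⇒≤ 0<½) (0≤* (<⇒≤ 0<½) 0≤ε))
            (sym (trans (cong₂ (λ x y → x + (½ * (½ * ε) + y) + ½ * (½ * ε)) Aη≡κ 6δ≡κ)
              (solve 1 (λ e → let k = con ½ :* (con ½ :* e) in k :+ (k :+ k) :+ k := e) refl ε)))))
        where
        t = suc (N ℕ.+ (J ℕ.+ L))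
        t≤r : t ℕ.≤ r
        t≤r = ℕ.≮⇒≥ λ r<t → ℕ.<-irrefl refl (ℕ.<-≤-trans (ℕ.+-mono-≤-< (ℕ.≤-trans M≤1+r (ℕ.m≤n⇒m≤1+n r<t)) r<t) big)
        J≤t : J ℕ.≤ t
        J≤t = ℕ.m≤n⇒m≤1+n (ℕ.≤-trans (ℕ.m≤m+n J L) (ℕ.m≤n+m (J ℕ.+ L) N))
        L≤t : L ℕ.≤ t
        L≤t = ℕ.m≤n⇒m≤1+n (ℕ.≤-trans (ℕ.m≤n+m L J) (ℕ.m≤n+m (J ℕ.+ L) N))
        n≤4r : N ℕ.+ (suc m ℕ.+ r) ℕ.≤ 4 ℕ.* r
        n≤4r = ℕ.≤-trans (ℕ.+-mono-≤ (ℕ.≤-trans (ℕ.≤-pred (ℕ.≤-trans (ℕ.s≤s (ℕ.m≤m+n N (J ℕ.+ L))) t≤r′)) (ℕ.≤-refl {r ℕ.∸ 1})) (ℕ.+-monoˡ-≤ r M≤1+r))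
          (shape r (ℕ.≤-trans (ℕ.s≤s ℕ.z≤n) t≤r))
          where
          t≤r′ : t ℕ.≤ suc (r ℕ.∸ 1)
          t≤r′ = ℕ.≤-trans t≤r (ℕ.≤-reflexive (sym (trans (ℕ.+-comm 1 (r ℕ.∸ 1)) (ℕ.m∸n+n≡m (ℕ.≤-trans (ℕ.s≤s ℕ.z≤n) t≤r)))))
          shape : ∀ r → 1 ℕ.≤ r → (r ℕ.∸ 1) ℕ.+ (suc r ℕ.+ r) ℕ.≤ 4 ℕ.* r
          shape (suc r) _ = ℕ.≤-trans (ℕ.≤-reflexive (ℕ.+-suc r (suc r ℕ.+ suc r)))
            (ℕ.+-monoʳ-≤ (suc r) (ℕ.+-monoʳ-≤ (suc r) (ℕ.m≤m+n (suc r) (1 ℕ.* suc r))))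

-- The series in use are tame

module TameMembers where

  open Limits
  private module S = Series
  open Series using (Series; tail; const; z; z*-suc; θ; _≈_; ≈-trans; ≈-refl; at; pointwise; const-*; module SeriesSolver)
  open ClosedForms
  open GeneratingFunction
  open Coefficients using (x*-suc; x*-zero)
  open TameSeries
  open CentralBinomial
  open import Data.Rational.Base
  open import Data.Rational.Properties
  open import Data.Rational.Solver using (module +-*-Solver)
  open RationalSequences using (0<*; 0≤*; 0<½; 0<1; ½+½; *-mono-≤; divide; fromℕ; fromℕ-suc; fromℕ-mono; archimedean′)

  private
    module SS = SeriesSolver
    open +-*-Solver using (solve; con; _:=_; _:+_; _:*_; _:-_; :-_)

  β-1 : ∀ n → β 1ℚ n ≡ b n
  β-1 n = trans (cong (b n *_) (pow-1 n)) (*-identityʳ (b n))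
    where
    pow-1 : ∀ n → pow 1ℚ n ≡ 1ℚ
    pow-1 zero    = refl
    pow-1 (suc n) = trans (*-identityˡ (pow 1ℚ n)) (pow-1 n)

  σ-1-suc : ∀ n → σ 1ℚ (suc n) ≡ - (b n - b (suc n))
  σ-1-suc n = trans (at expand (suc n)) (trans (cong₂ (λ x y → x - y) (β-1 (suc n)) (trans (z*-suc (β 1ℚ) n) (β-1 n)))
    (solve 2 (λ x y → y :- x := :- (x :- y)) refl (b n) (b (suc n))))
    where
    expand : σ 1ℚ ≈ β 1ℚ S.- z S.* β 1ℚ
    expand = SS.solve 2 (λ z B → (SS.con 1ℚ SS.:- SS.con 1ℚ SS.:* z) SS.:* B SS.:= B SS.:- z SS.:* B) ≈-refl z (β 1ℚ)

  telescope : ∀ (d : Series) N m → sum (λ k → d (N ℕ.+ k) - d (suc (N ℕ.+ k))) m ≡ d N - d (N ℕ.+ m)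
  telescope d N zero    = sym (trans (cong (λ k → d N - d k) (ℕ.+-identityʳ N)) (+-inverseʳ (d N)))
  telescope d N (suc m) = trans (sum-snoc (λ k → d (N ℕ.+ k) - d (suc (N ℕ.+ k))) m)
    (trans (cong₂ (λ x y → x + (d (N ℕ.+ m) - d y)) (telescope d N m) (sym (ℕ.+-suc N m)))
      (solve 3 (λ x y w → (x :- y) :+ (y :- w) := x :- w) refl (d N) (d (N ℕ.+ m)) (d (N ℕ.+ suc m))))

  -- After the first one, the coefficients are -(b(n) - b(n+1)): of constant sign and telescoping to
  -- a null sequence. By `θσ` the coefficients of θ are those of -(1/2) z β, and these are null as
  -- well.
  tame-σ-1 : Tame (σ 1ℚ)
  tame-σ-1 = tame
    (λ ε 0<ε → let N , b≤ε = b-small ε 0<ε in suc N , λ m → ≤-trans (≤-reflexive (trans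
       (sum-cong (λ k → trans (cong ∣_∣ (trans (drop-at (suc N) (σ 1ℚ) k) (σ-1-suc (N ℕ.+ k)))) (trans (∣-p∣≡∣p∣ (b (N ℕ.+ k) - b (suc (N ℕ.+ k)))) (0≤p⇒∣p∣≡p (0≤step (N ℕ.+ k))))) m)
       (telescope b N m)))
       (≤-trans (≤-via (b (N ℕ.+ m)) (0≤b (N ℕ.+ m)) (solve 2 (λ x y → x := (x :- y) :+ y) refl (b N) (b (N ℕ.+ m)))) (b≤ε N ℕ.≤-refl)))
    (null-≡ {b = λ n → - (½ * 1ℚ * (z S.* β 1ℚ) n)} (λ n → trans (at (θσ 1ℚ) n) (cong (λ y → - y) (const-* (½ * 1ℚ) (z S.* β 1ℚ) n)))
      (null-neg {λ n → ½ * 1ℚ * (z S.* β 1ℚ) n} (null-* {λ _ → ½ * 1ℚ} {z S.* β 1ℚ} (bounded-const (½ * 1ℚ))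
        (summable*null {z} {β 1ℚ} (summable tame-z) (null-≡ {β 1ℚ} {b} β-1 b-null)))))
    where
    0≤step : ∀ n → 0ℚ ≤ b n - b (suc n)
    0≤step n = subst (_≤ b n - b (suc n)) (+-inverseʳ (b (suc n))) (+-monoˡ-≤ (- b (suc n)) (b-step n))

  pow-≥0 : ∀ {ϑ} → 0ℚ ≤ ϑ → ∀ j → 0ℚ ≤ pow ϑ j
  pow-≥0 0≤ϑ zero    = <⇒≤ 0<1
  pow-≥0 0≤ϑ (suc j) = 0≤* 0≤ϑ (pow-≥0 0≤ϑ j)

  -- Bernoulli's inequality in the form ϑ^j (1 + j (1 - ϑ)) ≤ 1, which is preserved by
  -- multiplication with ϑ; the resulting decay like 1/j is enough for `pow-small`.
  bernoulli : ∀ {ϑ} → 0ℚ ≤ ϑ → ϑ ≤ 1ℚ → ∀ j → fromℕ j * (1ℚ - ϑ) * pow ϑ j + pow ϑ j ≤ 1ℚ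
  bernoulli {ϑ} 0≤ϑ ϑ≤1 zero    = ≤-reflexive (trans (cong (λ x → x * 1ℚ + 1ℚ) (*-zeroˡ (1ℚ - ϑ))) refl)
  bernoulli {ϑ} 0≤ϑ ϑ≤1 (suc j) = begin
    fromℕ (suc j) * (1ℚ - ϑ) * (ϑ * P) + ϑ * P
      ≡⟨ cong (λ x → x * (1ℚ - ϑ) * (ϑ * P) + ϑ * P) (fromℕ-suc j) ⟩
    (fromℕ j + 1ℚ) * (1ℚ - ϑ) * (ϑ * P) + ϑ * P
      ≡⟨ solve 3 (λ j t p → (j :+ con 1ℚ) :* (con 1ℚ :- t) :* (t :* p) :+ t :* p
           := t :* (j :* (con 1ℚ :- t) :* p :+ p) :+ (con 1ℚ :- t) :* (t :* p)) refl (fromℕ j) ϑ P ⟩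
    ϑ * (fromℕ j * (1ℚ - ϑ) * P + P) + (1ℚ - ϑ) * (ϑ * P)
      ≤⟨ +-mono-≤ (*-≤ˡ 0≤ϑ (bernoulli 0≤ϑ ϑ≤1 j)) (*-≤ˡ 0≤1-ϑ (*-mono-≤ 0≤ϑ ϑ≤1 (pow-≥0 0≤ϑ j) (pow-≤1 j))) ⟩
    ϑ * 1ℚ + (1ℚ - ϑ) * (1ℚ * 1ℚ)
      ≡⟨ solve 1 (λ t → t :* con 1ℚ :+ (con 1ℚ :- t) :* (con 1ℚ :* con 1ℚ) := con 1ℚ) refl ϑ ⟩
    1ℚ ∎
    where
    open ≤-Reasoning
    P = pow ϑ j
    0≤1-ϑ : 0ℚ ≤ 1ℚ - ϑ
    0≤1-ϑ = subst (_≤ 1ℚ - ϑ) (+-inverseʳ ϑ) (+-monoˡ-≤ (- ϑ) ϑ≤1)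
    pow-≤1 : ∀ j → pow ϑ j ≤ 1ℚ
    pow-≤1 zero    = ≤-refl
    pow-≤1 (suc j) = *-mono-≤ 0≤ϑ ϑ≤1 (pow-≥0 0≤ϑ j) (pow-≤1 j)

  pow-small : ∀ {ϑ} → 0ℚ ≤ ϑ → ϑ < 1ℚ → ∀ ε → 0ℚ < ε → ∃[ j ] pow ϑ j ≤ ε
  pow-small {ϑ} 0≤ϑ ϑ<1 ε 0<ε =
    let J , 1≤ = archimedean′ 1ℚ (ε * (1ℚ - ϑ)) (0<* 0<ε 0<1-ϑ)
    in suc J , *-cancel-≤ (0<* (0<fromℕ-suc J) 0<1-ϑ) (begin
      fromℕ (suc J) * (1ℚ - ϑ) * pow ϑ (suc J)
        ≤⟨ ≤-trans (≤+ _ (pow-≥0 0≤ϑ (suc J))) (bernoulli 0≤ϑ (<⇒≤ ϑ<1) (suc J)) ⟩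
      1ℚ                                       ≤⟨ 1≤ ⟩
      ε * (1ℚ - ϑ) * fromℕ J                   ≤⟨ *-≤ˡ (<⇒≤ (0<* 0<ε 0<1-ϑ)) (fromℕ-mono (ℕ.n≤1+n J)) ⟩
      ε * (1ℚ - ϑ) * fromℕ (suc J)
        ≡⟨ solve 3 (λ e d f → e :* d :* f := f :* d :* e) refl ε (1ℚ - ϑ) (fromℕ (suc J)) ⟩
      fromℕ (suc J) * (1ℚ - ϑ) * ε             ∎)
    where
    open ≤-Reasoning
    0<1-ϑ : 0ℚ < 1ℚ - ϑ
    0<1-ϑ = subst (_< 1ℚ - ϑ) (+-inverseʳ ϑ) (+-monoˡ-< (- ϑ) ϑ<1)

  abs-sum : ∀ {a : Series} → (∀ n → 0ℚ ≤ a n) → ∀ m → sum (abs a) m ≡ sum a m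
  abs-sum 0≤a = sum-cong (λ n → 0≤p⇒∣p∣≡p (0≤a n))

  sum-const-≤ : ∀ q → 0ℚ ≤ q → ∀ m → sum (const q) m ≤ q
  sum-const-≤ q 0≤q zero    = 0≤q
  sum-const-≤ q 0≤q (suc m) = ≤-reflexive (trans (cong (q +_) (sum-tail-const q m)) (+-identityʳ q))

  -- Nonnegative coefficients of total mass at most ϑ < 1 keep 1 - p away from 0 on the closed unit
  -- disc. This elementary case stands in for Wiener's lemma on inverting absolutely convergent
  -- series.
  module Geometric {p : Series} {ϑ : ℚ} (p₀ : p 0 ≡ 0ℚ) (0≤p : ∀ n → 0ℚ ≤ p n) (tp : Tame p)
                   (0≤ϑ : 0ℚ ≤ ϑ) (ϑ<1 : ϑ < 1ℚ) (sum-p : ∀ m → sum p m ≤ ϑ) where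

    private
      Q : Series
      Q = geometric p
      0<1-ϑ : 0ℚ < 1ℚ - ϑ
      0<1-ϑ = subst (_< 1ℚ - ϑ) (+-inverseʳ ϑ) (+-monoˡ-< (- ϑ) ϑ<1)

    approx-≥0 : ∀ k n → 0ℚ ≤ approx p k n
    approx-≥0 zero    zero    = ≤-refl
    approx-≥0 zero    (suc n) = ≤-refl
    approx-≥0 (suc k) n = +-mono-≤ (0≤const n) (conv-≥0 p (approx p k) n 0≤p (approx-≥0 k))
      where
      0≤const : ∀ n → 0ℚ ≤ const 1ℚ n
      0≤const zero    = <⇒≤ 0<1
      0≤const (suc n) = ≤-refl

    geometric-≥0 : ∀ n → 0ℚ ≤ geometric p n
    geometric-≥0 n = approx-≥0 (suc n) n

    private
      bound : ∃[ B ] 0ℚ < B × (∀ m → sum Q m ≤ B)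
      bound = let B , 0<B , B≡ = divide 0<1-ϑ 0<1 in B , 0<B , λ m → *-cancel-≤ 0<1-ϑ
        (≤-trans (≤-trans (≤-reflexive (solve 2 (λ t s → (con 1ℚ :- t) :* s := s :- t :* s) refl ϑ (sum Q m)))
          (RationalSequences.p-q≤r {sum Q m} {1ℚ} {ϑ * sum Q m} (≤-trans (≤-reflexive (trans (sum-cong (at (geometric-eq {p} p₀)) m) (sum-+ (const 1ℚ) (p S.* Q) m)))
            (+-mono-≤ (sum-const-≤ 1ℚ (<⇒≤ 0<1) m) (≤-trans (sum-conv-≤ p Q m 0≤p geometric-≥0)
              (*-≤ʳ (sum-≥0 geometric-≥0 m) (sum-p m))))))) (≤-reflexive (sym B≡)))

      Tail : ℕ → ℚ → Set
      Tail M e = ∀ j → M ℕ.≤ j → ∀ m → sum (abs (drop j Q)) m ≤ e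

      -- One application of q = 1 + p q to the tails of q: the head of p contracts a known bound e
      -- by ϑ, and the tail of p contributes at most δB.
      step : ∀ {B δ e} N M → 0ℚ ≤ e → (∀ m → sum Q m ≤ B) → (∀ m → sum (abs (drop N p)) m ≤ δ) → 0ℚ ≤ B →
             Tail M e → Tail (suc (N ℕ.+ M)) (ϑ * e + δ * B)
      step {B} {δ} {e} N M 0≤e sum-Q tail-p 0≤B tail-Q j le m =
        tail-sums {ε = ϑ * e + δ * B} (suc (N ℕ.+ M)) {j} Q m le first
        where
        first : ∀ m → sum (abs (drop (suc (N ℕ.+ M)) Q)) m ≤ ϑ * e + δ * B
        first m = ≤-trans (≤-reflexive (sum-cong (λ k → cong ∣_∣ (trans (drop-at (suc (N ℕ.+ M)) Q k)
            (trans (at (geometric-eq {p} p₀) (suc (N ℕ.+ M ℕ.+ k))) (trans (+-identityˡ _) (sym (drop-at (suc (N ℕ.+ M)) (p S.* Q) k)))))) m))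
          (≤-trans (tail-sums (N ℕ.+ M) (p S.* Q) m (ℕ.n≤1+n (N ℕ.+ M)) (λ m → tail-conv N M p Q m {e} {δ * B} tail-Q
              (≤-trans (drop-sum-≤ M (drop N p S.* Q) m) (≤-trans (sum-abs-conv (drop N p) Q (M ℕ.+ m))
                (*-mono-≤ (sum-≥0 (λ n → 0≤∣p∣ (drop N p n)) (M ℕ.+ m)) (tail-p (M ℕ.+ m))
                  (sum-≥0 (λ n → 0≤∣p∣ (Q n)) (M ℕ.+ m)) (≤-trans (≤-reflexive (abs-sum geometric-≥0 (M ℕ.+ m))) (sum-Q (M ℕ.+ m))))))))
            (+-monoˡ-≤ (δ * B) (*-≤ʳ 0≤e (≤-trans (≤-reflexive (abs-sum 0≤p N)) (sum-p N)))))

      -- The hypothesis makes e the fixed point of the contraction e ↦ ϑ e + δB in `step`, so the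
      -- bounds approach it from B + e at rate ϑ.
      iterate : ∀ {B δ e} N → 0ℚ ≤ e → 0ℚ ≤ B → (∀ m → sum Q m ≤ B) → (∀ m → sum (abs (drop N p)) m ≤ δ) →
                δ * B ≡ (1ℚ - ϑ) * e → ∀ j → ∃[ M ] Tail M (pow ϑ j * B + e)
      iterate {B} {δ} {e} N 0≤e 0≤B sum-Q tail-p δB≡ zero = 0 , λ j _ m →
        ≤-trans (drop-sum-≤ j Q m) (≤-trans (≤-reflexive (abs-sum geometric-≥0 (j ℕ.+ m)))
          (≤-trans (sum-Q (j ℕ.+ m)) (≤-trans (≤-reflexive (sym (*-identityˡ B))) (≤+ (1ℚ * B) 0≤e))))
      iterate {B} {δ} {e} N 0≤e 0≤B sum-Q tail-p δB≡ (suc j) =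
        let M , tail-Q = iterate {B} {δ} {e} N 0≤e 0≤B sum-Q tail-p δB≡ j
        in suc (N ℕ.+ M) , λ i le m → ≤-trans
          (step {B} {δ} {pow ϑ j * B + e} N M (+-mono-≤ (0≤* (pow-≥0 0≤ϑ j) 0≤B) 0≤e) sum-Q tail-p 0≤B tail-Q i le m)
          (≤-reflexive (trans (cong (ϑ * (pow ϑ j * B + e) +_) δB≡)
            (solve 4 (λ t p b e → t :* (p :* b :+ e) :+ (con 1ℚ :- t) :* e := t :* p :* b :+ e) refl ϑ (pow ϑ j) B e)))

    summable-geometric : Summable (geometric p)
    summable-geometric ε 0<ε =
      let B , 0<B , sum-Q = bound
          e = ½ * ε
          0<e = 0<* 0<½ 0<ε
          δ , 0<δ , Bδ≡ = divide 0<B (0<* 0<1-ϑ 0<e)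
          N , tail-p = summable tp δ 0<δ
          ι , 0<ι , Bι≡ = divide 0<B 0<e
          j , pow≤ι = pow-small 0≤ϑ ϑ<1 ι 0<ι
          M , tail-Q = iterate {B} {δ} {e} N (<⇒≤ 0<e) (<⇒≤ 0<B) sum-Q tail-p (trans (*-comm δ B) Bδ≡) j
      in M , λ m → ≤-trans (tail-Q M ℕ.≤-refl m) (≤-trans (+-monoˡ-≤ e (≤-trans (*-≤ʳ (<⇒≤ 0<B) pow≤ι)
           (≤-reflexive (trans (*-comm ι B) Bι≡)))) (≤-reflexive (½+½ ε)))

    tame-geometric : Tame (geometric p)
    tame-geometric = tame summable-geometric (null-≡ {b = (Q S.* Q) S.* θ p} (at (θ-geometric {p} p₀))
      (summable*null {Q S.* Q} (summable-* {Q} {Q} summable-geometric summable-geometric) (null-θ tp)))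

  0≤const : ∀ {q} → 0ℚ ≤ q → ∀ n → 0ℚ ≤ const q n
  0≤const 0≤q zero    = 0≤q
  0≤const 0≤q (suc n) = ≤-refl

  x*-≥0 : ∀ a n → (∀ k → 0ℚ ≤ a k) → 0ℚ ≤ (x S.* a) n
  x*-≥0 a zero    0≤a = ≤-reflexive (sym (x*-zero a))
  x*-≥0 a (suc n) 0≤a = subst (0ℚ ≤_) (sym (x*-suc a n)) (0≤* {⅙} {a n} (≤ᵇ⇒≤ _) (0≤a n))

  sum-x* : ∀ a m → sum (x S.* a) (suc m) ≡ ⅙ * sum a m
  sum-x* a m = trans (cong (_+ sum (tail (x S.* a)) m) (x*-zero a)) (trans (+-identityˡ _)
    (trans (sum-cong (x*-suc a) m) (sum-scale ⅙ a m)))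

  tame-pow : Tame (pow ⅔)
  tame-pow = tame-≈ (≈-trans (geometric-unique {const ⅔ S.* z} refl {pow ⅔} {const 1ℚ} (pointwise rec))
      (S.*-identityˡ (geometric (const ⅔ S.* z))))
    (Geometric.tame-geometric {const ⅔ S.* z} {⅔} refl
      (λ { zero → ≤-refl ; (suc zero) → ≤ᵇ⇒≤ _ ; (suc (suc n)) → ≤-reflexive (sym (zero-at n)) })
      (tame-* {const ⅔} {z} (tame-const ⅔) tame-z) (≤ᵇ⇒≤ _) (≰⇒> (λ 1≤⅔ → ≤⇒≤ᵇ 1≤⅔)) mass)
    where
    zero-at : ∀ n → (const ⅔ S.* z) (suc (suc n)) ≡ 0ℚ
    zero-at n = trans (const-* ⅔ z (suc (suc n))) (*-zeroʳ ⅔)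
    rec : ∀ n → pow ⅔ n ≡ const 1ℚ n + ((const ⅔ S.* z) S.* pow ⅔) n
    rec n = sym (trans (cong (const 1ℚ n +_) (trans (at (S.*-assoc (const ⅔) z (pow ⅔)) n) (const-* ⅔ (z S.* pow ⅔) n))) (go n))
      where
      go : ∀ n → const 1ℚ n + ⅔ * (z S.* pow ⅔) n ≡ pow ⅔ n
      go zero    = refl
      go (suc n) = trans (+-identityˡ _) (cong (⅔ *_) (z*-suc (pow ⅔) n))
    mass : ∀ m → sum (const ⅔ S.* z) m ≤ ⅔
    mass zero          = ≤ᵇ⇒≤ _
    mass (suc zero)    = ≤ᵇ⇒≤ _
    mass (suc (suc m)) = ≤-reflexive (trans (cong (λ y → 0ℚ + (⅔ + y)) (zeros m)) refl)
      where
      zeros : ∀ m → sum (tail (tail (const ⅔ S.* z))) m ≡ 0ℚ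
      zeros m = trans (sum-cong {b = λ _ → 0ℚ} zero-at m) (const-zeros m)
        where
        const-zeros : ∀ m → sum (λ _ → 0ℚ) m ≡ 0ℚ
        const-zeros zero    = refl
        const-zeros (suc m) = trans (+-identityˡ _) (const-zeros m)

  -- The bound 2/3 covers both parameters in use, 2/3 and -1/3, so a single geometric series
  -- dominates them.
  tame-β : ∀ {t} → ∣ t ∣ ≤ ⅔ → Tame (β t)
  tame-β {t} t≤⅔ = tame-≤ (λ n → ≤-trans (∣∣-*-≤ (b n) (pow t n) (≤-trans (≤-reflexive (0≤p⇒∣p∣≡p (0≤b n))) (b≤1 n)) (∣pow∣ n))
      (≤-trans (≤-reflexive (*-identityˡ (pow ⅔ n))) (RationalSequences.p≤∣p∣ (pow ⅔ n)))) tame-pow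
    where
    ∣pow∣ : ∀ n → ∣ pow t n ∣ ≤ pow ⅔ n
    ∣pow∣ zero    = ≤-refl
    ∣pow∣ (suc n) = ∣∣-*-≤ t (pow t n) t≤⅔ (∣pow∣ n)

  tame-minus : ∀ {a b} → Tame a → Tame b → Tame (a S.- b)
  tame-minus {a} {b} ta tb = tame-+ {a} {S.- b} ta (tame-neg tb)

  tame-σ : ∀ {t} → ∣ t ∣ ≤ ⅔ → Tame (σ t)
  tame-σ {t} t≤⅔ = tame-* {const 1ℚ S.- const t S.* z} {β t}
    (tame-minus (tame-const 1ℚ) (tame-* {const t} {z} (tame-const t) tame-z)) (tame-β t≤⅔)

  tame-β-⅔ : Tame (β ⅔)
  tame-β-⅔ = tame-β (≤ᵇ⇒≤ _)

  tame-β--⅓ : Tame (β -⅓)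
  tame-β--⅓ = tame-β (≤ᵇ⇒≤ _)

  tame-σ-⅔ : Tame (σ ⅔)
  tame-σ-⅔ = tame-σ (≤ᵇ⇒≤ _)

  tame-σ--⅓ : Tame (σ -⅓)
  tame-σ--⅓ = tame-σ (≤ᵇ⇒≤ _)

  tame-Cat : Tame Cat
  tame-Cat = tame-* {const 3ℚ} (tame-const 3ℚ) (tame-tail (tame-minus (tame-const 1ℚ) tame-σ-⅔))

  tame-μ : Tame μ
  tame-μ = tame-* {const 3/2} (tame-const 3/2) (tame-tail (tame-minus
    (tame-minus (tame-const 1ℚ) (tame-* {const ⅓} {z} (tame-const ⅓) tame-z))
    (tame-* {σ 1ℚ} {σ -⅓} tame-σ-1 tame-σ--⅓)))

  conv-≥0-upto : ∀ a b n → (∀ k → k ℕ.≤ n → 0ℚ ≤ a k) → (∀ k → k ℕ.≤ n → 0ℚ ≤ b k) → 0ℚ ≤ (a S.* b) n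
  conv-≥0-upto a b zero    0≤a 0≤b = 0≤* (0≤a 0 ℕ.z≤n) (0≤b 0 ℕ.z≤n)
  conv-≥0-upto a b (suc n) 0≤a 0≤b = +-mono-≤ (0≤* (0≤a 0 ℕ.z≤n) (0≤b (suc n) ℕ.≤-refl))
    (conv-≥0-upto (tail a) b n (λ k k≤n → 0≤a (suc k) (ℕ.s≤s k≤n)) (λ k k≤n → 0≤b k (ℕ.m≤n⇒m≤1+n k≤n)))

  strong-≥0 : ∀ {a : Series} → 0ℚ ≤ a 0 → (∀ n → (∀ k → k ℕ.≤ n → 0ℚ ≤ a k) → 0ℚ ≤ a (suc n)) → ∀ n → 0ℚ ≤ a n
  strong-≥0 {a} base step n = upto n n ℕ.≤-refl
    where
    upto : ∀ n k → k ℕ.≤ n → 0ℚ ≤ a k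
    upto n       zero    _           = base
    upto (suc n) (suc k) (ℕ.s≤s k≤n) = step k (λ j j≤k → upto n j (ℕ.≤-trans j≤k k≤n))

  Cat-suc : ∀ n → Cat (suc n) ≡ ⅙ * (Cat S.* Cat) n
  Cat-suc n = trans (at Cat-eq (suc n)) (trans (+-identityˡ _) (x*-suc (Cat S.* Cat) n))

  Cat-zero : Cat 0 ≡ 1ℚ
  Cat-zero = trans (at Cat-eq 0) (trans (cong (1ℚ +_) (x*-zero (Cat S.* Cat))) (+-identityʳ 1ℚ))

  Cat-≥0 : ∀ n → 0ℚ ≤ Cat n
  Cat-≥0 = strong-≥0 {Cat} (subst (0ℚ ≤_) (sym Cat-zero) (<⇒≤ 0<1)) λ n h →
    subst (0ℚ ≤_) (sym (Cat-suc n)) (0≤* {⅙} {(Cat S.* Cat) n} (≤ᵇ⇒≤ _) (conv-≥0-upto Cat Cat n h h))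

  Y : Series
  Y = const 1ℚ S.+ μ S.+ μ S.* μ

  μ-zero : μ 0 ≡ 0ℚ
  μ-zero = refl

  μ-suc : ∀ n → μ (suc n) ≡ ⅓ * Y n
  μ-suc n = trans (at μ-eq (suc n)) (trans (const-* ⅓ (z S.* Y) (suc n)) (cong (⅓ *_) (z*-suc Y n)))

  μ-≥0 : ∀ n → 0ℚ ≤ μ n
  μ-≥0 = strong-≥0 {μ} (≤-reflexive (sym μ-zero)) λ n h → subst (0ℚ ≤_) (sym (μ-suc n)) (0≤* {⅓} {Y n} (≤ᵇ⇒≤ _)
    (+-mono-≤ (+-mono-≤ (0≤const (<⇒≤ 0<1) n) (h n ℕ.≤-refl)) (conv-≥0-upto μ μ n h h)))

  4/3 : ℚ
  4/3 = 1ℚ + ⅓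

  -- The functional equation preserves any bound B with 1 + B²/6 ≤ B; the rational 4/3 lies between
  -- the two roots 3 - √3 and 3 + √3.
  sum-Cat : ∀ m → sum Cat m ≤ 4/3
  sum-Cat zero    = ≤ᵇ⇒≤ _
  sum-Cat (suc m) = begin
    sum Cat (suc m)                          ≡⟨ cong₂ _+_ Cat-zero (trans (sum-cong Cat-suc m) (sum-scale ⅙ (Cat S.* Cat) m)) ⟩
    1ℚ + ⅙ * sum (Cat S.* Cat) m             ≤⟨ +-monoʳ-≤ 1ℚ (*-≤ˡ {⅙} (≤ᵇ⇒≤ _) (≤-trans (sum-conv-≤ Cat Cat m Cat-≥0 Cat-≥0)
                                                  (*-mono-≤ (sum-≥0 Cat-≥0 m) (sum-Cat m) (sum-≥0 Cat-≥0 m) (sum-Cat m)))) ⟩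
    1ℚ + ⅙ * (4/3 * 4/3)                     ≤⟨ ≤ᵇ⇒≤ _ ⟩
    4/3                                      ∎
    where open ≤-Reasoning

  -- 1 is the double root of B = (1 + B + B²) / 3, so the functional equation preserves this bound
  -- exactly.
  sum-μ : ∀ m → sum μ m ≤ 1ℚ
  sum-μ zero    = ≤ᵇ⇒≤ _
  sum-μ (suc m) = begin
    sum μ (suc m)                            ≡⟨ cong₂ _+_ μ-zero (trans (sum-cong μ-suc m) (sum-scale ⅓ Y m)) ⟩
    0ℚ + ⅓ * sum Y m                         ≡⟨ +-identityˡ _ ⟩
    ⅓ * sum Y m                              ≡⟨ cong (⅓ *_) (trans (sum-+ (const 1ℚ S.+ μ) (μ S.* μ) m) (cong (_+ sum (μ S.* μ) m) (sum-+ (const 1ℚ) μ m))) ⟩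
    ⅓ * (sum (const 1ℚ) m + sum μ m + sum (μ S.* μ) m)
      ≤⟨ *-≤ˡ (≤ᵇ⇒≤ _) (+-mono-≤ (+-mono-≤ (sum-const-≤ 1ℚ (<⇒≤ 0<1) m) (sum-μ m)) (≤-trans (sum-conv-≤ μ μ m μ-≥0 μ-≥0)
           (*-mono-≤ (sum-≥0 μ-≥0 m) (sum-μ m) (sum-≥0 μ-≥0 m) (sum-μ m)))) ⟩
    ⅓ * (1ℚ + 1ℚ + 1ℚ * 1ℚ)                  ≡⟨⟩
    1ℚ                                       ∎
    where open ≤-Reasoning

  -- A form without subtraction, by x C² = C - 1; it shows that p has nonnegative coefficients.
  Cat²-1 : Cat S.* Cat S.- const 1ℚ ≈ (x S.* (Cat S.* Cat)) S.* (Cat S.+ const 1ℚ)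
  Cat²-1 = ≈-trans (correct (Cat S.* Cat S.- const 1ℚ) (S.- (Cat S.+ const 1ℚ)) Cat-eq)
    (SS.solve 2 (λ C X → C SS.:* C SS.:- SS.con 1ℚ SS.:+ SS.:- (C SS.:+ SS.con 1ℚ) SS.:* (C SS.:- (SS.con 1ℚ SS.:+ X))
      SS.:= X SS.:* (C SS.:+ SS.con 1ℚ)) ≈-refl Cat (x S.* (Cat S.* Cat)))

  private
    -- This is 56/81, the product of the bounds for the three factors of p. That it is below 1 keeps
    -- the pole of q away, so that the singularity at z = 1 comes from μ.
    ϑ : ℚ
    ϑ = ⅙ * (4/3 * 4/3) * (4/3 + 1ℚ) * 1ℚ
    X²  = x S.* (Cat S.* Cat)
    C+1 = Cat S.+ const 1ℚ

    X²-≥0 : ∀ n → 0ℚ ≤ X² n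
    X²-≥0 n = x*-≥0 (Cat S.* Cat) n (λ k → conv-≥0 Cat Cat k Cat-≥0 Cat-≥0)

    C+1-≥0 : ∀ n → 0ℚ ≤ C+1 n
    C+1-≥0 n = +-mono-≤ (Cat-≥0 n) (0≤const (<⇒≤ 0<1) n)

    sum-X² : ∀ m → sum X² m ≤ ⅙ * (4/3 * 4/3)
    sum-X² zero    = ≤ᵇ⇒≤ _
    sum-X² (suc m) = ≤-trans (≤-reflexive (sum-x* (Cat S.* Cat) m)) (*-≤ˡ (≤ᵇ⇒≤ _) (≤-trans (sum-conv-≤ Cat Cat m Cat-≥0 Cat-≥0)
      (*-mono-≤ (sum-≥0 Cat-≥0 m) (sum-Cat m) (sum-≥0 Cat-≥0 m) (sum-Cat m))))

    p≈ : p ≈ (X² S.* C+1) S.* μ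
    p≈ = S.*-cong Cat²-1 (≈-refl {μ})

    p-≥0 : ∀ n → 0ℚ ≤ p n
    p-≥0 n = subst (0ℚ ≤_) (sym (at p≈ n)) (conv-≥0 (X² S.* C+1) μ n (λ k → conv-≥0 X² C+1 k X²-≥0 C+1-≥0) μ-≥0)

    sum-p : ∀ m → sum p m ≤ ϑ
    sum-p m = ≤-trans (≤-reflexive (sum-cong (at p≈) m)) (≤-trans
      (sum-conv-≤ (X² S.* C+1) μ m (λ k → conv-≥0 X² C+1 k X²-≥0 C+1-≥0) μ-≥0)
      (*-mono-≤ (sum-≥0 (λ k → conv-≥0 X² C+1 k X²-≥0 C+1-≥0) m) (≤-trans (sum-conv-≤ X² C+1 m X²-≥0 C+1-≥0)
        (*-mono-≤ (sum-≥0 X²-≥0 m) (sum-X² m) (sum-≥0 C+1-≥0 m) (≤-trans (≤-reflexive (sum-+ Cat (const 1ℚ) m))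
          (+-mono-≤ (sum-Cat m) (sum-const-≤ 1ℚ (<⇒≤ 0<1) m))))) (sum-≥0 μ-≥0 m) (sum-μ m)))

  tame-p : Tame p
  tame-p = tame-* {Cat S.* Cat S.- const 1ℚ} {μ} (tame-minus (tame-* {Cat} {Cat} tame-Cat tame-Cat) (tame-const 1ℚ)) tame-μ

  tame-q : Tame q
  tame-q = Geometric.tame-geometric {p} {ϑ} p-zero p-≥0 tame-p (≤ᵇ⇒≤ _) (≰⇒> (λ 1≤ϑ → ≤⇒≤ᵇ 1≤ϑ)) sum-p

  tame-C²q² : Tame ((Cat S.- const 1ℚ) S.* (Cat S.* Cat) S.* (q S.* q))
  tame-C²q² = tame-* {(Cat S.- const 1ℚ) S.* (Cat S.* Cat)} {q S.* q}
    (tame-* {Cat S.- const 1ℚ} {Cat S.* Cat} (tame-minus tame-Cat (tame-const 1ℚ)) (tame-* {Cat} {Cat} tame-Cat tame-Cat))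
    (tame-* {q} {q} tame-q tame-q)

  tame-h : Tame h
  tame-h = tame-* {(Cat S.- const 1ℚ) S.* (Cat S.* Cat) S.* (q S.* q) S.* μ} {β -⅓}
    (tame-* {(Cat S.- const 1ℚ) S.* (Cat S.* Cat) S.* (q S.* q)} {μ} tame-C²q² tame-μ) tame-β--⅓

  tame-w : Tame w
  tame-w = tame-* {θ Cat} (tame-≈ θCat (tame-minus tame-β-⅔ tame-Cat))
    (tame-* {(const 1ℚ S.+ μ) S.* q} (tame-* {const 1ℚ S.+ μ} {q} (tame-+ {const 1ℚ} {μ} (tame-const 1ℚ) tame-μ) tame-q)
      (tame-+ {const 1ℚ} (tame-const 1ℚ)
        (tame-* {(Cat S.- const 1ℚ) S.* q} {const 2ℚ S.* Cat S.* μ}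
          (tame-* {Cat S.- const 1ℚ} {q} (tame-minus tame-Cat (tame-const 1ℚ)) tame-q)
          (tame-* {const 2ℚ S.* Cat} {μ} (tame-* {const 2ℚ} {Cat} (tame-const 2ℚ) tame-Cat) tame-μ))))

  -- The equation for z·`Cat` read off coefficient by coefficient; it turns the upper bound for
  -- `Cat` into a lower bound for the value of σ(2/3).
  value-σ-⅔ : ∀ n → value (σ ⅔) n ≡ 1ℚ - ⅓ * sum Cat n
  value-σ-⅔ n = trans (cong (_+ sum (tail (σ ⅔)) n) (σ-zero ⅔)) (trans
    (solve 1 (λ t → con 1ℚ :+ t := con 1ℚ :- con ⅓ :* (con 3ℚ :* (con (- 1ℚ) :* t))) refl (sum (tail (σ ⅔)) n))
    (cong (λ y → 1ℚ - ⅓ * y) (sym (trans (sum-cong Cat-at n) (trans (sum-scale 3ℚ (λ k → - 1ℚ * σ ⅔ (suc k)) n)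
      (cong (3ℚ *_) (sum-scale (- 1ℚ) (tail (σ ⅔)) n)))))))
    where
    Cat-at : ∀ k → Cat k ≡ 3ℚ * (- 1ℚ * σ ⅔ (suc k))
    Cat-at k = trans (const-* 3ℚ (tail (const 1ℚ S.- σ ⅔)) k) (cong (3ℚ *_)
      (solve 1 (λ t → con 0ℚ :- t := con (- 1ℚ) :* t) refl (σ ⅔ (suc k))))

-- The ring of bounded functions modulo null ones

module NullRing where

  open import Algebra.Bundles using (CommutativeRing)
  import Algebra.Solver.Ring as Ring-Solver
  open import Algebra.Solver.Ring.AlmostCommutativeRing
    using (AlmostCommutativeRing; fromCommutativeRing; _-Raw-AlmostCommutative⟶_)
  open import Data.Maybe.Base using (Maybe; just; nothing)
  open import Level using (0ℓ)
  open Limits using (Filter; module Null)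

  -- Bounded functions modulo null functions

  module _ {I : Set} (F : Filter I) where

    open Null F

    record Element : Set where
      constructor element
      field
        fun     : I → ℚ
        bounded : Bounded fun

    open Element

    record _≃_ (a b : Element) : Set where
      constructor close
      field related : fun a ~ fun b

    private
      _+_ _*_ : Element → Element → Element
      a + b = element (λ i → fun a i ℚ.+ fun b i) (bounded-+ {fun a} {fun b} (bounded a) (bounded b))
      a * b = element (λ i → fun a i ℚ.* fun b i) (bounded-* {fun a} {fun b} (bounded a) (bounded b))

      -_ : Element → Element
      - a = element (λ i → ℚ.- fun a i) (bounded-neg {fun a} (bounded a))

      same : ∀ {a b} → (∀ i → fun a i ≡ fun b i) → a ≃ b
      same e = close (~-≡ e)

    constant : ℚ → Element
    constant q = element (λ _ → q) (bounded-const q)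

    private
      *-cong : ∀ {a a′ b b′} → a ≃ a′ → b ≃ b′ → (a * b) ≃ (a′ * b′)
      *-cong {a} {a′} {b} {b′} (close e) (close f) =
        close (~-* {fun a} {fun b′} {fun a′} {fun b} (bounded a) (bounded b′) e f)

      neg-cong : ∀ {a b} → a ≃ b → (- a) ≃ (- b)
      neg-cong {a} {b} (close (near n)) = close (near (null-≡
        (λ i → sym (ℚ.neg-distrib-+ (fun a i) (ℚ.- fun b i))) (null-neg {λ i → fun a i ℚ.- fun b i} n)))

    nullRing : CommutativeRing 0ℓ 0ℓ
    nullRing = record
      { Carrier = Element ; _≈_ = _≃_ ; _+_ = _+_ ; _*_ = _*_ ; -_ = -_ ; 0# = constant 0ℚ ; 1# = constant 1ℚ
      ; isCommutativeRing = record
        { isRing = record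
          { +-isAbelianGroup = record
            { isGroup = record
              { isMonoid = record
                { isSemigroup = record
                  { isMagma = record
                    { isEquivalence = record
                      { refl  = close ~-refl
                      ; sym   = λ (close e) → close (~-sym e)
                      ; trans = λ (close e) (close f) → close (~-trans e f) }
                    ; ∙-cong = λ (close e) (close f) → close (~-+ e f) }
                  ; assoc = λ a b c → same λ i → ℚ.+-assoc (fun a i) (fun b i) (fun c i) }
                ; identity = (λ a → same λ i → ℚ.+-identityˡ (fun a i)) , (λ a → same λ i → ℚ.+-identityʳ (fun a i)) }
              ; inverse = (λ a → same λ i → ℚ.+-inverseˡ (fun a i)) , (λ a → same λ i → ℚ.+-inverseʳ (fun a i))
              ; ⁻¹-cong = neg-cong }
            ; comm = λ a b → same λ i → ℚ.+-comm (fun a i) (fun b i) }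
          ; *-cong = *-cong
          ; *-assoc = λ a b c → same λ i → ℚ.*-assoc (fun a i) (fun b i) (fun c i)
          ; *-identity = (λ a → same λ i → ℚ.*-identityˡ (fun a i)) , (λ a → same λ i → ℚ.*-identityʳ (fun a i))
          ; distrib = (λ a b c → same λ i → ℚ.*-distribˡ-+ (fun a i) (fun b i) (fun c i))
                    , (λ a b c → same λ i → ℚ.*-distribʳ-+ (fun a i) (fun b i) (fun c i)) }
        ; *-comm = λ a b → same λ i → ℚ.*-comm (fun a i) (fun b i) } }

    module NullSolver where

      private
        almost : AlmostCommutativeRing 0ℓ 0ℓ
        almost = fromCommutativeRing nullRing

        constant-morphism : AlmostCommutativeRing.rawRing (fromCommutativeRing ℚ.+-*-commutativeRing)
                            -Raw-AlmostCommutative⟶ almost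
        constant-morphism = record
          { ⟦_⟧    = constant
          ; +-homo = λ p q → same λ _ → refl
          ; *-homo = λ p q → same λ _ → refl
          ; -‿homo = λ p → same λ _ → refl
          ; 0-homo = same λ _ → refl
          ; 1-homo = same λ _ → refl }

        weakly : ∀ p q → Maybe (constant p ≃ constant q)
        weakly p q with p ℚ.≟ q
        ... | yes refl = just (same λ _ → refl)
        ... | no _     = nothing

      open Ring-Solver _ almost constant-morphism weakly public

    -- The counterpart of `correct` in the quotient ring: adding a multiple of a known equation
    -- reduces a limit identity to a polynomial one.
    add-multiple : ∀ {l r} a u → l ≃ r → a ≃ (a + (u * (l + (- r))))
    add-multiple {l} {r} a u e = trans′ (NullSolver.solve 3 (λ a u r → a := a :+ u :* (r :- r)) refl′ a u r)
      (+-cong (refl′ {a}) (*-cong (refl′ {u}) (+-cong (sym′ e) (refl′ { - r}))))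
      where
      open NullSolver using (_:=_; _:+_; _:*_; _:-_)
      open CommutativeRing nullRing using (+-cong) renaming (refl to refl′; sym to sym′; trans to trans′)

-- Values at the singularity

module Values where

  open import Algebra.Bundles using (CommutativeRing)
  private module S = Series
  open Series using (Series; const; z; at)
  open ClosedForms
  open GeneratingFunction
  open Limits using (sequences)
  open NullRing
  open TameSeries
  open CentralBinomial
  open TameMembers
  open import Data.Integer.Base using (+_)
  open import Data.Rational.Base using (_/_)
  open import Data.Rational.Solver using (module +-*-Solver)
  import Relation.Binary.Reasoning.Setoid as Setoid-Reasoning

  private
    R = nullRing sequences
    module R = CommutativeRing R
    open R using (_+_; _*_; _-_; -_; _≈_)
    open NullSolver sequences using (solve; con; _:=_; _:+_; _:*_; _:-_; :-_)
    open Setoid-Reasoning R.setoid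
    open Element
    module Q = +-*-Solver

    # : ℚ → R.Carrier
    # = constant sequences

    fix : ∀ {l r} x u → l ≈ r → x ≈ x + u * (l - r)
    fix = add-multiple sequences

  abstract
    bounded-value : ∀ {a} → Tame a → Bounded (value a)
    bounded-value {a} t = let B , 0<B , h = summable-bound {a} (summable t) in
      B , 0<B , 0 , λ n _ → ℚ.≤-trans (∣sum∣ a (suc n)) (h (suc n))

  -- The value at z = 1 of a tame series, modulo null sequences

  val : ∀ {a} → Tame a → R.Carrier
  val {a} t = element (value a) (bounded-value t)

  val-≈ : ∀ {a b} (s : Tame a) (t : Tame b) → a S.≈ b → val s ≈ val t
  val-≈ s t e = close (~-≡ λ n → sum-cong (at e) (suc n))

  val-+ : ∀ {a b} (s : Tame a) (t : Tame b) (u : Tame (a S.+ b)) → val u ≈ val s + val t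
  val-+ {a} {b} s t u = close (~-≡ λ n → sum-+ a b (suc n))

  val-* : ∀ {a b} (s : Tame a) (t : Tame b) (u : Tame (a S.* b)) → val u ≈ val s * val t
  val-* {a} {b} s t u = close (value-* {a} {b} (summable s) (summable t))

  val-const : ∀ q → val (tame-const q) ≈ # q
  val-const q = close (~-≡ λ n → trans (cong (q ℚ.+_) (sum-tail-const q n)) (ℚ.+-identityʳ q))

  val-neg : ∀ {a} (s : Tame a) (u : Tame (S.- a)) → val u ≈ - val s
  val-neg {a} s u = close (~-≡ λ n → neg-sum a (suc n))
    where
    neg-sum : ∀ a n → sum (S.- a) n ≡ ℚ.- sum a n
    neg-sum a zero    = refl
    neg-sum a (suc n) = trans (cong (ℚ.- a 0 ℚ.+_) (neg-sum (S.tail a) n)) (sym (ℚ.neg-distrib-+ (a 0) (sum (S.tail a) n)))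

  val-minus : ∀ {a b} (s : Tame a) (t : Tame b) → val (tame-minus s t) ≈ val s - val t
  val-minus {a} {b} s t = R.trans (val-+ s (tame-neg t) (tame-minus s t)) (R.+-cong (R.refl {val s}) (val-neg t (tame-neg t)))

  val-z : val tame-z ≈ # 1ℚ
  val-z = close (near λ ε 0<ε → 1 , λ { (suc n) _ → subst (λ x → ℚ.∣ x ℚ.- 1ℚ ∣ ℚ.≤ ε) (sym (one n)) (ℚ.<⇒≤ 0<ε) })
    where
    one : ∀ n → value z (suc n) ≡ 1ℚ
    one n = trans (cong (λ y → 0ℚ ℚ.+ (1ℚ ℚ.+ y)) (sum-tail-const 1ℚ n)) refl

  tame-linear : ∀ t → Tame (const 1ℚ S.- const t S.* z)
  tame-linear t = tame-minus (tame-const 1ℚ) (tame-* {const t} {z} (tame-const t) tame-z)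

  val-const* : ∀ {a} q (s : Tame a) (u : Tame (const q S.* a)) → val u ≈ # q * val s
  val-const* {a} q s u = R.trans (val-* {const q} {a} (tame-const q) s u) (R.*-cong (val-const q) (R.refl {val s}))

  val-z* : ∀ {a} (s : Tame a) (u : Tame (z S.* a)) → val u ≈ val s
  val-z* {a} s u = R.trans (val-* {z} {a} tame-z s u) (R.trans (R.*-cong val-z (R.refl {val s})) (R.*-identityˡ (val s)))

  val-linear : ∀ t → val (tame-linear t) ≈ # (1ℚ ℚ.- t)
  val-linear t = begin
    val (tame-linear t)                        ≈⟨ val-minus (tame-const 1ℚ) (tame-* {const t} {z} (tame-const t) tame-z) ⟩
    val (tame-const 1ℚ) - val (tame-* {const t} {z} (tame-const t) tame-z)
      ≈⟨ R.+-cong (val-const 1ℚ) (R.-‿cong (R.trans (val-const* t tame-z (tame-* {const t} {z} (tame-const t) tame-z)) (R.*-cong (R.refl {# t}) val-z))) ⟩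
    # 1ℚ - # t * # 1ℚ                          ≈⟨ close (~-≡ λ n → cong (λ y → 1ℚ ℚ.- y) (ℚ.*-identityʳ t)) ⟩
    # (1ℚ ℚ.- t)                               ∎

  -- These stand for 1/√3, 3 - √3, 1, (5 + 3√3)/4, √3/2 and (9 + 6√3)/8.
  s C M Qv D H : R.Carrier
  s  = val tame-σ-⅔
  C  = val tame-Cat
  M  = val tame-μ
  Qv = val tame-q
  D  = val tame-β--⅓
  H  = val tame-h

  s² : s * s ≈ # ⅓
  s² = R.trans (R.sym (val-* {σ ⅔} {σ ⅔} tame-σ-⅔ tame-σ-⅔ t²)) (R.trans (val-≈ t² (tame-linear ⅔) (σ² ⅔)) (val-linear ⅔))
    where t² = tame-* {σ ⅔} {σ ⅔} tame-σ-⅔ tame-σ-⅔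

  C≈ : C ≈ # 3ℚ * (# 1ℚ - s)
  C≈ = begin
    C                                       ≈⟨ val-z* tame-Cat zC ⟨
    val zC                                  ≈⟨ val-≈ zC rhs z*Cat ⟩
    val rhs                                 ≈⟨ val-const* 3ℚ 1-σ rhs ⟩
    # 3ℚ * val 1-σ                          ≈⟨ R.*-cong (R.refl {# 3ℚ}) (R.trans (val-minus (tame-const 1ℚ) tame-σ-⅔) (R.+-cong (val-const 1ℚ) (R.refl { - s}))) ⟩
    # 3ℚ * (# 1ℚ - s)                       ∎
    where
    zC  = tame-* {z} {Cat} tame-z tame-Cat
    1-σ = tame-minus (tame-const 1ℚ) tame-σ-⅔
    rhs = tame-* {const 3ℚ} {const 1ℚ S.- σ ⅔} (tame-const 3ℚ) 1-σ

  -- The partial sums telescope to b(n), which is null. Since the root vanishes at z = 1, the value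
  -- of μ there is rational.
  val-σ-1 : val tame-σ-1 ≈ # 0ℚ
  val-σ-1 = close (near (null-≡ (λ n → trans (cong (ℚ._- 0ℚ) (partial n)) (Q.solve 1 (λ x → x Q.:- Q.con 0ℚ Q.:= x) refl (b n))) b-null))
    where
    partial : ∀ n → value (σ 1ℚ) n ≡ b n
    partial n = trans (cong₂ ℚ._+_ (σ-zero 1ℚ) (trans (sum-cong σ-1-suc n) (trans (neg n) (cong ℚ.-_ (telescope b 0 n)))))
      (Q.solve 1 (λ x → Q.con 1ℚ Q.:+ Q.:- (Q.con 1ℚ Q.:- x) Q.:= x) refl (b n))
      where
      neg : ∀ n → sum (λ k → ℚ.- (b k ℚ.- b (suc k))) n ≡ ℚ.- sum (λ k → b k ℚ.- b (suc k)) n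
      neg n = go (λ k → b k ℚ.- b (suc k)) n
        where
        go : ∀ a n → sum (λ k → ℚ.- a k) n ≡ ℚ.- sum a n
        go a zero    = refl
        go a (suc n) = trans (cong (ℚ.- a 0 ℚ.+_) (go (S.tail a) n)) (sym (ℚ.neg-distrib-+ (a 0) (sum (S.tail a) n)))

  M≈1 : M ≈ # 1ℚ
  M≈1 = begin
    M                                ≈⟨ val-z* tame-μ zM ⟨
    val zM                           ≈⟨ val-≈ zM rhs z*μ ⟩
    val rhs                          ≈⟨ val-const* 3/2 inner rhs ⟩
    # 3/2 * val inner                ≈⟨ R.*-cong (R.refl {# 3/2}) (R.trans (val-minus (tame-linear ⅓) ss) (R.+-cong (val-linear ⅓)
                                          (R.-‿cong (R.trans (val-* {σ 1ℚ} {σ -⅓} tame-σ-1 tame-σ--⅓ ss) (R.*-cong val-σ-1 (R.refl {val tame-σ--⅓})))))) ⟩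
    # 3/2 * (# (1ℚ ℚ.- ⅓) - # 0ℚ * val tame-σ--⅓)
      ≈⟨ solve 1 (λ y → con 3/2 :* (con (1ℚ ℚ.- ⅓) :- con 0ℚ :* y) := con 1ℚ) R.refl (val tame-σ--⅓) ⟩
    # 1ℚ                             ∎
    where
    zM    = tame-* {z} {μ} tame-z tame-μ
    ss    = tame-* {σ 1ℚ} {σ -⅓} tame-σ-1 tame-σ--⅓
    inner = tame-minus (tame-linear ⅓) ss
    rhs   = tame-* {const 3/2} {const 1ℚ S.- const ⅓ S.* z S.- σ 1ℚ S.* σ -⅓} (tame-const 3/2) inner

  Cat²-1-val : val (tame-minus (tame-* {Cat} {Cat} tame-Cat tame-Cat) (tame-const 1ℚ)) ≈ C * C - # 1ℚ
  Cat²-1-val = R.trans (val-minus CC (tame-const 1ℚ)) (R.+-cong (val-* {Cat} {Cat} tame-Cat tame-Cat CC) (R.-‿cong (val-const 1ℚ)))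
    where CC = tame-* {Cat} {Cat} tame-Cat tame-Cat

  Q-eq : Qv ≈ # 1ℚ + (C * C - # 1ℚ) * M * Qv
  Q-eq = begin
    Qv                           ≈⟨ val-≈ tame-q t q-eq ⟩
    val t                        ≈⟨ val-+ (tame-const 1ℚ) pq t ⟩
    val (tame-const 1ℚ) + val pq ≈⟨ R.+-cong (val-const 1ℚ) (R.trans (val-* {p} {q} tame-p tame-q pq)
                                      (R.*-cong (R.trans (val-* {Cat S.* Cat S.- const 1ℚ} {μ} CC-1 tame-μ tame-p) (R.*-cong Cat²-1-val (R.refl {M}))) (R.refl {Qv}))) ⟩
    # 1ℚ + (C * C - # 1ℚ) * M * Qv ∎
    where
    pq   = tame-* {p} {q} tame-p tame-q
    t    = tame-+ {const 1ℚ} {p S.* q} (tame-const 1ℚ) pq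
    CC-1 = tame-minus (tame-* {Cat} {Cat} tame-Cat tame-Cat) (tame-const 1ℚ)

  D² : D * D ≈ # (+ 3 / 4)
  D² = begin
    D * D                        ≈⟨ fix (D * D) (# (ℚ.- (+ 3 / 4))) 4/3D² ⟩
    D * D + # (ℚ.- (+ 3 / 4)) * (D * D * # (1ℚ ℚ.- -⅓) - # 1ℚ)
      ≈⟨ solve 1 (λ d → d :* d :+ con (ℚ.- (+ 3 / 4)) :* (d :* d :* con (1ℚ ℚ.- -⅓) :- con 1ℚ) := con (+ 3 / 4)) R.refl D ⟩
    # (+ 3 / 4)                  ∎
    where
    DD = tame-* {β -⅓} {β -⅓} tame-β--⅓ tame-β--⅓
    lhs = tame-* {β -⅓ S.* β -⅓} DD (tame-linear -⅓)
    4/3D² : D * D * # (1ℚ ℚ.- -⅓) ≈ # 1ℚ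
    4/3D² = begin
      D * D * # (1ℚ ℚ.- -⅓)      ≈⟨ R.*-cong (val-* {β -⅓} {β -⅓} tame-β--⅓ tame-β--⅓ DD) (val-linear -⅓) ⟨
      val DD * val (tame-linear -⅓) ≈⟨ val-* {β -⅓ S.* β -⅓} DD (tame-linear -⅓) lhs ⟨
      val lhs                    ≈⟨ val-≈ lhs (tame-const 1ℚ) (β² -⅓) ⟩
      val (tame-const 1ℚ)        ≈⟨ val-const 1ℚ ⟩
      # 1ℚ                       ∎

  H≈ : H ≈ (C - # 1ℚ) * (C * C) * (Qv * Qv) * M * D
  H≈ = begin
    H                                             ≈⟨ val-* {a₄} {β -⅓} t₄ tame-β--⅓ tame-h ⟩
    val t₄ * D                                    ≈⟨ R.*-cong (val-* {a₃} {μ} tame-C²q² tame-μ t₄) (R.refl {D}) ⟩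
    val tame-C²q² * M * D                         ≈⟨ R.*-cong (R.*-cong (val-* {(Cat S.- const 1ℚ) S.* (Cat S.* Cat)} {q S.* q} t₂ qq tame-C²q²) (R.refl {M})) (R.refl {D}) ⟩
    val t₂ * val qq * M * D
      ≈⟨ R.*-cong (R.*-cong (R.*-cong (R.trans (val-* {Cat S.- const 1ℚ} {Cat S.* Cat} t₁ CC t₂)
           (R.*-cong (R.trans (val-minus tame-Cat (tame-const 1ℚ)) (R.+-cong (R.refl {C}) (R.-‿cong (val-const 1ℚ)))) (val-* {Cat} {Cat} tame-Cat tame-Cat CC)))
           (val-* {q} {q} tame-q tame-q qq)) (R.refl {M})) (R.refl {D}) ⟩
    (C - # 1ℚ) * (C * C) * (Qv * Qv) * M * D      ∎
    where
    t₁ = tame-minus tame-Cat (tame-const 1ℚ)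
    CC = tame-* {Cat} {Cat} tame-Cat tame-Cat
    t₂ = tame-* {Cat S.- const 1ℚ} {Cat S.* Cat} t₁ CC
    qq = tame-* {q} {q} tame-q tame-q
    a₃ = (Cat S.- const 1ℚ) S.* (Cat S.* Cat) S.* (q S.* q)
    a₄ = a₃ S.* μ
    t₄ = tame-* {a₃} {μ} tame-C²q² tame-μ

  private
    -- `q̂` is the value of q in terms of s, and `u` is the cofactor of s² - 1/3 in the reduction of
    -- `Â`.
    q̂ Â G u : R.Carrier
    q̂ = # (+ 9 / 4) * s + # (+ 5 / 4)
    Â = (# 3ℚ * (# 1ℚ - s) - # 1ℚ) * (# 3ℚ * (# 1ℚ - s) * (# 3ℚ * (# 1ℚ - s))) * (q̂ * q̂)
    G = (# 2ℚ - # 3ℚ * s) * (# (+ 9 / 1) * s + # (+ 5 / 1))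
    u = - (# (+ 3 / 8) * (# (+ 9 / 1) - # (+ 27 / 1) * (G + # 1ℚ + # 3ℚ * s))
          + # (+ 9 / 1) * (# 2ℚ - # 3ℚ * s) * (q̂ * q̂))

  -- As M is 1, the value is 1 / (2 - C²) = 1 / (18s - 10), and s² = 1/3 rationalises it to (18s +
  -- 10) / 8.
  Q≈ : Qv ≈ # (+ 9 / 4) * s + # (+ 5 / 4)
  Q≈ = begin
    Qv
      ≈⟨ fix Qv (- q̂) Q-eq′ ⟩
    Qv + - q̂ * (Qv - (# 1ℚ + (# 3ℚ * (# 1ℚ - s) * (# 3ℚ * (# 1ℚ - s)) - # 1ℚ) * # 1ℚ * Qv))
      ≈⟨ fix _ (# (+ 81 / 2) * Qv - q̂ * # (+ 9 / 1) * Qv) s² ⟩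
    Qv + - q̂ * (Qv - (# 1ℚ + (# 3ℚ * (# 1ℚ - s) * (# 3ℚ * (# 1ℚ - s)) - # 1ℚ) * # 1ℚ * Qv))
      + (# (+ 81 / 2) * Qv - q̂ * # (+ 9 / 1) * Qv) * (s * s - # ⅓)
      ≈⟨ solve 2 (λ s Q → let q̂ = con (+ 9 / 4) :* s :+ con (+ 5 / 4)
                              C = con 3ℚ :* (con 1ℚ :- s) in
           Q :+ :- q̂ :* (Q :- (con 1ℚ :+ (C :* C :- con 1ℚ) :* con 1ℚ :* Q))
             :+ (con (+ 81 / 2) :* Q :- q̂ :* con (+ 9 / 1) :* Q) :* (s :* s :- con ⅓)
           := q̂) R.refl s Qv ⟩
    q̂ ∎
    where
    Q-eq′ : Qv ≈ # 1ℚ + (# 3ℚ * (# 1ℚ - s) * (# 3ℚ * (# 1ℚ - s)) - # 1ℚ) * # 1ℚ * Qv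
    Q-eq′ = R.trans Q-eq (R.+-cong (R.refl {# 1ℚ}) (R.*-cong (R.*-cong (R.+-cong (R.*-cong C≈ C≈) (R.refl { - # 1ℚ})) M≈1) (R.refl {Qv})))

  -- Modulo s² = 1/3, C² is 6 (2 - 3s) while C - 1 is 2 - 3s, so the product is (3/8) G²; and G
  -- reduces to 1 + 3s.
  Â≈ : Â ≈ # (+ 3 / 4) * (# 2ℚ + # 3ℚ * s)
  Â≈ = R.trans (fix Â u s²) (solve 1 (λ s →
    let q̂ = con (+ 9 / 4) :* s :+ con (+ 5 / 4)
        C = con 3ℚ :* (con 1ℚ :- s)
        G = (con 2ℚ :- con 3ℚ :* s) :* (con (+ 9 / 1) :* s :+ con (+ 5 / 1))
        u = :- (con (+ 3 / 8) :* (con (+ 9 / 1) :- con (+ 27 / 1) :* (G :+ con 1ℚ :+ con 3ℚ :* s))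
              :+ con (+ 9 / 1) :* (con 2ℚ :- con 3ℚ :* s) :* (q̂ :* q̂))
    in (C :- con 1ℚ) :* (C :* C) :* (q̂ :* q̂) :+ u :* (s :* s :- con ⅓)
       := con (+ 3 / 4) :* (con 2ℚ :+ con 3ℚ :* s)) R.refl s)

  -- With s = 1/√3 the right side is (27/64)(2 + √3)², the square of (9 + 6√3)/8. Squaring brings in
  -- D through D² alone, which is rational.
  H² : H * H ≈ # (+ 27 / 64) * (# (+ 7 / 1) + # (+ 12 / 1) * s)
  H² = begin
    H * H                       ≈⟨ R.*-cong H≈′ H≈′ ⟩
    B * D * (B * D)             ≈⟨ fix _ (- (B * B)) D² ⟩
    B * D * (B * D) + - (B * B) * (D * D - # (+ 3 / 4))
      -- 243/64 is the coefficient of s² in (3/4) B².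
      ≈⟨ fix _ (# (ℚ.- (+ 243 / 64))) s² ⟩
    B * D * (B * D) + - (B * B) * (D * D - # (+ 3 / 4)) + # (ℚ.- (+ 243 / 64)) * (s * s - # ⅓)
      ≈⟨ solve 2 (λ s D → let B = con (+ 3 / 4) :* (con 2ℚ :+ con 3ℚ :* s) in
           B :* D :* (B :* D) :+ :- (B :* B) :* (D :* D :- con (+ 3 / 4)) :+ con (ℚ.- (+ 243 / 64)) :* (s :* s :- con ⅓)
           := con (+ 27 / 64) :* (con (+ 7 / 1) :+ con (+ 12 / 1) :* s)) R.refl s D ⟩
    # (+ 27 / 64) * (# (+ 7 / 1) + # (+ 12 / 1) * s) ∎
    where
    B = # (+ 3 / 4) * (# 2ℚ + # 3ℚ * s)
    H≈′ : H ≈ B * D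
    H≈′ = begin
      H                                               ≈⟨ H≈ ⟩
      (C - # 1ℚ) * (C * C) * (Qv * Qv) * M * D
        ≈⟨ R.*-cong (R.*-cong (R.*-cong (R.*-cong (R.+-cong C≈ (R.refl { - # 1ℚ})) (R.*-cong C≈ C≈)) (R.*-cong Q≈ Q≈)) M≈1) (R.refl {D}) ⟩
      Â * # 1ℚ * D                                    ≈⟨ R.*-cong (R.trans (R.*-identityʳ Â) Â≈) (R.refl {D}) ⟩
      B * D                                           ∎

-- Wallis' product from the Leibniz series

module Wallis where

  open ClosedForms using (b; inv; fromℕ*inv)
  open CentralBinomial
  open Limits
  open Series using (Series; tail)
  open Coefficients using (fromℕ-+)
  open TameSeries using (drop; drop-at; sum; sum-mono; sum-≥0; sum-scale)
  open import Data.Nat.Base using (_∸_)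
  open import Data.Rational.Base
  open import Data.Rational.Properties
  open import Data.Rational.Solver using (module +-*-Solver)
  open RationalSequences using
    (0<*; 0≤*; 0<½; 0<1; *-mono-≤; divide; fromℕ; 0≤fromℕ; fromℕ-suc; fromℕ-mono; -1^_; odd⁻¹; leibniz; odd⁻¹-anti; 0≤odd⁻¹; odd⁻¹-small; ∣-1^∣; ∣-∣-comm)
  open +-*-Solver

  private
    F = fromℕ

  -- r N k = C(2N+1, N−k) / C(2N+1, N)

  r : ℕ → ℕ → ℚ
  r N zero    = 1ℚ
  r N (suc k) = r N k * (F (N ∸ k) * inv (suc (N ℕ.+ k)))

  r-zero : ∀ N k → N ℕ.< k → r N k ≡ 0ℚ
  r-zero N (suc k) (ℕ.s≤s N≤k) = trans (cong (λ j → r N k * (F j * inv (suc (N ℕ.+ k)))) (ℕ.m≤n⇒m∸n≡0 N≤k))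
    (trans (cong (r N k *_) (*-zeroˡ (inv (suc (N ℕ.+ k))))) (*-zeroʳ (r N k)))

  F-∸ : ∀ {k N} → k ℕ.≤ N → F (N ∸ k) ≡ F N - F k
  F-∸ {k} {N} k≤N = trans (solve 2 (λ x y → x := (x :+ y) :- y) refl (F (N ∸ k)) (F k))
    (cong (_- F k) (trans (sym (fromℕ-+ (N ∸ k) k)) (cong F (ℕ.m∸n+n≡m k≤N))))

  F-suc-suc : ∀ N k → F (suc (suc (N ℕ.+ k))) ≡ F N + F k + 2ℚ
  F-suc-suc N k = trans (fromℕ-suc (suc (N ℕ.+ k))) (trans (cong (_+ 1ℚ) (trans (fromℕ-suc (N ℕ.+ k)) (cong (_+ 1ℚ) (fromℕ-+ N k))))
    (+-assoc (F N + F k) 1ℚ 1ℚ))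

  r-rec : ∀ N k → (F N + F k + 2ℚ) * r N (suc k) ≡ (F N - F k) * r N k
  r-rec N k with k ℕ.≤? N
  ... | yes k≤N = trans (cong₂ (λ x y → x * (r N k * (y * inv (suc (N ℕ.+ k))))) (sym (F-suc-suc N k)) (F-∸ k≤N))
    (trans (solve 4 (λ x r y i → x :* (r :* (y :* i)) := (x :* i) :* (y :* r)) refl
        (F (suc (suc (N ℕ.+ k)))) (r N k) (F N - F k) (inv (suc (N ℕ.+ k))))
      (trans (cong (_* ((F N - F k) * r N k)) (fromℕ*inv (suc (N ℕ.+ k)))) (*-identityˡ _)))
  ... | no k≰N = trans (cong ((F N + F k + 2ℚ) *_) (r-zero N (suc k) (ℕ.m≤n⇒m≤1+n (ℕ.≰⇒> k≰N))))
    (trans (*-zeroʳ (F N + F k + 2ℚ)) (sym (trans (cong ((F N - F k) *_) (r-zero N k (ℕ.≰⇒> k≰N))) (*-zeroʳ (F N - F k)))))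

  0≤r : ∀ N k → 0ℚ ≤ r N k
  0≤r N zero    = <⇒≤ 0<1
  0≤r N (suc k) = 0≤* (0≤r N k) (0≤* (0≤fromℕ (N ∸ k)) (<⇒≤ (0<inv (suc (N ℕ.+ k)))))

  r-anti : ∀ N k → r N (suc k) ≤ r N k
  r-anti N k = ≤-trans (*-≤ˡ (0≤r N k) (≤-trans
      (*-≤ʳ (<⇒≤ (0<inv (suc (N ℕ.+ k)))) (fromℕ-mono (ℕ.≤-trans (ℕ.m∸n≤m N k) (ℕ.m≤n⇒m≤1+n (ℕ.m≤n⇒m≤1+n (ℕ.m≤m+n N k))))))
      (≤-reflexive (fromℕ*inv (suc (N ℕ.+ k)))))) (≤-reflexive (*-identityʳ (r N k)))

  r≤1 : ∀ N k → r N k ≤ 1ℚ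
  r≤1 N zero    = ≤-refl
  r≤1 N (suc k) = ≤-trans (r-anti N k) (r≤1 N k)

  0<N+k+2 : ∀ N k → 0ℚ < F N + F k + 2ℚ
  0<N+k+2 N k = +-mono-≤-< (+-mono-≤ (0≤fromℕ N) (0≤fromℕ k)) (+-mono-< 0<1 0<1)

  -- In closed form k(k+1); divided by N+1 it bounds how far `r` has dropped from 1 after k steps.
  defect : ℕ → ℚ
  defect zero    = 0ℚ
  defect (suc k) = defect k + 2ℚ * (F k + 1ℚ)

  0≤defect : ∀ k → 0ℚ ≤ defect k
  0≤defect zero    = ≤-refl
  0≤defect (suc k) = +-mono-≤ (0≤defect k) (0≤* (<⇒≤ (+-mono-< 0<1 0<1)) (+-mono-≤ (0≤fromℕ k) (<⇒≤ 0<1)))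

  r-near-1 : ∀ N k → 1ℚ - r N k ≤ defect k * inv N
  r-near-1 N zero    = ≤-reflexive (trans (+-inverseʳ 1ℚ) (sym (*-zeroˡ (inv N))))
  r-near-1 N (suc k) = begin
    1ℚ - r N (suc k)                                ≡⟨ solve 3 (λ o r s → o :- s := (o :- r) :+ (r :- s)) refl 1ℚ (r N k) (r N (suc k)) ⟩
    (1ℚ - r N k) + (r N k - r N (suc k))            ≤⟨ +-mono-≤ (r-near-1 N k) drop-≤ ⟩
    defect k * inv N + 2ℚ * (F k + 1ℚ) * inv N          ≡⟨ *-distribʳ-+ (inv N) (defect k) (2ℚ * (F k + 1ℚ)) ⟨
    defect (suc k) * inv N                              ∎
    where
    open ≤-Reasoning
    j = suc (N ℕ.+ k)
    e = F N + F k + 2ℚ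
    drop-≤ : r N k - r N (suc k) ≤ 2ℚ * (F k + 1ℚ) * inv N
    drop-≤ = *-cancel-≤ (0<N+k+2 N k) (begin
      e * (r N k - r N (suc k))                     ≡⟨ solve 3 (λ e r s → e :* (r :- s) := e :* r :- e :* s) refl e (r N k) (r N (suc k)) ⟩
      e * r N k - e * r N (suc k)                   ≡⟨ cong (λ y → e * r N k - y) (r-rec N k) ⟩
      e * r N k - (F N - F k) * r N k
        ≡⟨ solve 3 (λ N k r → (N :+ k :+ con 2ℚ) :* r :- (N :- k) :* r := con 2ℚ :* (k :+ con 1ℚ) :* r) refl (F N) (F k) (r N k) ⟩
      2ℚ * (F k + 1ℚ) * r N k                       ≤⟨ *-≤ˡ 0≤2k+2 (≤-trans (r≤1 N k) 1≤e*inv) ⟩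
      2ℚ * (F k + 1ℚ) * (e * inv N)                 ≡⟨ solve 3 (λ c e i → c :* (e :* i) := e :* (c :* i)) refl (2ℚ * (F k + 1ℚ)) e (inv N) ⟩
      e * (2ℚ * (F k + 1ℚ) * inv N)                 ∎)
      where
      0≤2k+2 : 0ℚ ≤ 2ℚ * (F k + 1ℚ)
      0≤2k+2 = 0≤* (<⇒≤ (+-mono-< 0<1 0<1)) (+-mono-≤ (0≤fromℕ k) (<⇒≤ 0<1))
      1≤e*inv : 1ℚ ≤ e * inv N
      1≤e*inv = ≤-trans (≤-reflexive (sym (fromℕ*inv N))) (*-≤ʳ {p = F (suc N)} {q = e} (<⇒≤ (0<inv N))
        (≤-via (F k + 1ℚ) (+-mono-≤ (0≤fromℕ k) (<⇒≤ 0<1)) (trans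
          (solve 2 (λ N k → N :+ k :+ con 2ℚ := (N :+ con 1ℚ) :+ (k :+ con 1ℚ)) refl (F N) (F k))
          (cong (_+ (F k + 1ℚ)) (sym (fromℕ-suc N))))))

  alt : Series → ℕ → ℚ
  alt a zero    = 0ℚ
  alt a (suc n) = a 0 - alt (tail a) n

  alt-snoc : ∀ a n → alt a (suc n) ≡ alt a n + -1^ n * a n
  alt-snoc a zero    = solve 1 (λ a → a :- con 0ℚ := con 0ℚ :+ con 1ℚ :* a) refl (a 0)
  alt-snoc a (suc n) = trans (cong (λ y → a 0 - y) (alt-snoc (tail a) n))
    (solve 4 (λ a s t u → a :- (s :+ t :* u) := (a :- s) :+ (:- t) :* u) refl (a 0) (alt (tail a) n) (-1^ n) (a (suc n)))

  alt-split : ∀ a K n → alt a (K ℕ.+ n) ≡ alt a K + -1^ K * alt (drop K a) n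
  alt-split a zero    n = solve 1 (λ x → x := con 0ℚ :+ con 1ℚ :* x) refl (alt a n)
  alt-split a (suc K) n = trans (cong (λ y → a 0 - y) (alt-split (tail a) K n))
    (solve 4 (λ a s t u → a :- (s :+ t :* u) := (a :- s) :+ (:- t) :* u) refl (a 0) (alt (tail a) K) (-1^ K) (alt (drop K (tail a)) n))

  alt-bounds : ∀ a n → (∀ k → 0ℚ ≤ a k) → (∀ k → a (suc k) ≤ a k) → 0ℚ ≤ alt a n × alt a n ≤ a 0
  alt-bounds a zero    0≤a a↓ = ≤-refl , 0≤a 0
  alt-bounds a (suc n) 0≤a a↓ =
    let 0≤t , t≤ = alt-bounds (tail a) n (λ k → 0≤a (suc k)) (λ k → a↓ (suc k))
    in subst (_≤ a 0 - alt (tail a) n) (+-inverseʳ (alt (tail a) n)) (+-monoˡ-≤ (- alt (tail a) n) (≤-trans t≤ (a↓ 0)))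
     , ≤-via (alt (tail a) n) 0≤t (solve 2 (λ x y → x := (x :- y) :+ y) refl (a 0) (alt (tail a) n))

  alt-tail : ∀ a K n → (∀ k → 0ℚ ≤ a k) → (∀ k → a (suc k) ≤ a k) → K ℕ.≤ n → ∣ alt a n - alt a K ∣ ≤ a K
  alt-tail a K n 0≤a a↓ K≤n = let o , K+o≡n = ℕ.m≤n⇒∃[o]m+o≡n K≤n in
    subst (λ n → ∣ alt a n - alt a K ∣ ≤ a K) K+o≡n (begin
      ∣ alt a (K ℕ.+ o) - alt a K ∣          ≡⟨ cong (λ y → ∣ y - alt a K ∣) (alt-split a K o) ⟩
      ∣ alt a K + -1^ K * alt (drop K a) o - alt a K ∣
        ≡⟨ cong ∣_∣ (solve 2 (λ x y → (x :+ y) :- x := y) refl (alt a K) (-1^ K * alt (drop K a) o)) ⟩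
      ∣ -1^ K * alt (drop K a) o ∣           ≡⟨ trans (∣p*q∣≡∣p∣*∣q∣ (-1^ K) (alt (drop K a) o)) (trans (cong (_* ∣ alt (drop K a) o ∣) (∣-1^∣ K)) (*-identityˡ _)) ⟩
      ∣ alt (drop K a) o ∣                   ≡⟨ 0≤p⇒∣p∣≡p (proj₁ (bounds o)) ⟩
      alt (drop K a) o                       ≤⟨ proj₂ (bounds o) ⟩
      drop K a 0                             ≡⟨ trans (drop-at K a 0) (cong a (ℕ.+-identityʳ K)) ⟩
      a K                                    ∎)
    where
    open ≤-Reasoning
    bounds : ∀ o → 0ℚ ≤ alt (drop K a) o × alt (drop K a) o ≤ drop K a 0
    bounds o = alt-bounds (drop K a) o (λ k → subst (0ℚ ≤_) (sym (drop-at K a k)) (0≤a (K ℕ.+ k)))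
      (λ k → subst₂ _≤_ (sym (trans (drop-at K a (suc k)) (cong a (ℕ.+-suc K k)))) (sym (drop-at K a k)) (a↓ (K ℕ.+ k)))

  alt-difference : ∀ a a′ n → ∣ alt a n - alt a′ n ∣ ≤ sum (λ k → ∣ a k - a′ k ∣) n
  alt-difference a a′ zero    = ≤-refl
  alt-difference a a′ (suc n) = ≤-trans (≤-reflexive (cong ∣_∣
      (solve 4 (λ a s a′ s′ → (a :- s) :- (a′ :- s′) := (a :- a′) :+ :- (s :- s′)) refl (a 0) (alt (tail a) n) (a′ 0) (alt (tail a′) n))))
    (∣∣-+-≤ (a 0 - a′ 0) (- (alt (tail a) n - alt (tail a′) n)) ≤-refl
      (≤-trans (≤-reflexive (∣-p∣≡∣p∣ (alt (tail a) n - alt (tail a′) n))) (alt-difference (tail a) (tail a′) n)))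

  alt-cong : ∀ {a a′} n → (∀ k → a k ≡ a′ k) → alt a n ≡ alt a′ n
  alt-cong zero    e = refl
  alt-cong (suc n) e = cong₂ _-_ (e 0) (alt-cong n (λ k → e (suc k)))

  alt-linear : ∀ p q a a′ n → alt (λ k → p * a k - q * a′ k) n ≡ p * alt a n - q * alt a′ n
  alt-linear p q a a′ zero    = solve 2 (λ p q → con 0ℚ := p :* con 0ℚ :- q :* con 0ℚ) refl p q
  alt-linear p q a a′ (suc n) = trans (cong (λ y → p * a 0 - q * a′ 0 - y) (alt-linear p q (tail a) (tail a′) n))
    (solve 6 (λ p q a a′ s s′ → p :* a :- q :* a′ :- (p :* s :- q :* s′) := p :* (a :- s) :- q :* (a′ :- s′)) refl
      p q (a 0) (a′ 0) (alt (tail a) n) (alt (tail a′) n))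

  leibniz≡alt : ∀ n → leibniz n ≡ alt odd⁻¹ n
  leibniz≡alt zero    = refl
  leibniz≡alt (suc n) = trans (cong (_+ -1^ n * odd⁻¹ n) (leibniz≡alt n)) (sym (alt-snoc odd⁻¹ n))

  -- Up to normalisation this is the integral of cos^(2N+1) over a quarter period: its Fourier
  -- coefficients are binomial, and cos((2k+1)t) integrates to (-1)^k / (2k+1). Its recurrence is
  -- derived below by summation alone.
  L : ℕ → ℚ
  L N = alt (λ k → r N k * odd⁻¹ k) (suc N)

  odd*odd⁻¹ : ∀ k → odd k * odd⁻¹ k ≡ 1ℚ
  odd*odd⁻¹ k = trans (cong (_* odd⁻¹ k) (sym (trans (fromℕ-suc (2 ℕ.* k)) (cong (_+ 1ℚ)
    (trans (fromℕ-+ k (1 ℕ.* k)) (cong (F k +_) (trans (fromℕ-+ k 0) (+-identityʳ (F k))))))))) (fromℕ*inv (2 ℕ.* k))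

  -- The left factor is (N+1-k)(N+2+k), so this is the quotient of the entries at k in rows N+1 and
  -- N, cleared of its denominator.
  r-step : ∀ N k → ((F N + 1ℚ) * (F N + 2ℚ) - F k * (F k + 1ℚ)) * r (suc N) k ≡ (F N + 1ℚ) * (F N + 2ℚ) * r N k
  r-step N zero    = solve 1 (λ n → ((n :+ con 1ℚ) :* (n :+ con 2ℚ) :- con 0ℚ :* (con 0ℚ :+ con 1ℚ)) :* con 1ℚ
    := (n :+ con 1ℚ) :* (n :+ con 2ℚ) :* con 1ℚ) refl (F N)
  r-step N (suc k) = *-cancel-≡ (0<N+k+2 N k) (begin
    e * ((m * (n + 2ℚ) - F (suc k) * (F (suc k) + 1ℚ)) * s′)
      ≡⟨ cong (λ y → e * ((m * (n + 2ℚ) - y * (y + 1ℚ)) * s′)) (fromℕ-suc k) ⟩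
    e * ((m * (n + 2ℚ) - (F k + 1ℚ) * (F k + 1ℚ + 1ℚ)) * s′)
      ≡⟨ solve 3 (λ n k s → (n :+ k :+ con 2ℚ) :* (((n :+ con 1ℚ) :* (n :+ con 2ℚ) :- (k :+ con 1ℚ) :* (k :+ con 1ℚ :+ con 1ℚ)) :* s)
           := (n :+ k :+ con 2ℚ) :* (n :- k) :* ((n :+ con 1ℚ :+ k :+ con 2ℚ) :* s)) refl n (F k) s′ ⟩
    e * (n - F k) * ((m + F k + 2ℚ) * s′)
      ≡⟨ cong (λ y → e * (n - F k) * ((y + F k + 2ℚ) * s′)) (sym (fromℕ-suc N)) ⟩
    e * (n - F k) * ((F (suc N) + F k + 2ℚ) * s′)
      ≡⟨ cong (e * (n - F k) *_) (trans (r-rec (suc N) k) (cong (λ y → (y - F k) * s) (fromℕ-suc N))) ⟩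
    e * (n - F k) * ((m - F k) * s)
      ≡⟨ solve 3 (λ n k s → (n :+ k :+ con 2ℚ) :* (n :- k) :* ((n :+ con 1ℚ :- k) :* s)
           := (n :- k) :* (((n :+ con 1ℚ) :* (n :+ con 2ℚ) :- k :* (k :+ con 1ℚ)) :* s)) refl n (F k) s ⟩
    (n - F k) * ((m * (n + 2ℚ) - F k * (F k + 1ℚ)) * s)
      ≡⟨ cong ((n - F k) *_) (r-step N k) ⟩
    (n - F k) * (m * (n + 2ℚ) * r N k)
      ≡⟨ solve 3 (λ x y z → x :* (y :* z) := y :* (x :* z)) refl (n - F k) (m * (n + 2ℚ)) (r N k) ⟩
    m * (n + 2ℚ) * ((n - F k) * r N k)
      ≡⟨ cong (m * (n + 2ℚ) *_) (sym (r-rec N k)) ⟩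
    m * (n + 2ℚ) * (e * r N (suc k))
      ≡⟨ solve 3 (λ y e z → y :* (e :* z) := e :* (y :* z)) refl (m * (n + 2ℚ)) e (r N (suc k)) ⟩
    e * (m * (n + 2ℚ) * r N (suc k)) ∎)
    where
    open ≡-Reasoning
    n  = F N
    m  = F N + 1ℚ
    e  = F N + F k + 2ℚ
    s  = r (suc N) k
    s′ = r (suc N) (suc k)

  -- The multipliers rest on (2N+3)² - 4((N+1)(N+2) - k(k+1)) = (2k+1)², which cancels the
  -- denominator 2k+1 and leaves a term whose alternating sums have a closed form.
  term-step : ∀ N k → odd (suc N) * odd (suc N) * (r (suc N) k * odd⁻¹ k) - 4ℚ * ((F N + 1ℚ) * (F N + 2ℚ)) * (r N k * odd⁻¹ k)
              ≡ odd k * r (suc N) k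
  term-step N k = begin
    odd (suc N) * odd (suc N) * (s * o) - 4ℚ * ((n + 1ℚ) * (n + 2ℚ)) * (r N k * o)
      ≡⟨ cong₂ (λ x y → x * x * (s * o) - y) (odd-suc N)
           (trans (solve 3 (λ q r o → con 4ℚ :* q :* (r :* o) := con 4ℚ :* (q :* r) :* o) refl ((n + 1ℚ) * (n + 2ℚ)) (r N k) o)
             (cong (λ y → 4ℚ * y * o) (sym (r-step N k)))) ⟩
    (odd N + 2ℚ) * (odd N + 2ℚ) * (s * o) - 4ℚ * (((n + 1ℚ) * (n + 2ℚ) - F k * (F k + 1ℚ)) * s) * o
      ≡⟨ solve 4 (λ n k s o → (n :+ n :+ con 1ℚ :+ con 2ℚ) :* (n :+ n :+ con 1ℚ :+ con 2ℚ) :* (s :* o)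
           :- con 4ℚ :* (((n :+ con 1ℚ) :* (n :+ con 2ℚ) :- k :* (k :+ con 1ℚ)) :* s) :* o
           := (k :+ k :+ con 1ℚ) :* s :* ((k :+ k :+ con 1ℚ) :* o)) refl n (F k) s o ⟩
    odd k * s * (odd k * o)                ≡⟨ trans (cong (odd k * s *_) (odd*odd⁻¹ k)) (*-identityʳ (odd k * s)) ⟩
    odd k * s                              ∎
    where
    open ≡-Reasoning
    n = F N
    s = r (suc N) k
    o = odd⁻¹ k

  -- Since N(2k+1) = (N+k+1)k + (N-k)(k+1) and (N-k) r(k) = (N+k+2) r(k+1), neighbouring terms
  -- cancel. For K beyond N the remainder vanishes along with `r`.
  alt-telescope : ∀ N K → F N * alt (λ k → odd k * r N k) K ≡ - (-1^ K * ((F N + F K + 1ℚ) * F K * r N K))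
  alt-telescope N zero    = solve 1 (λ n → n :* con 0ℚ := :- (con 1ℚ :* ((n :+ con 0ℚ :+ con 1ℚ) :* con 0ℚ :* con 1ℚ))) refl (F N)
  alt-telescope N (suc K) = begin
    F N * alt (λ k → odd k * r N k) (suc K)            ≡⟨ cong (F N *_) (alt-snoc (λ k → odd k * r N k) K) ⟩
    F N * (alt (λ k → odd k * r N k) K + -1^ K * (odd K * r N K))
      ≡⟨ trans (*-distribˡ-+ (F N) _ _) (cong (_+ F N * (-1^ K * (odd K * r N K))) (alt-telescope N K)) ⟩
    - (-1^ K * ((F N + F K + 1ℚ) * F K * r N K)) + F N * (-1^ K * (odd K * r N K))
      ≡⟨ solve 4 (λ n k s r → :- (s :* ((n :+ k :+ con 1ℚ) :* k :* r)) :+ n :* (s :* ((k :+ k :+ con 1ℚ) :* r))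
           := :- (:- s :* ((k :+ con 1ℚ) :* ((n :- k) :* r)))) refl (F N) (F K) (-1^ K) (r N K) ⟩
    - (- (-1^ K) * ((F K + 1ℚ) * ((F N - F K) * r N K)))
      ≡⟨ cong (λ y → - (- (-1^ K) * ((F K + 1ℚ) * y))) (sym (r-rec N K)) ⟩
    - (- (-1^ K) * ((F K + 1ℚ) * ((F N + F K + 2ℚ) * r N (suc K))))
      ≡⟨ cong (λ y → - (- (-1^ K) * y)) (solve 3 (λ n k r → (k :+ con 1ℚ) :* ((n :+ k :+ con 2ℚ) :* r)
           := (n :+ (k :+ con 1ℚ) :+ con 1ℚ) :* (k :+ con 1ℚ) :* r) refl (F N) (F K) (r N (suc K))) ⟩
    - (- (-1^ K) * ((F N + (F K + 1ℚ) + 1ℚ) * (F K + 1ℚ) * r N (suc K)))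
      ≡⟨ cong (λ y → - (- (-1^ K) * ((F N + y + 1ℚ) * y * r N (suc K)))) (sym (fromℕ-suc K)) ⟩
    - (- (-1^ K) * ((F N + F (suc K) + 1ℚ) * F (suc K) * r N (suc K))) ∎
    where open ≡-Reasoning

  alt-odd*r≡0 : ∀ N → alt (λ k → odd k * r (suc N) k) (suc (suc N)) ≡ 0ℚ
  alt-odd*r≡0 N = *-cancel-≡ (0<fromℕ-suc N) zero-eq
    where
    K = suc (suc N)
    zero-eq : F (suc N) * alt (λ k → odd k * r (suc N) k) K ≡ F (suc N) * 0ℚ
    zero-eq = trans (alt-telescope (suc N) K) (trans
      (cong (λ y → - (-1^ K * ((F (suc N) + F K + 1ℚ) * F K * y))) (r-zero (suc N) K ℕ.≤-refl))
      (solve 3 (λ s t f → :- (s :* (t :* con 0ℚ)) := f :* con 0ℚ) refl (-1^ K) ((F (suc N) + F K + 1ℚ) * F K) (F (suc N))))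

  L-step : ∀ N → odd (suc N) * odd (suc N) * L (suc N) ≡ 4ℚ * ((F N + 1ℚ) * (F N + 2ℚ)) * L N
  L-step N = begin
    p * L (suc N)                       ≡⟨ solve 2 (λ x y → x := (x :- y) :+ y) refl (p * L (suc N)) (q * L N) ⟩
    p * L (suc N) - q * L N + q * L N   ≡⟨ cong (λ y → p * L (suc N) - q * y + q * L N) extend ⟩
    p * L (suc N) - q * alt (λ k → r N k * odd⁻¹ k) (suc (suc N)) + q * L N
      ≡⟨ cong (_+ q * L N) (trans (sym (alt-linear p q (λ k → r (suc N) k * odd⁻¹ k) (λ k → r N k * odd⁻¹ k) (suc (suc N))))
           (trans (alt-cong (suc (suc N)) (term-step N)) (alt-odd*r≡0 N))) ⟩
    0ℚ + q * L N                        ≡⟨ +-identityˡ (q * L N) ⟩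
    q * L N                             ∎
    where
    open ≡-Reasoning
    p = odd (suc N) * odd (suc N)
    q = 4ℚ * ((F N + 1ℚ) * (F N + 2ℚ))
    extend : L N ≡ alt (λ k → r N k * odd⁻¹ k) (suc (suc N))
    extend = sym (trans (alt-snoc (λ k → r N k * odd⁻¹ k) (suc N)) (trans
      (cong (λ y → L N + -1^ (suc N) * (y * odd⁻¹ (suc N))) (r-zero N (suc N) ℕ.≤-refl))
      (solve 3 (λ l s o → l :+ s :* (con 0ℚ :* o) := l) refl (L N) (-1^ (suc N)) (odd⁻¹ (suc N)))))

  -- By induction: the factor 4(N+1)(N+2) of `L-step` and the factor (N+½)²/(N+1)² by which b²
  -- changes combine to (2N+1)² (N+2)/(N+1).
  L*b² : ∀ N → odd N * odd N * L N * (b N * b N) ≡ F N + 1ℚ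
  L*b² zero    = refl
  L*b² (suc N) = *-cancel-≡ 0<m main
    where
    open ≡-Reasoning
    n = F N
    m = F N + 1ℚ
    c = b (suc N)
    0<m : 0ℚ < m
    0<m = +-mono-≤-< (0≤fromℕ N) 0<1
    main : m * (odd (suc N) * odd (suc N) * L (suc N) * (c * c)) ≡ m * (F (suc N) + 1ℚ)
    main = begin
      m * (odd (suc N) * odd (suc N) * L (suc N) * (c * c))   ≡⟨ cong (λ y → m * (y * (c * c))) (L-step N) ⟩
      m * (4ℚ * (m * (n + 2ℚ)) * L N * (c * c))
        ≡⟨ solve 4 (λ m n l c → m :* (con 4ℚ :* (m :* (n :+ con 2ℚ)) :* l :* (c :* c))
             := con 4ℚ :* (n :+ con 2ℚ) :* l :* ((m :* c) :* (m :* c))) refl m n (L N) c ⟩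
      4ℚ * (n + 2ℚ) * L N * ((m * c) * (m * c))
        ≡⟨ cong (λ y → 4ℚ * (n + 2ℚ) * L N * (y * y)) (b-rec′ N) ⟩
      4ℚ * (n + 2ℚ) * L N * (((n + ½) * b N) * ((n + ½) * b N))
        ≡⟨ solve 3 (λ n l b → con 4ℚ :* (n :+ con 2ℚ) :* l :* (((n :+ con ½) :* b) :* ((n :+ con ½) :* b))
             := (n :+ con 2ℚ) :* ((n :+ n :+ con 1ℚ) :* (n :+ n :+ con 1ℚ) :* l :* (b :* b))) refl n (L N) (b N) ⟩
      (n + 2ℚ) * (odd N * odd N * L N * (b N * b N))          ≡⟨ cong ((n + 2ℚ) *_) (L*b² N) ⟩
      (n + 2ℚ) * m
        ≡⟨ solve 1 (λ n → (n :+ con 2ℚ) :* (n :+ con 1ℚ) := (n :+ con 1ℚ) :* ((n :+ con 1ℚ) :+ con 1ℚ)) refl n ⟩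
      m * (m + 1ℚ)                                            ≡⟨ cong (λ y → m * (y + 1ℚ)) (sym (fromℕ-suc N)) ⟩
      m * (F (suc N) + 1ℚ)                                    ∎

  -- From `L*b²`, because 4N(N+1) = (2N+1)² - 1.
  wallis-exact : ∀ N → 4ℚ * (F N * (b N * b N)) * L N ≡ 1ℚ - odd⁻¹ N * odd⁻¹ N
  wallis-exact N = begin
    4ℚ * (n * (b N * b N)) * L N
      ≡⟨ solve 3 (λ n b l → con 4ℚ :* (n :* (b :* b)) :* l := con 4ℚ :* (n :* (b :* b)) :* l :* (con 1ℚ :* con 1ℚ)) refl n (b N) (L N) ⟩
    4ℚ * (n * (b N * b N)) * L N * (1ℚ * 1ℚ)
      ≡⟨ cong (λ y → 4ℚ * (n * (b N * b N)) * L N * (y * y)) (sym (odd*odd⁻¹ N)) ⟩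
    4ℚ * (n * (b N * b N)) * L N * ((odd N * o) * (odd N * o))
      ≡⟨ solve 5 (λ n b l d o → con 4ℚ :* (n :* (b :* b)) :* l :* ((d :* o) :* (d :* o)) := con 4ℚ :* n :* (o :* o) :* (d :* d :* l :* (b :* b)))
           refl n (b N) (L N) (odd N) o ⟩
    4ℚ * n * (o * o) * (odd N * odd N * L N * (b N * b N))   ≡⟨ cong (4ℚ * n * (o * o) *_) (L*b² N) ⟩
    4ℚ * n * (o * o) * (n + 1ℚ)
      ≡⟨ solve 2 (λ n o → con 4ℚ :* n :* (o :* o) :* (n :+ con 1ℚ)
           := ((n :+ n :+ con 1ℚ) :* o) :* ((n :+ n :+ con 1ℚ) :* o) :- o :* o) refl n o ⟩
    (odd N * o) * (odd N * o) - o * o                        ≡⟨ cong (λ y → y * y - o * o) (odd*odd⁻¹ N) ⟩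
    1ℚ - o * o                                               ∎
    where
    open ≡-Reasoning
    n = F N
    o = odd⁻¹ N

  odd⁻¹≤1 : ∀ k → odd⁻¹ k ≤ 1ℚ
  odd⁻¹≤1 k = inv-anti {0} {2 ℕ.* k} ℕ.z≤n

  -- Tannery's argument: the first K terms converge one by one, and both alternating remainders are
  -- at most 1/(2K+1).
  L-near-leibniz : ∀ ε → 0ℚ < ε → ∃[ J ] ∀ N m → J ℕ.≤ N → J ℕ.≤ m → ∣ L N - leibniz m ∣ ≤ ε
  L-near-leibniz ε 0<ε =
    let δ = ½ * (½ * ε)
        0<δ = 0<* 0<½ (0<* 0<½ 0<ε)
        K , small = odd⁻¹-small δ 0<δ
        o<δ = small K ℕ.≤-refl
        S = 1ℚ + sum defect K
        0<S = <-≤-trans 0<1 (≤+ 1ℚ (sum-≥0 0≤defect K))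
        η , 0<η , Sη≡ = divide 0<S (0<* 0<½ 0<ε)
        J , inv≤η = inv-null η 0<η
    in J ℕ.+ K , λ N m le le′ → bound N m K (ℕ.≤-trans (ℕ.m≤n+m K J) le) (ℕ.≤-trans (ℕ.m≤n+m K J) le′) (<⇒≤ o<δ)
         (≤-trans (*-≤ˡ (sum-≥0 0≤defect K) (inv≤η N (ℕ.≤-trans (ℕ.m≤m+n J K) le)))
           (≤-trans (*-≤ʳ (<⇒≤ 0<η) (≤-trans (≤+ (sum defect K) (<⇒≤ 0<1)) (≤-reflexive (+-comm (sum defect K) 1ℚ)))) (≤-reflexive Sη≡)))
    where
    open ≤-Reasoning
    bound : ∀ N m K → K ℕ.≤ N → K ℕ.≤ m → odd⁻¹ K ≤ ½ * (½ * ε) → sum defect K * inv N ≤ ½ * ε → ∣ L N - leibniz m ∣ ≤ ε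
    bound N m K K≤N K≤m o≤δ head≤ = begin
      ∣ L N - leibniz m ∣                                    ≡⟨ cong (λ y → ∣ L N - y ∣) (leibniz≡alt m) ⟩
      ∣ L N - alt odd⁻¹ m ∣
        ≡⟨ cong ∣_∣ (solve 4 (λ l x y a → l :- a := (l :- x) :+ ((x :- y) :+ :- (a :- y))) refl (L N) (alt a K) (alt odd⁻¹ K) (alt odd⁻¹ m)) ⟩
      ∣ (L N - alt a K) + ((alt a K - alt odd⁻¹ K) + - (alt odd⁻¹ m - alt odd⁻¹ K)) ∣
        ≤⟨ ∣∣-+-≤ (L N - alt a K) _ (alt-tail a K (suc N) 0≤a a↓ (ℕ.m≤n⇒m≤1+n K≤N))
             (∣∣-+-≤ (alt a K - alt odd⁻¹ K) (- (alt odd⁻¹ m - alt odd⁻¹ K)) head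
               (≤-trans (≤-reflexive (∣-p∣≡∣p∣ (alt odd⁻¹ m - alt odd⁻¹ K))) (alt-tail odd⁻¹ K m 0≤odd⁻¹ odd⁻¹-anti K≤m))) ⟩
      a K + (½ * ε + odd⁻¹ K)                                ≤⟨ +-mono-≤ (≤-trans a≤o o≤δ) (+-monoʳ-≤ (½ * ε) o≤δ) ⟩
      ½ * (½ * ε) + (½ * ε + ½ * (½ * ε))
        ≡⟨ solve 1 (λ e → con ½ :* (con ½ :* e) :+ (con ½ :* e :+ con ½ :* (con ½ :* e)) := e) refl ε ⟩
      ε                                                      ∎
      where
      a : Series
      a k = r N k * odd⁻¹ k
      0≤a : ∀ k → 0ℚ ≤ a k
      0≤a k = 0≤* (0≤r N k) (0≤odd⁻¹ k)
      a↓ : ∀ k → a (suc k) ≤ a k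
      a↓ k = *-mono-≤ (0≤r N (suc k)) (r-anti N k) (0≤odd⁻¹ (suc k)) (odd⁻¹-anti k)
      a≤o : a K ≤ odd⁻¹ K
      a≤o = ≤-trans (*-≤ʳ (0≤odd⁻¹ K) (r≤1 N K)) (≤-reflexive (*-identityˡ (odd⁻¹ K)))
      term : ∀ k → ∣ a k - odd⁻¹ k ∣ ≤ inv N * defect k
      term k = begin
        ∣ a k - odd⁻¹ k ∣               ≡⟨ ∣-∣-comm (a k) (odd⁻¹ k) ⟩
        ∣ odd⁻¹ k - a k ∣               ≡⟨ cong ∣_∣ (solve 2 (λ r o → o :- r :* o := (con 1ℚ :- r) :* o) refl (r N k) (odd⁻¹ k)) ⟩
        ∣ (1ℚ - r N k) * odd⁻¹ k ∣      ≡⟨ 0≤p⇒∣p∣≡p (0≤* 0≤1-r (0≤odd⁻¹ k)) ⟩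
        (1ℚ - r N k) * odd⁻¹ k          ≤⟨ *-mono-≤ 0≤1-r (r-near-1 N k) (0≤odd⁻¹ k) (odd⁻¹≤1 k) ⟩
        defect k * inv N * 1ℚ               ≡⟨ trans (*-identityʳ _) (*-comm (defect k) (inv N)) ⟩
        inv N * defect k                    ∎
        where
        0≤1-r : 0ℚ ≤ 1ℚ - r N k
        0≤1-r = subst (_≤ 1ℚ - r N k) (+-inverseʳ (r N k)) (+-monoˡ-≤ (- r N k) (r≤1 N k))
      head : ∣ alt a K - alt odd⁻¹ K ∣ ≤ ½ * ε
      head = ≤-trans (alt-difference a odd⁻¹ K) (≤-trans (sum-mono term K)
        (≤-trans (≤-reflexive (trans (sum-scale (inv N) defect K) (*-comm (inv N) (sum defect K)))) head≤))

-- Squared asymptotics in the iterated limit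

module Asymptotics where

  open import Algebra.Bundles using (CommutativeRing)
  open ClosedForms using (b; σ; ⅔; ⅓; 3ℚ; fromℕ*inv)
  open Coefficients using (fromℕ-+)
  open GeneratingFunction using (f; h; w; θf)
  private module S = Series
  open Series using (at; pointwise)
  open Limits
  open NullRing
  open CentralBinomial
  open TameMembers using (tame-h; tame-w; sum-Cat; β-1; value-σ-⅔)
  open Values using (s; H; s²; H²)
  open Wallis using (L; L-near-leibniz; wallis-exact; odd⁻¹≤1)
  open TameSeries using (value; null-θ)
  open import Data.Integer.Base using (+_)
  open import Data.Rational.Base using (_/_)
  open import Data.Rational.Solver using (module +-*-Solver)
  open import Defs using (Cauchy; Eventually; cauchy)
  import Relation.Binary.Reasoning.Setoid as Setoid-Reasoning
  open RationalSequences using (fromℕ; 0≤fromℕ; sqrt; leibniz; leibniz-cauchy; odd⁻¹; 0≤odd⁻¹; odd⁻¹-small; inverse; inverseʳ; sqrt-bracket; sqrt-width; sqrt-width-small; 0≤sqrt-width; 0<*; 0≤*; 0<½; 0<1; *-mono-≤; divide; module Bracket; sqrtInterval; p≤∣p∣)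

  private
    module Q = +-*-Solver
    module N₁ = Null sequences
    module N₂ = Null iterated
    module R = CommutativeRing (nullRing iterated)
    open R using (_+_; _*_; _-_; -_; _≈_)
    open NullSolver iterated using (solve; con; _:=_; _:+_; _:*_; _:-_; :-_)
    open Setoid-Reasoning R.setoid
    open Element

    # : ℚ → R.Carrier
    # = constant iterated

    fix : ∀ {l r} x u → l ≈ r → x ≈ x + u * (l - r)
    fix = add-multiple iterated

  lift₁ : ∀ {a : ℕ → ℚ} → N₁.Null a → N₂.Null (λ i → a (proj₁ i))
  lift₁ na ε 0<ε = let N , k = na ε 0<ε in N , λ n N≤n → 0 , λ m _ → k n N≤n

  lift₂ : ∀ {a : ℕ → ℚ} → N₁.Null a → N₂.Null (λ i → a (proj₂ i))
  lift₂ na ε 0<ε = let M , k = na ε 0<ε in 0 , λ n _ → M , k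

  liftB₁ : ∀ {a : ℕ → ℚ} → N₁.Bounded a → N₂.Bounded (λ i → a (proj₁ i))
  liftB₁ (B , 0<B , N , k) = B , 0<B , N , λ n N≤n → 0 , λ m _ → k n N≤n

  liftB₂ : ∀ {a : ℕ → ℚ} → N₁.Bounded a → N₂.Bounded (λ i → a (proj₂ i))
  liftB₂ (B , 0<B , M , k) = B , 0<B , 0 , λ n _ → M , k

  sqrt-≥0 : ∀ m q → 0ℚ ℚ.≤ sqrt m q
  sqrt-≥0 m q = Bracket.lo≥0 (sqrt-bracket m q)

  -- From l² ≤ q < (l + w)² the error is at most (2l + w) w, where l ≤ B + 1 and w ≤ 1.
  sqrt-error : ∀ m q {B η} → 0ℚ ℚ.≤ q → q ℚ.≤ B → sqrt-width m q ℚ.≤ η → η ℚ.≤ 1ℚ →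
               ℚ.∣ sqrt m q ℚ.* sqrt m q ℚ.- q ∣ ℚ.≤ (2ℚ ℚ.* B ℚ.+ (2ℚ ℚ.+ 1ℚ)) ℚ.* η
  sqrt-error m q {B} {η} 0≤q q≤B w≤η η≤1 = ℚ.≤-trans (ℚ.≤-reflexive (trans
      (RationalSequences.∣-∣-comm (l ℚ.* l) q) (ℚ.0≤p⇒∣p∣≡p 0≤diff))) diff≤
    where
    module B = Bracket (sqrt-bracket m q)
    l = sqrt m q
    hi = proj₂ (sqrtInterval m q)
    wd = sqrt-width m q
    q⁺≡q : 0ℚ ℚ.⊔ q ≡ q
    q⁺≡q = ℚ.p≤q⇒p⊔q≡q 0≤q
    l²≤q : l ℚ.* l ℚ.≤ q
    l²≤q = subst (l ℚ.* l ℚ.≤_) q⁺≡q B.lo²≤q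
    0≤diff : 0ℚ ℚ.≤ q ℚ.- l ℚ.* l
    0≤diff = subst (ℚ._≤ q ℚ.- l ℚ.* l) (ℚ.+-inverseʳ (l ℚ.* l)) (ℚ.+-monoˡ-≤ (ℚ.- (l ℚ.* l)) l²≤q)
    0≤w = 0≤sqrt-width m q
    0≤B = ℚ.≤-trans 0≤q q≤B
    l≤B+1 : l ℚ.≤ B ℚ.+ 1ℚ
    l≤B+1 = square-cancel-≤ (ℚ.+-mono-≤ 0≤B (ℚ.<⇒≤ 0<1)) (ℚ.≤-trans l²≤q (ℚ.≤-trans q≤B
      (≤-via (B ℚ.* B ℚ.+ B ℚ.+ 1ℚ) (ℚ.+-mono-≤ (ℚ.+-mono-≤ (0≤* 0≤B 0≤B) 0≤B) (ℚ.<⇒≤ 0<1))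
        (Q.solve 1 (λ B → (B Q.:+ Q.con 1ℚ) Q.:* (B Q.:+ Q.con 1ℚ) Q.:= B Q.:+ (B Q.:* B Q.:+ B Q.:+ Q.con 1ℚ)) refl B))))
    diff≤ : q ℚ.- l ℚ.* l ℚ.≤ (2ℚ ℚ.* B ℚ.+ (2ℚ ℚ.+ 1ℚ)) ℚ.* η
    diff≤ = ℚ.≤-trans (ℚ.+-monoˡ-≤ (ℚ.- (l ℚ.* l)) (ℚ.<⇒≤ (subst (ℚ._< hi ℚ.* hi) q⁺≡q B.q<hi²)))
      (ℚ.≤-trans (ℚ.≤-reflexive (trans (cong (λ y → y ℚ.* y ℚ.- l ℚ.* l) B.width)
          (Q.solve 2 (λ l w → (l Q.:+ w) Q.:* (l Q.:+ w) Q.:- l Q.:* l Q.:= (Q.con 2ℚ Q.:* l Q.:+ w) Q.:* w) refl l wd)))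
        (*-mono-≤ (ℚ.+-mono-≤ (0≤* (ℚ.<⇒≤ (ℚ.+-mono-< 0<1 0<1)) B.lo≥0) 0≤w)
          (ℚ.≤-trans (ℚ.+-mono-≤ (*-≤ˡ (ℚ.<⇒≤ (ℚ.+-mono-< 0<1 0<1)) l≤B+1) (ℚ.≤-trans w≤η η≤1))
            (ℚ.≤-reflexive (Q.solve 1 (λ B → Q.con 2ℚ Q.:* (B Q.:+ Q.con 1ℚ) Q.:+ Q.con 1ℚ Q.:= Q.con 2ℚ Q.:* B Q.:+ (Q.con 2ℚ Q.:+ Q.con 1ℚ)) refl B)))
          0≤w w≤η))

  sqrt²-null : ∀ {u : ℕ → ℚ} → Cauchy u → (∀ m → 0ℚ ℚ.≤ u m) → N₁.Null (λ m → sqrt m (u m) ℚ.* sqrt m (u m) ℚ.- u m)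
  sqrt²-null {u} cu 0≤u ε 0<ε =
    let B , 0<B , M , u≤B = RationalSequences.bounded {u} cu
        K = 2ℚ ℚ.* B ℚ.+ (2ℚ ℚ.+ 1ℚ)
        0<2 = ℚ.+-mono-< 0<1 0<1
        η , 0<η , Kη≡ = divide (ℚ.+-mono-< (0<* 0<2 0<B) (ℚ.+-mono-< 0<2 0<1)) 0<ε
        η′ = η ℚ.⊓ 1ℚ
        M′ , w≤ = sqrt-width-small {u} cu η′ (RationalSequences.0<⊓ 0<η 0<1)
    in M ℕ.⊔ M′ , λ m le → ℚ.≤-trans
      (sqrt-error m (u m) {B} {η′} (0≤u m) (ℚ.≤-trans (p≤∣p∣ (u m)) (u≤B m (ℕ.m⊔n≤o⇒m≤o M M′ le)))
        (w≤ m (ℕ.m⊔n≤o⇒n≤o M M′ le)) (ℚ.p⊓q≤q η 1ℚ))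
      (ℚ.≤-trans (*-≤ˡ (ℚ.<⇒≤ (ℚ.+-mono-< (0<* 0<2 0<B) (ℚ.+-mono-< 0<2 0<1))) (ℚ.p⊓q≤p η 1ℚ)) (ℚ.≤-reflexive Kη≡))

  cauchy-bounded : ∀ {u : ℕ → ℚ} → Cauchy u → N₁.Bounded u
  cauchy-bounded {u} cu = RationalSequences.bounded {u} cu

  -- A positive default at 0 keeps `0<x⁻³` total.
  x⁻³ : ℕ → ℚ
  x⁻³ zero    = 1ℚ
  x⁻³ (suc k) = (+ 1 / (suc k ℕ.^ 3)) {{ℕ.m^n≢0 (suc k) 3}}

  0<x⁻³ : ∀ n → 0ℚ ℚ.< x⁻³ n
  0<x⁻³ zero    = 0<1
  0<x⁻³ (suc k) = ℚ.positive⁻¹ (x⁻³ (suc k)) {{ℚ.normalize-pos 1 (suc k ℕ.^ 3) {{ℕ.m^n≢0 (suc k) 3}}}}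

  recip : ∀ d .{{_ : ℕ.NonZero d}} → fromℕ d ℚ.* (+ 1 / d) ≡ 1ℚ
  recip (suc d) = fromℕ*inv d

  fromℕ-* : ∀ m n → fromℕ (m ℕ.* n) ≡ fromℕ m ℚ.* fromℕ n
  fromℕ-* zero    n = sym (ℚ.*-zeroˡ (fromℕ n))
  fromℕ-* (suc m) n = trans (fromℕ-+ n (m ℕ.* n)) (trans (cong (fromℕ n ℚ.+_) (fromℕ-* m n))
    (trans (Q.solve 2 (λ m n → n Q.:+ m Q.:* n Q.:= (m Q.:+ Q.con 1ℚ) Q.:* n) refl (fromℕ m) (fromℕ n))
      (cong (ℚ._* fromℕ n) (sym (RationalSequences.fromℕ-suc m)))))

  cube : ℕ → ℚ
  cube n = fromℕ n ℚ.* (fromℕ n ℚ.* fromℕ n)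

  cube*x⁻³ : ∀ k → cube (suc k) ℚ.* x⁻³ (suc k) ≡ 1ℚ
  cube*x⁻³ k = trans (cong (ℚ._* x⁻³ (suc k)) (sym (trans (fromℕ-* n (n ℕ.* (n ℕ.* 1))) (cong (fromℕ n ℚ.*_)
      (trans (fromℕ-* n (n ℕ.* 1)) (cong (fromℕ n ℚ.*_) (cong fromℕ (ℕ.*-identityʳ n))))))))
    (recip (n ℕ.^ 3) {{ℕ.m^n≢0 n 3}})
    where n = suc k

  -- Here n is the index of the sequences and m the precision of the real numbers.

  √3 √π ξ : ℕ × ℕ → ℚ
  √3 (n , m) = sqrt m (fromℕ 3)
  √π (n , m) = sqrt m (fromℕ 4 ℚ.* leibniz m)
  ξ  (n , m) = sqrt m (x⁻³ n)

  t̂ π̂ Λ ŝ Ĥ X Ŷ Ξ : R.Carrier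

  t̂ = element √3 (liftB₂ {λ m → sqrt m (fromℕ 3)} (cauchy-bounded (cauchy (Defs.√ (Defs.fromℕ 3)))))
  π̂ = element √π (liftB₂ {λ m → sqrt m (fromℕ 4 ℚ.* leibniz m)} (cauchy-bounded (cauchy (Defs.√ Defs.π))))
  Λ = element (λ i → leibniz (proj₂ i)) (liftB₂ {leibniz} (cauchy-bounded leibniz-cauchy))
  ŝ = element (λ i → value (σ ⅔) (proj₁ i)) (liftB₁ {value (σ ⅔)} (bounded s))
  Ĥ = element (λ i → value h (proj₁ i)) (liftB₁ {value h} (bounded H))

  n*b² : ℕ → ℚ
  n*b² n = fromℕ n ℚ.* (b n ℚ.* b n)

  n*b²-≥0 : ∀ n → 0ℚ ℚ.≤ n*b² n
  n*b²-≥0 n = 0≤* (0≤fromℕ n) (0≤* (0≤b n) (0≤b n))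

  n*b²≤1 : ∀ n → n*b² n ℚ.≤ 1ℚ
  n*b²≤1 n = ℚ.≤-trans (*-≤ʳ {p = fromℕ n} {q = odd n} (0≤* (0≤b n) (0≤b n)) (≤-via (fromℕ n ℚ.+ 1ℚ) (ℚ.+-mono-≤ (0≤fromℕ n) (ℚ.<⇒≤ 0<1))
    (ℚ.+-assoc (fromℕ n) (fromℕ n) 1ℚ))) (odd*b²≤1 n)

  X = element (λ i → n*b² (proj₁ i)) (liftB₁ {n*b²} (1ℚ , 0<1 , 0 , λ n _ →
    ℚ.≤-trans (ℚ.≤-reflexive (ℚ.0≤p⇒∣p∣≡p (n*b²-≥0 n))) (n*b²≤1 n)))

  b≢0 : ∀ n → b n ≡ 0ℚ → _
  b≢0 n e = ℚ.<-irrefl (sym e) (0<b n)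

  -- The coefficients of θ f measured against those of (1 - z)^(-1/2); by `θf` and the convolution
  -- estimate this tends to h(1).
  y : ℕ → ℚ
  y n = fromℕ n ℚ.* f n ℚ.* inverse (b n)

  y*b : ∀ n → y n ℚ.* b n ≡ fromℕ n ℚ.* f n
  y*b n = trans (ℚ.*-assoc (fromℕ n ℚ.* f n) (inverse (b n)) (b n)) (trans
    (cong (fromℕ n ℚ.* f n ℚ.*_) (trans (ℚ.*-comm (inverse (b n)) (b n)) (inverseʳ (b≢0 n)))) (ℚ.*-identityʳ _))

  small-÷b : ∀ {e : ℕ → ℚ} → Small e → N₁.Null (λ n → e n ℚ.* inverse (b n))
  small-÷b {e} se ε 0<ε = let N , k = se ε 0<ε in N , λ n N≤n → ℚ.≤-trans (ℚ.≤-reflexive (ℚ.∣p*q∣≡∣p∣*∣q∣ (e n) (inverse (b n))))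
    (ℚ.≤-trans (*-≤ʳ (ℚ.0≤∣p∣ (inverse (b n))) (k n N≤n)) (ℚ.≤-reflexive (trans (ℚ.*-assoc ε (b n) _)
      (trans (cong (ε ℚ.*_) (trans (cong (ℚ._* ℚ.∣ inverse (b n) ∣) (sym (ℚ.0≤p⇒∣p∣≡p (0≤b n))))
        (trans (sym (ℚ.∣p*q∣≡∣p∣*∣q∣ (b n) (inverse (b n)))) (cong ℚ.∣_∣ (inverseʳ (b≢0 n)))))) (ℚ.*-identityʳ ε)))))

  y~H : N₁.Null (λ n → y n ℚ.- value h n)
  y~H = N₁.null-≡ {b = λ n → e₁ n ℚ.* inverse (b n) ℚ.+ w n ℚ.* inverse (b n)} split
    (N₁.null-+ {λ n → e₁ n ℚ.* inverse (b n)} {λ n → w n ℚ.* inverse (b n)}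
      (small-÷b {e₁} (conv-b {h} tame-h)) (small-÷b {w} (small-θ {w} (null-θ tame-w))))
    where
    e₁ : ℕ → ℚ
    e₁ n = (h S.* b) n ℚ.- value h n ℚ.* b n
    split : ∀ n → y n ℚ.- value h n ≡ e₁ n ℚ.* inverse (b n) ℚ.+ w n ℚ.* inverse (b n)
    split n = trans (cong₂ (λ p q → p ℚ.* inverse (b n) ℚ.- q) (trans (at θf n) (cong (ℚ._+ w n)
        (at (S.*-cong (S.≈-refl {h}) (pointwise {b = b} β-1)) n)))
        (sym (trans (cong (value h n ℚ.*_) (inverseʳ (b≢0 n))) (ℚ.*-identityʳ _))))
      (Q.solve 5 (λ c w v b i → (c Q.:+ w) Q.:* i Q.:- v Q.:* (b Q.:* i) Q.:= (c Q.:- v Q.:* b) Q.:* i Q.:+ w Q.:* i) refl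
        ((h S.* b) n) (w n) (value h n) (b n) (inverse (b n)))

  Ŷ = element (λ i → y (proj₁ i)) (N₂.bounded-~ {b = fun Ĥ} (N₂.near (lift₁ {λ n → y n ℚ.- value h n} y~H)) (bounded Ĥ))

  Ŷ≈ : Ŷ ≈ Ĥ
  Ŷ≈ = close (N₂.near (lift₁ {λ n → y n ℚ.- value h n} y~H))

  -- The order of the limits is essential here: n is fixed before m, so n³ is a constant in front of
  -- the error of the square root.
  Ξ-null : N₂.Null (λ i → cube (proj₁ i) ℚ.* (ξ i ℚ.* ξ i) ℚ.- 1ℚ)
  Ξ-null ε 0<ε = 1 , λ { (suc k) _ → N₁.null-≡ {b = λ m → cube (suc k) ℚ.* (ξ (suc k , m) ℚ.* ξ (suc k , m) ℚ.- x⁻³ (suc k))}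
      (λ m → trans (cong (λ v → cube (suc k) ℚ.* (ξ (suc k , m) ℚ.* ξ (suc k , m)) ℚ.- v) (sym (cube*x⁻³ k)))
        (Q.solve 3 (λ c s x → c Q.:* s Q.:- c Q.:* x Q.:= c Q.:* (s Q.:- x)) refl (cube (suc k)) (ξ (suc k , m) ℚ.* ξ (suc k , m)) (x⁻³ (suc k))))
      (N₁.null-* {λ _ → cube (suc k)} {λ m → ξ (suc k , m) ℚ.* ξ (suc k , m) ℚ.- x⁻³ (suc k)} (N₁.bounded-const (cube (suc k)))
        (sqrt²-null {λ _ → x⁻³ (suc k)} (RationalSequences.const-cauchy (x⁻³ (suc k))) (λ _ → ℚ.<⇒≤ (0<x⁻³ (suc k)))))
      ε 0<ε }

  Ξ = element (λ i → cube (proj₁ i) ℚ.* (ξ i ℚ.* ξ i))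
    (N₂.bounded-~ {b = λ _ → 1ℚ} (N₂.near Ξ-null) (N₂.bounded-const 1ℚ))

  Ξ≈1 : Ξ ≈ # 1ℚ
  Ξ≈1 = close (N₂.near Ξ-null)

  t̂² : t̂ * t̂ ≈ # (fromℕ 3)
  t̂² = close (N₂.near (lift₂ {λ m → sqrt m (fromℕ 3) ℚ.* sqrt m (fromℕ 3) ℚ.- fromℕ 3}
    (sqrt²-null {λ _ → fromℕ 3} (RationalSequences.const-cauchy (fromℕ 3)) (λ _ → 0≤fromℕ 3))))

  0≤leibniz : ∀ m → 0ℚ ℚ.≤ leibniz m
  0≤leibniz zero    = ℚ.≤-refl
  0≤leibniz (suc m) = ℚ.≤-trans (ℚ.<⇒≤ 0<½) (RationalSequences.½≤leibniz (suc m) (ℕ.s≤s ℕ.z≤n))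

  π̂² : π̂ * π̂ ≈ # (fromℕ 4) * Λ
  π̂² = close (N₂.near (lift₂ {λ m → sqrt m (fromℕ 4 ℚ.* leibniz m) ℚ.* sqrt m (fromℕ 4 ℚ.* leibniz m) ℚ.- fromℕ 4 ℚ.* leibniz m}
    (sqrt²-null {λ m → fromℕ 4 ℚ.* leibniz m} (cauchy Defs.π) (λ m → 0≤* {fromℕ 4} {leibniz m} (0≤fromℕ 4) (0≤leibniz m)))))

  odd⁻¹-null : N₁.Null (λ n → odd⁻¹ n ℚ.* odd⁻¹ n)
  odd⁻¹-null ε 0<ε = let N , k = odd⁻¹-small ε 0<ε in N , λ n N≤n → ℚ.≤-trans (ℚ.≤-reflexive (ℚ.0≤p⇒∣p∣≡p (0≤* (0≤odd⁻¹ n) (0≤odd⁻¹ n))))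
    (ℚ.≤-trans (*-≤ˡ (0≤odd⁻¹ n) (odd⁻¹≤1 n)) (ℚ.≤-trans (ℚ.≤-reflexive (ℚ.*-identityʳ (odd⁻¹ n))) (ℚ.<⇒≤ (k n N≤n))))

  XΛ : # (fromℕ 4) * X * Λ ≈ # 1ℚ
  XΛ = close (N₂.near (N₂.null-≡ {b = λ (n , m) → fromℕ 4 ℚ.* n*b² n ℚ.* (leibniz m ℚ.- L n) ℚ.+ ℚ.- (odd⁻¹ n ℚ.* odd⁻¹ n)}
    (λ (n , m) → trans (Q.solve 3 (λ a l m → a Q.:* m Q.:- Q.con 1ℚ Q.:= a Q.:* (m Q.:- l) Q.:+ (a Q.:* l Q.:- Q.con 1ℚ)) refl
        (fromℕ 4 ℚ.* n*b² n) (L n) (leibniz m))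
      (cong (fromℕ 4 ℚ.* n*b² n ℚ.* (leibniz m ℚ.- L n) ℚ.+_) (trans (cong (ℚ._- 1ℚ) (wallis-exact n))
        (Q.solve 1 (λ o → (Q.con 1ℚ Q.:- o) Q.:- Q.con 1ℚ Q.:= Q.:- o) refl (odd⁻¹ n ℚ.* odd⁻¹ n)))))
    (N₂.null-+ {λ (n , m) → fromℕ 4 ℚ.* n*b² n ℚ.* (leibniz m ℚ.- L n)} {λ (n , m) → ℚ.- (odd⁻¹ n ℚ.* odd⁻¹ n)}
      (N₂.null-* {λ (n , m) → fromℕ 4 ℚ.* n*b² n} {λ (n , m) → leibniz m ℚ.- L n} (bounded (# (fromℕ 4) * X))
        (λ ε 0<ε → let J , k = L-near-leibniz ε 0<ε in J , λ n J≤n → J , λ m J≤m →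
          ℚ.≤-trans (ℚ.≤-reflexive (RationalSequences.∣-∣-comm (leibniz m) (L n))) (k n m J≤n J≤m)))
      (N₂.null-neg {λ (n , m) → odd⁻¹ n ℚ.* odd⁻¹ n} (lift₁ {λ n → odd⁻¹ n ℚ.* odd⁻¹ n} odd⁻¹-null)))))

  ŝ² : ŝ * ŝ ≈ # ⅓
  ŝ² = close (N₂.near (lift₁ {λ n → value (σ ⅔) n ℚ.* value (σ ⅔) n ℚ.- ⅓} (N₁.null (_≃_.related s²))))

  Ĥ² : Ĥ * Ĥ ≈ # (+ 27 / 64) * (# (+ 7 / 1) + # (+ 12 / 1) * ŝ)
  Ĥ² = close (N₂.near (lift₁ {λ n → value h n ℚ.* value h n ℚ.- (+ 27 / 64) ℚ.* ((+ 7 / 1) ℚ.+ (+ 12 / 1) ℚ.* value (σ ⅔) n)}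
    (N₁.null (_≃_.related H²))))

  -- 5/9 is 1 - (1/3)(4/3), from the bound 4/3 for `Cat`.
  5/9≤s : ∀ n → + 5 / 9 ℚ.≤ value (σ ⅔) n
  5/9≤s n = ℚ.≤-trans (ℚ.≤-trans (ℚ.≤ᵇ⇒≤ {+ 5 / 9} {1ℚ ℚ.- ⅓ ℚ.* (1ℚ ℚ.+ ⅓)} _) (ℚ.+-monoʳ-≤ 1ℚ (ℚ.neg-antimono-≤ (*-≤ˡ {⅓} (ℚ.≤ᵇ⇒≤ _) (sum-Cat n)))))
    (ℚ.≤-reflexive (sym (value-σ-⅔ n)))

  -- The squares agree, and a difference is at most the difference of the squares once the sum is at
  -- least 1. The positivity of s given by `5/9≤s` thereby selects the root.
  t≈3s : t̂ ≈ # 3ℚ * ŝ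
  t≈3s = close (N₂.near (N₂.null-≤ {b = λ i → √3 i ℚ.* √3 i ℚ.- 3ℚ ℚ.* 3ℚ ℚ.* (fun ŝ i ℚ.* fun ŝ i)} {1ℚ} 0<1
      (Filter.always iterated bound) (N₂.null (_≃_.related diff))))
    where
    diff : t̂ * t̂ ≈ # 3ℚ * # 3ℚ * (ŝ * ŝ)
    diff = R.trans t̂² (R.sym (R.trans (R.*-cong (R.refl {# 3ℚ * # 3ℚ}) ŝ²)
      (solve 0 (con 3ℚ :* con 3ℚ :* con ⅓ := con (fromℕ 3)) R.refl)))
    bound : ∀ i → ℚ.∣ √3 i ℚ.- 3ℚ ℚ.* fun ŝ i ∣ ℚ.≤ 1ℚ ℚ.* ℚ.∣ √3 i ℚ.* √3 i ℚ.- 3ℚ ℚ.* 3ℚ ℚ.* (fun ŝ i ℚ.* fun ŝ i) ∣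
    bound i@(n , m) = ℚ.≤-trans (ℚ.≤-trans (ℚ.≤-reflexive (sym (ℚ.*-identityʳ _))) (*-≤ˡ (ℚ.0≤∣p∣ (u ℚ.- v)) 1≤))
      (ℚ.≤-reflexive (trans (sym (ℚ.∣p*q∣≡∣p∣*∣q∣ (u ℚ.- v) (u ℚ.+ v))) (trans (cong ℚ.∣_∣
        (Q.solve 2 (λ u s → (u Q.:- Q.con 3ℚ Q.:* s) Q.:* (u Q.:+ Q.con 3ℚ Q.:* s) Q.:= u Q.:* u Q.:- Q.con 3ℚ Q.:* Q.con 3ℚ Q.:* (s Q.:* s)) refl u (fun ŝ i)))
        (sym (ℚ.*-identityˡ _)))))
      where
      u = √3 i
      v = 3ℚ ℚ.* fun ŝ i
      1≤v : 1ℚ ℚ.≤ v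
      1≤v = ℚ.≤-trans (ℚ.≤ᵇ⇒≤ {1ℚ} {3ℚ ℚ.* (+ 5 / 9)} _) (*-≤ˡ {3ℚ} (ℚ.≤ᵇ⇒≤ _) (5/9≤s n))
      1≤ : 1ℚ ℚ.≤ ℚ.∣ u ℚ.+ v ∣
      1≤ = ℚ.≤-trans (ℚ.≤-trans 1≤v (ℚ.≤-trans (≤+ v (sqrt-≥0 m (fromℕ 3))) (ℚ.≤-reflexive (ℚ.+-comm v u)))) (p≤∣p∣ (u ℚ.+ v))

  -- The square of 9 + 6√3, times n³ (n^(-3/2))², which tends to 1. The square of the ratio in
  -- question is the right side of `main≈` divided by this.
  weight : R.Carrier
  weight = (# (fromℕ 9) + # (fromℕ 6) * t̂) * (# (fromℕ 9) + # (fromℕ 6) * t̂) * Ξ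

  weight≈ : weight ≈ # (+ 189 / 1) + # (+ 324 / 1) * ŝ
  weight≈ = begin
    (# (fromℕ 9) + # (fromℕ 6) * t̂) * (# (fromℕ 9) + # (fromℕ 6) * t̂) * Ξ
      -- 36 and 108 are the coefficients of t² and t in (9 + 6t)².
      ≈⟨ R.*-cong (fix _ (# (ℚ.- (+ 36 / 1))) t̂²) Ξ≈1 ⟩
    ((# (fromℕ 9) + # (fromℕ 6) * t̂) * (# (fromℕ 9) + # (fromℕ 6) * t̂) + # (ℚ.- (+ 36 / 1)) * (t̂ * t̂ - # (fromℕ 3))) * # 1ℚ
      ≈⟨ fix _ (# (ℚ.- (+ 108 / 1))) t≈3s ⟩
    ((# (fromℕ 9) + # (fromℕ 6) * t̂) * (# (fromℕ 9) + # (fromℕ 6) * t̂) + # (ℚ.- (+ 36 / 1)) * (t̂ * t̂ - # (fromℕ 3))) * # 1ℚ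
      + # (ℚ.- (+ 108 / 1)) * (t̂ - # 3ℚ * ŝ)
      ≈⟨ solve 2 (λ t s → ((con (fromℕ 9) :+ con (fromℕ 6) :* t) :* (con (fromℕ 9) :+ con (fromℕ 6) :* t)
             :+ con (ℚ.- (+ 36 / 1)) :* (t :* t :- con (fromℕ 3))) :* con 1ℚ :+ con (ℚ.- (+ 108 / 1)) :* (t :- con 3ℚ :* s)
           := con (+ 189 / 1) :+ con (+ 324 / 1) :* s) R.refl t̂ ŝ ⟩
    # (+ 189 / 1) + # (+ 324 / 1) * ŝ ∎

  -- Both sides are 27 (7 + 12s) in the limit: by `XΛ`, which is Wallis' product, n b(n)² cancels
  -- against π, whose value is 4Λ.
  main≈ : weight ≈ # (+ 64 / 1) * (π̂ * π̂) * (X * (Ŷ * Ŷ))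
  main≈ = R.trans weight≈ (R.sym (begin
    # (+ 64 / 1) * (π̂ * π̂) * (X * (Ŷ * Ŷ))
      ≈⟨ R.*-cong (R.*-cong (R.refl {# (+ 64 / 1)}) π̂²) (R.*-cong (R.refl {X}) (R.trans (R.*-cong Ŷ≈ Ŷ≈) Ĥ²)) ⟩
    # (+ 64 / 1) * (# (fromℕ 4) * Λ) * (X * (# (+ 27 / 64) * (# (+ 7 / 1) + # (+ 12 / 1) * ŝ)))
      ≈⟨ solve 3 (λ l x s → con (+ 64 / 1) :* (con (fromℕ 4) :* l) :* (x :* (con (+ 27 / 64) :* (con (+ 7 / 1) :+ con (+ 12 / 1) :* s)))
           := con (fromℕ 4) :* x :* l :* (con (+ 189 / 1) :+ con (+ 324 / 1) :* s)) R.refl Λ X ŝ ⟩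
    # (fromℕ 4) * X * Λ * (# (+ 189 / 1) + # (+ 324 / 1) * ŝ)
      ≈⟨ R.*-cong XΛ (R.refl {# (+ 189 / 1) + # (+ 324 / 1) * ŝ}) ⟩
    # 1ℚ * (# (+ 189 / 1) + # (+ 324 / 1) * ŝ)
      ≈⟨ R.*-identityˡ _ ⟩
    # (+ 189 / 1) + # (+ 324 / 1) * ŝ ∎))

  -- This permits division by the weight; the bound 189 + 324·(5/9) = 369 for its limit leaves ample
  -- room.
  weight-large : Filter.Ev iterated (λ i → 1ℚ ℚ.≤ fun weight i)
  weight-large = Filter.map iterated large (N₂.null (_≃_.related weight≈) 1ℚ 0<1)
    where
    v : ℕ × ℕ → ℚ
    v i = (+ 189 / 1) ℚ.+ (+ 324 / 1) ℚ.* fun ŝ i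
    large : ∀ i → ℚ.∣ fun weight i ℚ.- v i ∣ ℚ.≤ 1ℚ → 1ℚ ℚ.≤ fun weight i
    large i close≤ = ℚ.≤-trans 1≤v-1 (ℚ.≤-trans (ℚ.+-monoʳ-≤ (v i) (ℚ.neg-antimono-≤ v-w≤1)) (ℚ.≤-reflexive
        (Q.solve 2 (λ v w → v Q.:- (v Q.:- w) Q.:= w) refl (v i) (fun weight i))))
      where
      v-w≤1 : v i ℚ.- fun weight i ℚ.≤ 1ℚ
      v-w≤1 = ℚ.≤-trans (p≤∣p∣ (v i ℚ.- fun weight i)) (ℚ.≤-trans (ℚ.≤-reflexive (RationalSequences.∣-∣-comm (v i) (fun weight i))) close≤)
      1≤v-1 : 1ℚ ℚ.≤ v i ℚ.- 1ℚ
      1≤v-1 = ℚ.≤-trans (ℚ.≤ᵇ⇒≤ {1ℚ} {(+ 189 / 1) ℚ.+ (+ 324 / 1) ℚ.* (+ 5 / 9) ℚ.- 1ℚ} _)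
        (ℚ.+-monoˡ-≤ (ℚ.- 1ℚ) (ℚ.+-monoʳ-≤ (+ 189 / 1) (*-≤ˡ {+ 324 / 1} (ℚ.≤ᵇ⇒≤ _) (5/9≤s (proj₁ i)))))

  lhs rhs : ℕ → ℕ → ℚ
  lhs n m = A ℚ.* A ℚ.* (fromℕ n ℚ.* (fromℕ n ℚ.* fromℕ n) ℚ.* (ξ (n , m) ℚ.* ξ (n , m)))
    where A = fromℕ 9 ℚ.+ fromℕ 6 ℚ.* sqrt m (fromℕ 3)
  rhs n m = fromℕ 64 ℚ.* (√π (n , m) ℚ.* √π (n , m)) ℚ.* (fromℕ n ℚ.* (b n ℚ.* b n) ℚ.* (y n ℚ.* y n))

  weight-limit : ∀ δ → 0ℚ ℚ.< δ → Eventually (λ n → Eventually (λ m → 1ℚ ℚ.≤ lhs n m × ℚ.∣ lhs n m ℚ.- rhs n m ∣ ℚ.≤ δ))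
  weight-limit δ 0<δ = Filter.both iterated weight-large (N₂.null (_≃_.related main≈) δ 0<δ)

-- From squares to the ratio

module Ratio where

  open CentralBinomial using (≤-via)
  open Limits
  open import Data.Rational.Base
  open import Data.Rational.Properties
  open import Data.Rational.Solver using (module +-*-Solver)
  open RationalSequences using (0≤*; 0<1; p≤∣p∣; fromℕ; inverse; inverseʳ)
  open +-*-Solver

  positive-factor : ∀ {p q} → 0ℚ < p → p * q ≡ 1ℚ → 0ℚ ≤ q
  positive-factor {p} {q} 0<p pq≡1 = *-cancelˡ-≤-pos p {{positive 0<p}}
    (≤-trans (≤-reflexive (*-zeroʳ p)) (≤-trans (<⇒≤ 0<1) (≤-reflexive (sym pq≡1))))

  0<⇒≢0 : ∀ {p} → 0ℚ < p → p ≡ 0ℚ → _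
  0<⇒≢0 0<p e = <-irrefl (sym e) 0<p

  ∣ρ-1∣≤∣ρ²-1∣ : ∀ {ρ} → 0ℚ ≤ ρ → ∣ ρ - 1ℚ ∣ ≤ ∣ ρ * ρ - 1ℚ ∣
  ∣ρ-1∣≤∣ρ²-1∣ {ρ} 0≤ρ = begin
    ∣ ρ - 1ℚ ∣                        ≡⟨ *-identityʳ _ ⟨
    ∣ ρ - 1ℚ ∣ * 1ℚ                   ≤⟨ *-≤ˡ (0≤∣p∣ (ρ - 1ℚ)) (≤-trans (≤-via ρ 0≤ρ (+-comm ρ 1ℚ)) (p≤∣p∣ (ρ + 1ℚ))) ⟩
    ∣ ρ - 1ℚ ∣ * ∣ ρ + 1ℚ ∣           ≡⟨ ∣p*q∣≡∣p∣*∣q∣ (ρ - 1ℚ) (ρ + 1ℚ) ⟨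
    ∣ (ρ - 1ℚ) * (ρ + 1ℚ) ∣           ≡⟨ cong ∣_∣ (solve 1 (λ r → (r :- con 1ℚ) :* (r :+ con 1ℚ) := r :* r :- con 1ℚ) refl ρ) ⟩
    ∣ ρ * ρ - 1ℚ ∣                    ∎
    where open ≤-Reasoning

  -- The data at one index and one precision: `p6` is 6^(-n) and `six` its inverse, `A` approximates
  -- 9 + 6√3, `P` approximates √π and `i8` inverts 8 `P`, `ξ` approximates n^(-3/2), and `N` is n.
  module _ {c six p6 f A i8 P ξ N b y : ℚ} (c*p6 : c * p6 ≡ f) (six*p6 : six * p6 ≡ 1ℚ)
           (8P*i8 : fromℕ 8 * P * i8 ≡ 1ℚ) (y*b : y * b ≡ N * f) where

    private
      g = A * i8 * six * ξ
      W = A * A * (N * (N * N) * (ξ * ξ))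

    square-ratio : ∀ ρ → ρ * g ≡ c → W * (ρ * ρ) ≡ fromℕ 64 * (P * P) * (N * (b * b) * (y * y))
    square-ratio ρ ρg≡c = begin
      W * (ρ * ρ)
        ≡⟨ solve 4 (λ A N x r → A :* A :* (N :* (N :* N) :* (x :* x)) :* (r :* r) := N :* (N :* N) :* ((r :* A :* x) :* (r :* A :* x)))
             refl A N ξ ρ ⟩
      N * (N * N) * ((ρ * A * ξ) * (ρ * A * ξ))         ≡⟨ cong (λ v → N * (N * N) * (v * v)) linear ⟩
      N * (N * N) * ((fromℕ 8 * P * f) * (fromℕ 8 * P * f))
        ≡⟨ solve 3 (λ N P f → N :* (N :* N) :* ((con (fromℕ 8) :* P :* f) :* (con (fromℕ 8) :* P :* f))
             := con (fromℕ 64) :* (P :* P) :* (N :* ((N :* f) :* (N :* f)))) refl N P f ⟩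
      fromℕ 64 * (P * P) * (N * ((N * f) * (N * f)))    ≡⟨ cong (λ v → fromℕ 64 * (P * P) * (N * (v * v))) y*b ⟨
      fromℕ 64 * (P * P) * (N * ((y * b) * (y * b)))
        ≡⟨ solve 4 (λ P N y b → P :* (N :* ((y :* b) :* (y :* b))) := P :* (N :* (b :* b) :* (y :* y))) refl (fromℕ 64 * (P * P)) N y b ⟩
      fromℕ 64 * (P * P) * (N * (b * b) * (y * y))      ∎
      where
      open ≡-Reasoning
      linear : ρ * A * ξ ≡ fromℕ 8 * P * f
      linear = begin
        ρ * A * ξ                                       ≡⟨ *-identityˡ _ ⟨
        1ℚ * (ρ * A * ξ)                                ≡⟨ cong₂ (λ u v → u * v * (ρ * A * ξ)) 8P*i8 six*p6 ⟨
        fromℕ 8 * P * i8 * (six * p6) * (ρ * A * ξ)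
          ≡⟨ solve 7 (λ e i s p r A x → e :* i :* (s :* p) :* (r :* A :* x) := e :* ((r :* (A :* i :* s :* x)) :* p)) refl
               (fromℕ 8 * P) i8 six p6 ρ A ξ ⟩
        fromℕ 8 * P * ((ρ * g) * p6)                    ≡⟨ cong (λ v → fromℕ 8 * P * (v * p6)) ρg≡c ⟩
        fromℕ 8 * P * (c * p6)                          ≡⟨ cong (fromℕ 8 * P *_) c*p6 ⟩
        fromℕ 8 * P * f                                 ∎

    -- For ρ ≥ 0 the distance of ρ from 1 is at most that of ρ², and the factor W ≥ 1 only enlarges
    -- it, so no root has to be extracted.
    ratio-near-1 : ∀ {δ} → 0ℚ < g → 0ℚ ≤ c → 1ℚ ≤ W →
                   ∣ W - fromℕ 64 * (P * P) * (N * (b * b) * (y * y)) ∣ ≤ δ → ∣ c * inverse g - 1ℚ ∣ ≤ δ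
    ratio-near-1 {δ} 0<g 0≤c 1≤W near = begin
      ∣ ρ - 1ℚ ∣                        ≤⟨ ∣ρ-1∣≤∣ρ²-1∣ (0≤* 0≤c (positive-factor 0<g g*inverse)) ⟩
      ∣ ρ * ρ - 1ℚ ∣                    ≡⟨ *-identityʳ _ ⟨
      ∣ ρ * ρ - 1ℚ ∣ * 1ℚ               ≤⟨ *-≤ˡ (0≤∣p∣ (ρ * ρ - 1ℚ)) (≤-trans 1≤W (p≤∣p∣ W)) ⟩
      ∣ ρ * ρ - 1ℚ ∣ * ∣ W ∣            ≡⟨ ∣p*q∣≡∣p∣*∣q∣ (ρ * ρ - 1ℚ) W ⟨
      ∣ (ρ * ρ - 1ℚ) * W ∣
        ≡⟨ cong ∣_∣ (solve 2 (λ s W → (s :- con 1ℚ) :* W := :- (W :- W :* s)) refl (ρ * ρ) W) ⟩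
      ∣ - (W - W * (ρ * ρ)) ∣           ≡⟨ ∣-p∣≡∣p∣ (W - W * (ρ * ρ)) ⟩
      ∣ W - W * (ρ * ρ) ∣               ≡⟨ cong (λ v → ∣ W - v ∣) (square-ratio ρ ρ*g) ⟩
      ∣ W - fromℕ 64 * (P * P) * (N * (b * b) * (y * y)) ∣ ≤⟨ near ⟩
      δ                                 ∎
      where
      open ≤-Reasoning
      ρ = c * inverse g
      g*inverse : g * inverse g ≡ 1ℚ
      g*inverse = inverseʳ (0<⇒≢0 0<g)
      ρ*g : ρ * g ≡ c
      ρ*g = trans (*-assoc c (inverse g) g) (trans (cong (c *_) (trans (*-comm (inverse g) g) g*inverse)) (*-identityʳ c))

-- Assembly over the real numbers

open import Defs
open import Data.Nat.Base using (_^_)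
open import Data.Integer.Base using (+_)
open Limits using (≤+)
open ClosedForms using (b; pow; ⅙)
open GeneratingFunction using (f)
open Coefficients using (norm-f)
open NonnestingWords using (c≡A)
open CentralBinomial using (*-cancel-≤)
open Asymptotics using (lhs; rhs; √π; ξ; weight-limit; sqrt-≥0; y; y*b; fromℕ-*; x⁻³; 0<x⁻³; cauchy-bounded)
open Ratio using (ratio-near-1; positive-factor; 0<⇒≢0)
open RationalSequences using (0<*; 0≤*; 0<½; 0<1; ½+½; sqrt; inverse; inverseʳ; divide; 0≤fromℕ; p≤∣p∣)

-- A Cauchy sequence is bounded, and the inverse of an upper bound bounds the inverses from below.
0<⁻¹ : ∀ x (x≉0 : x ≉0) → 0ℝ < x → 0ℝ < x ⁻¹⟨ x≉0 ⟩
0<⁻¹ x x≉0 (δ , 0<δ , M , δ≤x) =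
  let B , 0<B , N , x≤B = cauchy-bounded {seq x} (cauchy x)
      η , 0<η , Bη≡1 = divide 0<B 0<1
  in η , 0<η , M ℕ.⊔ N , λ m le →
    let x>0 = ℚ.<-≤-trans 0<δ (drop-0+ {δ} {seq x m} (δ≤x m (ℕ.m⊔n≤o⇒m≤o M N le)))
        x*i = inverseʳ (0<⇒≢0 x>0)
    in add-0+ {η} {inverse (seq x m)} (*-cancel-≤ 0<B (ℚ.≤-trans (ℚ.≤-reflexive (trans Bη≡1 (sym x*i)))
      (RationalSequences.*-mono-≤ (ℚ.<⇒≤ x>0) (ℚ.≤-trans (p≤∣p∣ (seq x m)) (x≤B m (ℕ.m⊔n≤o⇒n≤o M N le)))
        (positive-factor x>0 x*i) ℚ.≤-refl)))

0<fromℕ : ∀ n .{{_ : ℕ.NonZero n}} → 0ℝ < fromℕ n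
0<fromℕ (suc n) = 0<fromℕ-suc n

numerator denominator : ℝ
numerator   = fromℕ 9 + fromℕ 6 * √ (fromℕ 3)
denominator = fromℕ 8 * √ π

0<numerator : 0ℝ < numerator
0<numerator = RationalSequences.fromℕ 9 , proj₁ (proj₂ (0<fromℕ-suc 8)) , 0 , λ m _ →
  add-0+ {RationalSequences.fromℕ 9} {seq numerator m} (≤+ (RationalSequences.fromℕ 9)
    (0≤* {RationalSequences.fromℕ 6} {sqrt m (RationalSequences.fromℕ 3)} (0≤fromℕ 6) (sqrt-≥0 m (RationalSequences.fromℕ 3))))

0<denominator : 0ℝ < denominator
0<denominator = 0<*-ℝ (fromℕ 8) (√ π) (0<fromℕ-suc 7) (0<√ π 0<π)

-- Indexed by n - 1, so that n is nonzero by its form.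
growth : ℕ → ℝ
growth k = (numerator ÷ denominator ⟨ 8√π≉0 ⟩) * fromℕ (6 ^ suc k) * suc k ^[-3/2]

0<growth : ∀ k → 0ℝ < growth k
0<growth k = 0<*-ℝ ((numerator ÷ denominator ⟨ 8√π≉0 ⟩) * fromℕ (6 ^ suc k)) (suc k ^[-3/2])
  (0<*-ℝ (numerator ÷ denominator ⟨ 8√π≉0 ⟩) (fromℕ (6 ^ suc k))
    (0<*-ℝ numerator (denominator ⁻¹⟨ 8√π≉0 ⟩) 0<numerator (0<⁻¹ denominator 8√π≉0 0<denominator))
    (0<fromℕ (6 ^ suc k) {{ℕ.m^n≢0 6 (suc k)}}))
  (0<√ (fromℚ (x⁻³ (suc k))) (x⁻³ (suc k) , 0<x⁻³ (suc k) , 0 , λ _ _ → add-0+ {x⁻³ (suc k)} {x⁻³ (suc k)} ℚ.≤-refl))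

6^*⅙^ : ∀ n → RationalSequences.fromℕ (6 ^ n) ℚ.* pow ⅙ n ≡ 1ℚ
6^*⅙^ zero    = refl
6^*⅙^ (suc n) = trans (cong (ℚ._* (⅙ ℚ.* pow ⅙ n)) (fromℕ-* 6 (6 ^ n)))
  (trans (interchange (RationalSequences.fromℕ 6) (RationalSequences.fromℕ (6 ^ n)) ⅙ (pow ⅙ n))
    (trans (cong (ℚ._* (RationalSequences.fromℕ (6 ^ n) ℚ.* pow ⅙ n)) {RationalSequences.fromℕ 6 ℚ.* ⅙} {1ℚ} refl)
      (trans (ℚ.*-identityˡ _) (6^*⅙^ n))))
  where
  open import Data.Rational.Solver using (module +-*-Solver)
  open +-*-Solver
  interchange : ∀ p q r s → p ℚ.* q ℚ.* (r ℚ.* s) ≡ p ℚ.* r ℚ.* (q ℚ.* s)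
  interchange = solve 4 (λ p q r s → p :* q :* (r :* s) := p :* r :* (q :* s)) refl

c*⅙^ : ∀ k → RationalSequences.fromℕ (c (suc k)) ℚ.* pow ⅙ (suc k) ≡ f (suc k)
c*⅙^ k = trans (cong (λ v → RationalSequences.fromℕ v ℚ.* pow ⅙ (suc k)) (c≡A (suc k))) (norm-f k)

eventually-positive : ∀ x → 0ℝ < x → Eventually (λ m → 0ℚ ℚ.< seq x m)
eventually-positive x (η , 0<η , M , η≤x) = M , λ m M≤m → ℚ.<-≤-trans 0<η (drop-0+ {η} {seq x m} (η≤x m M≤m))

abstract
  growth-positive : ∀ k → Eventually (λ m → 0ℚ ℚ.< seq (growth k) m)
  growth-positive k = eventually-positive (growth k) (0<growth k)

  denominator-positive : Eventually (λ m → 0ℚ ℚ.< seq denominator m)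
  denominator-positive = eventually-positive denominator 0<denominator

ratio-limit : ∀ δ → 0ℚ ℚ.< δ → ∃[ N ] ∀ k → N ℕ.≤ suc k →
  Eventually (λ m → ℚ.∣ RationalSequences.fromℕ (c (suc k)) ℚ.* inverse (seq (growth k) m) ℚ.- 1ℚ ∣ ℚ.≤ δ)
ratio-limit δ 0<δ =
  let N , h = weight-limit δ 0<δ
  in N , λ k N≤n →
    let M , near = h (suc k) N≤n
        M₁ , g>0 = growth-positive k
        M₂ , d>0 = denominator-positive
    in M ℕ.⊔ (M₁ ℕ.⊔ M₂) , λ m le →
      let le′ = ℕ.m⊔n≤o⇒n≤o M (M₁ ℕ.⊔ M₂) le
      in conclude k m (g>0 m (ℕ.m⊔n≤o⇒m≤o M₁ M₂ le′)) (d>0 m (ℕ.m⊔n≤o⇒n≤o M₁ M₂ le′))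
           (near m (ℕ.m⊔n≤o⇒m≤o M (M₁ ℕ.⊔ M₂) le))
  where
  conclude : ∀ k m → 0ℚ ℚ.< seq (growth k) m → 0ℚ ℚ.< seq denominator m →
    1ℚ ℚ.≤ lhs (suc k) m × ℚ.∣ lhs (suc k) m ℚ.- rhs (suc k) m ∣ ℚ.≤ δ →
    ℚ.∣ RationalSequences.fromℕ (c (suc k)) ℚ.* inverse (seq (growth k) m) ℚ.- 1ℚ ∣ ℚ.≤ δ
  conclude k m g>0 d>0 (1≤W , near≤) =
    ratio-near-1 {RationalSequences.fromℕ (c (suc k))} {RationalSequences.fromℕ (6 ^ suc k)} {pow ⅙ (suc k)} {f (suc k)}
      {seq numerator m} {inverse (seq denominator m)} {√π (suc k , m)} {ξ (suc k , m)}
      {RationalSequences.fromℕ (suc k)} {b (suc k)} {y (suc k)}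
      (c*⅙^ k) (6^*⅙^ (suc k)) (inverseʳ (0<⇒≢0 d>0)) (y*b (suc k)) {δ} g>0 (0≤fromℕ (c (suc k))) 1≤W near≤

corollary1p3 : (λ n → fromℕ (c n))
    ∼ (λ n → ((fromℕ 9 + fromℕ 6 * √ (fromℕ 3)) ÷ (fromℕ 8 * √ π) ⟨ 8√π≉0 ⟩)
    * fromℕ (6 ^ n) * n ^[-3/2])
corollary1p3 ε (δ , 0<δ , Nε , δ≤ε) =
  -- `<` between real numbers asks for a gap: half of δ bounds the error and the other half is the
  -- gap.
  let N , limit = ratio-limit (½ ℚ.* δ) (0<* 0<½ 0<δ)
  -- The successor rules out n = 0.
  in suc N , λ
    { zero ()
    ; (suc k) N<n → 0<⇒≉0 (growth k) (0<growth k) ,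
        (let M , near = limit k (ℕ.≤-trans (ℕ.n≤1+n N) N<n)
         in ½ ℚ.* δ , 0<* 0<½ 0<δ , M ℕ.⊔ Nε , λ m le → ℚ.≤-trans
           (ℚ.+-monoˡ-≤ (½ ℚ.* δ) (near m (ℕ.m⊔n≤o⇒m≤o M Nε le)))
           (ℚ.≤-trans (ℚ.≤-reflexive (½+½ δ)) (drop-0+ {δ} {seq ε m} (δ≤ε m (ℕ.m⊔n≤o⇒n≤o M Nε le))))) }
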